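{- Let $\alpha$ be an indeterminate and $\Lambda$ the algebra of symmetric functions over $\mathbb{Q}(\alpha)$ in $x_1,x_2,\ldots$, with the bilinear form $\langle p_\lambda,p_\mu\rangle=\alpha^{\ell(\lambda)}z_\lambda\delta_{\lambda\mu}$. Let $A^{(1)},A^{(2)},\ldots$ be the Sekiguchi–Debiard operators at infinity acting on $\Lambda$ (defined in the context). Then for each $k=1,2,\ldots$, $$A^{(k)}=(-1)^k\sum_{\ell(\lambda)=k}c_\lambda\, m_\lambda\, m_\lambda^{\ast},$$ where $\lambda$ ranges over all partitions of length $k$ (on any given element of $\Lambda$ only finitely many terms of the sum act nontrivially).
   Context: Partitions: for a partition $\lambda$, $\ell(\lambda)$ is the number of nonzero parts; if $k_r$ is the multiplicity of the part $r$ then $c_\lambda=k_1!\,k_2!\cdots$ and $z_\lambda=1^{k_1}k_1!\,2^{k_2}k_2!\cdots$. Let $\Lambda_N$ be the algebra of symmetric polynomials in $x_1,\dots,x_N$ over $\mathbb{Q}(\alpha)$, $\rho_N:\Lambda_N\to\Lambda_{N-1}$ the homomorphism $x_N\mapsto 0$ ($\Lambda_0=\mathbb{Q}(\alpha)$), and $\Lambda$ the inverse limit of $\Lambda_1\leftarrow\Lambda_2\leftarrow\cdots$ in graded algebras, with projections $\pi_N:\Lambda\to\Lambda_N$ (setting $x_{N+1}=x_{N+2}=\dots=0$). $m_\lambda\in\Lambda$ is the monomial symmetric function (the limit of the sums of all distinct monomials obtained by permuting variables in $x_1^{\lambda_1}x_2^{\lambda_2}\cdots$), $m_\emptyset=1$;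 $p_n=x_1^n+x_2^n+\cdots$, $p_\lambda=p_{\lambda_1}p_{\lambda_2}\cdots$. For $f\in\Lambda$, $f^\ast$ is the operator adjoint to multiplication by $f$ with respect to $\langle\,,\rangle$. Sekiguchi–Debiard operators: with $\Delta(x_1,\dots,x_N)=\prod_{i<j}(x_i-x_j)$, $\partial_i=\partial/\partial x_i$ and $u$ a variable, put $$S_N(u)=\Delta(x_1,\dots,x_N)^{ -1}\sum_{\sigma\in S_N}(-1)^\sigma\prod_{i=1}^N x_i^{N-\sigma(i)}\big(u+\sigma(i)-1-\alpha x_i\partial_i\big),$$ a polynomial in $u$ of degree $N$ whose coefficients are pairwise commuting operators preserving $\Lambda_N$. Writing $(u)_k=u(u+1)\cdots(u+k-1)$, $(u)_0=1$, expand uniquely $S_N(u)/(u)_N=\sum_{k=0}^N A_N^{(k)}/(u)_k$ with operators $A_N^{(k)}$ on $\Lambda_N$ (set $A_N^{(k)}=0$ for $k>N$). It is known that $\rho_N A_N^{(k)}=A_{N-1}^{(k)}\rho_N$ for all $N,k$, so there are unique linear operators $A^{(k)}$ on $\Lambda$ with $\pi_N A^{(k)}=A_N^{(k)}\pi_N$ for all $N\ge1$; these are the Sekiguchi–Debiard operators at infinity, and $A(u)=1+\sum_{k\ge1}A^{(k)}/(u)_k$. -}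

module Defs where

open import Data.Nat as ℕ using (ℕ; zero; suc; _≤_; _<_; _∸_; _⊔_; _!; _^_)
open import Data.Nat.Properties using (≤-decTotalOrder; ≤-totalOrder)
open import Data.Integer using (+_)
open import Data.Nat.ListAction using (product)
open import Data.Rational as ℚ using (ℚ; 0ℚ; 1ℚ)
open import Data.List as L using (List; []; _∷_; _++_; map; concatMap; foldr; length; upTo; allFin)
import Data.List.Properties as LP
open import Data.List.Relation.Unary.All using (All)
open import Data.Vec as V using (Vec; []; _∷_)
import Data.Vec.Properties as VP
open import Data.Fin as Fin using (Fin)
open import Data.Product using (_×_; _,_)
open import Data.Bool using (if_then_else_)
open import Relation.Nullary using (¬_; yes; no; does)
open import Relation.Binary.PropositionalEquality using (_≡_)
open import Data.List.Sort.Base ≤-totalOrder using (SortingAlgorithm)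
open import Data.List.Sort.MergeSort ≤-decTotalOrder using (mergeSort)

sortℕ : List ℕ → List ℕ
sortℕ = SortingAlgorithm.sort mergeSort

-- Polynomials over ℚ in α (coefficient lists, constant term first)

QPoly : Set
QPoly = List ℚ

infixl 6 _+q_
infixl 7 _*q_

_+q_ : QPoly → QPoly → QPoly
[] +q q = q
(a ∷ p) +q [] = a ∷ p
(a ∷ p) +q (b ∷ q) = (a ℚ.+ b) ∷ (p +q q)

_*q_ : QPoly → QPoly → QPoly
[] *q q = []
(a ∷ p) *q q = map (a ℚ.*_) q +q (0ℚ ∷ (p *q q))

negq : QPoly → QPoly
negq = map (λ x → ℚ.- x)

IsZeroQ : QPoly → Set
IsZeroQ p = All (_≡ 0ℚ) p

-- The field Q(α): fractions whose denominator is a product of nonzero polynomials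

record NZPoly : Set where
  field
    poly    : QPoly
    nonzero : ¬ IsZeroQ poly

denProd : List NZPoly → QPoly
denProd = foldr (λ d acc → NZPoly.poly d *q acc) (1ℚ ∷ [])

record F : Set where
  constructor _//_
  field
    num : QPoly
    den : List NZPoly
open F

infix 4 _≃_
_≃_ : F → F → Set
a ≃ b = IsZeroQ (num a *q denProd (den b) +q negq (num b *q denProd (den a)))

infixl 6 _+F_
infixl 7 _*F_

0F 1F αF : F
0F = [] // []
1F = (1ℚ ∷ []) // []
αF = (0ℚ ∷ 1ℚ ∷ []) // []

_+F_ : F → F → F
a +F b = (num a *q denProd (den b) +q num b *q denProd (den a)) // (den a ++ den b)

_*F_ : F → F → F
a *F b = (num a *q num b) // (den a ++ den b)

-F_ : F → F
-F a = negq (num a) // den a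

ℕ→F : ℕ → F
ℕ→F n = ((+ n) ℚ./ 1 ∷ []) // []

negOnePow : ℕ → F
negOnePow zero = 1F
negOnePow (suc k) = -F negOnePow k

powF : F → ℕ → F
powF a zero = 1F
powF a (suc k) = a *F powF a k

Mono : ℕ → Set
Mono n = Vec ℕ n

Poly : ℕ → Set
Poly n = List (Mono n × F)

coeff : ∀ {n} → Poly n → Mono n → F
coeff [] e = 0F
coeff ((e′ , c) ∷ p) e with VP.≡-dec ℕ._≟_ e′ e
... | yes _ = c +F coeff p e
... | no _ = coeff p e

infix 4 _≈P_
_≈P_ : ∀ {n} → Poly n → Poly n → Set
p ≈P q = ∀ e → coeff p e ≃ coeff q e

0P : ∀ {n} → Poly n
0P = []

infixl 6 _+P_
infixl 7 _*P_

_+P_ : ∀ {n} → Poly n → Poly n → Poly n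
_+P_ = _++_

scaleP : ∀ {n} → F → Poly n → Poly n
scaleP c = map (λ { (e , d) → (e , c *F d) })

negP : ∀ {n} → Poly n → Poly n
negP = scaleP (-F 1F)

_*P_ : ∀ {n} → Poly n → Poly n → Poly n
p *P q = concatMap (λ { (e , c) → map (λ { (e′ , d) → (V.zipWith ℕ._+_ e e′ , c *F d) }) q }) p

constP : ∀ {n} → F → Poly n
constP {n} c = (V.replicate n 0 , c) ∷ []

prodP : ∀ {n} → List (Poly n) → Poly n
prodP = foldr _*P_ (constP 1F)

sumP : ∀ {n} → List (Poly n) → Poly n
sumP = foldr _+P_ 0P

unitExp : ∀ {n} → Fin n → ℕ → Mono n
unitExp i r = V.tabulate (λ j → if does (i Fin.≟ j) then r else 0)

powSum : (n : ℕ) → ℕ → Poly n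
powSum n r = map (λ i → (unitExp i r , 1F)) (allFin n)

-- Λ: finite Q(α)-combinations of p_λ.  An index list [r₁,…,rₗ] stands for
-- p_{r₁+1} ⋯ p_{rₗ+1} (the shift guarantees all parts are positive).

Λel : Set
Λel = List (List ℕ × F)

infixl 6 _+Λ_
infixl 7 _*Λ_

_+Λ_ : Λel → Λel → Λel
_+Λ_ = _++_

_*Λ_ : Λel → Λel → Λel
f *Λ g = concatMap (λ { (a , c) → map (λ { (b , d) → (a ++ b , c *F d) }) g }) f

scaleΛ : F → Λel → Λel
scaleΛ c = map (λ { (a , d) → (a , c *F d) })

sumΛ : List Λel → Λel
sumΛ = foldr _+Λ_ []

π : (N : ℕ) → Λel → Poly N
π N f = sumP (map (λ { (ix , c) → scaleP c (prodP (map (λ r → powSum N (suc r)) ix)) }) f)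

count : ℕ → List ℕ → ℕ
count r = L.foldr (λ x acc → if does (x ℕ.≟ r) then suc acc else acc) 0

maxℕ : List ℕ → ℕ
maxℕ = foldr _⊔_ 0

zPart : List ℕ → ℕ
zPart la = product (map (λ r → (r ^ count r la) ℕ.* (count r la !)) (upTo (suc (maxℕ la))))

cPart : List ℕ → ℕ
cPart la = product (map (λ r → count r la !) (upTo (suc (maxℕ la))))

-- ⟨p_λ , p_μ⟩ = α^{ℓ(λ)} z_λ δ_{λμ}   (on shifted index lists)
pairBasis : List ℕ → List ℕ → F
pairBasis ix jx with LP.≡-dec ℕ._≟_ (sortℕ ix) (sortℕ jx)
... | yes _ = powF αF (length ix) *F ℕ→F (zPart (map suc ix))
... | no _ = 0F

sumF : List F → F
sumF = foldr _+F_ 0F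

⟨_,_⟩ : Λel → Λel → F
⟨ f , g ⟩ = sumF (concatMap (λ { (a , c) → map (λ { (b , d) → c *F d *F pairBasis a b }) g }) f)

allVecs : (n B : ℕ) → List (Vec ℕ n)
allVecs zero B = [] ∷ []
allVecs (suc n) B = concatMap (λ x → map (x ∷_) (allVecs n B)) (upTo (suc B))

nonzeros : List ℕ → List ℕ
nonzeros [] = []
nonzeros (zero ∷ xs) = nonzeros xs
nonzeros (suc x ∷ xs) = suc x ∷ nonzeros xs

msym : (n : ℕ) → List ℕ → Poly n
msym n la = map (λ e → (e , 1F))
  (L.filter (λ e → LP.≡-dec ℕ._≟_ (sortℕ (nonzeros (V.toList e))) (sortℕ la)) (allVecs n (maxℕ la)))

-- Sekiguchi–Debiard operator S_N(u), with u as an extra variable (index 0)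

-- permutations σ of {1,…,n}, as the vector (σ(1),…,σ(n))
insertAll : ∀ {n} → ℕ → Vec ℕ n → List (Vec ℕ (suc n))
insertAll x [] = (x ∷ []) ∷ []
insertAll x (y ∷ ys) = (x ∷ y ∷ ys) ∷ map (y ∷_) (insertAll x ys)

perms : (n : ℕ) → List (Vec ℕ n)
perms zero = [] ∷ []
perms (suc n) = concatMap (insertAll (suc n)) (perms n)

inv : ∀ {n} → Vec ℕ n → ℕ
inv [] = 0
inv (x ∷ xs) = V.count (λ y → y ℕ.<? x) xs ℕ.+ inv xs

uMono : ∀ {N} → Mono (suc N)
uMono {N} = 1 ∷ V.replicate N 0

linFactor : ∀ {N} → ℕ → ℕ → Poly (suc N)
linFactor s e = (uMono , 1F) ∷ constP (ℕ→F (s ∸ 1) +F -F (αF *F ℕ→F e))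

-- Δ(x_1,…,x_N) · S_N(u) applied to a polynomial g, i.e.
-- Σ_σ (-1)^σ ∏_i x_i^{N-σ(i)} (u + σ(i) - 1 - α x_i ∂_i) g
numS : (N : ℕ) → Poly N → Poly (suc N)
numS N g = concatMap (λ { (e , c) → concatMap (λ σ →
    prodP ((((0 ∷ V.zipWith (λ ei si → ei ℕ.+ (N ∸ si)) e σ) , negOnePow (inv σ) *F c)
           ∷ []) ∷ V.toList (V.zipWith linFactor σ e)))
  (perms N) }) g

xVar : ∀ {N} → Fin N → Poly (suc N)
xVar i = ((0 ∷ unitExp i 1) , 1F) ∷ []

vand : ∀ {N} → List (Poly (suc N)) → Poly (suc N)
vand [] = constP 1F
vand (x ∷ xs) = prodP (map (λ y → x +P negP y) xs) *P vand xs

Δ : (N : ℕ) → Poly (suc N)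
Δ N = vand (map xVar (allFin N))

liftU : ∀ {N} → Poly N → Poly (suc N)
liftU = map (λ { (e , c) → (0 ∷ e , c) })

-- (u)_N / (u)_k = (u+k)(u+k+1)⋯(u+N-1)
risingTail : (N k : ℕ) → Poly (suc N)
risingTail N k = prodP (map (λ j → (uMono , 1F) ∷ constP (ℕ→F j)) (map (k ℕ.+_) (upTo (N ∸ k))))

-- a_0,…,a_N are the coefficients of the expansion
--   S_N(u) g / (u)_N = Σ_{k=0}^N a_k / (u)_k ,
-- i.e.  Δ · Σ_k a_k (u)_N/(u)_k = Δ · S_N(u) g ; so a_k = A_N^{(k)} g.
IsSDExpansion : (N : ℕ) → Poly N → (ℕ → Poly N) → Set
IsSDExpansion N g a =
  Δ N *P sumP (map (λ k → liftU (a k) *P risingTail N k) (upTo (suc N))) ≈P numS N g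

decParts : ℕ → ℕ → List (List ℕ)
decParts zero D = [] ∷ []
decParts (suc k) D = concatMap (λ p → map (p ∷_) (decParts k p)) (map suc (upTo D))

-- truncated right-hand side  (-1)^k Σ_{ℓ(λ)=k, λ₁ ≤ D} c_λ m_λ (m_λ^* f),
-- where M λ = m_λ and G λ = m_λ^* f
rhsTrunc : ℕ → ℕ → (List ℕ → Λel) → (List ℕ → Λel) → Λel
rhsTrunc k D M G = sumΛ (map (λ la → scaleΛ (negOnePow k *F ℕ→F (cPart la)) (M la *Λ G la)) (decParts k D))

{-# OPTIONS --safe #-}

-- Adjoin ε_a with ε_a² = 0 for every part of λ.  Then p_λ is the coefficient of ∏ ε_a in ∏ (1 + ε_a p_{λ_a}),
-- on which α x_i ∂_i acts as multiplication by h_i = Σ_r d_r x_i^r, where d_r = Σ_{λ_a = r} α r ε_a.  Hence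
-- Δ S_N(u) p_λ is read off from the determinant of x_i^{N−s} (u + s − 1 − h_i), which equals
--   Δ Σ_K (−1)^{|K|} (u+|K|)⋯(u+N−1) Σ_γ x_K^γ (c_γ m_γ)(d),
-- with K ranging over sets of variables, γ over positive exponents on K, and (c_γ m_γ)(d) denoting c_γ m_γ
-- evaluated at p_r ↦ d_r.  This identity is proved by moving the variables one after the other along a dual
-- number.  Evaluation at d is adjoint to multiplication: ⟨p_λ, m_μ h⟩ is the coefficient of ∏ ε_a in
-- m_μ(d) h(d), so the terms with |K| = k add up to (−1)^k Σ c_μ m_μ m_μ^* p_λ.  Finally the coefficients of
-- the expansion are determined successively by the specialisations u = −(N−1), …, −1, 0.
module Submission where

open import Algebra.Bundles using (CommutativeRing)
import Algebra.Properties.Ring as RingProps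
import Algebra.Solver.Ring as RingSolver
open import Algebra.Solver.Ring.AlmostCommutativeRing using (fromCommutativeRing; _-Raw-AlmostCommutative⟶_; Induced-equivalence)
open import Data.Bool using (if_then_else_; true; false)
open import Data.Empty using (⊥-elim)
open import Data.Fin as Fin using (Fin; zero; suc)
open import Data.Integer as ℤ using (ℤ; +_; -[1+_])
import Data.Integer.Properties as ℤP
open import Data.List as L using (List; []; _∷_; _++_; length; concatMap; map; allFin; upTo; applyUpTo)
import Data.List.Properties as LP
open import Data.List.Relation.Binary.Equality.Propositional using (≋⇒≡)
open import Data.List.Relation.Binary.Permutation.Propositional as Perm using (_↭_; prep; swap; ↭-refl; ↭-sym; ↭-trans; ↭⇒↭ₛ)
import Data.List.Relation.Binary.Permutation.Propositional.Properties as PermP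
open import Data.List.Relation.Binary.Sublist.Propositional using (_⊆_; []; _∷_; _∷ʳ_; ⊆-trans)
import Data.List.Relation.Binary.Sublist.Propositional.Properties as SubP
open import Data.List.Relation.Unary.All as All using (All; []; _∷_)
import Data.List.Relation.Unary.All.Properties as AllP
open import Data.List.Relation.Unary.AllPairs as AllPairs using (AllPairs; []; _∷_)
import Data.List.Relation.Unary.AllPairs.Properties as AllPairsP
import Data.List.Relation.Unary.Sorted.TotalOrder.Properties as SortedP
import Data.List.Relation.Unary.Unique.Propositional.Properties as UniqueP
open import Data.Maybe using (Maybe; just; nothing)
open import Data.Nat as ℕ using (ℕ; zero; suc; _∸_; _≤_; _<_; s≤s; z≤n; _⊔_; _!)
open import Data.Nat.ListAction using (sum; product)
import Data.Nat.Properties as ℕP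
open import Data.Nat.Solver using (module +-*-Solver)
open import Data.Product using (_×_; _,_; proj₁; proj₂; ∃; ∃-syntax)
open import Data.Rational as ℚ using (ℚ; 0ℚ; 1ℚ)
import Data.Rational.Properties as ℚP
import Data.Rational.Unnormalised as ℚᵘ
import Data.Rational.Unnormalised.Properties as ℚᵘP
open import Data.Sum using (inj₁; inj₂)
open import Data.Unit using (⊤; tt)
open import Data.Vec as V using (Vec; []; _∷_)
import Data.Vec.Properties as VP
open import Data.Vec.Relation.Unary.All as VAll using ([]; _∷_)
import Data.Vec.Relation.Unary.All as VAll
open import Defs
open import Function using (id)
open import Level using (0ℓ)
open import Relation.Binary using (IsEquivalence; DecidableEquality)
open import Relation.Binary.Definitions using (tri<; tri≈; tri>)
open import Relation.Binary.PropositionalEquality as ≡ using (_≡_)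
import Relation.Binary.Reasoning.Setoid as SetoidReasoning
open import Relation.Nullary using (yes; no; ¬_; does; ¬?; Dec)
open import Relation.Nullary.Decidable using (dec-true; dec-false; map′)
open import Relation.Unary using (Decidable)
open import Data.List.Sort.Base ℕP.≤-totalOrder using (SortingAlgorithm)
open import Data.List.Sort.MergeSort ℕP.≤-decTotalOrder using (mergeSort)

-- A row x^(N-s) (u+s-1-h) equals (u+N-1-h) x^(N-s) minus x d/dx of x^(N-s). Such a free row is
-- therefore recovered from the real part and the ε-part of a plain row X^(N-s), a node, at X =
-- x(1+ε). With nodes only, the determinant is Vandermonde's. The induction meets determinants with
-- rows of both kinds, whose expansion coefficients depend on the nodes; they are kept as an
-- abstract family Y(K) subject only to a divided-difference recursion. A new node X replaces Y(K)
-- by the sum over I ⊆ K of |I|! ∏_{j∈I} x_j/(X-x_j) Y(K-I), and partial fractions preserve the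
-- recursion. For the family (-1)^|K| Σ x_K^γ (c_γ m_γ)(d) it is the rule for multiplying c_γ m_γ by
-- p_r.
--
-- Formal sums are lists without normal form, so identities between them are tested on all linear
-- functionals. Since m_λ is given only through its images in finitely many variables, its value at
-- p_r ↦ d_r is read off by a functional on the polynomials in N variables, for one large N.

CRing : Set₁
CRing = CommutativeRing 0ℓ 0ℓ

-- Finite sums, splittings and choices in a commutative ring.

module Kit (R : CRing) where
  open CommutativeRing R public using (Carrier; _≈_; _+_; _*_; -_; 0#; 1#; refl; sym; trans; reflexive; setoid; ring;
    +-cong; +-congˡ; +-congʳ; +-assoc; +-comm; +-identityˡ; +-identityʳ; *-cong; *-congˡ; *-congʳ; *-assoc; *-comm; *-identityˡ; *-identityʳ;
    distribˡ; distribʳ; zeroˡ; zeroʳ; -‿cong; -‿inverseˡ; -‿inverseʳ)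
  open RingProps ring public using (-‿distribˡ-*; -‿distribʳ-*; -‿involutive; -0#≈0#; -‿+-comm)
  open SetoidReasoning setoid public using (begin_; step-≈-⟩; step-≡-⟩; _∎)

  ι : ℕ → Carrier
  ι zero = 0#
  ι (suc n) = 1# + ι n

  ι-+ : ∀ m n → ι (m ℕ.+ n) ≈ ι m + ι n
  ι-+ zero n = sym (+-identityˡ _)
  ι-+ (suc m) n = trans (+-congˡ (ι-+ m n)) (sym (+-assoc _ _ _))

  ι-* : ∀ m n → ι (m ℕ.* n) ≈ ι m * ι n
  ι-* zero n = sym (zeroˡ _)
  ι-* (suc m) n = trans (ι-+ n (m ℕ.* n)) (trans (+-cong (sym (*-identityˡ _)) (ι-* m n)) (sym (distribʳ _ _ _)))

  private
    -- Separate clauses for 0 and 1 make the solver constants `con (+ 0)` and `con (+ 1)`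
    -- definitionally `0#` and `1#`.
    ⟦_⟧ℤ : ℤ → Carrier
    ⟦ + 0 ⟧ℤ = 0#
    ⟦ + 1 ⟧ℤ = 1#
    ⟦ + n ⟧ℤ = ι n
    ⟦ -[1+ n ] ⟧ℤ = - ι (suc n)

    ℤ-pos : ∀ n → ⟦ + n ⟧ℤ ≈ ι n
    ℤ-pos zero = refl
    ℤ-pos (suc zero) = sym (+-identityʳ _)
    ℤ-pos (suc (suc n)) = refl

    ℤ-neg : ∀ i → ⟦ ℤ.- i ⟧ℤ ≈ - ⟦ i ⟧ℤ
    ℤ-neg (+ zero) = sym -0#≈0#
    ℤ-neg (+ suc n) = -‿cong (sym (ℤ-pos (suc n)))
    ℤ-neg -[1+ n ] = trans (ℤ-pos (suc n)) (sym (-‿involutive _))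

    ℤ-⊖ : ∀ m n → ⟦ m ℤ.⊖ n ⟧ℤ ≈ ι m + - ι n
    ℤ-⊖ m zero = trans (ℤ-pos m) (sym (trans (+-congˡ -0#≈0#) (+-identityʳ _)))
    ℤ-⊖ zero (suc n) = sym (+-identityˡ _)
    ℤ-⊖ (suc m) (suc n) = begin
      ⟦ suc m ℤ.⊖ suc n ⟧ℤ            ≡⟨ ≡.cong ⟦_⟧ℤ (ℤP.[1+m]⊖[1+n]≡m⊖n m n) ⟩
      ⟦ m ℤ.⊖ n ⟧ℤ                    ≈⟨ ℤ-⊖ m n ⟩
      ι m + - ι n                     ≈⟨ +-congʳ (sym (+-identityˡ _)) ⟩
      0# + ι m + - ι n                ≈⟨ +-congʳ (+-congʳ (sym (-‿inverseʳ 1#))) ⟩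
      1# + - 1# + ι m + - ι n         ≈⟨ +-congʳ (trans (+-assoc _ _ _) (trans (+-congˡ (+-comm _ _)) (sym (+-assoc _ _ _)))) ⟩
      1# + ι m + - 1# + - ι n         ≈⟨ +-assoc _ _ _ ⟩
      1# + ι m + (- 1# + - ι n)       ≈⟨ +-congˡ (-‿+-comm _ _) ⟩
      1# + ι m + - (1# + ι n)         ∎

    ℤ-+ : ∀ i j → ⟦ i ℤ.+ j ⟧ℤ ≈ ⟦ i ⟧ℤ + ⟦ j ⟧ℤ
    ℤ-+ (+ m) (+ n) = trans (ℤ-pos (m ℕ.+ n)) (trans (ι-+ m n) (sym (+-cong (ℤ-pos m) (ℤ-pos n))))
    ℤ-+ (+ m) -[1+ n ] = trans (ℤ-⊖ m (suc n)) (+-congʳ (sym (ℤ-pos m)))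
    ℤ-+ -[1+ m ] (+ n) = trans (ℤ-⊖ n (suc m)) (trans (+-comm _ _) (+-congˡ (sym (ℤ-pos n))))
    ℤ-+ -[1+ m ] -[1+ n ] = begin
      - (1# + (1# + ι (m ℕ.+ n)))     ≈⟨ -‿cong (+-congˡ (+-congˡ (ι-+ m n))) ⟩
      - (1# + (1# + (ι m + ι n)))     ≈⟨ -‿cong (+-congˡ (trans (sym (+-assoc _ _ _)) (trans (+-congʳ (+-comm _ _)) (+-assoc _ _ _)))) ⟩
      - (1# + (ι m + (1# + ι n)))     ≈⟨ -‿cong (sym (+-assoc _ _ _)) ⟩
      - (1# + ι m + (1# + ι n))       ≈⟨ sym (-‿+-comm _ _) ⟩
      - (1# + ι m) + - (1# + ι n)     ∎

    ℤ-*⁺ : ∀ m j → ⟦ + m ℤ.* j ⟧ℤ ≈ ⟦ + m ⟧ℤ * ⟦ j ⟧ℤ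
    ℤ-*⁺ m (+ n) = begin
      ⟦ + m ℤ.* + n ⟧ℤ       ≡⟨ ≡.cong ⟦_⟧ℤ (≡.sym (ℤP.pos-* m n)) ⟩
      ⟦ + (m ℕ.* n) ⟧ℤ       ≈⟨ ℤ-pos (m ℕ.* n) ⟩
      ι (m ℕ.* n)            ≈⟨ ι-* m n ⟩
      ι m * ι n              ≈⟨ *-cong (sym (ℤ-pos m)) (sym (ℤ-pos n)) ⟩
      ⟦ + m ⟧ℤ * ⟦ + n ⟧ℤ    ∎
    ℤ-*⁺ m -[1+ n ] = begin
      ⟦ + m ℤ.* -[1+ n ] ⟧ℤ        ≡⟨ ≡.cong ⟦_⟧ℤ (≡.sym (ℤP.neg-distribʳ-* (+ m) (+ suc n))) ⟩
      ⟦ ℤ.- (+ m ℤ.* + suc n) ⟧ℤ   ≈⟨ ℤ-neg (+ m ℤ.* + suc n) ⟩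
      - ⟦ + m ℤ.* + suc n ⟧ℤ       ≈⟨ -‿cong (ℤ-*⁺ m (+ suc n)) ⟩
      - (⟦ + m ⟧ℤ * ⟦ + suc n ⟧ℤ)  ≈⟨ -‿distribʳ-* _ _ ⟩
      ⟦ + m ⟧ℤ * - ⟦ + suc n ⟧ℤ    ≈⟨ *-congˡ (-‿cong (ℤ-pos (suc n))) ⟩
      ⟦ + m ⟧ℤ * - ι (suc n)       ∎
    ℤ-* : ∀ i j → ⟦ i ℤ.* j ⟧ℤ ≈ ⟦ i ⟧ℤ * ⟦ j ⟧ℤ
    ℤ-* (+ m) j = ℤ-*⁺ m j
    ℤ-* -[1+ m ] j = begin
      ⟦ -[1+ m ] ℤ.* j ⟧ℤ          ≡⟨ ≡.cong ⟦_⟧ℤ (≡.sym (ℤP.neg-distribˡ-* (+ suc m) j)) ⟩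
      ⟦ ℤ.- (+ suc m ℤ.* j) ⟧ℤ     ≈⟨ ℤ-neg (+ suc m ℤ.* j) ⟩
      - ⟦ + suc m ℤ.* j ⟧ℤ         ≈⟨ -‿cong (ℤ-*⁺ (suc m) j) ⟩
      - (⟦ + suc m ⟧ℤ * ⟦ j ⟧ℤ)    ≈⟨ -‿distribˡ-* _ _ ⟩
      - ⟦ + suc m ⟧ℤ * ⟦ j ⟧ℤ      ≈⟨ *-congʳ (-‿cong (ℤ-pos (suc m))) ⟩
      - ι (suc m) * ⟦ j ⟧ℤ         ∎

    ℤ⟶R : ℤ.+-*-rawRing -Raw-AlmostCommutative⟶ fromCommutativeRing R
    ℤ⟶R = record { ⟦_⟧ = ⟦_⟧ℤ ; +-homo = ℤ-+ ; *-homo = ℤ-* ; -‿homo = ℤ-neg ; 0-homo = refl ; 1-homo = refl }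

    ℤ≟ : ∀ i j → Maybe (Induced-equivalence ℤ⟶R i j)
    ℤ≟ i j with i ℤ.≟ j
    ... | yes ≡.refl = just refl
    ... | no _ = nothing

  open RingSolver ℤ.+-*-rawRing (fromCommutativeRing R) ℤ⟶R ℤ≟ public
    using (solve; _:=_; _:+_; _:*_; :-_; _:-_; con)

  Σ : ∀ {A : Set} → List A → (A → Carrier) → Carrier
  Σ [] f = 0#
  Σ (a ∷ L) f = f a + Σ L f

  Σ-cong : ∀ {A : Set} (L : List A) {f g : A → Carrier} → (∀ a → f a ≈ g a) → Σ L f ≈ Σ L g
  Σ-cong [] e = refl
  Σ-cong (a ∷ L) e = +-cong (e a) (Σ-cong L e)

  Σ-+ : ∀ {A : Set} (L : List A) (f g : A → Carrier) → Σ L (λ a → f a + g a) ≈ Σ L f + Σ L g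
  Σ-+ [] f g = sym (+-identityˡ _)
  Σ-+ (a ∷ L) f g = trans (+-congˡ (Σ-+ L f g))
    (solve 4 (λ x y z w → x :+ y :+ (z :+ w) := x :+ z :+ (y :+ w)) refl _ _ _ _)

  Σ-*ˡ : ∀ {A : Set} (L : List A) c (f : A → Carrier) → Σ L (λ a → c * f a) ≈ c * Σ L f
  Σ-*ˡ [] c f = sym (zeroʳ _)
  Σ-*ˡ (a ∷ L) c f = trans (+-congˡ (Σ-*ˡ L c f)) (sym (distribˡ _ _ _))

  Σ-*ʳ : ∀ {A : Set} (L : List A) c (f : A → Carrier) → Σ L (λ a → f a * c) ≈ Σ L f * c
  Σ-*ʳ L c f = trans (Σ-cong L (λ a → *-comm _ _)) (trans (Σ-*ˡ L c f) (*-comm _ _))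

  Σ-0 : ∀ {A : Set} (L : List A) → Σ L (λ _ → 0#) ≈ 0#
  Σ-0 [] = refl
  Σ-0 (a ∷ L) = trans (+-identityˡ _) (Σ-0 L)

  Σ-zero : ∀ {A : Set} (L : List A) {f : A → Carrier} → (∀ a → f a ≈ 0#) → Σ L f ≈ 0#
  Σ-zero L e = trans (Σ-cong L e) (Σ-0 L)

  Σ-++ : ∀ {A : Set} (L M : List A) (f : A → Carrier) → Σ (L ++ M) f ≈ Σ L f + Σ M f
  Σ-++ [] M f = sym (+-identityˡ _)
  Σ-++ (a ∷ L) M f = trans (+-congˡ (Σ-++ L M f)) (sym (+-assoc _ _ _))

  Σ-map : ∀ {A B : Set} (h : A → B) (L : List A) (f : B → Carrier) → Σ (map h L) f ≈ Σ L (λ a → f (h a))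
  Σ-map h [] f = refl
  Σ-map h (a ∷ L) f = +-congˡ (Σ-map h L f)

  Σ-concatMap : ∀ {A B : Set} (h : A → List B) (L : List A) (f : B → Carrier) →
                Σ (concatMap h L) f ≈ Σ L (λ a → Σ (h a) f)
  Σ-concatMap h [] f = refl
  Σ-concatMap h (a ∷ L) f = trans (Σ-++ (h a) _ f) (+-congˡ (Σ-concatMap h L f))

  Σ-swap : ∀ {A B : Set} (L : List A) (M : List B) (f : A → B → Carrier) →
           Σ L (λ a → Σ M (f a)) ≈ Σ M (λ b → Σ L (λ a → f a b))
  Σ-swap [] M f = sym (Σ-0 M)
  Σ-swap (a ∷ L) M f = trans (+-congˡ (Σ-swap L M f)) (sym (Σ-+ M _ _))

  Σ-neg : ∀ {A : Set} (L : List A) (f : A → Carrier) → Σ L (λ a → - f a) ≈ - Σ L f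
  Σ-neg [] f = sym -0#≈0#
  Σ-neg (a ∷ L) f = trans (+-congˡ (Σ-neg L f)) (-‿+-comm _ _)

  infixr 8 _^_
  _^_ : Carrier → ℕ → Carrier
  a ^ zero = 1#
  a ^ suc n = a * a ^ n

  ^-+ : ∀ a m n → a ^ (m ℕ.+ n) ≈ a ^ m * a ^ n
  ^-+ a zero n = sym (*-identityˡ _)
  ^-+ a (suc m) n = trans (*-congˡ (^-+ a m n)) (sym (*-assoc _ _ _))

  -- sums over ordered splittings L = I ⊔ K, and over the choices of one element of L

  S2 : ∀ {A : Set} → List A → (List A → List A → Carrier) → Carrier
  S2 [] f = f [] []
  S2 (a ∷ L) f = S2 L (λ I K → f (a ∷ I) K) + S2 L (λ I K → f I (a ∷ K))

  P : ∀ {A : Set} → List A → (A → List A → Carrier) → Carrier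
  P [] f = 0#
  P (a ∷ L) f = f a L + P L (λ b M → f b (a ∷ M))

  S2-cong : ∀ {A : Set} (L : List A) {f g} → (∀ I K → f I K ≈ g I K) → S2 L f ≈ S2 L g
  S2-cong [] e = e [] []
  S2-cong (a ∷ L) e = +-cong (S2-cong L (λ I K → e (a ∷ I) K)) (S2-cong L (λ I K → e I (a ∷ K)))

  S2-+ : ∀ {A : Set} (L : List A) f g → S2 L (λ I K → f I K + g I K) ≈ S2 L f + S2 L g
  S2-+ [] f g = refl
  S2-+ (a ∷ L) f g = trans (+-cong (S2-+ L _ _) (S2-+ L _ _))
    (solve 4 (λ x y z w → x :+ y :+ (z :+ w) := x :+ z :+ (y :+ w)) refl _ _ _ _)

  S2-*ˡ : ∀ {A : Set} (L : List A) c f → S2 L (λ I K → c * f I K) ≈ c * S2 L f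
  S2-*ˡ [] c f = refl
  S2-*ˡ (a ∷ L) c f = trans (+-cong (S2-*ˡ L c _) (S2-*ˡ L c _)) (sym (distribˡ _ _ _))

  S2-neg : ∀ {A : Set} (L : List A) f → S2 L (λ I K → - f I K) ≈ - S2 L f
  S2-neg [] f = refl
  S2-neg (a ∷ L) f = trans (+-cong (S2-neg L _) (S2-neg L _)) (-‿+-comm _ _)

  S2-0 : ∀ {A : Set} (L : List A) → S2 L (λ _ _ → 0#) ≈ 0#
  S2-0 [] = refl
  S2-0 (a ∷ L) = trans (+-cong (S2-0 L) (S2-0 L)) (+-identityˡ _)

  P-cong : ∀ {A : Set} (L : List A) {f g} → (∀ a M → f a M ≈ g a M) → P L f ≈ P L g
  P-cong [] e = refl
  P-cong (a ∷ L) e = +-cong (e a L) (P-cong L (λ b M → e b (a ∷ M)))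

  P-+ : ∀ {A : Set} (L : List A) f g → P L (λ a M → f a M + g a M) ≈ P L f + P L g
  P-+ [] f g = sym (+-identityˡ _)
  P-+ (a ∷ L) f g = trans (+-congˡ (P-+ L _ _))
    (solve 4 (λ x y z w → x :+ y :+ (z :+ w) := x :+ z :+ (y :+ w)) refl _ _ _ _)

  P-*ˡ : ∀ {A : Set} (L : List A) c f → P L (λ a M → c * f a M) ≈ c * P L f
  P-*ˡ [] c f = sym (zeroʳ _)
  P-*ˡ (a ∷ L) c f = trans (+-congˡ (P-*ˡ L c _)) (sym (distribˡ _ _ _))

  P-neg : ∀ {A : Set} (L : List A) f → P L (λ a M → - f a M) ≈ - P L f
  P-neg [] f = sym -0#≈0#
  P-neg (a ∷ L) f = trans (+-congˡ (P-neg L _)) (-‿+-comm _ _)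

  -- Both sides run over the triples (j, I, K′) for which L is the disjoint union of j, I and K′.
  P-S2ʳ : ∀ {A : Set} (L : List A) (f : A → List A → List A → Carrier) →
          S2 L (λ I K → P K (λ j K′ → f j I K′)) ≈ P L (λ j L′ → S2 L′ (λ I K → f j I K))
  P-S2ʳ [] f = refl
  P-S2ʳ (a ∷ L) f = begin
    S2 L (λ I K → P K (λ j K′ → f j (a ∷ I) K′)) + S2 L (λ I K → f a I K + P K (λ j K′ → f j I (a ∷ K′)))
      ≈⟨ +-cong (P-S2ʳ L _) (trans (S2-+ L _ _) (+-congˡ (P-S2ʳ L _))) ⟩
    P L (λ j L′ → S2 L′ (λ I K → f j (a ∷ I) K)) + (S2 L (f a) + P L (λ j L′ → S2 L′ (λ I K → f j I (a ∷ K))))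
      ≈⟨ solve 3 (λ x y z → x :+ (y :+ z) := y :+ (x :+ z)) refl _ _ _ ⟩
    S2 L (f a) + (P L (λ j L′ → S2 L′ (λ I K → f j (a ∷ I) K)) + P L (λ j L′ → S2 L′ (λ I K → f j I (a ∷ K))))
      ≈⟨ +-congˡ (sym (P-+ L _ _)) ⟩
    S2 L (f a) + P L (λ j L′ → S2 (a ∷ L′) (f j)) ∎

  P-S2ˡ : ∀ {A : Set} (L : List A) (f : A → List A → List A → Carrier) →
          S2 L (λ I K → P I (λ j I′ → f j I′ K)) ≈ P L (λ j L′ → S2 L′ (λ I K → f j I K))
  P-S2ˡ [] f = refl
  P-S2ˡ (a ∷ L) f = begin
    S2 L (λ I K → f a I K + P I (λ j I′ → f j (a ∷ I′) K)) + S2 L (λ I K → P I (λ j I′ → f j I′ (a ∷ K)))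
      ≈⟨ +-cong (trans (S2-+ L _ _) (+-congˡ (P-S2ˡ L _))) (P-S2ˡ L _) ⟩
    S2 L (f a) + P L (λ j L′ → S2 L′ (λ I K → f j (a ∷ I) K)) + P L (λ j L′ → S2 L′ (λ I K → f j I (a ∷ K)))
      ≈⟨ +-assoc _ _ _ ⟩
    S2 L (f a) + (P L (λ j L′ → S2 L′ (λ I K → f j (a ∷ I) K)) + P L (λ j L′ → S2 L′ (λ I K → f j I (a ∷ K))))
      ≈⟨ +-congˡ (sym (P-+ L _ _)) ⟩
    S2 L (f a) + P L (λ j L′ → S2 (a ∷ L′) (f j)) ∎

  P-const : ∀ {A : Set} (L : List A) c → P L (λ _ _ → c) ≈ ι (length L) * c
  P-const [] c = sym (zeroˡ _)
  P-const (a ∷ L) c = trans (+-congˡ (P-const L c)) (solve 2 (λ n x → x :+ n :* x := (con (+ 1) :+ n) :* x) refl _ _)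

  prodOver : ∀ {A : Set} → (A → Carrier) → List A → Carrier
  prodOver f [] = 1#
  prodOver f (a ∷ L) = f a * prodOver f L

  -- Whichever j is chosen, β j and the product over the rest make up the full product; only φ j
  -- varies.
  P-prod : ∀ {A : Set} (β : A → Carrier) (L : List A) (φ : A → Carrier) →
           P L (λ j M → φ j * (β j * prodOver β M)) ≈ P L (λ j _ → φ j) * prodOver β L
  P-prod β [] φ = sym (zeroˡ _)
  P-prod β (a ∷ L) φ = begin
    φ a * (β a * prodOver β L) + P L (λ j M → φ j * (β j * (β a * prodOver β M)))
      ≈⟨ +-congˡ (trans (P-cong L (λ j M → solve 4 (λ x y z w → x :* (y :* (z :* w)) := z :* (x :* (y :* w))) refl _ _ _ _))
                 (trans (P-*ˡ L (β a) _) (*-congˡ (P-prod β L φ)))) ⟩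
    φ a * (β a * prodOver β L) + β a * (P L (λ j _ → φ j) * prodOver β L)
      ≈⟨ solve 4 (λ x y z w → x :* (y :* z) :+ y :* (w :* z) := (x :+ w) :* (y :* z)) refl _ _ _ _ ⟩
    (φ a + P L (λ j _ → φ j)) * (β a * prodOver β L) ∎

-- Determinants by insertion of the largest entry; Vandermonde's determinant.

permutation-entries : ∀ n → All (VAll.All (λ s → 1 ≤ s × s ≤ n)) (perms n)
permutation-entries zero = [] ∷ []
permutation-entries (suc n) = AllP.concat⁺ (AllP.map⁺ (All.map insert-entries (permutation-entries n)))
  where
  weaken : ∀ {m} {σ : Vec ℕ m} → VAll.All (λ s → 1 ≤ s × s ≤ n) σ → VAll.All (λ s → 1 ≤ s × s ≤ suc n) σ
  weaken = VAll.map (λ { (p , q) → p , ℕP.m≤n⇒m≤1+n q })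
  insert-entries : ∀ {m} {σ : Vec ℕ m} → VAll.All (λ s → 1 ≤ s × s ≤ n) σ →
                   All (VAll.All (λ s → 1 ≤ s × s ≤ suc n)) (insertAll (suc n) σ)
  insert-entries [] = ((s≤s z≤n , ℕP.≤-refl) ∷ []) ∷ []
  insert-entries {σ = y ∷ ys} (p ∷ ps) = ((s≤s z≤n , ℕP.≤-refl) ∷ weaken (p ∷ ps)) ∷
    AllP.map⁺ (All.map (λ q → (proj₁ p , ℕP.m≤n⇒m≤1+n (proj₂ p)) ∷ q) (insert-entries ps))

-- An entry x ≥ y inserted behind y forms no inversion with it, so the sign changes only through the
-- tail.
count-insert-irrelevant : ∀ {m} (x y : ℕ) (ys : Vec ℕ m) → y ≤ x →
  All (λ τ → V.count (λ z → z ℕ.<? y) τ ≡ V.count (λ z → z ℕ.<? y) ys) (insertAll x ys)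
count-insert-irrelevant x y [] y≤x =
  ≡.cong (λ b → (if b then suc else id) 0) (dec-false (x ℕ.<? y) (ℕP.≤⇒≯ y≤x)) ∷ []
count-insert-irrelevant x y (z ∷ zs) y≤x =
  ≡.cong (λ b → (if b then suc else id) (V.count (λ w → w ℕ.<? y) (z ∷ zs))) (dec-false (x ℕ.<? y) (ℕP.≤⇒≯ y≤x)) ∷
  AllP.map⁺ (All.map (≡.cong (if does (z ℕ.<? y) then suc else id)) (count-insert-irrelevant x y zs y≤x))

-- The new largest entry in front forms an inversion with every entry behind it, which gives the
-- sign of moving its row to the end.
count-all : ∀ {m n} (ys : Vec ℕ m) → VAll.All (λ s → 1 ≤ s × s ≤ n) ys → V.count (λ z → z ℕ.<? suc n) ys ≡ m
count-all [] [] = ≡.refl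
count-all {n = n} (y ∷ ys) (p ∷ ps) = ≡.trans
  (≡.cong (λ b → (if b then suc else id) (V.count (λ z → z ℕ.<? suc n) ys)) (dec-true (y ℕ.<? suc n) (s≤s (proj₂ p))))
  (≡.cong suc (count-all ys ps))

module Determinant (R : CRing) where
  open Kit R

  Σ-congᴬ : ∀ {A : Set} {L : List A} {f g : A → Carrier} → All (λ a → f a ≈ g a) L → Σ L f ≈ Σ L g
  Σ-congᴬ [] = refl
  Σ-congᴬ (e ∷ es) = +-cong e (Σ-congᴬ es)

  sgn : ℕ → Carrier
  sgn zero = 1#
  sgn (suc n) = - sgn n

  sgn-+ : ∀ m n → sgn (m ℕ.+ n) ≈ sgn m * sgn n
  sgn-+ zero n = sym (*-identityˡ _)
  sgn-+ (suc m) n = trans (-‿cong (sgn-+ m n)) (-‿distribˡ-* _ _)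

  -- Too short a permutation gives 0, so that rowProd is linear in each row without length conditions.
  rowProd : ∀ {n} → List (ℕ → Carrier) → Vec ℕ n → Carrier
  rowProd [] σ = 1#
  rowProd (r ∷ rs) [] = 0#
  rowProd (r ∷ rs) (s ∷ σ) = r s * rowProd rs σ

  det : ℕ → List (ℕ → Carrier) → Carrier
  det n rows = Σ (perms n) (λ σ → sgn (inv σ) * rowProd rows σ)

  rowProd-linear : ∀ {n} (pre : List (ℕ → Carrier)) post r r′ a b (σ : Vec ℕ n) →
    rowProd (pre ++ (λ s → a * r s + b * r′ s) ∷ post) σ ≈
    a * rowProd (pre ++ r ∷ post) σ + b * rowProd (pre ++ r′ ∷ post) σ
  rowProd-linear [] post r r′ a b [] = solve 2 (λ a b → con (+ 0) := a :* con (+ 0) :+ b :* con (+ 0)) refl _ _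
  rowProd-linear [] post r r′ a b (s ∷ σ) =
    solve 5 (λ a b x y z → (a :* x :+ b :* y) :* z := a :* (x :* z) :+ b :* (y :* z)) refl _ _ _ _ _
  rowProd-linear (q ∷ pre) post r r′ a b [] = solve 2 (λ a b → con (+ 0) := a :* con (+ 0) :+ b :* con (+ 0)) refl _ _
  rowProd-linear (q ∷ pre) post r r′ a b (s ∷ σ) = trans (*-congˡ (rowProd-linear pre post r r′ a b σ))
    (solve 5 (λ a b x y z → z :* (a :* x :+ b :* y) := a :* (z :* x) :+ b :* (z :* y)) refl _ _ _ _ _)

  det-linear : ∀ n (pre : List (ℕ → Carrier)) post r r′ a b →
    det n (pre ++ (λ s → a * r s + b * r′ s) ∷ post) ≈ a * det n (pre ++ r ∷ post) + b * det n (pre ++ r′ ∷ post)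
  det-linear n pre post r r′ a b = begin
    det n (pre ++ (λ s → a * r s + b * r′ s) ∷ post)
      ≈⟨ Σ-cong (perms n) (λ σ → trans (*-congˡ (rowProd-linear pre post r r′ a b σ))
          (solve 5 (λ a b x y z → z :* (a :* x :+ b :* y) := a :* (z :* x) :+ b :* (z :* y)) refl _ _ _ _ _)) ⟩
    Σ (perms n) (λ σ → a * (sgn (inv σ) * rowProd (pre ++ r ∷ post) σ) + b * (sgn (inv σ) * rowProd (pre ++ r′ ∷ post) σ))
      ≈⟨ trans (Σ-+ (perms n) _ _) (+-cong (Σ-*ˡ (perms n) a _) (Σ-*ˡ (perms n) b _)) ⟩
    a * det n (pre ++ r ∷ post) + b * det n (pre ++ r′ ∷ post) ∎

  data _≋_ : List (ℕ → Carrier) → List (ℕ → Carrier) → Set where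
    []  : [] ≋ []
    _∷_ : ∀ {r r′ rs rs′} → (∀ s → r s ≈ r′ s) → rs ≋ rs′ → (r ∷ rs) ≋ (r′ ∷ rs′)

  ≋-refl : ∀ {rs} → rs ≋ rs
  ≋-refl {[]} = []
  ≋-refl {r ∷ rs} = (λ _ → refl) ∷ ≋-refl

  ≋-++ : ∀ {rs rs′ qs qs′} → rs ≋ rs′ → qs ≋ qs′ → (rs ++ qs) ≋ (rs′ ++ qs′)
  ≋-++ [] q = q
  ≋-++ (e ∷ p) q = e ∷ ≋-++ p q

  ≋-map : ∀ {A : Set} {f g : A → ℕ → Carrier} → (∀ a s → f a s ≈ g a s) → (L : List A) → map f L ≋ map g L
  ≋-map e [] = []
  ≋-map e (a ∷ L) = e a ∷ ≋-map e L

  rowProd-cong : ∀ {n rs rs′} → rs ≋ rs′ → (σ : Vec ℕ n) → rowProd rs σ ≈ rowProd rs′ σ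
  rowProd-cong [] σ = refl
  rowProd-cong (e ∷ es) [] = refl
  rowProd-cong (e ∷ es) (s ∷ σ) = *-cong (e s) (rowProd-cong es σ)

  det-cong : ∀ n {rs rs′} → rs ≋ rs′ → det n rs ≈ det n rs′
  det-cong n e = Σ-cong (perms n) (λ σ → *-congˡ (rowProd-cong e σ))

  -- signed choice of an element, the sign being that of moving it to the end
  P± : ∀ {A : Set} → List A → (A → List A → Carrier) → Carrier
  P± [] f = 0#
  P± (a ∷ L) f = sgn (length L) * f a L + P± L (λ b M → f b (a ∷ M))

  P±-cong : ∀ {A : Set} (L : List A) {f g} → (∀ a M → f a M ≈ g a M) → P± L f ≈ P± L g
  P±-cong [] e = refl
  P±-cong (a ∷ L) e = +-cong (*-congˡ (e a L)) (P±-cong L (λ b M → e b (a ∷ M)))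

  P±-+ : ∀ {A : Set} (L : List A) f g → P± L (λ a M → f a M + g a M) ≈ P± L f + P± L g
  P±-+ [] f g = sym (+-identityˡ _)
  P±-+ (a ∷ L) f g = trans (+-congˡ (P±-+ L _ _))
    (solve 5 (λ c x y z w → c :* (x :+ y) :+ (z :+ w) := c :* x :+ z :+ (c :* y :+ w)) refl _ _ _ _ _)

  P±-*ˡ : ∀ {A : Set} (L : List A) c f → P± L (λ a M → c * f a M) ≈ c * P± L f
  P±-*ˡ [] c f = sym (zeroʳ _)
  P±-*ˡ (a ∷ L) c f = trans (+-congˡ (P±-*ˡ L c _))
    (solve 4 (λ s c x y → s :* (c :* x) :+ c :* y := c :* (s :* x :+ y)) refl _ _ _ _)

  P±-map : ∀ {A B : Set} (g : A → B) (L : List A) (f : B → List B → Carrier) →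
           P± (map g L) f ≈ P± L (λ a M → f (g a) (map g M))
  P±-map g [] f = refl
  P±-map g (a ∷ L) f = +-cong (*-congʳ (reflexive (≡.cong sgn (length-map′ L)))) (P±-map g L _)
    where
    length-map′ : ∀ M → length (map g M) ≡ length M
    length-map′ [] = ≡.refl
    length-map′ (b ∷ M) = ≡.cong suc (length-map′ M)

  P±-prod : ∀ {A : Set} (φ : A → Carrier) (L : List A) (g : A → List A → Carrier) →
            P± L (λ a M → φ a * prodOver φ M * g a M) ≈ prodOver φ L * P± L g
  P±-prod φ [] g = sym (zeroʳ _)
  P±-prod φ (a ∷ L) g = begin
    sgn (length L) * (φ a * prodOver φ L * g a L) + P± L (λ b M → φ b * (φ a * prodOver φ M) * g b (a ∷ M))
      ≈⟨ +-congˡ (trans (P±-cong L (λ b M → solve 4 (λ x y z w → x :* (y :* z) :* w := y :* (x :* z :* w)) refl _ _ _ _))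
                 (trans (P±-*ˡ L (φ a) _) (*-congˡ (P±-prod φ L _)))) ⟩
    sgn (length L) * (φ a * prodOver φ L * g a L) + φ a * (prodOver φ L * P± L (λ b M → g b (a ∷ M)))
      ≈⟨ solve 5 (λ s x y z w → s :* (x :* y :* z) :+ x :* (y :* w) := x :* y :* (s :* z :+ w)) refl _ _ _ _ _ ⟩
    φ a * prodOver φ L * (sgn (length L) * g a L + P± L (λ b M → g b (a ∷ M))) ∎

  P±-length : ∀ {A : Set} (h : ℕ → Carrier) (L : List A) (g : A → List A → Carrier) →
              P± L (λ a M → h (suc (length M)) * g a M) ≈ h (length L) * P± L g
  P±-length h [] g = sym (zeroʳ _)
  P±-length h (a ∷ L) g = trans (+-congˡ (P±-length (λ n → h (suc n)) L _))
    (solve 4 (λ s h x y → s :* (h :* x) :+ h :* y := h :* (s :* x :+ y)) refl _ _ _ _)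

  P±-length-cong : ∀ {A : Set} n (L : List A) {f g} → length L ≡ suc n →
                   (∀ a M → length M ≡ n → f a M ≈ g a M) → P± L f ≈ P± L g
  P±-length-cong zero (a ∷ []) e h = +-congʳ (*-congˡ (h a [] ≡.refl))
  P±-length-cong (suc n) (a ∷ L) e h = +-cong (*-congˡ (h a L (ℕP.suc-injective e)))
    (P±-length-cong n L (ℕP.suc-injective e) (λ b M l → h b (a ∷ M) (≡.cong suc l)))

  -- The position of the value n + 1 in τ decides which row meets column n + 1, and the inversions
  -- it creates are the entries behind it. Removing that row leaves σ on the others.
  insertion-sum : ∀ {m n} (σ : Vec ℕ m) → VAll.All (λ s → 1 ≤ s × s ≤ n) σ → ∀ rows → length rows ≡ suc m →
    Σ (insertAll (suc n) σ) (λ τ → sgn (inv τ) * rowProd rows τ) ≈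
    P± rows (λ r rest → r (suc n) * (sgn (inv σ) * rowProd rest σ))
  insertion-sum [] [] (r ∷ []) e = +-congʳ (solve 1 (λ x → con (+ 1) :* (x :* con (+ 1)) := con (+ 1) :* (x :* (con (+ 1) :* con (+ 1)))) refl _)
  insertion-sum {suc m} {n} (y ∷ ys) (p ∷ ps) (r ∷ rs) e = +-cong first others
    where
    first : sgn (V.count (λ z → z ℕ.<? suc n) (y ∷ ys) ℕ.+ inv (y ∷ ys)) * (r (suc n) * rowProd rs (y ∷ ys)) ≈
            sgn (length rs) * (r (suc n) * (sgn (inv (y ∷ ys)) * rowProd rs (y ∷ ys)))
    first = trans (*-congʳ (trans (sgn-+ (V.count (λ z → z ℕ.<? suc n) (y ∷ ys)) (inv (y ∷ ys)))
        (*-congʳ (reflexive (≡.cong sgn (≡.trans (count-all (y ∷ ys) (p ∷ ps)) (≡.sym (ℕP.suc-injective e))))))))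
      (solve 4 (λ a b c d → a :* b :* (c :* d) := a :* (c :* (b :* d))) refl _ _ _ _)
    cy = V.count (λ z → z ℕ.<? y) ys
    others : Σ (map (y ∷_) (insertAll (suc n) ys)) (λ τ → sgn (inv τ) * rowProd (r ∷ rs) τ) ≈
             P± rs (λ r′ rest → r′ (suc n) * (sgn (inv (y ∷ ys)) * (r y * rowProd rest ys)))
    others = begin
      Σ (map (y ∷_) (insertAll (suc n) ys)) (λ τ → sgn (inv τ) * rowProd (r ∷ rs) τ)
        ≈⟨ Σ-map (y ∷_) (insertAll (suc n) ys) _ ⟩
      Σ (insertAll (suc n) ys) (λ τ → sgn (V.count (λ z → z ℕ.<? y) τ ℕ.+ inv τ) * (r y * rowProd rs τ))
        ≈⟨ Σ-congᴬ (All.map (λ {τ} eq → trans (*-congʳ (trans (sgn-+ (V.count (λ z → z ℕ.<? y) τ) (inv τ)) (*-congʳ (reflexive (≡.cong sgn eq)))))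
             (solve 4 (λ a b c d → a :* b :* (c :* d) := a :* c :* (b :* d)) refl _ _ _ _))
             (count-insert-irrelevant (suc n) y ys (ℕP.m≤n⇒m≤1+n (proj₂ p)))) ⟩
      Σ (insertAll (suc n) ys) (λ τ → sgn cy * r y * (sgn (inv τ) * rowProd rs τ))
        ≈⟨ Σ-*ˡ (insertAll (suc n) ys) _ _ ⟩
      sgn cy * r y * Σ (insertAll (suc n) ys) (λ τ → sgn (inv τ) * rowProd rs τ)
        ≈⟨ *-congˡ (insertion-sum ys ps rs (ℕP.suc-injective e)) ⟩
      sgn cy * r y * P± rs (λ r′ rest → r′ (suc n) * (sgn (inv ys) * rowProd rest ys))
        ≈⟨ sym (P±-*ˡ rs _ _) ⟩
      P± rs (λ r′ rest → sgn cy * r y * (r′ (suc n) * (sgn (inv ys) * rowProd rest ys)))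
        ≈⟨ P±-cong rs (λ r′ rest → trans (solve 5 (λ a b c d e → a :* b :* (c :* (d :* e)) := c :* (a :* d :* (b :* e))) refl _ _ _ _ _)
             (*-congˡ (*-congʳ (sym (sgn-+ cy (inv ys)))))) ⟩
      P± rs (λ r′ rest → r′ (suc n) * (sgn (inv (y ∷ ys)) * (r y * rowProd rest ys))) ∎

  Σ-P± : ∀ {A B : Set} (M : List B) (L : List A) (f : B → A → List A → Carrier) →
         Σ M (λ b → P± L (f b)) ≈ P± L (λ a L′ → Σ M (λ b → f b a L′))
  Σ-P± M [] f = Σ-0 M
  Σ-P± M (a ∷ L) f = trans (Σ-+ M _ _) (+-cong (Σ-*ˡ M _ _) (Σ-P± M L _))

  -- Laplace expansion along the last column, as `perms (suc n)` arises by inserting n + 1 into the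
  -- permutations of n letters.
  det-expand : ∀ n rows → length rows ≡ suc n →
    det (suc n) rows ≈ P± rows (λ r rest → r (suc n) * det n rest)
  det-expand n rows e = begin
    det (suc n) rows
      ≈⟨ Σ-concatMap (insertAll (suc n)) (perms n) _ ⟩
    Σ (perms n) (λ σ → Σ (insertAll (suc n) σ) (λ τ → sgn (inv τ) * rowProd rows τ))
      ≈⟨ Σ-congᴬ (All.map (λ {σ} b → insertion-sum σ b rows e) (permutation-entries n)) ⟩
    Σ (perms n) (λ σ → P± rows (λ r rest → r (suc n) * (sgn (inv σ) * rowProd rest σ)))
      ≈⟨ Σ-P± (perms n) rows _ ⟩
    P± rows (λ r rest → Σ (perms n) (λ σ → r (suc n) * (sgn (inv σ) * rowProd rest σ)))
      ≈⟨ P±-cong rows (λ r rest → Σ-*ˡ (perms n) _ _) ⟩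
    P± rows (λ r rest → r (suc n) * det n rest) ∎

  diffs : Carrier → List Carrier → Carrier
  diffs x = prodOver (λ y → x + - y)

  vandermonde : List Carrier → Carrier
  vandermonde [] = 1#
  vandermonde (x ∷ xs) = diffs x xs * vandermonde xs

  codiffs : Carrier → List Carrier → Carrier
  codiffs c = prodOver (λ y → y + - c)

  diffs-codiffs : ∀ z L → diffs z L ≈ sgn (length L) * codiffs z L
  diffs-codiffs z [] = sym (*-identityˡ _)
  diffs-codiffs z (y ∷ L) = trans (*-congˡ (diffs-codiffs z L))
    (solve 4 (λ z y s p → (z :- y) :* (s :* p) := (:- s) :* ((y :- z) :* p)) refl _ _ _ _)

  -- The extra parameter c makes the induction go through: the step uses the cases c and c = z.
  vandermonde-expand : ∀ c z ys → P± (z ∷ ys) (λ _ rest → codiffs c rest * vandermonde rest) ≈ vandermonde (z ∷ ys)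
  expand-step : ∀ c z ys → (∀ c → P± ys (λ _ rest → codiffs c rest * vandermonde rest) ≈ vandermonde ys) →
    P± (z ∷ ys) (λ _ rest → codiffs c rest * vandermonde rest) ≈ vandermonde (z ∷ ys)

  vandermonde-expand c z [] = solve 0 (con (+ 1) :* (con (+ 1) :* con (+ 1)) :+ con (+ 0) := con (+ 1) :* con (+ 1)) refl
  vandermonde-expand c z (w ∷ ws) = expand-step c z (w ∷ ws) (λ c → vandermonde-expand c w ws)

  expand-step c z ys IH = begin
    sgn (length ys) * (codiffs c ys * vandermonde ys) + P± ys (λ _ rest → codiffs c (z ∷ rest) * vandermonde (z ∷ rest))
      ≈⟨ +-congˡ split ⟩
    sgn (length ys) * (codiffs c ys * vandermonde ys) +
      (diffs z ys * vandermonde ys + codiffs c ys * (- sgn (length ys) * vandermonde ys))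
      ≈⟨ solve 4 (λ s a b v → s :* (a :* v) :+ (b :* v :+ a :* ((:- s) :* v)) := b :* v) refl _ _ _ _ ⟩
    diffs z ys * vandermonde ys ∎
    where
    split : P± ys (λ _ rest → codiffs c (z ∷ rest) * vandermonde (z ∷ rest)) ≈
            diffs z ys * vandermonde ys + codiffs c ys * (- sgn (length ys) * vandermonde ys)
    split = begin
      P± ys (λ _ rest → codiffs c (z ∷ rest) * vandermonde (z ∷ rest))
        -- With p the element left out, z - c is split as (z - p) + (p - c). Each summand completes
        -- one of the two products over the rest to a product over all of `ys`.
        ≈⟨ P±-cong ys (λ p rest → solve 6 (λ z c p k d v →
             (z :- c) :* k :* (d :* v) := (z :- p) :* d :* (k :* v) :+ (p :- c) :* k :* (d :* v)) refl z c p (codiffs c rest) (diffs z rest) (vandermonde rest)) ⟩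
      P± ys (λ p rest → (z + - p) * diffs z rest * (codiffs c rest * vandermonde rest)
                        + (p + - c) * codiffs c rest * (diffs z rest * vandermonde rest))
        ≈⟨ trans (P±-+ ys _ _) (+-cong (P±-prod (λ y → z + - y) ys _) (P±-prod (λ y → y + - c) ys _)) ⟩
      diffs z ys * P± ys (λ _ rest → codiffs c rest * vandermonde rest)
        + codiffs c ys * P± ys (λ _ rest → diffs z rest * vandermonde rest)
        ≈⟨ +-cong (*-congˡ (IH c)) (*-congˡ (begin
             P± ys (λ _ rest → diffs z rest * vandermonde rest)
               ≈⟨ P±-cong ys (λ p rest → trans (*-congʳ (diffs-codiffs z rest))
                    (solve 3 (λ s a b → s :* a :* b := :- (:- s) :* (a :* b)) refl _ _ _)) ⟩
             P± ys (λ _ rest → - sgn (suc (length rest)) * (codiffs z rest * vandermonde rest))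
               ≈⟨ P±-length (λ n → - sgn n) ys _ ⟩
             - sgn (length ys) * P± ys (λ _ rest → codiffs z rest * vandermonde rest)
               ≈⟨ *-congˡ (IH z) ⟩
             - sgn (length ys) * vandermonde ys ∎)) ⟩
      diffs z ys * vandermonde ys + codiffs c ys * (- sgn (length ys) * vandermonde ys) ∎

  prodOver-cong : ∀ {A : Set} {f g : A → Carrier} (L : List A) → (∀ a → f a ≈ g a) → prodOver f L ≈ prodOver g L
  prodOver-cong [] e = refl
  prodOver-cong (a ∷ L) e = *-cong (e a) (prodOver-cong L e)

  prodOver-* : ∀ {A : Set} (f g : A → Carrier) (L : List A) → prodOver (λ a → f a * g a) L ≈ prodOver f L * prodOver g L
  prodOver-* f g [] = sym (*-identityˡ _)
  prodOver-* f g (a ∷ L) = trans (*-congˡ (prodOver-* f g L))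
    (solve 4 (λ x y z w → x :* y :* (z :* w) := x :* z :* (y :* w)) refl _ _ _ _)

  -- The surplus m makes the induction work: deleting the last of n + 1 columns leaves n columns
  -- with exponents n + (m + 1) - s.
  det-powers : ∀ n m xs → length xs ≡ n →
    det n (map (λ x s → x ^ ((n ℕ.+ m) ∸ s)) xs) ≈ prodOver (_^ m) xs * vandermonde xs
  det-powers zero m [] e = solve 0 (con (+ 1) :* con (+ 1) :+ con (+ 0) := con (+ 1) :* con (+ 1)) refl
  det-powers (suc n) m xs e = begin
    det (suc n) (map (λ x s → x ^ ((suc n ℕ.+ m) ∸ s)) xs)
      ≈⟨ det-expand n (map (λ x s → x ^ ((suc n ℕ.+ m) ∸ s)) xs) (≡.trans (length-map′ xs) e) ⟩
    P± (map (λ x s → x ^ ((suc n ℕ.+ m) ∸ s)) xs) (λ r rest → r (suc n) * det n rest)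
      ≈⟨ P±-map (λ x s → x ^ ((suc n ℕ.+ m) ∸ s)) xs _ ⟩
    P± xs (λ x M → x ^ ((n ℕ.+ m) ∸ n) * det n (map (λ x s → x ^ ((suc n ℕ.+ m) ∸ s)) M))
      ≈⟨ P±-length-cong n xs e minor ⟩
    P± xs (λ x M → x ^ m * prodOver (_^ m) M * (codiffs 0# M * vandermonde M))
      ≈⟨ P±-prod (_^ m) xs _ ⟩
    prodOver (_^ m) xs * P± xs (λ _ M → codiffs 0# M * vandermonde M)
      ≈⟨ *-congˡ (expand xs e) ⟩
    prodOver (_^ m) xs * vandermonde xs ∎
    where
    expand : ∀ xs → length xs ≡ suc n → P± xs (λ _ M → codiffs 0# M * vandermonde M) ≈ vandermonde xs
    expand (z ∷ zs) _ = vandermonde-expand 0# z zs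
    length-map′ : ∀ M → length (map (λ x s → x ^ ((suc n ℕ.+ m) ∸ s)) M) ≡ length M
    length-map′ [] = ≡.refl
    length-map′ (b ∷ M) = ≡.cong suc (length-map′ M)
    minor : ∀ x M → length M ≡ n →
      x ^ ((n ℕ.+ m) ∸ n) * det n (map (λ x s → x ^ ((suc n ℕ.+ m) ∸ s)) M) ≈
      x ^ m * prodOver (_^ m) M * (codiffs 0# M * vandermonde M)
    minor x M l = begin
      x ^ ((n ℕ.+ m) ∸ n) * det n (map (λ x s → x ^ ((suc n ℕ.+ m) ∸ s)) M)
        ≈⟨ *-cong (reflexive (≡.cong (x ^_) (ℕP.m+n∸m≡n n m)))
            (trans (det-cong n (≋-map (λ y s → reflexive (≡.cong (λ k → y ^ (k ∸ s)) (≡.sym (ℕP.+-suc n m)))) M))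
                   (det-powers n (suc m) M l)) ⟩
      x ^ m * (prodOver (_^ suc m) M * vandermonde M)
        ≈⟨ *-congˡ (*-congʳ (prodOver-* (λ y → y) (_^ m) M)) ⟩
      x ^ m * (prodOver (λ y → y) M * prodOver (_^ m) M * vandermonde M)
        -- The product of the remaining variables is `codiffs 0# M`, so the case c = 0 of the
        -- Vandermonde expansion applies.
        ≈⟨ *-congˡ (*-congʳ (*-congʳ (prodOver-cong M (λ y → solve 1 (λ y → y := y :- con (+ 0)) refl y)))) ⟩
      x ^ m * (codiffs 0# M * prodOver (_^ m) M * vandermonde M)
        ≈⟨ solve 4 (λ a b c d → a :* (b :* c :* d) := a :* c :* (b :* d)) refl _ _ _ _ ⟩
      x ^ m * prodOver (_^ m) M * (codiffs 0# M * vandermonde M) ∎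

-- Ring constructions: homomorphisms and dual numbers.

record RingLaws (C : Set) (_≈_ : C → C → Set) (_+_ _*_ : C → C → C) (neg : C → C) (0# 1# : C) : Set where
  field
    isEquivalence : IsEquivalence _≈_
    +-cong : ∀ {a b c d} → a ≈ b → c ≈ d → (a + c) ≈ (b + d)
    +-assoc : ∀ a b c → ((a + b) + c) ≈ (a + (b + c))
    +-comm : ∀ a b → (a + b) ≈ (b + a)
    +-identityˡ : ∀ a → (0# + a) ≈ a
    neg-cong : ∀ {a b} → a ≈ b → neg a ≈ neg b
    neg-inverseˡ : ∀ a → (neg a + a) ≈ 0#
    *-cong : ∀ {a b c d} → a ≈ b → c ≈ d → (a * c) ≈ (b * d)
    *-assoc : ∀ a b c → ((a * b) * c) ≈ (a * (b * c))
    *-comm : ∀ a b → (a * b) ≈ (b * a)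
    *-identityˡ : ∀ a → (1# * a) ≈ a
    distribʳ : ∀ a b c → ((b + c) * a) ≈ ((b * a) + (c * a))

  private
    module E = IsEquivalence isEquivalence

  commutativeRing : CRing
  commutativeRing = record
    { Carrier = C ; _≈_ = _≈_ ; _+_ = _+_ ; _*_ = _*_ ; -_ = neg ; 0# = 0# ; 1# = 1#
    ; isCommutativeRing = record
      { isRing = record
        { +-isAbelianGroup = record
          { isGroup = record
            { isMonoid = record
              { isSemigroup = record
                { isMagma = record { isEquivalence = isEquivalence ; ∙-cong = +-cong }
                ; assoc = +-assoc }
              ; identity = +-identityˡ , λ a → E.trans (+-comm a 0#) (+-identityˡ a) }
            ; inverse = neg-inverseˡ , λ a → E.trans (+-comm a (neg a)) (neg-inverseˡ a)
            ; ⁻¹-cong = neg-cong }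
          ; comm = +-comm }
        ; *-cong = *-cong
        ; *-assoc = *-assoc
        ; *-identity = *-identityˡ , λ a → E.trans (*-comm a 1#) (*-identityˡ a)
        ; distrib = (λ a b c → E.trans (*-comm a (b + c)) (E.trans (distribʳ a b c) (+-cong (*-comm b a) (*-comm c a)))) , distribʳ }
      ; *-comm = *-comm } }

record Hom (R S : CRing) : Set where
  private
    module R = CommutativeRing R
    module S = CommutativeRing S
  field
    ⟦_⟧ : R.Carrier → S.Carrier
    ⟦⟧-cong : ∀ {a b} → a R.≈ b → ⟦ a ⟧ S.≈ ⟦ b ⟧
    +-homo : ∀ a b → ⟦ a R.+ b ⟧ S.≈ ⟦ a ⟧ S.+ ⟦ b ⟧
    *-homo : ∀ a b → ⟦ a R.* b ⟧ S.≈ ⟦ a ⟧ S.* ⟦ b ⟧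
    1-homo : ⟦ R.1# ⟧ S.≈ S.1#

module RisingFactorial (R : CRing) where
  open Kit R

  fact : ℕ → Carrier
  fact zero = 1#
  fact (suc n) = ι (suc n) * fact n

  rise : Carrier → ℕ → ℕ → Carrier
  rise u m zero = 1#
  rise u m (suc r) = (u + ι m) * rise u (suc m) r

module HomProps {R S : CRing} (φ : Hom R S) where
  open Hom φ public
  private
    module R where
      open Kit R public
      open Determinant R public
      open RisingFactorial R public
  open Kit S
  open Determinant S
  open RisingFactorial S

  0-homo : ⟦ R.0# ⟧ ≈ 0#
  0-homo = begin
    ⟦ R.0# ⟧                          ≈⟨ solve 1 (λ a → a := a :+ a :- a) refl _ ⟩
    ⟦ R.0# ⟧ + ⟦ R.0# ⟧ + - ⟦ R.0# ⟧  ≈⟨ +-congʳ (trans (sym (+-homo _ _)) (⟦⟧-cong (R.+-identityˡ _))) ⟩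
    ⟦ R.0# ⟧ + - ⟦ R.0# ⟧             ≈⟨ -‿inverseʳ _ ⟩
    0# ∎

  neg-homo : ∀ a → ⟦ R.- a ⟧ ≈ - ⟦ a ⟧
  neg-homo a = begin
    ⟦ R.- a ⟧                     ≈⟨ solve 2 (λ x y → x := x :+ y :- y) refl _ ⟦ a ⟧ ⟩
    ⟦ R.- a ⟧ + ⟦ a ⟧ + - ⟦ a ⟧   ≈⟨ +-congʳ (trans (sym (+-homo _ _)) (trans (⟦⟧-cong (R.-‿inverseˡ a)) 0-homo)) ⟩
    0# + - ⟦ a ⟧                  ≈⟨ +-identityˡ _ ⟩
    - ⟦ a ⟧ ∎

  ι-homo : ∀ n → ⟦ R.ι n ⟧ ≈ ι n
  ι-homo zero = 0-homo
  ι-homo (suc n) = trans (+-homo _ _) (+-cong 1-homo (ι-homo n))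

  ^-homo : ∀ a n → ⟦ a R.^ n ⟧ ≈ ⟦ a ⟧ ^ n
  ^-homo a zero = 1-homo
  ^-homo a (suc n) = trans (*-homo _ _) (*-congˡ (^-homo a n))

  sgn-homo : ∀ n → ⟦ R.sgn n ⟧ ≈ sgn n
  sgn-homo zero = 1-homo
  sgn-homo (suc n) = trans (neg-homo _) (-‿cong (sgn-homo n))

  Σ-homo : ∀ {A : Set} (L : List A) f → ⟦ R.Σ L f ⟧ ≈ Σ L (λ a → ⟦ f a ⟧)
  Σ-homo [] f = 0-homo
  Σ-homo (a ∷ L) f = trans (+-homo _ _) (+-congˡ (Σ-homo L f))

  P-homo : ∀ {A : Set} (L : List A) f → ⟦ R.P L f ⟧ ≈ P L (λ a M → ⟦ f a M ⟧)
  P-homo [] f = 0-homo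
  P-homo (a ∷ L) f = trans (+-homo _ _) (+-congˡ (P-homo L _))

  S2-homo : ∀ {A : Set} (L : List A) f → ⟦ R.S2 L f ⟧ ≈ S2 L (λ I K → ⟦ f I K ⟧)
  S2-homo [] f = refl
  S2-homo (a ∷ L) f = trans (+-homo _ _) (+-cong (S2-homo L _) (S2-homo L _))

  prodOver-homo : ∀ {A : Set} (f : A → R.Carrier) L → ⟦ R.prodOver f L ⟧ ≈ prodOver (λ a → ⟦ f a ⟧) L
  prodOver-homo f [] = 1-homo
  prodOver-homo f (a ∷ L) = trans (*-homo _ _) (*-congˡ (prodOver-homo f L))

  diffs-homo : ∀ x L → ⟦ R.diffs x L ⟧ ≈ diffs ⟦ x ⟧ (map ⟦_⟧ L)
  diffs-homo x [] = 1-homo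
  diffs-homo x (y ∷ L) = trans (*-homo _ _) (*-cong (trans (+-homo _ _) (+-congˡ (neg-homo y))) (diffs-homo x L))

  vandermonde-homo : ∀ L → ⟦ R.vandermonde L ⟧ ≈ vandermonde (map ⟦_⟧ L)
  vandermonde-homo [] = 1-homo
  vandermonde-homo (x ∷ L) = trans (*-homo _ _) (*-cong (diffs-homo x L) (vandermonde-homo L))

  fact-homo : ∀ n → ⟦ R.fact n ⟧ ≈ fact n
  fact-homo zero = 1-homo
  fact-homo (suc n) = trans (*-homo _ _) (*-cong (ι-homo (suc n)) (fact-homo n))

  rise-homo : ∀ u m r → ⟦ R.rise u m r ⟧ ≈ rise ⟦ u ⟧ m r
  rise-homo u m zero = 1-homo
  rise-homo u m (suc r) = trans (*-homo _ _) (*-cong (trans (+-homo _ _) (+-congˡ (ι-homo m))) (rise-homo u (suc m) r))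

  mapRows : List (ℕ → R.Carrier) → List (ℕ → Carrier)
  mapRows = map (λ r s → ⟦ r s ⟧)

  rowProd-homo : ∀ {n} rows (σ : Vec ℕ n) → ⟦ R.rowProd rows σ ⟧ ≈ rowProd (mapRows rows) σ
  rowProd-homo [] σ = 1-homo
  rowProd-homo (r ∷ rows) [] = 0-homo
  rowProd-homo (r ∷ rows) (s ∷ σ) = trans (*-homo _ _) (*-congˡ (rowProd-homo rows σ))

  det-homo : ∀ n rows → ⟦ R.det n rows ⟧ ≈ det n (mapRows rows)
  det-homo n rows = trans (Σ-homo (perms n) _)
    (Σ-cong (perms n) (λ σ → trans (*-homo _ _) (*-cong (sgn-homo (inv σ)) (rowProd-homo rows σ))))

_∘ᴴ_ : ∀ {R S T} → Hom S T → Hom R S → Hom R T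
_∘ᴴ_ {T = T} ψ φ = record
  { ⟦_⟧ = λ a → ψ.⟦ φ.⟦ a ⟧ ⟧
  ; ⟦⟧-cong = λ e → ψ.⟦⟧-cong (φ.⟦⟧-cong e)
  ; +-homo = λ a b → T.trans (ψ.⟦⟧-cong (φ.+-homo a b)) (ψ.+-homo _ _)
  ; *-homo = λ a b → T.trans (ψ.⟦⟧-cong (φ.*-homo a b)) (ψ.*-homo _ _)
  ; 1-homo = T.trans (ψ.⟦⟧-cong φ.1-homo) ψ.1-homo }
  where
  module ψ = Hom ψ
  module φ = Hom φ
  module T = CommutativeRing T

idᴴ : ∀ {R} → Hom R R
idᴴ {R} = record { ⟦_⟧ = λ a → a ; ⟦⟧-cong = λ e → e ; +-homo = λ _ _ → refl ; *-homo = λ _ _ → refl ; 1-homo = refl }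
  where open CommutativeRing R

-- Abstract, so that towers of dual numbers do not unfold during unification.
module DualNumbers (R : CRing) where
  open Kit R

  private
    laws : RingLaws (Carrier × Carrier) (λ a b → proj₁ a ≈ proj₁ b × proj₂ a ≈ proj₂ b)
      (λ a b → proj₁ a + proj₁ b , proj₂ a + proj₂ b) (λ a b → proj₁ a * proj₁ b , proj₁ a * proj₂ b + proj₂ a * proj₁ b)
      (λ a → - proj₁ a , - proj₂ a) (0# , 0#) (1# , 0#)
    laws = record
      { isEquivalence = record { refl = refl , refl ; sym = λ { (p , q) → sym p , sym q } ; trans = λ { (p , q) (p′ , q′) → trans p p′ , trans q q′ } }
      ; +-cong = λ { (p , q) (p′ , q′) → +-cong p p′ , +-cong q q′ }
      ; +-assoc = λ _ _ _ → +-assoc _ _ _ , +-assoc _ _ _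
      ; +-comm = λ _ _ → +-comm _ _ , +-comm _ _
      ; +-identityˡ = λ _ → +-identityˡ _ , +-identityˡ _
      ; neg-cong = λ { (p , q) → -‿cong p , -‿cong q }
      ; neg-inverseˡ = λ _ → -‿inverseˡ _ , -‿inverseˡ _
      ; *-cong = λ { (p , q) (p′ , q′) → *-cong p p′ , +-cong (*-cong p q′) (*-cong q p′) }
      ; *-assoc = λ _ _ _ → *-assoc _ _ _ ,
          solve 6 (λ a b c d e f → a :* c :* f :+ (a :* d :+ b :* c) :* e := a :* (c :* f :+ d :* e) :+ b :* (c :* e)) refl _ _ _ _ _ _
      ; *-comm = λ _ _ → *-comm _ _ , solve 4 (λ a b c d → a :* d :+ b :* c := c :* b :+ d :* a) refl _ _ _ _
      ; *-identityˡ = λ _ → *-identityˡ _ , solve 2 (λ a b → con (+ 1) :* b :+ con (+ 0) :* a := b) refl _ _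
      ; distribʳ = λ _ _ _ → distribʳ _ _ _ ,
          solve 6 (λ a b c d e f → (c :+ e) :* b :+ (d :+ f) :* a := c :* b :+ d :* a :+ (e :* b :+ f :* a)) refl _ _ _ _ _ _
      }

  abstract
    Dual : CRing
    Dual = RingLaws.commutativeRing laws

    embed : Hom R Dual
    embed = record
      { ⟦_⟧ = λ a → a , 0#
      ; ⟦⟧-cong = λ e → e , refl
      ; +-homo = λ _ _ → refl , sym (+-identityˡ _)
      ; *-homo = λ _ _ → refl , solve 2 (λ a b → con (+ 0) := a :* con (+ 0) :+ con (+ 0) :* b) refl _ _
      ; 1-homo = refl , refl }

    real : Hom Dual R
    real = record
      { ⟦_⟧ = proj₁ ; ⟦⟧-cong = proj₁ ; +-homo = λ _ _ → refl ; *-homo = λ _ _ → refl ; 1-homo = refl }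

  private
    module D = Kit Dual
    emb : Carrier → D.Carrier
    emb = Hom.⟦_⟧ embed
    re : D.Carrier → Carrier
    re = Hom.⟦_⟧ real

  abstract
    εpart : D.Carrier → Carrier
    εpart = proj₂

    pair : Carrier → Carrier → D.Carrier
    pair = _,_

    dual-ext : ∀ {a b} → re a ≈ re b → εpart a ≈ εpart b → a D.≈ b
    dual-ext = _,_

    εpart-cong : ∀ {a b} → a D.≈ b → εpart a ≈ εpart b
    εpart-cong = proj₂

    εpart-+ : ∀ a b → εpart (a D.+ b) ≈ εpart a + εpart b
    εpart-+ _ _ = refl

    εpart-* : ∀ a b → εpart (a D.* b) ≈ re a * εpart b + εpart a * re b
    εpart-* _ _ = refl

    re-pair : ∀ a b → re (pair a b) ≈ a
    re-pair _ _ = refl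

    εpart-pair : ∀ a b → εpart (pair a b) ≈ b
    εpart-pair _ _ = refl

    re-emb : ∀ a → re (emb a) ≈ a
    re-emb _ = refl

    εpart-emb : ∀ a → εpart (emb a) ≈ 0#
    εpart-emb _ = refl

  εpart-0 : εpart D.0# ≈ 0#
  εpart-0 = trans (εpart-cong (D.sym (HomProps.0-homo embed))) (εpart-emb 0#)

  εpart-neg : ∀ a → εpart (D.- a) ≈ - εpart a
  εpart-neg a = begin
    εpart (D.- a)                         ≈⟨ solve 2 (λ x y → x := x :+ y :- y) refl _ (εpart a) ⟩
    εpart (D.- a) + εpart a + - εpart a   ≈⟨ +-congʳ (trans (sym (εpart-+ _ _)) (trans (εpart-cong (D.-‿inverseˡ a)) εpart-0)) ⟩
    0# + - εpart a                        ≈⟨ +-identityˡ _ ⟩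
    - εpart a ∎

  S2-εpart : ∀ {A : Set} (L : List A) f → εpart (D.S2 L f) ≈ S2 L (λ I K → εpart (f I K))
  S2-εpart [] f = refl
  S2-εpart (a ∷ L) f = trans (εpart-+ _ _) (+-cong (S2-εpart L _) (S2-εpart L _))

open DualNumbers public using (Dual)

-- How the coefficient family changes when a node is added.

module Nodes (R : CRing) where
  open Kit R
  open RisingFactorial R

  S2-cong-⊆ : ∀ {A : Set} (L : List A) {f g} → (∀ I K → I ⊆ L → K ⊆ L → f I K ≈ g I K) → S2 L f ≈ S2 L g
  S2-cong-⊆ [] e = e [] [] [] []
  S2-cong-⊆ (a ∷ L) e = +-cong (S2-cong-⊆ L (λ I K p q → e (a ∷ I) K (≡.refl ∷ p) (a ∷ʳ q)))
                               (S2-cong-⊆ L (λ I K p q → e I (a ∷ K) (a ∷ʳ p) (≡.refl ∷ q)))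

  P-congᴬ : ∀ {A : Set} {Q : A → Set} {L : List A} {f g} → All Q L → (∀ a M → Q a → f a M ≈ g a M) → P L f ≈ P L g
  P-congᴬ [] e = refl
  P-congᴬ (q ∷ qs) e = +-cong (e _ _ q) (P-congᴬ qs (λ b M → e b _))

  P-length : ∀ {A : Set} (h : ℕ → Carrier) (L : List A) (g : A → List A → Carrier) →
             P L (λ a M → h (suc (length M)) * g a M) ≈ h (length L) * P L g
  P-length h [] g = sym (zeroʳ _)
  P-length h (a ∷ L) g = trans (+-congˡ (P-length (λ n → h (suc n)) L _))
    (solve 3 (λ h x y → h :* x :+ h :* y := h :* (x :+ y)) refl _ _ _)

  sumOver : ∀ {A : Set} → (A → Carrier) → List A → Carrier
  sumOver φ L = P L (λ j _ → φ j)

  -- For every splitting of L the sums over I and K add up to the same sum over L, which can be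
  -- taken out.
  sumOver-split : ∀ {A : Set} (φ : A → Carrier) (L : List A) g →
    S2 L (λ I K → (sumOver φ I + sumOver φ K) * g I K) ≈ sumOver φ L * S2 L g
  sumOver-split φ [] g = *-congʳ (+-identityˡ _)
  sumOver-split φ (a ∷ L) g = begin
    S2 L (λ I K → (φ a + sumOver φ I + sumOver φ K) * g (a ∷ I) K) + S2 L (λ I K → (sumOver φ I + (φ a + sumOver φ K)) * g I (a ∷ K))
      ≈⟨ +-cong (trans (S2-cong L (λ I K → solve 4 (λ x y z w → (x :+ y :+ z) :* w := x :* w :+ (y :+ z) :* w) refl _ _ _ _)) (S2-+ L _ _))
                (trans (S2-cong L (λ I K → solve 4 (λ x y z w → (y :+ (x :+ z)) :* w := x :* w :+ (y :+ z) :* w) refl _ _ _ _)) (S2-+ L _ _)) ⟩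
    S2 L (λ I K → φ a * g (a ∷ I) K) + S2 L (λ I K → (sumOver φ I + sumOver φ K) * g (a ∷ I) K)
      + (S2 L (λ I K → φ a * g I (a ∷ K)) + S2 L (λ I K → (sumOver φ I + sumOver φ K) * g I (a ∷ K)))
      ≈⟨ +-cong (+-cong (S2-*ˡ L _ _) (sumOver-split φ L _)) (+-cong (S2-*ˡ L _ _) (sumOver-split φ L _)) ⟩
    φ a * S2 L (λ I K → g (a ∷ I) K) + sumOver φ L * S2 L (λ I K → g (a ∷ I) K)
      + (φ a * S2 L (λ I K → g I (a ∷ K)) + sumOver φ L * S2 L (λ I K → g I (a ∷ K)))
      ≈⟨ solve 4 (λ x y z w → x :* z :+ y :* z :+ (x :* w :+ y :* w) := (x :+ y) :* (z :+ w)) refl _ _ _ _ ⟩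
    (φ a + sumOver φ L) * (S2 L (λ I K → g (a ∷ I) K) + S2 L (λ I K → g I (a ∷ K))) ∎

  weight : ∀ {A : Set} → (A → Carrier) → List A → Carrier
  weight β I = fact (length I) * prodOver β I

  module _ {A : Set} (β : A → Carrier) (Y : List A → Carrier) where

    -- a new node absorbs I in any of |I|! orders
    absorb : List A → Carrier
    absorb K = S2 K (λ I K′ → weight β I * Y K′)

    -- Of the |I| + 1 equal shares of a term in which l is absorbed along with I, one accounts for
    -- the change of h into h - β l. The others come, by the hypothesis on β, from the terms of the
    -- recursion in which l takes the place of some j ∈ I.
    absorb-relation : ∀ l K (b : A → Carrier) h →
      All (λ j → β l * β j ≈ b j * β l + - ((1# + b j) * β j)) K →
      (∀ {K′} → K′ ⊆ K → Y (l ∷ K′) ≈ - h * Y K′ + P K′ (λ j K″ → b j * Y (l ∷ K″) + - ((1# + b j) * Y K′))) →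
      absorb (l ∷ K) ≈ - (h + - β l) * absorb K + P K (λ j K″ → b j * absorb (l ∷ K″) + - ((1# + b j) * absorb K))
    absorb-relation l K b h H Yrel = begin
      S2 K (λ I K′ → fact (suc (length I)) * (β l * prodOver β I) * Y K′) + S2 K (λ I K′ → weight β I * Y (l ∷ K′))
        ≈⟨ +-congˡ (trans (S2-cong-⊆ K (λ I K′ _ p → trans (*-congˡ (Yrel p)) (expand I K′))) (trans (S2-+ K _ _) (+-congʳ (S2-+ K _ _)))) ⟩
      S2 K (λ I K′ → fact (suc (length I)) * (β l * prodOver β I) * Y K′)
        + (S2 K (λ I K′ → - h * (weight β I * Y K′)) + S2 K (λ I K′ → P K′ (λ j K″ → b j * (weight β I * Y (l ∷ K″))))
           + S2 K (λ I K′ → - sumOver b₁ K′ * (weight β I * Y K′)))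
        ≈⟨ solve 4 (λ x y z w → x :+ (y :+ z :+ w) := y :+ (x :+ w) :+ z) refl _ _ _ _ ⟩
      S2 K (λ I K′ → - h * (weight β I * Y K′))
        + (S2 K (λ I K′ → fact (suc (length I)) * (β l * prodOver β I) * Y K′) + S2 K (λ I K′ → - sumOver b₁ K′ * (weight β I * Y K′)))
        + S2 K (λ I K′ → P K′ (λ j K″ → b j * (weight β I * Y (l ∷ K″))))
        ≈⟨ +-cong (+-congˡ (trans (sym (S2-+ K _ _)) (trans (S2-cong-⊆ K (λ I K′ p _ → exchange I K′ (SubP.All-resp-⊆ p H))) (S2-+ K _ _)))) refl ⟩
      S2 K (λ I K′ → - h * (weight β I * Y K′))
        + (S2 K (λ I K′ → β l * (weight β I * Y K′) + P I (λ j I′ → b j * (fact (suc (length I′)) * (β l * prodOver β I′) * Y K′)))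
           + S2 K (λ I K′ → (sumOver (λ j → - b₁ j) I + sumOver (λ j → - b₁ j) K′) * (weight β I * Y K′)))
        + S2 K (λ I K′ → P K′ (λ j K″ → b j * (weight β I * Y (l ∷ K″))))
        ≈⟨ +-cong (+-cong (S2-*ˡ K _ _) (+-cong (trans (S2-+ K _ _) (+-cong (S2-*ˡ K _ _) (P-S2ˡ K _))) (trans (sumOver-split (λ j → - b₁ j) K _) (*-congʳ (P-neg K _))))) (P-S2ʳ K _) ⟩
      - h * absorb K
        + (β l * absorb K + P K (λ j L → S2 L (λ I K′ → b j * (fact (suc (length I)) * (β l * prodOver β I) * Y K′)))
           + - sumOver b₁ K * absorb K)
        + P K (λ j L → S2 L (λ I K′ → b j * (weight β I * Y (l ∷ K′))))
        ≈⟨ +-cong (+-congˡ (+-congʳ (+-congˡ (P-cong K (λ j L → S2-*ˡ L _ _))))) (P-cong K (λ j L → S2-*ˡ L _ _)) ⟩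
      - h * absorb K
        + (β l * absorb K + P K (λ j L → b j * S2 L (λ I K′ → fact (suc (length I)) * (β l * prodOver β I) * Y K′)) + - sumOver b₁ K * absorb K)
        + P K (λ j L → b j * S2 L (λ I K′ → weight β I * Y (l ∷ K′)))
        ≈⟨ solve 6 (λ h a b p s q → (:- h) :* a :+ (b :* a :+ p :+ (:- s) :* a) :+ q := (:- (h :- b)) :* a :+ (p :+ q :+ (:- s) :* a)) refl _ _ _ _ _ _ ⟩
      - (h + - β l) * absorb K
        + (P K (λ j L → b j * S2 L (λ I K′ → fact (suc (length I)) * (β l * prodOver β I) * Y K′))
           + P K (λ j L → b j * S2 L (λ I K′ → weight β I * Y (l ∷ K′))) + - sumOver b₁ K * absorb K)
        ≈⟨ +-congˡ (sym (trans (P-+ K _ _) (+-cong (trans (P-cong K (λ j L → distribˡ _ _ _)) (P-+ K _ _))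
             (trans (P-neg K _) (trans (-‿cong (trans (P-cong K (λ j _ → *-comm _ _)) (trans (P-*ˡ K _ _) (*-comm _ _)))) (-‿distribˡ-* _ _)))))) ⟩
      - (h + - β l) * absorb K + P K (λ j K″ → b j * absorb (l ∷ K″) + - ((1# + b j) * absorb K)) ∎
      where
      b₁ : A → Carrier
      b₁ j = 1# + b j
      expand : ∀ I K′ → weight β I * (- h * Y K′ + P K′ (λ j K″ → b j * Y (l ∷ K″) + - ((1# + b j) * Y K′))) ≈
        - h * (weight β I * Y K′) + P K′ (λ j K″ → b j * (weight β I * Y (l ∷ K″))) + - sumOver b₁ K′ * (weight β I * Y K′)
      expand I K′ = begin
        weight β I * (- h * Y K′ + P K′ (λ j K″ → b j * Y (l ∷ K″) + - (b₁ j * Y K′)))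
          ≈⟨ *-congˡ (+-congˡ (trans (P-+ K′ _ _) (+-congˡ (trans (P-neg K′ _) (-‿cong (trans (P-cong K′ (λ j _ → *-comm _ _)) (P-*ˡ K′ _ _))))))) ⟩
        weight β I * (- h * Y K′ + (P K′ (λ j K″ → b j * Y (l ∷ K″)) + - (Y K′ * sumOver b₁ K′)))
          ≈⟨ solve 5 (λ w h y p s → w :* ((:- h) :* y :+ (p :- y :* s)) := (:- h) :* (w :* y) :+ w :* p :+ (:- s) :* (w :* y)) refl _ _ _ _ _ ⟩
        - h * (weight β I * Y K′) + weight β I * P K′ (λ j K″ → b j * Y (l ∷ K″)) + - sumOver b₁ K′ * (weight β I * Y K′)
          ≈⟨ +-congʳ (+-congˡ (trans (sym (P-*ˡ K′ _ _)) (P-cong K′ (λ j K″ → solve 3 (λ x y z → x :* (y :* z) := y :* (x :* z)) refl _ _ _)))) ⟩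
        - h * (weight β I * Y K′) + P K′ (λ j K″ → b j * (weight β I * Y (l ∷ K″))) + - sumOver b₁ K′ * (weight β I * Y K′) ∎
      -- For each j ∈ I the hypothesis turns b_j β_l into β_l β_j + (1 + b_j) β_j, which restores
      -- the full product over I.
      moved : ∀ I → All (λ j → β l * β j ≈ b j * β l + - ((1# + b j) * β j)) I →
        P I (λ j I′ → b j * (fact (suc (length I′)) * (β l * prodOver β I′))) ≈
        ι (length I) * (β l * weight β I) + sumOver b₁ I * weight β I
      moved I HI = begin
        P I (λ j I′ → b j * (fact (suc (length I′)) * (β l * prodOver β I′)))
          ≈⟨ trans (P-cong I (λ j I′ → solve 4 (λ x y z w → x :* (y :* (z :* w)) := y :* (x :* z :* w)) refl _ _ _ _))
                   (P-length fact I (λ j I′ → b j * β l * prodOver β I′)) ⟩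
        fact (length I) * P I (λ j I′ → b j * β l * prodOver β I′)
          ≈⟨ *-congˡ (P-congᴬ HI (λ j I′ e → begin
               b j * β l * prodOver β I′
                 ≈⟨ solve 4 (λ b l j p → b :* l :* p := (b :* l :- (con (+ 1) :+ b) :* j) :* p :+ (con (+ 1) :+ b) :* (j :* p)) refl (b j) (β l) (β j) (prodOver β I′) ⟩
               (b j * β l + - ((1# + b j) * β j)) * prodOver β I′ + (1# + b j) * (β j * prodOver β I′)
                 ≈⟨ +-congʳ (trans (*-congʳ (sym e)) (*-assoc _ _ _)) ⟩
               β l * (β j * prodOver β I′) + (1# + b j) * (β j * prodOver β I′) ∎)) ⟩
        fact (length I) * P I (λ j I′ → β l * (β j * prodOver β I′) + (1# + b j) * (β j * prodOver β I′))
          ≈⟨ *-congˡ (trans (P-+ I _ _) (+-cong (trans (P-prod β I (λ _ → β l)) (*-congʳ (P-const I (β l)))) (P-prod β I b₁))) ⟩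
        fact (length I) * (ι (length I) * β l * prodOver β I + sumOver b₁ I * prodOver β I)
          ≈⟨ solve 5 (λ f n l p s → f :* (n :* l :* p :+ s :* p) := n :* (l :* (f :* p)) :+ s :* (f :* p)) refl _ _ _ _ _ ⟩
        ι (length I) * (β l * weight β I) + sumOver b₁ I * weight β I ∎
      exchange : ∀ I K′ → All (λ j → β l * β j ≈ b j * β l + - ((1# + b j) * β j)) I →
        fact (suc (length I)) * (β l * prodOver β I) * Y K′ + - sumOver b₁ K′ * (weight β I * Y K′) ≈
        (β l * (weight β I * Y K′) + P I (λ j I′ → b j * (fact (suc (length I′)) * (β l * prodOver β I′) * Y K′)))
          + (sumOver (λ j → - b₁ j) I + sumOver (λ j → - b₁ j) K′) * (weight β I * Y K′)
      exchange I K′ HI = begin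
        (1# + ι (length I)) * fact (length I) * (β l * prodOver β I) * Y K′ + - sumOver b₁ K′ * (weight β I * Y K′)
          ≈⟨ solve 7 (λ n f l p y s t → (con (+ 1) :+ n) :* f :* (l :* p) :* y :+ (:- s) :* (f :* p :* y) :=
               (l :* (f :* p :* y) :+ (n :* (l :* (f :* p)) :+ t :* (f :* p)) :* y) :+ (:- t :+ :- s) :* (f :* p :* y)) refl
               (ι (length I)) (fact (length I)) (β l) (prodOver β I) (Y K′) (sumOver b₁ K′) (sumOver b₁ I) ⟩
        (β l * (weight β I * Y K′) + (ι (length I) * (β l * weight β I) + sumOver b₁ I * weight β I) * Y K′)
          + (- sumOver b₁ I + - sumOver b₁ K′) * (weight β I * Y K′)
          ≈⟨ +-cong (+-congˡ (trans (*-congʳ (sym (moved I HI))) (trans (*-comm _ _) (trans (sym (P-*ˡ I _ _))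
                (P-cong I (λ j I′ → solve 4 (λ y b f p → y :* (b :* (f :* p)) := b :* (f :* p :* y)) refl _ _ _ _))))))
              (*-congʳ (+-cong (sym (P-neg I _)) (sym (P-neg K′ _)))) ⟩
        (β l * (weight β I * Y K′) + P I (λ j I′ → b j * (fact (suc (length I′)) * (β l * prodOver β I′) * Y K′)))
          + (sumOver (λ j → - b₁ j) I + sumOver (λ j → - b₁ j) K′) * (weight β I * Y K′) ∎

  δ : ∀ {A : Set} → List A → Carrier
  δ [] = 1#
  δ (_ ∷ _) = 0#

  S2-δ : ∀ {A : Set} (L : List A) (g : List A → Carrier) → S2 L (λ I K → δ I * g K) ≈ g L
  S2-δ [] g = *-identityˡ _
  S2-δ (a ∷ L) g = trans (+-cong (trans (S2-cong L (λ I K → zeroˡ _)) (S2-0 L)) (S2-δ L (λ K → g (a ∷ K)))) (+-identityˡ _)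

  module _ {A : Set} (β : A → Carrier) where

    -- For nonempty I this is |I|! = |I| (|I| - 1)!, the factor |I| counting the choices of the
    -- element absorbed last; δ covers the empty set.
    weight-peel : ∀ I → weight β I ≈ δ I + P I (λ j I′ → β j * weight β I′)
    weight-peel [] = solve 0 (con (+ 1) :* con (+ 1) := con (+ 1) :+ con (+ 0)) refl
    weight-peel I@(a ∷ I₀) = sym (trans (+-identityˡ _) (peel I))
      where
      peel : ∀ I → P I (λ j I′ → β j * weight β I′) ≈ ι (length I) * fact (ℕ.pred (length I)) * prodOver β I
      peel I = begin
        P I (λ j I′ → β j * (fact (length I′) * prodOver β I′))
          ≈⟨ P-cong I (λ j I′ → solve 3 (λ x y z → x :* (y :* z) := y :* (con (+ 1) :* (x :* z))) refl _ _ _) ⟩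
        P I (λ j I′ → fact (ℕ.pred (suc (length I′))) * (1# * (β j * prodOver β I′)))
          ≈⟨ P-length (λ n → fact (ℕ.pred n)) I _ ⟩
        fact (ℕ.pred (length I)) * P I (λ j I′ → 1# * (β j * prodOver β I′))
          ≈⟨ *-congˡ (trans (P-prod β I (λ _ → 1#)) (*-congʳ (P-const I 1#))) ⟩
        fact (ℕ.pred (length I)) * (ι (length I) * 1# * prodOver β I)
          ≈⟨ solve 3 (λ f n p → f :* (n :* con (+ 1) :* p) := n :* f :* p) refl _ _ _ ⟩
        ι (length I) * fact (ℕ.pred (length I)) * prodOver β I ∎

    absorb-peel : ∀ (Y : List A → Carrier) K → absorb β Y K ≈ Y K + P K (λ j L → β j * absorb β Y L)
    absorb-peel Y K = begin
      absorb β Y K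
        ≈⟨ S2-cong K (λ I K′ → trans (*-congʳ (weight-peel I)) (trans (distribʳ _ _ _) (+-congˡ
             (trans (*-comm _ _) (trans (sym (P-*ˡ I _ _)) (P-cong I (λ j I′ → solve 3 (λ y b w → y :* (b :* w) := b :* (w :* y)) refl _ _ _))))))) ⟩
      S2 K (λ I K′ → δ I * Y K′ + P I (λ j I′ → β j * (weight β I′ * Y K′)))
        ≈⟨ trans (S2-+ K _ _) (+-cong (S2-δ K Y) (trans (P-S2ˡ K _) (P-cong K (λ j L → S2-*ˡ L _ _)))) ⟩
      Y K + P K (λ j L → β j * absorb β Y L) ∎

    -- Intended reading: k nodes are present, i is the free variable to be moved, `Yᵢ K` is Y(i ∷
    -- K), and h is h_i corrected by the poles at the nodes.
    module _ (u h : Carrier) (k : ℕ) (Y Yᵢ : List A → Carrier) where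

      private
        -- `r` is the rising factor for k + 1 nodes, `q` the one for k nodes and one more free
        -- variable; q K Z = (u + k + |K|) r K Z.
        r q : List A → List A → Carrier
        r K Z = rise u (suc (k ℕ.+ length K)) (length Z)
        q K Z = rise u (k ℕ.+ length K) (suc (length Z))

        w : List A → Carrier
        w = weight β

        -- (1# + β) is minus the logarithmic derivative of β with respect to the position of the node
        1+β : A → Carrier
        1+β j = 1# + β j

      -- The ε-part of `absorb` when the new node moves along x d/dx; each absorbed j contributes
      -- -(1 + β j) to the logarithmic derivative of its term.
      absorb-derivative : List A → Carrier
      absorb-derivative K = S2 K (λ I K′ → - sumOver 1+β I * (w I * Y K′))

      module _ (J : List A)
        (Yᵢ-relation : ∀ {K} → K ⊆ J → Yᵢ K ≈ - h * Y K + P K (λ j K′ → β j * Yᵢ K′ + - ((1# + β j) * Y K))) where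

        private
          one : A → Carrier
          one _ = 1#

          ι-sum : ∀ L → ι (length L) ≈ sumOver one L
          ι-sum L = sym (trans (P-const L 1#) (*-identityʳ _))

          -- The recursion of `Yᵢ`, with the sum of 1 + β j over K′ separated into |K′| and Σ β,
          -- solved for the term with Y K′.
          inner-term : ∀ K′ → K′ ⊆ J → (- h + - sumOver β K′) * Y K′ ≈
                       Yᵢ K′ + - P K′ (λ j K″ → β j * Yᵢ K″) + ι (length K′) * Y K′
          inner-term K′ p = sym (begin
            Yᵢ K′ + - P K′ (λ j K″ → β j * Yᵢ K″) + ι (length K′) * Y K′
              ≈⟨ +-congʳ (+-congʳ (Yᵢ-relation p)) ⟩
            - h * Y K′ + P K′ (λ j K″ → β j * Yᵢ K″ + - ((1# + β j) * Y K′)) + - P K′ (λ j K″ → β j * Yᵢ K″) + ι (length K′) * Y K′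
              ≈⟨ +-cong (+-congʳ (+-congˡ (trans (P-+ K′ _ _) (+-congˡ (trans (P-neg K′ _) (-‿cong
                   (trans (P-cong K′ (λ j _ → *-comm _ _)) (trans (P-*ˡ K′ _ _) (*-congˡ (trans (P-+ K′ _ _) (+-congʳ (sym (ι-sum K′)))))))))))))
                 refl ⟩
            - h * Y K′ + (P K′ (λ j K″ → β j * Yᵢ K″) + - (Y K′ * (ι (length K′) + sumOver β K′)))
              + - P K′ (λ j K″ → β j * Yᵢ K″) + ι (length K′) * Y K′
              ≈⟨ solve 5 (λ h y p n s → (:- h) :* y :+ (p :- y :* (n :+ s)) :- p :+ n :* y := (:- h :- s) :* y) refl _ _ _ _ _ ⟩
            (- h + - sumOver β K′) * Y K′ ∎)

          c₀ : Carrier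
          c₀ = u + ι k

          -- The terms -h, -Σ β over K and the derivative combine, by the recursion of `Yᵢ` inside
          -- `absorb`, into |K|. What is left of absorbing `Yᵢ` after one element is peeled off is
          -- `Yᵢ K` itself.
          per-K : ∀ K Z → K ⊆ J → (c₀ + - h + - (sumOver β K + sumOver β Z)) * absorb β Y K + - absorb-derivative K ≈
                  (c₀ + ι (length K)) * absorb β Y K + - (sumOver β Z * absorb β Y K) + Yᵢ K
          per-K K Z K⊆J = begin
            (c₀ + - h + - (sumOver β K + sumOver β Z)) * absorb β Y K + - absorb-derivative K
              ≈⟨ solve 6 (λ c h s z a d → (c :- h :- (s :+ z)) :* a :- d := c :* a :- z :* a :+ ((:- h) :* a :- s :* a :- d)) refl _ _ _ _ _ _ ⟩
            c₀ * absorb β Y K + - (sumOver β Z * absorb β Y K) + (- h * absorb β Y K + - (sumOver β K * absorb β Y K) + - absorb-derivative K)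
              ≈⟨ +-congˡ collect ⟩
            c₀ * absorb β Y K + - (sumOver β Z * absorb β Y K) + (ι (length K) * absorb β Y K + Yᵢ K)
              ≈⟨ solve 5 (λ c z a n y → c :* a :- z :* a :+ (n :* a :+ y) := (c :+ n) :* a :- z :* a :+ y) refl _ _ _ _ _ ⟩
            (c₀ + ι (length K)) * absorb β Y K + - (sumOver β Z * absorb β Y K) + Yᵢ K ∎
            where
            collect : - h * absorb β Y K + - (sumOver β K * absorb β Y K) + - absorb-derivative K ≈ ι (length K) * absorb β Y K + Yᵢ K
            collect = begin
              - h * absorb β Y K + - (sumOver β K * absorb β Y K) + - absorb-derivative K
                ≈⟨ +-cong (+-cong (sym (S2-*ˡ K _ _)) (trans (-‿cong (sym (sumOver-split β K _))) (sym (S2-neg K _)))) (sym (S2-neg K _)) ⟩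
              S2 K (λ I K′ → - h * (w I * Y K′)) + S2 K (λ I K′ → - ((sumOver β I + sumOver β K′) * (w I * Y K′)))
                + S2 K (λ I K′ → - (- sumOver 1+β I * (w I * Y K′)))
                ≈⟨ trans (+-congʳ (sym (S2-+ K _ _))) (sym (S2-+ K _ _)) ⟩
              S2 K (λ I K′ → - h * (w I * Y K′) + - ((sumOver β I + sumOver β K′) * (w I * Y K′)) + - (- sumOver 1+β I * (w I * Y K′)))
                ≈⟨ S2-cong-⊆ K (λ I K′ _ p → trans (+-congˡ (-‿cong (*-congʳ (-‿cong (P-+ I _ _))))) (trans
                     (solve 7 (λ h w y s t o z → (:- h) :* (w :* y) :- (s :+ t) :* (w :* y) :- (:- (o :+ s)) :* (w :* y) :=
                        o :* (w :* y) :+ w :* ((:- h :- t) :* y)) refl h (w I) (Y K′) (sumOver β I) (sumOver β K′) (sumOver one I) 0#)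
                     (trans (+-congˡ (*-congˡ (inner-term K′ (⊆-trans p K⊆J))))
                     (trans (+-congˡ (*-congˡ (+-congˡ (*-congʳ (ι-sum K′)))))
                     (solve 6 (λ w y o p yi pp → o :* (w :* y) :+ w :* (yi :- pp :+ p :* y) := (o :+ p) :* (w :* y) :+ (w :* yi :- w :* pp)) refl
                        (w I) (Y K′) (sumOver one I) (sumOver one K′) (Yᵢ K′) (P K′ (λ j K″ → β j * Yᵢ K″))))))) ⟩
              S2 K (λ I K′ → (sumOver one I + sumOver one K′) * (w I * Y K′) + (w I * Yᵢ K′ + - (w I * P K′ (λ j K″ → β j * Yᵢ K″))))
                ≈⟨ trans (S2-+ K _ _) (+-cong (trans (sumOver-split one K _) (*-congʳ (sym (ι-sum K)))) (trans (S2-+ K _ _) (+-congˡ (S2-neg K _)))) ⟩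
              ι (length K) * absorb β Y K + (absorb β Yᵢ K + - S2 K (λ I K′ → w I * P K′ (λ j K″ → β j * Yᵢ K″)))
                ≈⟨ +-congˡ (+-congˡ (-‿cong (trans (S2-cong K (λ I K′ → sym (P-*ˡ K′ _ _))) (trans (P-S2ʳ K _) (P-cong K (λ j L →
                     trans (S2-cong L (λ I K′ → solve 3 (λ x y z → x :* (y :* z) := y :* (x :* z)) refl _ _ _)) (S2-*ˡ L _ _))))))) ⟩
              ι (length K) * absorb β Y K + (absorb β Yᵢ K + - P K (λ j L → β j * absorb β Yᵢ L))
                ≈⟨ +-congˡ (trans (+-congʳ (absorb-peel Yᵢ K)) (solve 2 (λ x y → x :+ y :- y := x) refl _ _)) ⟩
              ι (length K) * absorb β Y K + Yᵢ K ∎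

          -- A splitting with a marked z ∈ Z becomes a splitting with a marked element of K when z
          -- changes sides; the start and the length of the rising factor shift accordingly.
          free-to-node : S2 J (λ K Z → r K Z * (sumOver β Z * absorb β Y K)) ≈ S2 J (λ K Z → q K Z * P K (λ j L → β j * absorb β Y L))
          free-to-node = begin
            S2 J (λ K Z → r K Z * (sumOver β Z * absorb β Y K))
              ≈⟨ S2-cong J (λ K Z → trans (*-congˡ (trans (*-comm _ _) (sym (P-*ˡ Z _ _))))
                   (sym (P-length (λ n → rise u (suc (k ℕ.+ length K)) n) Z _))) ⟩
            S2 J (λ K Z → P Z (λ j Z′ → rise u (suc (k ℕ.+ length K)) (suc (length Z′)) * (absorb β Y K * β j)))
              ≈⟨ trans (P-S2ʳ J _) (sym (P-S2ˡ J _)) ⟩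
            S2 J (λ K Z → P K (λ j L → rise u (suc (k ℕ.+ length L)) (suc (length Z)) * (absorb β Y L * β j)))
              ≈⟨ S2-cong J (λ K Z → trans (P-cong K (λ j L → *-cong
                   (reflexive (≡.cong (λ n → rise u n (suc (length Z))) (≡.sym (ℕP.+-suc k (length L))))) (*-comm _ _)))
                   (P-length (λ n → rise u (k ℕ.+ n) (suc (length Z))) K _)) ⟩
            S2 J (λ K Z → q K Z * P K (λ j L → β j * absorb β Y L)) ∎

        -- adding a node and differentiating in its position has the effect of making it a free variable
        add-free : (c₀ + - h + - sumOver β J) * S2 J (λ K Z → r K Z * absorb β Y K) + - S2 J (λ K Z → r K Z * absorb-derivative K) ≈
          S2 J (λ K Z → rise u (k ℕ.+ suc (length K)) (length Z) * Yᵢ K) + S2 J (λ K Z → q K Z * Y K)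
        add-free = begin
          (c₀ + - h + - sumOver β J) * S2 J (λ K Z → r K Z * absorb β Y K) + - S2 J (λ K Z → r K Z * absorb-derivative K)
            ≈⟨ solve 4 (λ c s x d → (c :- s) :* x :- d := c :* x :+ :- (s :* x) :- d) refl _ _ _ _ ⟩
          (c₀ + - h) * S2 J (λ K Z → r K Z * absorb β Y K) + - (sumOver β J * S2 J (λ K Z → r K Z * absorb β Y K))
            + - S2 J (λ K Z → r K Z * absorb-derivative K)
            ≈⟨ +-cong (+-cong (sym (S2-*ˡ J _ _)) (trans (-‿cong (sym (sumOver-split β J _))) (sym (S2-neg J _)))) (sym (S2-neg J _)) ⟩
          S2 J (λ K Z → (c₀ + - h) * (r K Z * absorb β Y K)) + S2 J (λ K Z → - ((sumOver β K + sumOver β Z) * (r K Z * absorb β Y K)))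
            + S2 J (λ K Z → - (r K Z * absorb-derivative K))
            ≈⟨ trans (+-congʳ (sym (S2-+ J _ _))) (sym (S2-+ J _ _)) ⟩
          S2 J (λ K Z → (c₀ + - h) * (r K Z * absorb β Y K) + - ((sumOver β K + sumOver β Z) * (r K Z * absorb β Y K)) + - (r K Z * absorb-derivative K))
            ≈⟨ S2-cong-⊆ J (λ K Z p _ → trans
                 (solve 6 (λ c s z r a d → c :* (r :* a) :- (s :+ z) :* (r :* a) :- r :* d := r :* ((c :- (s :+ z)) :* a :- d)) refl
                    (c₀ + - h) (sumOver β K) (sumOver β Z) (r K Z) (absorb β Y K) (absorb-derivative K))
                 (trans (*-congˡ (per-K K Z p)) (trans
                 (solve 7 (λ u k n r a z y → r :* ((u :+ k :+ n) :* a :- z :* a :+ y) := r :* y :+ ((u :+ (k :+ n)) :* r :* a :- r :* (z :* a))) refl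
                    u (ι k) (ι (length K)) (r K Z) (absorb β Y K) (sumOver β Z) (Yᵢ K))
                 (+-congˡ (+-congʳ (*-congʳ (*-congʳ (+-congˡ (sym (ι-+ k (length K)))))))))) ) ⟩
          S2 J (λ K Z → r K Z * Yᵢ K + (q K Z * absorb β Y K + - (r K Z * (sumOver β Z * absorb β Y K))))
            ≈⟨ trans (S2-+ J _ _) (+-congˡ (trans (S2-+ J _ _) (+-cong
                 (trans (S2-cong J (λ K Z → trans (*-congˡ (absorb-peel Y K)) (distribˡ _ _ _))) (S2-+ J _ _))
                 (trans (S2-neg J _) (-‿cong free-to-node))))) ⟩
          S2 J (λ K Z → r K Z * Yᵢ K) + (S2 J (λ K Z → q K Z * Y K) + S2 J (λ K Z → q K Z * P K (λ j L → β j * absorb β Y L))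
            + - S2 J (λ K Z → q K Z * P K (λ j L → β j * absorb β Y L)))
            ≈⟨ solve 3 (λ x y z → x :+ (y :+ z :- z) := x :+ y) refl _ _ _ ⟩
          S2 J (λ K Z → r K Z * Yᵢ K) + S2 J (λ K Z → q K Z * Y K)
            ≈⟨ +-congʳ (S2-cong J (λ K Z → *-congʳ (reflexive (≡.cong (λ n → rise u n (length Z)) (≡.sym (ℕP.+-suc k (length K))))))) ⟩
          S2 J (λ K Z → rise u (k ℕ.+ suc (length K)) (length Z) * Yᵢ K) + S2 J (λ K Z → q K Z * Y K) ∎

-- The determinant with nodes and free variables.

record Node (R : CRing) (A : Set) : Set where
  constructor node
  field
    value : CommutativeRing.Carrier R
    recip : A → CommutativeRing.Carrier R   -- recip j = 1 / (value − x j)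
open Node

module Rows (R : CRing) where
  open Kit R
  open RisingFactorial R

  nodeRow : ℕ → Carrier → ℕ → Carrier
  nodeRow N a s = a ^ (N ∸ s)

  -- The factor u + s - 1 is written u + (N - 1) - (N - s) in order to exhibit N - s, the eigenvalue
  -- of x d/dx on x^(N - s).
  freeRow : ℕ → Carrier → Carrier → Carrier → ℕ → Carrier
  freeRow N u a h s = a ^ (N ∸ s) * (u + ι (N ∸ 1) + - ι (N ∸ s) + - h)

  module _ {A : Set} (u : Carrier) (x h : A → Carrier) (rc : A → A → Carrier) (S : List (Node R A)) (Y : List A → Carrier) where

    -- Every node v lowers h_l by the pole x_l/(v - x_l), which comes from the logarithmic
    -- derivative of the Vandermonde factor v - x_l.
    shifted : A → Carrier
    shifted l = h l + - Σ S (λ nd → x l * recip nd l)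

    -- With `rc l j` = 1/(x_l - x_j) one has 1 + x_j rc = x_l rc. So the term for j is the divided
    -- difference (x_j Y(l, K - j) - x_l Y(K))/(x_l - x_j).
    Relation : List A → Set
    Relation J = ∀ {l K} → (l ∷ K) ⊆ J →
      Y (l ∷ K) ≈ - shifted l * Y K + P K (λ j K′ → x j * rc l j * Y (l ∷ K′) + - ((1# + x j * rc l j) * Y K))

    -- Reciprocals are carried as data with their defining equations, because the rings of the
    -- induction are iterated dual numbers and not fields.
    Separated : List A → Set
    Separated J = AllPairs (λ l j → rc l j * (x l + - x j) ≈ 1#) J × All (λ nd → All (λ j → recip nd j * (value nd + - x j) ≈ 1#) J) S

    expansion : List A → Carrier
    expansion J = S2 J (λ K Z → rise u (length S ℕ.+ length K) (length Z) * Y K)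

    DetFormula : ℕ → List A → Set
    DetFormula N J = det N (map (λ nd → nodeRow N (value nd)) S ++ map (λ j → freeRow N u (x j) (h j)) J) ≈
                     vandermonde (map value S ++ map x J) * expansion J
      where open Determinant R

module Unit (R : CRing) where
  open Kit R

  -- The hypotheses give r r′ = c (r - r′) and y c = 1 + z c; the claim is the first equation times
  -- y z.
  partial-fractions : ∀ X y z r r′ c → r * (X + - y) ≈ 1# → r′ * (X + - z) ≈ 1# → c * (y + - z) ≈ 1# →
    (y * r) * (z * r′) ≈ (z * c) * (y * r) + - ((1# + z * c) * (z * r′))
  partial-fractions X y z r r′ c e e′ f = begin
    (y * r) * (z * r′)
      ≈⟨ solve 4 (λ y r z r′ → (y :* r) :* (z :* r′) := y :* z :* (r :* r′ :* con (+ 1))) refl y r z r′ ⟩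
    y * z * (r * r′ * 1#)
      ≈⟨ *-congˡ (*-congˡ (sym f)) ⟩
    y * z * (r * r′ * (c * (y + - z)))
      ≈⟨ solve 6 (λ X y z r r′ c → y :* z :* (r :* r′ :* (c :* (y :- z))) :=
             y :* z :* c :* (r :* (r′ :* (X :- z)) :- r′ :* (r :* (X :- y)))) refl X y z r r′ c ⟩
    y * z * c * (r * (r′ * (X + - z)) + - (r′ * (r * (X + - y))))
      ≈⟨ *-congˡ (+-cong (*-congˡ e′) (-‿cong (*-congˡ e))) ⟩
    y * z * c * (r * 1# + - (r′ * 1#))
      ≈⟨ solve 5 (λ y z r r′ c → y :* z :* c :* (r :* con (+ 1) :- (r′ :* con (+ 1))) :=
             (z :* c) :* (y :* r) :- (c :* (y :- z) :+ z :* c) :* (z :* r′)) refl y z r r′ c ⟩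
    (z * c) * (y * r) + - ((c * (y + - z) + z * c) * (z * r′))
      ≈⟨ +-congˡ (-‿cong (*-congʳ (+-congʳ f))) ⟩
    (z * c) * (y * r) + - ((1# + z * c) * (z * r′)) ∎

-- The data of the determinant formula are carried along φ and enlarged by one node; the induction
-- takes T = R[ε].
module Transport {R T : CRing} (φ : Hom R T) {A : Set} (N : ℕ)
  (u : CommutativeRing.Carrier R) (x h : A → CommutativeRing.Carrier R) (rc : A → A → CommutativeRing.Carrier R)
  (S : List (Node R A)) (Y : List A → CommutativeRing.Carrier R) (newNode : Node T A) where
  private
    module R where
      open Kit R public
      open Determinant R public
      open RisingFactorial R public
      open Rows R public
    module E = HomProps φ
    emb : R.Carrier → CommutativeRing.Carrier T
    emb = E.⟦_⟧
  open Kit T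
  open Determinant T
  open RisingFactorial T
  open Nodes T
  open Rows T

  embNode : Node R A → Node T A
  embNode nd = node (emb (value nd)) (λ j → emb (recip nd j))

  S′ : List (Node T A)
  S′ = map embNode S ++ newNode ∷ []

  x′ h′ β′ : A → Carrier
  x′ j = emb (x j)
  h′ j = emb (h j)
  β′ j = x′ j * recip newNode j

  rc′ : A → A → Carrier
  rc′ l j = emb (rc l j)

  Y′ : List A → Carrier
  Y′ = absorb β′ (λ K → emb (Y K))

  length-S′ : length S′ ≡ suc (length S)
  length-S′ = ≡.trans (LP.length-++ (map embNode S)) (≡.trans (ℕP.+-comm _ 1) (≡.cong suc (LP.length-map embNode S)))

  emb-unit : ∀ {a b c} → a R.* (b R.+ R.- c) R.≈ R.1# → emb a * (emb b + - emb c) ≈ 1#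
  emb-unit {a} {b} {c} e = trans (*-congˡ (trans (+-congˡ (sym (E.neg-homo c))) (sym (E.+-homo b (R.- c)))))
    (trans (sym (E.*-homo a _)) (trans (E.⟦⟧-cong e) E.1-homo))

  module _ (J : List A) (sep : R.Separated u x h rc S Y J)
           (newUnits : All (λ j → recip newNode j * (value newNode + - x′ j) ≈ 1#) J) where

    separated′ : Separated (emb u) x′ h′ rc′ S′ Y′ J
    separated′ = AllPairs.map emb-unit (proj₁ sep) ,
      AllP.++⁺ (AllP.map⁺ (All.map (All.map emb-unit) (proj₂ sep))) (newUnits ∷ [])

    private
      Σ-recip : ∀ l → Σ S′ (λ nd → x′ l * recip nd l) ≈ emb (R.Σ S (λ nd → x l R.* recip nd l)) + β′ l
      Σ-recip l = trans (Σ-++ (map embNode S) (newNode ∷ []) _) (+-cong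
        (trans (Σ-map embNode S _) (trans (Σ-cong S (λ nd → sym (E.*-homo _ _))) (sym (E.Σ-homo S _))))
        (+-identityʳ _))

      pairs : ∀ {l K L} → (l ∷ K) ⊆ L → AllPairs (λ l j → rc′ l j * (x′ l + - x′ j) ≈ 1#) L →
              All (λ j → rc′ l j * (x′ l + - x′ j) ≈ 1#) K
      pairs (_ ∷ʳ p) (_ ∷ qs) = pairs p qs
      pairs (≡.refl ∷ p) (q ∷ _) = SubP.All-resp-⊆ p q

    relation′ : R.Relation u x h rc S Y J → Relation (emb u) x′ h′ rc′ S′ Y′ J
    relation′ rel {l} {K} p = trans
      (absorb-relation β′ (λ K → emb (Y K)) l K (λ j → x′ j * rc′ l j) (emb (R.shifted u x h rc S Y l))
        (All.zipWith (λ { (c , r′) → Unit.partial-fractions T _ _ _ _ _ _ (All.head (SubP.All-resp-⊆ p newUnits)) r′ c })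
          (pairs p (proj₁ separated′) , All.tail (SubP.All-resp-⊆ p newUnits)))
        (λ {K′} q → trans (E.⟦⟧-cong (rel (⊆-trans (≡.refl ∷ q) p))) (emb-rel K′)))
      (+-congʳ (*-congʳ (-‿cong (sym shifted′))))
      where
      shifted′ : shifted (emb u) x′ h′ rc′ S′ Y′ l ≈ emb (R.shifted u x h rc S Y l) + - β′ l
      shifted′ = trans (+-congˡ (-‿cong (Σ-recip l)))
        (trans (solve 3 (λ a b c → a :- (b :+ c) := a :- b :- c) refl _ _ _)
                 (+-congʳ (sym (trans (E.+-homo _ _) (+-congˡ (E.neg-homo _))))))
      emb-rel : ∀ K′ → emb (R.- R.shifted u x h rc S Y l R.* Y K′ R.+ R.P K′ (λ j K″ → x j R.* rc l j R.* Y (l ∷ K″) R.+ R.- ((R.1# R.+ x j R.* rc l j) R.* Y K′)))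
        ≈ - emb (R.shifted u x h rc S Y l) * emb (Y K′) +
            P K′ (λ j K″ → x′ j * rc′ l j * emb (Y (l ∷ K″)) + - ((1# + x′ j * rc′ l j) * emb (Y K′)))
      emb-rel K′ = trans (E.+-homo _ _) (+-cong (trans (E.*-homo _ _) (*-congʳ (E.neg-homo _)))
        (trans (E.P-homo K′ _) (P-cong K′ (λ j K″ → trans (E.+-homo _ _) (+-cong
          (trans (E.*-homo _ _) (*-congʳ (E.*-homo _ _)))
          (trans (E.neg-homo _) (-‿cong (trans (E.*-homo _ _) (*-congʳ (trans (E.+-homo _ _) (+-cong E.1-homo (E.*-homo _ _))))))))))))

  Y′[] : Y [] R.≈ R.1# → Y′ [] ≈ 1#
  Y′[] e = trans (*-congˡ (trans (E.⟦⟧-cong e) E.1-homo)) (solve 0 (con (+ 1) :* con (+ 1) :* con (+ 1) := con (+ 1)) refl)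

  module _ (J : List A) (row₀ row₁ : ℕ → R.Carrier) (ε : Carrier)
           (split : ∀ s → nodeRow N (value newNode) s ≈ 1# * emb (row₀ s) + ε * emb (row₁ s)) where
    private
      pre post : List (ℕ → R.Carrier)
      pre = map (λ nd → R.nodeRow N (value nd)) S
      post = map (λ j → R.freeRow N u (x j) (h j)) J

      rows-≋ : (map (λ nd → nodeRow N (value nd)) S′ ++ map (λ j → freeRow N (emb u) (x′ j) (h′ j)) J) ≋
               (E.mapRows pre ++ (λ s → 1# * emb (row₀ s) + ε * emb (row₁ s)) ∷ E.mapRows post)
      rows-≋ = nodes S
        where
        frees : ∀ L → map (λ j → freeRow N (emb u) (x′ j) (h′ j)) L ≋ E.mapRows (map (λ j → R.freeRow N u (x j) (h j)) L)
        frees [] = []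
        frees (j ∷ L) = (λ s → sym (trans (E.*-homo _ _) (*-cong (E.^-homo _ (N ∸ s))
          (trans (E.+-homo _ _) (+-cong (trans (E.+-homo _ _) (+-cong (trans (E.+-homo _ _) (+-congˡ (E.ι-homo (N ∸ 1))))
            (trans (E.neg-homo _) (-‿cong (E.ι-homo (N ∸ s)))))) (E.neg-homo _)))))) ∷ frees L
        nodes : ∀ L → (map (λ nd → nodeRow N (value nd)) (map embNode L ++ newNode ∷ []) ++ map (λ j → freeRow N (emb u) (x′ j) (h′ j)) J) ≋
               (E.mapRows (map (λ nd → R.nodeRow N (value nd)) L) ++ (λ s → 1# * emb (row₀ s) + ε * emb (row₁ s)) ∷ E.mapRows post)
        nodes [] = split ∷ frees J
        nodes (nd ∷ L) = (λ s → sym (E.^-homo _ (N ∸ s))) ∷ nodes L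

    det′ : det N (map (λ nd → nodeRow N (value nd)) S′ ++ map (λ j → freeRow N (emb u) (x′ j) (h′ j)) J) ≈
           1# * emb (R.det N (pre ++ row₀ ∷ post)) + ε * emb (R.det N (pre ++ row₁ ∷ post))
    det′ = trans (det-cong N rows-≋) (trans (det-linear N (E.mapRows pre) (E.mapRows post) _ _ _ _)
      (+-cong (*-congˡ (back row₀)) (*-congˡ (back row₁))))
      where
      back : ∀ r → det N (E.mapRows pre ++ (λ s → emb (r s)) ∷ E.mapRows post) ≈ emb (R.det N (pre ++ r ∷ post))
      back r = trans (reflexive (≡.cong (det N) (≡.sym (LP.map-++ _ pre (r ∷ post))))) (sym (E.det-homo N (pre ++ r ∷ post)))

  rise′ : ∀ n r → rise (emb u) (length S′ ℕ.+ n) r ≈ emb (R.rise u (suc (length S ℕ.+ n)) r)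
  rise′ n r = trans (reflexive (≡.cong (λ m → rise (emb u) (m ℕ.+ n) r) length-S′)) (sym (E.rise-homo u (suc (length S ℕ.+ n)) r))

module DetStep (R : CRing) {A : Set} (N : ℕ) (i : A) (J : List A) where
  open Kit R
  open Determinant R
  open RisingFactorial R
  open Nodes R
  open Rows R
  open DualNumbers R hiding (Dual)
  private
    module D where
      open Kit (Dual R) public
      open Determinant (Dual R) public
      open RisingFactorial (Dual R) public
      open Nodes (Dual R) public
      open Rows (Dual R) public
    module E = HomProps embed
    module Re = HomProps real
    emb : Carrier → D.Carrier
    emb = E.⟦_⟧

  -- a′ = a (1 + ε c)
  record Log (a′ : D.Carrier) (a c : Carrier) : Set where
    constructor _∣_
    field
      re : Re.⟦ a′ ⟧ ≈ a
      im : εpart a′ ≈ a * c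
  open Log

  Log-* : ∀ {a′ b′ a b c d} → Log a′ a c → Log b′ b d → Log (a′ D.* b′) (a * b) (c + d)
  Log-* (p ∣ q) (p′ ∣ q′) = trans (Re.*-homo _ _) (*-cong p p′) ∣ trans (εpart-* _ _) (trans (+-cong (*-cong p q′) (*-cong q p′))
    (solve 4 (λ a b c d → a :* (b :* d) :+ a :* c :* b := a :* b :* (c :+ d)) refl _ _ _ _))

  Log-emb : ∀ a → Log (emb a) a 0#
  Log-emb a = re-emb a ∣ trans (εpart-emb a) (sym (zeroʳ _))

  Log-cong : ∀ {a′ a b c d} → a ≈ b → c ≈ d → Log a′ a c → Log a′ b d
  Log-cong e f (p ∣ q) = trans p e ∣ trans q (*-cong e f)

  Log-resp : ∀ {a′ b′ a c} → a′ D.≈ b′ → Log a′ a c → Log b′ a c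
  Log-resp e (p ∣ q) = trans (Re.⟦⟧-cong (D.sym e)) p ∣ trans (εpart-cong (D.sym e)) q

  Log-1 : Log D.1# 1# 0#
  Log-1 = Log-resp E.1-homo (Log-emb 1#)

  Log-difference : ∀ {a b a′ b′ v w c} → Re.⟦ a′ ⟧ ≈ a → εpart a′ ≈ v → Re.⟦ b′ ⟧ ≈ b → εpart b′ ≈ w →
    v + - w ≈ (a + - b) * c → Log (a′ D.+ D.- b′) (a + - b) c
  Log-difference p q p′ q′ e = trans (Re.+-homo _ _) (+-cong p (trans (Re.neg-homo _) (-‿cong p′))) ∣
    trans (trans (εpart-+ _ _) (+-cong q (trans (εpart-neg _) (-‿cong q′)))) e

  module _ (u : Carrier) (x h : A → Carrier) (rc : A → A → Carrier) (S : List (Node R A)) (Y : List A → Carrier)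
           (sep : Separated u x h rc S Y (i ∷ J)) (rel : Relation u x h rc S Y (i ∷ J)) (Y[] : Y [] ≈ 1#) where

    private
      k : ℕ
      k = length S
      β : A → Carrier
      β j = x j * rc i j
      moving : D.Carrier
      moving = pair (x i) (x i)
    -- The node lies at x_i (1 + ε), so that ε differentiates along x d/dx. The reciprocal of x_i (1
    -- + ε) - x_j is accordingly 1/(x_i - x_j) - ε x_i/(x_i - x_j)².
    newNode : Node (Dual R) A
    newNode = node moving (λ j → pair (rc i j) (- (x i * (rc i j * rc i j))))
    open Transport embed N u x h rc S Y newNode

    private
      sep-i : All (λ j → rc i j * (x i + - x j) ≈ 1#) J
      sep-i = AllPairs.head (proj₁ sep)

      sep-S : ∀ {L : List (Node R A)} → All (λ nd → All (λ j → recip nd j * (value nd + - x j) ≈ 1#) (i ∷ J)) L →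
              All (λ nd → recip nd i * (value nd + - x i) ≈ 1#) L
      sep-S = All.map All.head

    newUnits : All (λ j → recip newNode j D.* (moving D.+ D.- x′ j) D.≈ D.1#) J
    newUnits = All.map (λ {j} → new-unit j) sep-i
      where
      new-unit : ∀ j → rc i j * (x i + - x j) ≈ 1# → recip newNode j D.* (moving D.+ D.- x′ j) D.≈ D.1#
      new-unit j e = dual-ext
        (trans (trans (Re.*-homo _ _) (*-cong (re-pair _ _) re-diff)) (trans e (sym Re.1-homo)))
        (trans (trans (εpart-* _ _) (+-cong (*-cong (re-pair _ _) ε-diff) (*-cong (εpart-pair _ _) re-diff)))
               (trans cancel (trans (sym (εpart-emb 1#)) (εpart-cong E.1-homo))))
        where
        r = rc i j
        re-diff : Re.⟦ moving D.+ D.- x′ j ⟧ ≈ x i + - x j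
        re-diff = trans (Re.+-homo _ _) (+-cong (re-pair _ _) (trans (Re.neg-homo _) (-‿cong (re-emb _))))
        ε-diff : εpart (moving D.+ D.- x′ j) ≈ x i + - 0#
        ε-diff = trans (εpart-+ _ _) (+-cong (εpart-pair _ _) (trans (εpart-neg _) (-‿cong (εpart-emb _))))
        cancel : r * (x i + - 0#) + - (x i * (r * r)) * (x i + - x j) ≈ 0#
        cancel = begin
          r * (x i + - 0#) + - (x i * (r * r)) * (x i + - x j)
            ≈⟨ solve 3 (λ r y d → r :* (y :- con (+ 0)) :+ (:- (y :* (r :* r))) :* d := r :* y :- y :* r :* (r :* d)) refl r (x i) (x i + - x j) ⟩
          r * x i + - (x i * r * (r * (x i + - x j)))   ≈⟨ +-congˡ (-‿cong (*-congˡ e)) ⟩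
          r * x i + - (x i * r * 1#)                    ≈⟨ solve 2 (λ r y → r :* y :- y :* r :* con (+ 1) := con (+ 0)) refl r (x i) ⟩
          0# ∎

    sep-tail : Separated u x h rc S Y J
    sep-tail = AllPairs.tail (proj₁ sep) , All.map All.tail (proj₂ sep)

    private

      pre post : List (ℕ → Carrier)
      pre = map (λ nd → nodeRow N (value nd)) S
      post = map (λ j → freeRow N u (x j) (h j)) J
      row₀ row₁ : ℕ → Carrier
      row₀ = nodeRow N (x i)
      row₁ s = ι (N ∸ s) * x i ^ (N ∸ s)
      D₀ D₁ : Carrier
      D₀ = det N (pre ++ row₀ ∷ post)
      D₁ = det N (pre ++ row₁ ∷ post)

      moving-^ : ∀ n → Log (moving D.^ n) (x i ^ n) (ι n)
      moving-^ zero = Log-1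
      moving-^ (suc n) = Log-* (re-pair _ _ ∣ trans (εpart-pair _ _) (sym (*-identityʳ _))) (moving-^ n)

      ε : D.Carrier
      ε = pair 0# 1#

      re-combination : ∀ a b → Re.⟦ D.1# D.* emb a D.+ ε D.* emb b ⟧ ≈ a
      re-combination a b = trans (Re.+-homo _ _) (trans (+-cong (trans (Re.*-homo _ _) (*-cong Re.1-homo (re-emb a)))
        (trans (Re.*-homo _ _) (*-cong (re-pair _ _) (re-emb b)))) (solve 2 (λ a b → con (+ 1) :* a :+ con (+ 0) :* b := a) refl a b))

      ε-combination : ∀ a b → εpart (D.1# D.* emb a D.+ ε D.* emb b) ≈ b
      ε-combination a b = trans (εpart-+ _ _) (trans (+-cong
        (trans (εpart-cong (D.*-identityˡ _)) (εpart-emb a))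
        (trans (εpart-* _ _) (+-cong (*-cong (re-pair _ _) (εpart-emb b)) (*-cong (εpart-pair _ _) (re-emb b)))))
        (solve 1 (λ b → con (+ 0) :+ (con (+ 0) :* con (+ 0) :+ con (+ 1) :* b) := b) refl b))

      split : ∀ s → D.nodeRow N moving s D.≈ D.1# D.* emb (row₀ s) D.+ ε D.* emb (row₁ s)
      split s = dual-ext (trans (re (moving-^ (N ∸ s))) (sym (re-combination _ _)))
        (trans (im (moving-^ (N ∸ s))) (trans (*-comm _ _) (sym (ε-combination _ _))))

      V : Carrier
      V = vandermonde (map value S ++ map x (i ∷ J))

      c : Carrier
      c = Σ S (λ nd → - (x i * recip nd i)) + sumOver (λ j → x i * rc i j) J

      -- Factor by factor: v - X contributes -x_i/(v - x_i), X - x_j contributes x_i/(x_i - x_j),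
      -- and the factors without X are constant.
      V′-Log : Log (D.vandermonde (map value S′ ++ map x′ J)) V c
      V′-Log = nodes S (sep-S (proj₂ sep))
        where
        diffs-frees : ∀ v L → Log (D.diffs (emb v) (map x′ L)) (diffs v (map x L)) 0#
        diffs-frees v [] = Log-1
        diffs-frees v (j ∷ L) = Log-cong refl (+-identityˡ _) (Log-* (Log-difference (re-emb _) (εpart-emb _) (re-emb _) (εpart-emb _)
          (solve 1 (λ a → con (+ 0) :- con (+ 0) := a :* con (+ 0)) refl _)) (diffs-frees v L))
        frees : ∀ L → Log (D.vandermonde (map x′ L)) (vandermonde (map x L)) 0#
        frees [] = Log-1
        frees (j ∷ L) = Log-cong refl (+-identityˡ _) (Log-* (diffs-frees (x j) L) (frees L))
        moving-diffs : ∀ {L} → All (λ j → rc i j * (x i + - x j) ≈ 1#) L → Log (D.diffs moving (map x′ L)) (diffs (x i) (map x L)) (sumOver (λ j → x i * rc i j) L)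
        moving-diffs [] = Log-1
        moving-diffs {j ∷ L} (e ∷ es) = Log-* (Log-difference (re-pair _ _) (εpart-pair _ _) (re-emb _) (εpart-emb _) (begin
          x i + - 0#                            ≈⟨ solve 1 (λ a → a :- con (+ 0) := a :* con (+ 1)) refl _ ⟩
          x i * 1#                              ≈⟨ *-congˡ (sym e) ⟩
          x i * (rc i j * (x i + - x j))        ≈⟨ solve 3 (λ a b c → a :* (b :* c) := c :* (a :* b)) refl _ _ _ ⟩
          (x i + - x j) * (x i * rc i j)        ∎)) (moving-diffs es)
        across : ∀ v r → r * (v + - x i) ≈ 1# → ∀ T → Log (D.diffs (emb v) (map value (map embNode T ++ newNode ∷ []) ++ map x′ J))
          (diffs v (map value T ++ map x (i ∷ J))) (- (x i * r))
        across v r e [] = Log-cong refl (+-identityʳ _) (Log-* (Log-difference (re-emb _) (εpart-emb _) (re-pair _ _) (εpart-pair _ _) (begin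
          0# + - x i                            ≈⟨ solve 1 (λ a → con (+ 0) :- a := :- (a :* con (+ 1))) refl _ ⟩
          - (x i * 1#)                          ≈⟨ -‿cong (*-congˡ (sym e)) ⟩
          - (x i * (r * (v + - x i)))           ≈⟨ solve 3 (λ a b c → :- (a :* (b :* c)) := c :* (:- (a :* b))) refl _ _ _ ⟩
          (v + - x i) * - (x i * r)             ∎)) (diffs-frees v J))
        across v r e (nd ∷ T) = Log-cong refl (+-identityˡ _) (Log-* (Log-difference (re-emb _) (εpart-emb _) (re-emb _) (εpart-emb _)
          (solve 1 (λ a → con (+ 0) :- con (+ 0) := a :* con (+ 0)) refl _)) (across v r e T))
        nodes : ∀ T → All (λ nd → recip nd i * (value nd + - x i) ≈ 1#) T →
          Log (D.vandermonde (map value (map embNode T ++ newNode ∷ []) ++ map x′ J)) (vandermonde (map value T ++ map x (i ∷ J)))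
              (Σ T (λ nd → - (x i * recip nd i)) + sumOver (λ j → x i * rc i j) J)
        nodes [] [] = Log-cong refl (trans (+-identityʳ _) (sym (+-identityˡ _))) (Log-* (moving-diffs sep-i) (frees J))
        nodes (nd ∷ T) (e ∷ es) = Log-cong refl (sym (+-assoc _ _ _)) (Log-* (across (value nd) (recip nd i) e T) (nodes T es))

      β-Log : ∀ {j} → rc i j * (x i + - x j) ≈ 1# → Log (β′ j) (β j) (- (1# + β j))
      β-Log {j} e = trans (Re.*-homo _ _) (*-cong (re-emb _) (re-pair _ _)) ∣
        trans (trans (εpart-* _ _) (+-cong (*-cong (re-emb _) (εpart-pair _ _)) (*-cong (εpart-emb _) (re-pair _ _)))) (begin
        x j * - (x i * (rc i j * rc i j)) + 0# * rc i j
          ≈⟨ solve 3 (λ x y r → x :* (:- (y :* (r :* r))) :+ con (+ 0) :* r := x :* r :* (:- (r :* (y :- x) :+ x :* r))) refl _ _ _ ⟩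
        x j * rc i j * - (rc i j * (x i + - x j) + x j * rc i j)
          ≈⟨ *-congˡ (-‿cong (+-congʳ e)) ⟩
        x j * rc i j * - (1# + x j * rc i j) ∎)

      weight-Log : ∀ {I} → All (λ j → rc i j * (x i + - x j) ≈ 1#) I → Log (D.weight β′ I) (weight β I) (- sumOver (λ j → 1# + β j) I)
      weight-Log {I} es = Log-cong refl (+-identityˡ _) (Log-* (Log-resp (E.fact-homo (length I)) (Log-emb (fact (length I)))) (product-log es))
        where
        product-log : ∀ {I} → All (λ j → rc i j * (x i + - x j) ≈ 1#) I → Log (D.prodOver β′ I) (prodOver β I) (- sumOver (λ j → 1# + β j) I)
        product-log [] = Log-cong refl (sym -0#≈0#) Log-1
        product-log (e ∷ es) = Log-cong refl (-‿+-comm _ _) (Log-* (β-Log e) (product-log es))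

      W₀ W₁ : Carrier
      W₀ = S2 J (λ K Z → rise u (suc (k ℕ.+ length K)) (length Z) * absorb β Y K)
      W₁ = S2 J (λ K Z → rise u (suc (k ℕ.+ length K)) (length Z) * absorb-derivative β u (shifted u x h rc S Y i) k Y (λ K → Y (i ∷ K)) K)

      D-absorb : List A → Carrier
      D-absorb = absorb-derivative β u (shifted u x h rc S Y i) k Y (λ K → Y (i ∷ K))

      absorb′-re : ∀ {K} → K ⊆ J → Re.⟦ Y′ K ⟧ ≈ absorb β Y K
      absorb′-re {K} p = trans (Re.S2-homo K _) (S2-cong-⊆ K (λ I K′ q _ → trans (Re.*-homo _ _)
        (*-cong (re (weight-Log (SubP.All-resp-⊆ (⊆-trans q p) sep-i))) (re-emb _))))

      absorb′-ε : ∀ {K} → K ⊆ J → εpart (Y′ K) ≈ D-absorb K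
      absorb′-ε {K} p = trans (S2-εpart K _) (S2-cong-⊆ K (λ I K′ q _ → trans (εpart-* _ _) (trans
        (+-cong (*-congˡ (εpart-emb _)) (*-cong (im (weight-Log (SubP.All-resp-⊆ (⊆-trans q p) sep-i))) (re-emb _)))
        (solve 4 (λ v w s y → v :* con (+ 0) :+ w :* s :* y := s :* (w :* y)) refl _ _ _ _))))

      E′ : D.Carrier
      E′ = D.expansion (emb u) x′ h′ rc′ S′ Y′ J

      rise′-re : ∀ n r → Re.⟦ D.rise (emb u) (length S′ ℕ.+ n) r ⟧ ≈ rise u (suc (k ℕ.+ n)) r
      rise′-re n r = trans (Re.⟦⟧-cong (rise′ n r)) (re-emb _)

      expansion′-re : Re.⟦ E′ ⟧ ≈ W₀
      expansion′-re = trans (Re.S2-homo J _) (S2-cong-⊆ J (λ K Z p _ → trans (Re.*-homo _ _)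
        (*-cong (rise′-re (length K) (length Z)) (absorb′-re p))))

      expansion′-ε : εpart E′ ≈ W₁
      expansion′-ε = trans (S2-εpart J _) (S2-cong-⊆ J (λ K Z p _ → trans (εpart-* _ _) (trans
        (+-cong (*-cong (rise′-re (length K) (length Z)) (absorb′-ε p)) (*-congʳ (trans (εpart-cong (rise′ (length K) (length Z))) (εpart-emb _))))
        (solve 2 (λ a b → a :+ con (+ 0) :* b := a) refl _ _))))

    -- The row of i is (u + N - 1 - h_i) `row₀` - `row₁`. The induction hypothesis over R[ε]
    -- supplies both determinants, as its real part and its ε-part, and `add-free` recombines the
    -- two expansions.
    det-step : N ≡ suc (k ℕ.+ length J) → D.DetFormula (emb u) x′ h′ rc′ S′ Y′ N J → DetFormula u x h rc S Y N (i ∷ J)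
    det-step e IH = begin
      det N (pre ++ freeRow N u (x i) (h i) ∷ post)
        ≈⟨ det-cong N (≋-++ (≋-refl {pre}) ((λ s → solve 5 (λ a u n g h → a :* (u :+ n :- g :- h) := (u :+ n :- h) :* a :+ (:- con (+ 1)) :* (g :* a)) refl
             (x i ^ (N ∸ s)) u (ι (N ∸ 1)) (ι (N ∸ s)) (h i)) ∷ ≋-refl)) ⟩
      det N (pre ++ (λ s → (u + ι (N ∸ 1) + - h i) * row₀ s + - 1# * row₁ s) ∷ post)
        ≈⟨ det-linear N pre post row₀ row₁ _ _ ⟩
      (u + ι (N ∸ 1) + - h i) * D₀ + - 1# * D₁
        ≈⟨ +-cong (*-congˡ D₀-value) (*-congˡ D₁-value) ⟩
      (u + ι (N ∸ 1) + - h i) * (V * W₀) + - 1# * (V * W₁ + V * c * W₀)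
        ≈⟨ solve 6 (λ v a w z c h → (a :- h) :* (v :* w) :+ (:- con (+ 1)) :* (v :* z :+ v :* c :* w) := v :* ((a :- h :- c) :* w :- z)) refl
             V (u + ι (N ∸ 1)) W₀ W₁ c (h i) ⟩
      V * ((u + ι (N ∸ 1) + - h i + - c) * W₀ + - W₁)
        ≈⟨ *-congˡ (+-congʳ (*-congʳ coefficient)) ⟩
      V * ((u + ι k + - shifted u x h rc S Y i + - sumOver β J) * W₀ + - W₁)
        ≈⟨ *-congˡ (add-free β u (shifted u x h rc S Y i) k Y (λ K → Y (i ∷ K)) J (λ p → rel (≡.refl ∷ p))) ⟩
      V * expansion u x h rc S Y (i ∷ J) ∎
      where
      value′ : D.1# D.* emb D₀ D.+ ε D.* emb D₁ D.≈ D.vandermonde (map value S′ ++ map x′ J) D.* E′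
      value′ = D.trans (D.sym (det′ J row₀ row₁ ε split)) IH
      D₀-value : D₀ ≈ V * W₀
      D₀-value = trans (sym (re-combination D₀ D₁)) (trans (Re.⟦⟧-cong value′) (trans (Re.*-homo _ _) (*-cong (re V′-Log) expansion′-re)))
      D₁-value : D₁ ≈ V * W₁ + V * c * W₀
      D₁-value = trans (sym (ε-combination D₀ D₁)) (trans (εpart-cong value′) (trans (εpart-* _ _)
        (+-cong (*-cong (re V′-Log) expansion′-ε) (*-cong (im V′-Log) expansion′-re))))
      frees-sum : ∀ {L} → All (λ j → rc i j * (x i + - x j) ≈ 1#) L → sumOver (λ j → x i * rc i j) L ≈ ι (length L) + sumOver β L
      frees-sum [] = sym (+-identityˡ _)
      frees-sum {j ∷ L} (e ∷ es) = trans (+-cong (trans (solve 3 (λ x y r → x :* r := r :* (x :- y) :+ y :* r) refl (x i) (x j) (rc i j)) (+-congʳ e)) (frees-sum es))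
        (solve 3 (λ b n s → con (+ 1) :+ b :+ (n :+ s) := con (+ 1) :+ n :+ (b :+ s)) refl _ _ _)
      -- As x_i/(x_i - x_j) = 1 + β j, the logarithmic derivative of the Vandermonde product uses up
      -- |J| of N - 1 = k + |J|. Its poles at the nodes turn h_i into `shifted`.
      coefficient : u + ι (N ∸ 1) + - h i + - c ≈ u + ι k + - shifted u x h rc S Y i + - sumOver β J
      coefficient = begin
        u + ι (N ∸ 1) + - h i + - c
          ≈⟨ +-cong (+-congʳ (+-congˡ (trans (reflexive (≡.cong (λ n → ι (n ∸ 1)) e)) (ι-+ k (length J)))))
               (-‿cong (+-cong (Σ-neg S _) (frees-sum sep-i))) ⟩
        u + (ι k + ι (length J)) + - h i + - (- Σ S (λ nd → x i * recip nd i) + (ι (length J) + sumOver β J))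
          ≈⟨ solve 6 (λ u k j h s b → u :+ (k :+ j) :- h :- (:- s :+ (j :+ b)) := u :+ k :- (h :- s) :- b) refl _ _ _ _ _ _ ⟩
        u + ι k + - shifted u x h rc S Y i + - sumOver β J ∎

-- The induction on the free variables is over all rings at once, since each step replaces R by R[ε]
-- and the first free variable by a node. When no free variable is left, Vandermonde's determinant
-- remains.
det-formula : ∀ {A : Set} (J : List A) (R : CRing) (let open Kit R) (N : ℕ) (u : Carrier) (x h : A → Carrier) (rc : A → A → Carrier)
  (S : List (Node R A)) (Y : List A → Carrier) → N ≡ length S ℕ.+ length J →
  Rows.Separated R u x h rc S Y J → Rows.Relation R u x h rc S Y J → Y [] ≈ 1# → Rows.DetFormula R u x h rc S Y N J
det-formula [] R N u x h rc S Y e sep rel Y[] = begin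
  det N (map (λ nd → nodeRow N (value nd)) S ++ [])
    ≡⟨ ≡.cong (det N) (≡.trans (LP.++-identityʳ _) (LP.map-∘ S)) ⟩
  det N (map (nodeRow N) (map value S))
    ≈⟨ det-cong N (≋-map (λ a s → reflexive (≡.cong (λ n → a ^ (n ∸ s)) (≡.sym (ℕP.+-identityʳ N)))) (map value S)) ⟩
  det N (map (λ a s → a ^ ((N ℕ.+ 0) ∸ s)) (map value S))
    ≈⟨ det-powers N 0 (map value S) (≡.trans (LP.length-map value S) (≡.trans (≡.sym (ℕP.+-identityʳ _)) (≡.sym e))) ⟩
  prodOver (_^ 0) (map value S) * vandermonde (map value S)
    ≈⟨ *-cong (ones (map value S)) (reflexive (≡.cong vandermonde (≡.sym (LP.++-identityʳ (map value S))))) ⟩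
  1# * vandermonde (map value S ++ [])
    ≈⟨ solve 1 (λ v → con (+ 1) :* v := v :* (con (+ 1) :* con (+ 1))) refl _ ⟩
  vandermonde (map value S ++ []) * (1# * 1#)
    ≈⟨ *-congˡ (*-congˡ (sym Y[])) ⟩
  vandermonde (map value S ++ []) * expansion u x h rc S Y [] ∎
  where
  open Kit R
  open Determinant R
  open Rows R
  ones : ∀ L → prodOver (_^ 0) L ≈ 1#
  ones [] = refl
  ones (a ∷ L) = trans (*-identityˡ _) (ones L)
det-formula {A} (i ∷ J) R N u x h rc S Y e sep rel Y[] = det-step u x h rc S Y sep rel Y[] e′
  (det-formula J (Dual R) N (emb u) x′ h′ rc′ S′ Y′ (≡.trans e′ (≡.sym (≡.cong (ℕ._+ length J) length-S′)))
    (separated′ J (sep-tail u x h rc S Y sep rel Y[]) units) (relation′ J (sep-tail u x h rc S Y sep rel Y[]) units (λ p → rel (i ∷ʳ p))) (Y′[] Y[]))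
  where
  open DetStep R N i J
  emb : CommutativeRing.Carrier R → CommutativeRing.Carrier (Dual R)
  emb = Hom.⟦_⟧ (DualNumbers.embed R)
  units = newUnits u x h rc S Y sep rel Y[]
  open Transport (DualNumbers.embed R) N u x h rc S Y (DetStep.newNode R N i J u x h rc S Y sep rel Y[])
  e′ : N ≡ suc (length S ℕ.+ length J)
  e′ = ≡.trans e (ℕP.+-suc (length S) (length J))

-- Augmented monomial functions and sums over exponents.

module Augmented (R : CRing) where
  open Kit R

  bumpSum : ℕ → List ℕ → (List ℕ → Carrier) → Carrier
  bumpSum r [] f = 0#
  bumpSum r (g ∷ γ) f = f ((r ℕ.+ g) ∷ γ) + bumpSum r γ (λ γ′ → f (g ∷ γ′))

  bump-cong : ∀ r γ {f g : List ℕ → Carrier} → (∀ γ′ → length γ′ ≡ length γ → f γ′ ≈ g γ′) → bumpSum r γ f ≈ bumpSum r γ g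
  bump-cong r [] e = refl
  bump-cong r (g ∷ γ) e = +-cong (e _ ≡.refl) (bump-cong r γ (λ γ′ l → e (g ∷ γ′) (≡.cong suc l)))

  bump-+ : ∀ r γ f g → bumpSum r γ (λ γ′ → f γ′ + g γ′) ≈ bumpSum r γ f + bumpSum r γ g
  bump-+ r [] f g = sym (+-identityˡ _)
  bump-+ r (a ∷ γ) f g = trans (+-congˡ (bump-+ r γ _ _))
    (solve 4 (λ x y z w → x :+ y :+ (z :+ w) := x :+ z :+ (y :+ w)) refl _ _ _ _)

  bump-*ˡ : ∀ r γ c f → bumpSum r γ (λ γ′ → c * f γ′) ≈ c * bumpSum r γ f
  bump-*ˡ r [] c f = sym (zeroʳ _)
  bump-*ˡ r (a ∷ γ) c f = trans (+-congˡ (bump-*ˡ r γ c _)) (sym (distribˡ _ _ _))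

  bump-neg : ∀ r γ f → bumpSum r γ (λ γ′ → - f γ′) ≈ - bumpSum r γ f
  bump-neg r [] f = sym -0#≈0#
  bump-neg r (a ∷ γ) f = trans (+-congˡ (bump-neg r γ _)) (-‿+-comm _ _)

  bump-comm : ∀ r s γ f → bumpSum r γ (λ γ′ → bumpSum s γ′ f) ≈ bumpSum s γ (λ γ′ → bumpSum r γ′ f)
  bump-comm r s [] f = refl
  bump-comm r s (g ∷ γ) f = begin
    f ((s ℕ.+ (r ℕ.+ g)) ∷ γ) + bumpSum s γ (λ γ′ → f ((r ℕ.+ g) ∷ γ′))
      + bumpSum r γ (λ γ′ → f ((s ℕ.+ g) ∷ γ′) + bumpSum s γ′ (λ γ″ → f (g ∷ γ″)))
      ≈⟨ +-cong (+-congʳ (reflexive (≡.cong (λ n → f (n ∷ γ)) eq))) (trans (bump-+ r γ _ _) (+-congˡ (bump-comm r s γ (λ γ″ → f (g ∷ γ″))))) ⟩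
    f ((r ℕ.+ (s ℕ.+ g)) ∷ γ) + bumpSum s γ (λ γ′ → f ((r ℕ.+ g) ∷ γ′))
      + (bumpSum r γ (λ γ′ → f ((s ℕ.+ g) ∷ γ′)) + bumpSum s γ (λ γ′ → bumpSum r γ′ (λ γ″ → f (g ∷ γ″))))
      ≈⟨ solve 4 (λ x y z w → x :+ y :+ (z :+ w) := x :+ z :+ (y :+ w)) refl _ _ _ _ ⟩
    f ((r ℕ.+ (s ℕ.+ g)) ∷ γ) + bumpSum r γ (λ γ′ → f ((s ℕ.+ g) ∷ γ′))
      + (bumpSum s γ (λ γ′ → f ((r ℕ.+ g) ∷ γ′)) + bumpSum s γ (λ γ′ → bumpSum r γ′ (λ γ″ → f (g ∷ γ″))))
      ≈⟨ +-congˡ (sym (bump-+ s γ _ _)) ⟩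
    f ((r ℕ.+ (s ℕ.+ g)) ∷ γ) + bumpSum r γ (λ γ′ → f ((s ℕ.+ g) ∷ γ′))
      + bumpSum s γ (λ γ′ → f ((r ℕ.+ g) ∷ γ′) + bumpSum r γ′ (λ γ″ → f (g ∷ γ″))) ∎
    where
    eq : s ℕ.+ (r ℕ.+ g) ≡ r ℕ.+ (s ℕ.+ g)
    eq = ≡.trans (≡.sym (ℕP.+-assoc s r g)) (≡.trans (≡.cong (ℕ._+ g) (ℕP.+-comm s r)) (ℕP.+-assoc r s g))

  -- The augmented monomial functions c_γ m_γ as polynomials in the power sums d r:
  -- p_r · (r₁,…,rₖ) = (r,r₁,…,rₖ) + Σᵢ (r₁,…,rᵢ+r,…,rₖ).
  module _ (d : ℕ → Carrier) where

    private
      -- The first argument is fuel, because the lists under `bumpSum` are not structurally smaller.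
      -- It always equals the length when started by `augmented`, so the clause with `0#` is a
      -- default.
      mon : ℕ → List ℕ → Carrier
      mon n [] = 1#
      mon zero (_ ∷ _) = 0#
      mon (suc n) (r ∷ γ) = d r * mon n γ + - bumpSum r γ (mon n)

    augmented : List ℕ → Carrier
    augmented γ = mon (length γ) γ

    augmented-∷ : ∀ r γ → augmented (r ∷ γ) ≈ d r * augmented γ + - bumpSum r γ augmented
    augmented-∷ r γ = +-congˡ (-‿cong (bump-cong r γ (λ γ′ l → reflexive (≡.cong (λ n → mon n γ′) (≡.sym l)))))

    private
      Invariant : ℕ → (List ℕ → Carrier) → Set
      Invariant n f = ∀ {γ γ′} → length γ ≡ n → γ ↭ γ′ → f γ ≈ f γ′

      bump-↭ : ∀ r {γ γ′} f → Invariant (length γ) f → γ ↭ γ′ → bumpSum r γ f ≈ bumpSum r γ′ f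
      bump-↭ r f i Perm.refl = refl
      bump-↭ r f i (prep x p) = +-cong (i ≡.refl (prep _ p)) (bump-↭ r (λ γ → f (x ∷ γ)) (λ l q → i (≡.cong suc l) (prep x q)) p)
      bump-↭ r {x ∷ y ∷ γ} {_ ∷ _ ∷ γ′} f i (swap x y p) = begin
        f ((r ℕ.+ x) ∷ y ∷ γ) + (f (x ∷ (r ℕ.+ y) ∷ γ) + bumpSum r γ (λ γ₁ → f (x ∷ y ∷ γ₁)))
          ≈⟨ +-cong (i ≡.refl (swap _ _ p)) (+-cong (i ≡.refl (swap _ _ p))
               (trans (bump-cong r γ (λ γ₁ l → i (≡.cong (λ n → suc (suc n)) l) (swap x y ↭-refl)))
                      (bump-↭ r (λ γ₁ → f (y ∷ x ∷ γ₁)) (λ l q → i (≡.cong (λ n → suc (suc n)) l) (prep y (prep x q))) p))) ⟩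
        f (y ∷ (r ℕ.+ x) ∷ γ′) + (f ((r ℕ.+ y) ∷ x ∷ γ′) + bumpSum r γ′ (λ γ₁ → f (y ∷ x ∷ γ₁)))
          ≈⟨ solve 3 (λ a b c → a :+ (b :+ c) := b :+ (a :+ c)) refl _ _ _ ⟩
        f ((r ℕ.+ y) ∷ x ∷ γ′) + (f (y ∷ (r ℕ.+ x) ∷ γ′) + bumpSum r γ′ (λ γ₁ → f (y ∷ x ∷ γ₁))) ∎
      bump-↭ r f i (Perm.trans p q) = trans (bump-↭ r f i p)
        (bump-↭ r f (λ l s → i (≡.trans l (≡.sym (PermP.↭-length p))) s) q)

      -- Unfolding both heads gives an expression symmetric in r and s, up to the commutativity of
      -- the merged entry r + s and of two bumps.
      swap-heads : ∀ r s γ → augmented (r ∷ s ∷ γ) ≈ augmented (s ∷ r ∷ γ)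
      swap-heads r s γ = begin
        augmented (r ∷ s ∷ γ) ≈⟨ unfold r s ⟩
        expanded r s
          ≈⟨ +-cong (+-cong (solve 5 (λ x y a b b′ → x :* (y :* a :- b) :- y :* b′ := y :* (x :* a :- b′) :- x :* b) refl _ _ _ _ _)
               (-‿cong (reflexive (≡.cong (λ n → augmented (n ∷ γ)) (ℕP.+-comm r s))))) (bump-comm r s γ augmented) ⟩
        expanded s r ≈⟨ sym (unfold s r) ⟩
        augmented (s ∷ r ∷ γ) ∎
        where
        expanded : ℕ → ℕ → Carrier
        expanded r s = d r * (d s * augmented γ + - bumpSum s γ augmented) + - (d s * bumpSum r γ augmented)
          + - augmented ((r ℕ.+ s) ∷ γ) + bumpSum r γ (λ γ′ → bumpSum s γ′ augmented)
        unfold : ∀ r s → augmented (r ∷ s ∷ γ) ≈ expanded r s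
        unfold r s = begin
          augmented (r ∷ s ∷ γ)
            ≈⟨ augmented-∷ r (s ∷ γ) ⟩
          d r * augmented (s ∷ γ) + - (augmented ((r ℕ.+ s) ∷ γ) + bumpSum r γ (λ γ′ → augmented (s ∷ γ′)))
            ≈⟨ +-cong (*-congˡ (augmented-∷ s γ)) (-‿cong (+-congˡ (trans (bump-cong r γ (λ γ′ _ → augmented-∷ s γ′))
                 (trans (bump-+ r γ _ _) (+-cong (bump-*ˡ r γ _ _) (bump-neg r γ _)))))) ⟩
          d r * (d s * augmented γ + - bumpSum s γ augmented)
            + - (augmented ((r ℕ.+ s) ∷ γ) + (d s * bumpSum r γ augmented + - bumpSum r γ (λ γ′ → bumpSum s γ′ augmented)))
            ≈⟨ solve 4 (λ x m y b → x :- (m :+ (y :- b)) := x :- y :- m :+ b) refl _ _ _ _ ⟩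
          expanded r s ∎

      augmented-↭ⁿ : ∀ n → Invariant n augmented
      augmented-↭ⁿ n l Perm.refl = refl
      augmented-↭ⁿ (suc n) l (prep {xs} {ys} x p) = begin
        augmented (x ∷ xs)                              ≈⟨ augmented-∷ x xs ⟩
        d x * augmented xs + - bumpSum x xs augmented   ≈⟨ +-cong (*-congˡ (augmented-↭ⁿ n l′ p)) (-‿cong (bump-↭ x augmented (≡.subst (λ m → Invariant m augmented) (≡.sym l′) (augmented-↭ⁿ n)) p)) ⟩
        d x * augmented ys + - bumpSum x ys augmented   ≈⟨ sym (augmented-∷ x ys) ⟩
        augmented (x ∷ ys) ∎
        where l′ = ℕP.suc-injective l
      augmented-↭ⁿ (suc n) l (swap {xs} {ys} x y p) = trans (swap-heads x y xs) (begin
        augmented (y ∷ x ∷ xs)                                      ≈⟨ augmented-∷ y (x ∷ xs) ⟩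
        d y * augmented (x ∷ xs) + - bumpSum y (x ∷ xs) augmented   ≈⟨ +-cong (*-congˡ (augmented-↭ⁿ n l′ (prep x p)))
          (-‿cong (bump-↭ y augmented (≡.subst (λ m → Invariant m augmented) (≡.sym l′) (augmented-↭ⁿ n)) (prep x p))) ⟩
        d y * augmented (x ∷ ys) + - bumpSum y (x ∷ ys) augmented   ≈⟨ sym (augmented-∷ y (x ∷ ys)) ⟩
        augmented (y ∷ x ∷ ys) ∎)
        where l′ = ℕP.suc-injective l
      augmented-↭ⁿ n l (Perm.trans p q) = trans (augmented-↭ⁿ n l p) (augmented-↭ⁿ n (≡.trans (≡.sym (PermP.↭-length p)) l) q)

    augmented-↭ : ∀ {γ γ′} → γ ↭ γ′ → augmented γ ≈ augmented γ′
    augmented-↭ {γ} p = augmented-↭ⁿ (length γ) ≡.refl p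

  -- Σ_{1 ≤ n ≤ B} zⁿ G n
  powers : ℕ → Carrier → (ℕ → Carrier) → Carrier
  powers zero z G = 0#
  powers (suc B) z G = z * (G 1 + powers B z (λ n → G (suc n)))

  powers-cong : ∀ B z {G H} → (∀ n → G n ≈ H n) → powers B z G ≈ powers B z H
  powers-cong zero z e = refl
  powers-cong (suc B) z e = *-congˡ (+-cong (e 1) (powers-cong B z (λ n → e (suc n))))

  powers-+ : ∀ B z G H → powers B z (λ n → G n + H n) ≈ powers B z G + powers B z H
  powers-+ zero z G H = sym (+-identityˡ _)
  powers-+ (suc B) z G H = trans (*-congˡ (+-congˡ (powers-+ B z _ _)))
    (solve 5 (λ z a b c d → z :* (a :+ b :+ (c :+ d)) := z :* (a :+ c) :+ z :* (b :+ d)) refl _ _ _ _ _)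

  powers-*ˡ : ∀ B z c G → powers B z (λ n → c * G n) ≈ c * powers B z G
  powers-*ˡ zero z c G = sym (zeroʳ _)
  powers-*ˡ (suc B) z c G = trans (*-congˡ (+-congˡ (powers-*ˡ B z c _)))
    (solve 4 (λ z c a b → z :* (c :* a :+ c :* b) := c :* (z :* (a :+ b))) refl _ _ _ _)

  powers-neg : ∀ B z G → powers B z (λ n → - G n) ≈ - powers B z G
  powers-neg zero z G = sym -0#≈0#
  powers-neg (suc B) z G = trans (*-congˡ (+-congˡ (powers-neg B z _)))
    (solve 3 (λ z a b → z :* (:- a :- b) := :- (z :* (a :+ b))) refl _ _ _)

  powers-zero : ∀ B z {G} → (∀ n → G n ≈ 0#) → powers B z G ≈ 0#
  powers-zero zero z e = refl
  powers-zero (suc B) z e = trans (*-congˡ (trans (+-cong (e 1) (powers-zero B z (λ n → e (suc n)))) (+-identityˡ _))) (zeroʳ _)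

  powers-zero⁺ : ∀ B z {G} → (∀ n → G (suc n) ≈ 0#) → powers B z G ≈ 0#
  powers-zero⁺ zero z e = refl
  powers-zero⁺ (suc B) z e = trans (*-congˡ (trans (+-cong (e 0) (powers-zero⁺ B z (λ n → e (suc n)))) (+-identityˡ _))) (zeroʳ _)

  powers-swap : ∀ B B′ y z (G : ℕ → ℕ → Carrier) → powers B y (λ r → powers B′ z (G r)) ≈ powers B′ z (λ e → powers B y (λ r → G r e))
  powers-swap zero B′ y z G = sym (powers-zero B′ z (λ _ → refl))
  powers-swap (suc B) B′ y z G = trans (*-congˡ (trans (+-congˡ (powers-swap B B′ y z (λ r → G (suc r)))) (sym (powers-+ B′ z _ _))))
    (sym (powers-*ˡ B′ z y _))

  powers-top : ∀ B z G → (∀ n → B < n → G n ≈ 0#) → powers (suc B) z G ≈ powers B z G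
  powers-top zero z G v = trans (*-congˡ (trans (+-identityʳ _) (v 1 (s≤s z≤n)))) (zeroʳ _)
  powers-top (suc B) z G v = *-congˡ (+-congˡ (powers-top B z _ (λ n p → v (suc n) (s≤s p))))

  -- Σ_{r,e ≥ 1} yʳ zᵉ G(r + e) is a divided difference of Σ yⁿ G n
  powers-conv : ∀ B y z c G → c * (y + - z) ≈ 1# → (∀ n → B < n → G n ≈ 0#) →
    powers B y (λ r → powers B z (λ e → G (r ℕ.+ e))) ≈ z * c * powers B y G + - ((1# + z * c) * powers B z G)
  powers-conv zero y z c G e v = solve 2 (λ a b → con (+ 0) := a :* con (+ 0) :- b :* con (+ 0)) refl _ _
  powers-conv (suc B) y z c G e v = begin
    y * (powers (suc B) z (λ e → G (suc e)) + powers B y (λ r → powers (suc B) z (λ e → G (suc r ℕ.+ e))))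
      -- The function shifted by one vanishes beyond B, so the sums up to B + 1 may be cut at B,
      -- where the induction hypothesis applies.
      ≈⟨ *-congˡ (+-cong (powers-top B z _ (λ n p → v (suc n) (s≤s p)))
           (trans (powers-cong B y (λ r → powers-top B z _ (λ n p → v (suc (r ℕ.+ n)) (s≤s (ℕP.≤-trans p (ℕP.m≤n+m n r))))))
                  (powers-conv B y z c (λ n → G (suc n)) e (λ n p → v (suc n) (s≤s p))))) ⟩
    y * (Sz + (z * c * Sy + - ((1# + z * c) * Sz)))
      ≈⟨ solve 6 (λ y z c a b g → y :* (b :+ (z :* c :* a :- (con (+ 1) :+ z :* c) :* b)) :=
           z :* c :* (y :* (g :+ a)) :- (c :* (y :- z) :+ z :* c) :* (z :* (g :+ b))) refl y z c Sy Sz (G 1) ⟩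
    z * c * (y * (G 1 + Sy)) + - ((c * (y + - z) + z * c) * (z * (G 1 + Sz)))
      ≈⟨ +-congˡ (-‿cong (*-congʳ (+-congʳ e))) ⟩
    z * c * (y * (G 1 + Sy)) + - ((1# + z * c) * (z * (G 1 + Sz))) ∎
    where
    Sy Sz : Carrier
    Sy = powers B y (λ n → G (suc n))
    Sz = powers B z (λ n → G (suc n))

  module _ {A : Set} (x : A → Carrier) (B : ℕ) where

    -- Σ_γ x^γ f(γ) over exponents 1 ≤ γⱼ ≤ B
    expSum : List A → (List ℕ → Carrier) → Carrier
    expSum [] f = f []
    expSum (j ∷ K) f = powers B (x j) (λ e → expSum K (λ γ → f (e ∷ γ)))

    expSum-cong : ∀ K {f g} → (∀ γ → length γ ≡ length K → f γ ≈ g γ) → expSum K f ≈ expSum K g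
    expSum-cong [] e = e [] ≡.refl
    expSum-cong (j ∷ K) e = powers-cong B (x j) (λ n → expSum-cong K (λ γ l → e (n ∷ γ) (≡.cong suc l)))

    expSum-+ : ∀ K f g → expSum K (λ γ → f γ + g γ) ≈ expSum K f + expSum K g
    expSum-+ [] f g = refl
    expSum-+ (j ∷ K) f g = trans (powers-cong B (x j) (λ n → expSum-+ K _ _)) (powers-+ B (x j) _ _)

    expSum-*ˡ : ∀ K c f → expSum K (λ γ → c * f γ) ≈ c * expSum K f
    expSum-*ˡ [] c f = refl
    expSum-*ˡ (j ∷ K) c f = trans (powers-cong B (x j) (λ n → expSum-*ˡ K c _)) (powers-*ˡ B (x j) c _)

    expSum-neg : ∀ K f → expSum K (λ γ → - f γ) ≈ - expSum K f
    expSum-neg [] f = refl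
    expSum-neg (j ∷ K) f = trans (powers-cong B (x j) (λ n → expSum-neg K _)) (powers-neg B (x j) _)

    expSum-zero : ∀ K {f} → (∀ γ → f γ ≈ 0#) → expSum K f ≈ 0#
    expSum-zero [] e = e []
    expSum-zero (j ∷ K) e = powers-zero B (x j) (λ n → expSum-zero K (λ γ → e (n ∷ γ)))

    powers-P : ∀ (K : List A) z (f : ℕ → A → List A → Carrier) → powers B z (λ e → P K (f e)) ≈ P K (λ j M → powers B z (λ e → f e j M))
    powers-P [] z f = powers-zero B z (λ _ → refl)
    powers-P (j ∷ K) z f = trans (powers-+ B z _ _) (+-congˡ (powers-P K z _))

    -- The bump at j merges r with the exponent of x_j, and the double sum over r and this exponent
    -- is a divided difference by `powers-conv`. Symmetry of f moves the merged exponent to the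
    -- front; vanishing of f beyond B makes the truncation exact.
    expSum-bump : ∀ y (rc : A → Carrier) K f → All (λ j → rc j * (y + - x j) ≈ 1#) K →
      (∀ {γ γ′} → γ ↭ γ′ → f γ ≈ f γ′) → (∀ γ → B < sum γ → f γ ≈ 0#) →
      powers B y (λ r → expSum K (λ γ → bumpSum r γ f)) ≈
      P K (λ j K′ → x j * rc j * powers B y (λ r → expSum K′ (λ γ → f (r ∷ γ))) + - ((1# + x j * rc j) * expSum K f))
    expSum-bump y rc [] f [] inv van = powers-zero B y (λ _ → refl)
    expSum-bump y rc (j ∷ K) f (u ∷ us) inv van = begin
      powers B y (λ r → powers B (x j) (λ e → expSum K (λ γ → f ((r ℕ.+ e) ∷ γ) + bumpSum r γ (λ γ′ → f (e ∷ γ′)))))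
        ≈⟨ trans (powers-cong B y (λ r → trans (powers-cong B (x j) (λ e → expSum-+ K _ _)) (powers-+ B (x j) _ _))) (powers-+ B y _ _) ⟩
      powers B y (λ r → powers B (x j) (λ e → expSum K (λ γ → f ((r ℕ.+ e) ∷ γ))))
        + powers B y (λ r → powers B (x j) (λ e → expSum K (λ γ → bumpSum r γ (λ γ′ → f (e ∷ γ′)))))
        ≈⟨ +-cong (powers-conv B y (x j) (rc j) (λ n → expSum K (λ γ → f (n ∷ γ))) u
                    (λ n p → expSum-zero K (λ γ → van (n ∷ γ) (ℕP.≤-trans p (ℕP.m≤m+n n (sum γ))))))
                  (powers-swap B B y (x j) _) ⟩
      x j * rc j * powers B y (λ r → expSum K (λ γ → f (r ∷ γ))) + - ((1# + x j * rc j) * expSum (j ∷ K) f)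
        + powers B (x j) (λ e → powers B y (λ r → expSum K (λ γ → bumpSum r γ (λ γ′ → f (e ∷ γ′)))))
        ≈⟨ +-congˡ (trans (powers-cong B (x j) (λ e → expSum-bump y rc K (λ γ → f (e ∷ γ)) us (λ p → inv (prep e p))
             (λ γ p → van (e ∷ γ) (ℕP.≤-trans p (ℕP.m≤n+m (sum γ) e))))) (powers-P K (x j) _)) ⟩
      x j * rc j * powers B y (λ r → expSum K (λ γ → f (r ∷ γ))) + - ((1# + x j * rc j) * expSum (j ∷ K) f)
        + P K (λ j′ K′ → powers B (x j) (λ e → x j′ * rc j′ * powers B y (λ r → expSum K′ (λ γ → f (e ∷ r ∷ γ)))
            + - ((1# + x j′ * rc j′) * expSum K (λ γ → f (e ∷ γ)))))
        ≈⟨ +-congˡ (P-cong K (λ j′ K′ → trans (powers-+ B (x j) _ _) (+-cong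
             (trans (powers-*ˡ B (x j) _ _) (*-congˡ (trans (powers-swap B B (x j) y _)
               (powers-cong B y (λ r → powers-cong B (x j) (λ e → expSum-cong K′ (λ γ _ → inv (swap e r ↭-refl))))))))
             (trans (powers-neg B (x j) _) (-‿cong (powers-*ˡ B (x j) _ _)))))) ⟩
      P (j ∷ K) (λ j′ K′ → x j′ * rc j′ * powers B y (λ r → expSum K′ (λ γ → f (r ∷ γ))) + - ((1# + x j′ * rc j′) * expSum (j ∷ K) f)) ∎

  module Expansion {A : Set} (u : Carrier) (x : A → Carrier) (rc : A → A → Carrier) (d : ℕ → Carrier) (B : ℕ)
    (van : ∀ γ → B < sum γ → augmented d γ ≈ 0#) where
    open Determinant R
    open RisingFactorial R
    open Rows R

    generating : A → Carrier
    generating j = powers B (x j) d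

    signedSum : List A → Carrier
    signedSum K = sgn (length K) * expSum x B K (augmented d)

    private
      signed-relation : ∀ l K → All (λ j → rc l j * (x l + - x j) ≈ 1#) K →
        signedSum (l ∷ K) ≈ - generating l * signedSum K + P K (λ j K′ → x j * rc l j * signedSum (l ∷ K′) + - ((1# + x j * rc l j) * signedSum K))
      signed-relation l K us = begin
        - s * powers B (x l) (λ r → expSum x B K (λ γ → augmented d (r ∷ γ)))
          ≈⟨ *-congˡ (trans (powers-cong B (x l) (λ r → trans (expSum-cong x B K (λ γ _ → augmented-∷ d r γ))
               (trans (expSum-+ x B K _ _) (+-cong (trans (expSum-*ˡ x B K _ _) (*-comm _ _)) (expSum-neg x B K _)))))
               (trans (powers-+ B (x l) _ _) (+-cong (powers-*ˡ B (x l) _ _) (powers-neg B (x l) _)))) ⟩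
        - s * (expSum x B K (augmented d) * generating l + - powers B (x l) (λ r → expSum x B K (λ γ → bumpSum r γ (augmented d))))
          ≈⟨ *-congˡ (+-congˡ (-‿cong (expSum-bump x B (x l) (rc l) K (augmented d) us (augmented-↭ d) van))) ⟩
        - s * (expSum x B K (augmented d) * generating l + - P K (λ j K′ → x j * rc l j * powers B (x l) (λ r → expSum x B K′ (λ γ → augmented d (r ∷ γ)))
             + - ((1# + x j * rc l j) * expSum x B K (augmented d))))
          ≈⟨ solve 4 (λ s e h p → (:- s) :* (e :* h :- p) := (:- h) :* (s :* e) :+ s :* p) refl _ _ _ _ ⟩
        - generating l * signedSum K + s * P K (λ j K′ → x j * rc l j * powers B (x l) (λ r → expSum x B K′ (λ γ → augmented d (r ∷ γ)))
             + - ((1# + x j * rc l j) * expSum x B K (augmented d)))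
          ≈⟨ +-congˡ (trans (sym (P-length-sgn K)) (P-cong K (λ j K′ → solve 6 (λ t s b e c y → (:- t) :* (b :* e) :- s :* (c :* y) := b :* ((:- t) :* e) :- c :* (s :* y)) refl
               (sgn (length K′)) s (x j * rc l j) (powers B (x l) (λ r → expSum x B K′ (λ γ → augmented d (r ∷ γ)))) (1# + x j * rc l j) (expSum x B K (augmented d))))) ⟩
        - generating l * signedSum K + P K (λ j K′ → x j * rc l j * signedSum (l ∷ K′) + - ((1# + x j * rc l j) * signedSum K)) ∎
        where
        s = sgn (length K)
        -- Since |K′| + 1 = |L|, replacing the chosen element by l restores the sign belonging to L.
        P-length-sgn : ∀ L {f g : A → List A → Carrier} → P L (λ j K′ → - sgn (length K′) * f j K′ + - (sgn (length L) * g j K′)) ≈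
                       sgn (length L) * P L (λ j K′ → f j K′ + - g j K′)
        P-length-sgn L = trans (P-+ L _ _) (trans (+-cong (Nodes.P-length R sgn L _) (trans (P-neg L _) (-‿cong (P-*ˡ L _ _))))
          (trans (solve 3 (λ s a b → s :* a :- s :* b := s :* (a :- b)) refl _ _ _) (*-congˡ (trans (+-congˡ (sym (P-neg L _))) (sym (P-+ L _ _))))))

    -- The start of the induction: no nodes, Y = `signedSum`, and `shifted` differs from
    -- `generating` only by an empty sum.
    det-expansion : ∀ N J → N ≡ length J → AllPairs (λ l j → rc l j * (x l + - x j) ≈ 1#) J →
      det N (map (λ j → freeRow N u (x j) (generating j)) J) ≈
      vandermonde (map x J) * S2 J (λ K Z → rise u (length K) (length Z) * signedSum K)
    det-expansion N J e us = det-formula J R N u x generating rc [] signedSum e (us , [])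
      (λ {l} {K} p → trans (signed-relation l K (pairs p us)) (+-congʳ (*-congʳ (-‿cong (sym (trans (+-congˡ -0#≈0#) (+-identityʳ _)))))))
      (*-identityˡ _)
      where
      pairs : ∀ {l K L} → (l ∷ K) ⊆ L → AllPairs (λ l j → rc l j * (x l + - x j) ≈ 1#) L → All (λ j → rc l j * (x l + - x j) ≈ 1#) K
      pairs (_ ∷ʳ p) (_ ∷ qs) = pairs p qs
      pairs (≡.refl ∷ p) (q ∷ _) = SubP.All-resp-⊆ p q

-- Non-zero-divisors and rings of fractions.

NonZeroDivisor : (R : CRing) → CommutativeRing.Carrier R → Set
NonZeroDivisor R v = ∀ a → v * a ≈ 0# → a ≈ 0#
  where open CommutativeRing R

module NonZeroDivisors (R : CRing) where
  open Kit R

  nzd-cancel : ∀ {v a b} → NonZeroDivisor R v → v * a ≈ v * b → a ≈ b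
  nzd-cancel {v} {a} {b} n e = trans (solve 2 (λ a b → a := (a :- b) :+ b) refl a b)
    (trans (+-congʳ (n (a + - b) (trans (solve 3 (λ v a b → v :* (a :- b) := v :* a :- v :* b) refl v a b) (trans (+-congʳ e) (-‿inverseʳ _))))) (+-identityˡ _))

-- Parametrised by the product of a denominator list, so that it serves both for `denProd` in the
-- given model of ℚ(α) and for total rings of fractions. Lists make the product of two denominators
-- a mere concatenation.
module Fractions (R : CRing) (D : Set) (val : D → CommutativeRing.Carrier R) (nzd : ∀ d → NonZeroDivisor R (val d))
  (prod : List D → CommutativeRing.Carrier R)
  (prod-[] : CommutativeRing._≈_ R (prod []) (CommutativeRing.1# R))
  (prod-∷ : ∀ d ds → CommutativeRing._≈_ R (prod (d ∷ ds)) (CommutativeRing._*_ R (val d) (prod ds))) where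
  open Kit R
  open NonZeroDivisors R

  Fraction : Set
  Fraction = Carrier × List D

  infix 4 _≈ꟳ_
  _≈ꟳ_ : Fraction → Fraction → Set
  a ≈ꟳ b = proj₁ a * prod (proj₂ b) ≈ proj₁ b * prod (proj₂ a)

  prod-++ : ∀ ds es → prod (ds ++ es) ≈ prod ds * prod es
  prod-++ [] es = trans (sym (*-identityˡ _)) (*-congʳ (sym prod-[]))
  prod-++ (d ∷ ds) es = trans (prod-∷ d (ds ++ es)) (trans (*-congˡ (prod-++ ds es)) (trans (sym (*-assoc _ _ _)) (*-congʳ (sym (prod-∷ d ds)))))

  prod-nzd : ∀ ds → NonZeroDivisor R (prod ds)
  prod-nzd [] a e = trans (sym (*-identityˡ a)) (trans (*-congʳ (sym prod-[])) e)
  prod-nzd (d ∷ ds) a e = prod-nzd ds a (nzd d (prod ds * a) (trans (sym (*-assoc _ _ _)) (trans (*-congʳ (sym (prod-∷ d ds))) e)))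

  laws : RingLaws Fraction _≈ꟳ_
    (λ a b → proj₁ a * prod (proj₂ b) + proj₁ b * prod (proj₂ a) , proj₂ a ++ proj₂ b)
    (λ a b → proj₁ a * proj₁ b , proj₂ a ++ proj₂ b) (λ a → - proj₁ a , proj₂ a) (0# , []) (1# , [])
  laws = record
    { isEquivalence = record { refl = refl ; sym = sym ; trans = λ { {a , d} {b , e} {c , f} → tr a d b e c f } }
    ; +-cong = λ { {a , d} {b , e} {c , f} {g , h} → add-cong a d b e c f g h }
    ; +-assoc = λ { (a , d) (b , e) (c , f) → trans
        (*-cong (+-cong refl (*-congˡ (prod-++ d e))) (trans (prod-++ d (e ++ f)) (*-congˡ (prod-++ e f))))
        (trans (solve 6 (λ a d b e c f → ((a :* e :+ b :* d) :* f :+ c :* (d :* e)) :* (d :* (e :* f)) := (a :* (e :* f) :+ (b :* f :+ c :* e) :* d) :* (d :* e :* f)) refl a (prod d) b (prod e) c (prod f))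
        (sym (*-cong (+-cong (*-congˡ (prod-++ e f)) refl) (trans (prod-++ (d ++ e) f) (*-congʳ (prod-++ d e)))))) }
    ; +-comm = λ { (a , d) (b , e) → *-cong (+-comm _ _) (trans (prod-++ e d) (trans (*-comm _ _) (sym (prod-++ d e)))) }
    ; +-identityˡ = λ { (a , d) → *-congʳ (trans (+-cong (zeroˡ _) (trans (*-congˡ prod-[]) (*-identityʳ _))) (+-identityˡ _)) }
    ; neg-cong = λ { {a , d} {b , e} p → trans (sym (-‿distribˡ-* _ _)) (trans (-‿cong p) (-‿distribˡ-* _ _)) }
    ; neg-inverseˡ = λ { (a , d) → solve 3 (λ a d o → (:- a :* d :+ a :* d) :* o := con (+ 0) :* (d :* d)) refl a (prod d) (prod []) ○ *-congˡ (sym (prod-++ d d)) }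
    ; *-cong = λ { {a , d} {b , e} {c , f} {g , h} p q → begin
        a * c * prod (e ++ h)              ≈⟨ *-congˡ (prod-++ e h) ⟩
        a * c * (prod e * prod h)          ≈⟨ solve 4 (λ a c e h → a :* c :* (e :* h) := a :* e :* (c :* h)) refl _ _ _ _ ⟩
        a * prod e * (c * prod h)          ≈⟨ *-cong p q ⟩
        b * prod d * (g * prod f)          ≈⟨ solve 4 (λ b d g f → b :* d :* (g :* f) := b :* g :* (d :* f)) refl _ _ _ _ ⟩
        b * g * (prod d * prod f)          ≈⟨ *-congˡ (sym (prod-++ d f)) ⟩
        b * g * prod (d ++ f)              ∎ }
    ; *-assoc = λ { (a , d) (b , e) (c , f) → *-cong (*-assoc _ _ _)
        (trans (prod-++ d (e ++ f)) (trans (*-congˡ (prod-++ e f)) (trans (sym (*-assoc _ _ _)) (sym (trans (prod-++ (d ++ e) f) (*-congʳ (prod-++ d e))))))) }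
    ; *-comm = λ { (a , d) (b , e) → *-cong (*-comm _ _) (trans (prod-++ e d) (trans (*-comm _ _) (sym (prod-++ d e)))) }
    ; *-identityˡ = λ { (a , d) → *-congʳ (*-identityˡ _) }
    ; distribʳ = λ { (a , d) (b , e) (c , f) → begin
        (b * prod f + c * prod e) * a * prod ((e ++ d) ++ (f ++ d))
          ≈⟨ *-congˡ (trans (prod-++ (e ++ d) (f ++ d)) (*-cong (prod-++ e d) (prod-++ f d))) ⟩
        (b * prod f + c * prod e) * a * (prod e * prod d * (prod f * prod d))
          ≈⟨ solve 6 (λ a d b e c f → (b :* f :+ c :* e) :* a :* (e :* d :* (f :* d)) := (b :* a :* (f :* d) :+ c :* a :* (e :* d)) :* (e :* f :* d)) refl a (prod d) b (prod e) c (prod f) ⟩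
        (b * a * (prod f * prod d) + c * a * (prod e * prod d)) * (prod e * prod f * prod d)
          ≈⟨ sym (*-cong (+-cong (*-congˡ (prod-++ f d)) (*-congˡ (prod-++ e d))) (trans (prod-++ (e ++ f) d) (*-congʳ (prod-++ e f)))) ⟩
        (b * a * prod (f ++ d) + c * a * prod (e ++ d)) * prod ((e ++ f) ++ d) ∎ }
    }
    where
    infixr 5 _○_
    _○_ : ∀ {a b c} → a ≈ b → b ≈ c → a ≈ c
    _○_ = trans
    tr : ∀ a d b e c f → a * prod e ≈ b * prod d → b * prod f ≈ c * prod e → a * prod f ≈ c * prod d
    tr a d b e c f p q = nzd-cancel (prod-nzd e) (begin
      prod e * (a * prod f)     ≈⟨ solve 3 (λ e a f → e :* (a :* f) := a :* e :* f) refl _ _ _ ⟩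
      a * prod e * prod f       ≈⟨ *-congʳ p ⟩
      b * prod d * prod f       ≈⟨ solve 3 (λ b d f → b :* d :* f := b :* f :* d) refl _ _ _ ⟩
      b * prod f * prod d       ≈⟨ *-congʳ q ⟩
      c * prod e * prod d       ≈⟨ solve 3 (λ c e d → c :* e :* d := e :* (c :* d)) refl _ _ _ ⟩
      prod e * (c * prod d)     ∎)
    add-cong : ∀ a d b e c f g h → a * prod e ≈ b * prod d → c * prod h ≈ g * prod f →
      (a * prod f + c * prod d) * prod (e ++ h) ≈ (b * prod h + g * prod e) * prod (d ++ f)
    add-cong a d b e c f g h p q = begin
      (a * prod f + c * prod d) * prod (e ++ h)
        ≈⟨ *-congˡ (prod-++ e h) ⟩
      (a * prod f + c * prod d) * (prod e * prod h)
        ≈⟨ solve 6 (λ a f c d e h → (a :* f :+ c :* d) :* (e :* h) := a :* e :* (f :* h) :+ c :* h :* (d :* e)) refl a (prod f) c (prod d) (prod e) (prod h) ⟩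
      a * prod e * (prod f * prod h) + c * prod h * (prod d * prod e)
        ≈⟨ +-cong (*-congʳ p) (*-congʳ q) ⟩
      b * prod d * (prod f * prod h) + g * prod f * (prod d * prod e)
        ≈⟨ solve 6 (λ b f g d e h → b :* d :* (f :* h) :+ g :* f :* (d :* e) := (b :* h :+ g :* e) :* (d :* f)) refl b (prod f) g (prod d) (prod e) (prod h) ⟩
      (b * prod h + g * prod e) * (prod d * prod f)
        ≈⟨ *-congˡ (sym (prod-++ d f)) ⟩
      (b * prod h + g * prod e) * prod (d ++ f) ∎

module TotalFractions (R : CRing) where
  open Kit R
  NZD : Set
  NZD = ∃ (NonZeroDivisor R)

  private
    module G = Fractions R NZD proj₁ proj₂ (prodOver proj₁) refl (λ _ _ → refl)

  abstract
    Frac : CRing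
    Frac = RingLaws.commutativeRing G.laws

    toFrac : Hom R Frac
    toFrac = record
      { ⟦_⟧ = λ a → a , []
      ; ⟦⟧-cong = *-congʳ
      ; +-homo = λ _ _ → solve 2 (λ a b → (a :+ b) :* con (+ 1) := (a :* con (+ 1) :+ b :* con (+ 1)) :* con (+ 1)) refl _ _
      ; *-homo = λ _ _ → refl
      ; 1-homo = refl }

    toFrac-injective : ∀ {a b} → CommutativeRing._≈_ Frac (Hom.⟦_⟧ toFrac a) (Hom.⟦_⟧ toFrac b) → a ≈ b
    toFrac-injective e = trans (sym (*-identityʳ _)) (trans e (*-identityʳ _))

    reciprocal : ∀ v → NonZeroDivisor R v → CommutativeRing.Carrier Frac
    reciprocal v n = 1# , (v , n) ∷ []

    reciprocal-* : ∀ v n → CommutativeRing._≈_ Frac (CommutativeRing._*_ Frac (reciprocal v n) (Hom.⟦_⟧ toFrac v)) (CommutativeRing.1# Frac)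
    reciprocal-* v n = solve 1 (λ v → con (+ 1) :* v :* con (+ 1) := con (+ 1) :* (v :* con (+ 1))) refl v

-- ℚ[α] and ℚ(α)

module QPolynomials where
  private
    module Q = Kit ℚP.+-*-commutativeRing
  open ≡ using (refl; sym; trans; cong; cong₂)

  cf : QPoly → ℕ → ℚ
  cf [] n = 0ℚ
  cf (a ∷ p) zero = a
  cf (a ∷ p) (suc n) = cf p n

  infix 4 _≐_
  -- Coefficientwise equality, which ignores trailing zeros; the zero-difference condition of the
  -- definitions is equivalent to it.
  _≐_ : QPoly → QPoly → Set
  p ≐ q = ∀ n → cf p n ≡ cf q n

  cf-+ : ∀ p q n → cf (p +q q) n ≡ cf p n ℚ.+ cf q n
  cf-+ [] q n = sym (ℚP.+-identityˡ _)
  cf-+ (a ∷ p) [] n = sym (ℚP.+-identityʳ _)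
  cf-+ (a ∷ p) (b ∷ q) zero = refl
  cf-+ (a ∷ p) (b ∷ q) (suc n) = cf-+ p q n

  cf-neg : ∀ p n → cf (negq p) n ≡ ℚ.- cf p n
  cf-neg [] n = refl
  cf-neg (a ∷ p) zero = refl
  cf-neg (a ∷ p) (suc n) = cf-neg p n

  cf-scale : ∀ a p n → cf (map (a ℚ.*_) p) n ≡ a ℚ.* cf p n
  cf-scale a [] n = sym (ℚP.*-zeroʳ a)
  cf-scale a (b ∷ p) zero = refl
  cf-scale a (b ∷ p) (suc n) = cf-scale a p n

  zero⇒≐ : ∀ {p} → IsZeroQ p → p ≐ []
  zero⇒≐ [] n = refl
  zero⇒≐ (e ∷ es) zero = e
  zero⇒≐ (e ∷ es) (suc n) = zero⇒≐ es n

  ≐⇒zero : ∀ p → p ≐ [] → IsZeroQ p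
  ≐⇒zero [] e = []
  ≐⇒zero (a ∷ p) e = e 0 ∷ ≐⇒zero p (λ n → e (suc n))

  infix 4 _≈q_
  _≈q_ : QPoly → QPoly → Set
  p ≈q q = IsZeroQ (p +q negq q)

  ≈⇒≐ : ∀ p q → p ≈q q → p ≐ q
  ≈⇒≐ p q e n = begin
    cf p n                                ≡⟨ Q.solve 2 (λ a b → a Q.:= (a Q.:- b) Q.:+ b) refl (cf p n) (cf q n) ⟩
    (cf p n ℚ.+ ℚ.- cf q n) ℚ.+ cf q n    ≡⟨ cong (ℚ._+ cf q n) (trans (sym (trans (cf-+ p (negq q) n) (cong (cf p n ℚ.+_) (cf-neg q n)))) (zero⇒≐ e n)) ⟩
    0ℚ ℚ.+ cf q n                         ≡⟨ ℚP.+-identityˡ _ ⟩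
    cf q n ∎
    where open ≡.≡-Reasoning

  ≐⇒≈ : ∀ p q → p ≐ q → p ≈q q
  ≐⇒≈ p q e = ≐⇒zero _ (λ n → trans (cf-+ p (negq q) n) (trans (cong₂ ℚ._+_ (e n) (cf-neg q n)) (ℚP.+-inverseʳ (cf q n))))

  cf-*-zero : ∀ a p q → cf ((a ∷ p) *q q) 0 ≡ a ℚ.* cf q 0
  cf-*-zero a p q = trans (cf-+ (map (a ℚ.*_) q) _ 0) (trans (cong (ℚ._+ 0ℚ) (cf-scale a q 0)) (ℚP.+-identityʳ _))

  cf-*-suc : ∀ a p q n → cf ((a ∷ p) *q q) (suc n) ≡ a ℚ.* cf q (suc n) ℚ.+ cf (p *q q) n
  cf-*-suc a p q n = trans (cf-+ (map (a ℚ.*_) q) _ (suc n)) (cong (ℚ._+ cf (p *q q) n) (cf-scale a q (suc n)))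

  *-[] : ∀ p → p *q [] ≐ []
  *-[] [] n = refl
  *-[] (a ∷ p) zero = trans (cf-*-zero a p []) (ℚP.*-zeroʳ a)
  *-[] (a ∷ p) (suc n) = trans (cf-*-suc a p [] n) (trans (cong₂ ℚ._+_ (ℚP.*-zeroʳ a) (*-[] p n)) (ℚP.+-identityˡ _))

  *-∷ : ∀ p b q → p *q (b ∷ q) ≐ map (b ℚ.*_) p +q (0ℚ ∷ (p *q q))
  *-∷ [] b q zero = refl
  *-∷ [] b q (suc n) = refl
  *-∷ (a ∷ p) b q zero = trans (cf-*-zero a p (b ∷ q)) (trans (ℚP.*-comm a b) (sym (ℚP.+-identityʳ _)))
  *-∷ (a ∷ p) b q (suc n) = begin
    cf ((a ∷ p) *q (b ∷ q)) (suc n)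
      ≡⟨ trans (cf-*-suc a p (b ∷ q) n) (cong (a ℚ.* cf q n ℚ.+_) (trans (*-∷ p b q n) (cf-+ (map (b ℚ.*_) p) (0ℚ ∷ (p *q q)) n))) ⟩
    a ℚ.* cf q n ℚ.+ (cf (map (b ℚ.*_) p) n ℚ.+ cf (0ℚ ∷ (p *q q)) n)
      ≡⟨ Q.solve 3 (λ x y z → x Q.:+ (y Q.:+ z) Q.:= y Q.:+ (x Q.:+ z)) refl (a ℚ.* cf q n) (cf (map (b ℚ.*_) p) n) (cf (0ℚ ∷ (p *q q)) n) ⟩
    cf (map (b ℚ.*_) p) n ℚ.+ (a ℚ.* cf q n ℚ.+ cf (0ℚ ∷ (p *q q)) n)
      ≡⟨ cong (cf (map (b ℚ.*_) p) n ℚ.+_) (trans (cong (ℚ._+ cf (0ℚ ∷ (p *q q)) n) (sym (cf-scale a q n))) (sym (cf-+ (map (a ℚ.*_) q) _ n))) ⟩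
    cf (map (b ℚ.*_) p) n ℚ.+ cf ((a ∷ p) *q q) n
      ≡⟨ sym (cf-+ (map (b ℚ.*_) p) _ n) ⟩
    cf (map (b ℚ.*_) (a ∷ p) +q (0ℚ ∷ ((a ∷ p) *q q))) (suc n) ∎
    where open ≡.≡-Reasoning

  cf-shift : ∀ {p q} → p ≐ q → (0ℚ ∷ p) ≐ (0ℚ ∷ q)
  cf-shift e zero = refl
  cf-shift e (suc n) = e n

  *-comm′ : ∀ p q → p *q q ≐ q *q p
  *-comm′ [] q n = sym (*-[] q n)
  *-comm′ (a ∷ p) q n = trans (cf-+ (map (a ℚ.*_) q) _ n) (trans (cong (cf (map (a ℚ.*_) q) n ℚ.+_) (cf-shift (*-comm′ p q) n))
    (trans (sym (cf-+ (map (a ℚ.*_) q) _ n)) (sym (*-∷ q a p n))))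

  *-congˡ′ : ∀ p {q r} → q ≐ r → p *q q ≐ p *q r
  *-congˡ′ [] e n = refl
  *-congˡ′ (a ∷ p) {q} {r} e zero = trans (cf-*-zero a p q) (trans (cong (a ℚ.*_) (e 0)) (sym (cf-*-zero a p r)))
  *-congˡ′ (a ∷ p) {q} {r} e (suc n) = trans (cf-*-suc a p q n) (trans (cong₂ ℚ._+_ (cong (a ℚ.*_) (e (suc n))) (*-congˡ′ p e n)) (sym (cf-*-suc a p r n)))

  *-cong′ : ∀ {p p′ q q′} → p ≐ p′ → q ≐ q′ → p *q q ≐ p′ *q q′
  *-cong′ {p} {p′} {q} {q′} e f n = trans (*-congˡ′ p f n) (trans (*-comm′ p q′ n) (trans (*-congˡ′ q′ e n) (*-comm′ q′ p′ n)))

  *-distribˡ′ : ∀ p q r → p *q (q +q r) ≐ (p *q q) +q (p *q r)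
  *-distribˡ′ [] q r n = refl
  *-distribˡ′ (a ∷ p) q r zero = trans (cf-*-zero a p (q +q r)) (trans (cong (a ℚ.*_) (cf-+ q r 0)) (trans (ℚP.*-distribˡ-+ a _ _)
    (sym (trans (cf-+ ((a ∷ p) *q q) _ 0) (cong₂ ℚ._+_ (cf-*-zero a p q) (cf-*-zero a p r))))))
  *-distribˡ′ (a ∷ p) q r (suc n) = trans (cf-*-suc a p (q +q r) n) (trans
    (cong₂ ℚ._+_ (trans (cong (a ℚ.*_) (cf-+ q r (suc n))) (ℚP.*-distribˡ-+ a _ _)) (trans (*-distribˡ′ p q r n) (cf-+ (p *q q) _ n)))
    (trans (Q.solve 4 (λ x y z w → (x Q.:+ y) Q.:+ (z Q.:+ w) Q.:= (x Q.:+ z) Q.:+ (y Q.:+ w)) refl (a ℚ.* cf q (suc n)) (a ℚ.* cf r (suc n)) (cf (p *q q) n) (cf (p *q r) n))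
    (sym (trans (cf-+ ((a ∷ p) *q q) _ (suc n)) (cong₂ ℚ._+_ (cf-*-suc a p q n) (cf-*-suc a p r n))))))

  *-distribʳ′ : ∀ p q r → (q +q r) *q p ≐ (q *q p) +q (r *q p)
  *-distribʳ′ p q r n = trans (*-comm′ (q +q r) p n) (trans (*-distribˡ′ p q r n) (trans (cf-+ (p *q q) _ n)
    (trans (cong₂ ℚ._+_ (*-comm′ p q n) (*-comm′ p r n)) (sym (cf-+ (q *q p) _ n)))))

  scale-* : ∀ a q r → map (a ℚ.*_) q *q r ≐ map (a ℚ.*_) (q *q r)
  scale-* a [] r n = refl
  scale-* a (b ∷ q) r zero = trans (cf-*-zero (a ℚ.* b) (map (a ℚ.*_) q) r) (trans (ℚP.*-assoc a b _)
    (sym (trans (cf-scale a ((b ∷ q) *q r) 0) (cong (a ℚ.*_) (cf-*-zero b q r)))))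
  scale-* a (b ∷ q) r (suc n) = trans (cf-*-suc (a ℚ.* b) (map (a ℚ.*_) q) r n) (trans
    (cong₂ ℚ._+_ (ℚP.*-assoc a b _) (trans (scale-* a q r n) (cf-scale a (q *q r) n)))
    (sym (trans (cf-scale a ((b ∷ q) *q r) (suc n)) (trans (cong (a ℚ.*_) (cf-*-suc b q r n)) (ℚP.*-distribˡ-+ a _ _)))))

  *-assoc′ : ∀ p q r → (p *q q) *q r ≐ p *q (q *q r)
  *-assoc′ [] q r n = refl
  *-assoc′ (a ∷ p) q r n = trans (*-distribʳ′ r (map (a ℚ.*_) q) (0ℚ ∷ (p *q q)) n) (trans (cf-+ (map (a ℚ.*_) q *q r) _ n)
    (trans (cong₂ ℚ._+_ (scale-* a q r n) (shifted n)) (sym (cf-+ (map (a ℚ.*_) (q *q r)) _ n))))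
    where
    shifted : (0ℚ ∷ (p *q q)) *q r ≐ (0ℚ ∷ (p *q (q *q r)))
    shifted zero = trans (cf-*-zero 0ℚ (p *q q) r) (ℚP.*-zeroˡ (cf r 0))
    shifted (suc n) = trans (cf-*-suc 0ℚ (p *q q) r n) (trans (cong₂ ℚ._+_ (ℚP.*-zeroˡ (cf r (suc n))) (*-assoc′ p q r n)) (ℚP.+-identityˡ _))

  *-one : ∀ q → (1ℚ ∷ []) *q q ≐ q
  *-one q zero = trans (cf-*-zero 1ℚ [] q) (ℚP.*-identityˡ _)
  *-one q (suc n) = trans (cf-*-suc 1ℚ [] q n) (trans (ℚP.+-identityʳ _) (ℚP.*-identityˡ _))

  ℚ[α] : CRing
  ℚ[α] = RingLaws.commutativeRing {C = QPoly} {_≈_ = _≈q_} {_+_ = _+q_} {_*_ = _*q_} {neg = negq} {0# = []} {1# = 1ℚ ∷ []} record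
    { isEquivalence = record
      { refl = λ {p} → ≐⇒≈ p p (λ _ → refl)
      ; sym = λ {p} {q} e → ≐⇒≈ q p (λ n → sym (≈⇒≐ p q e n))
      ; trans = λ {p} {q} {r} e f → ≐⇒≈ p r (λ n → trans (≈⇒≐ p q e n) (≈⇒≐ q r f n)) }
    ; +-cong = λ {a} {b} {c} {d} e f → ≐⇒≈ (a +q c) (b +q d) (λ n → trans (cf-+ a c n) (trans (cong₂ ℚ._+_ (≈⇒≐ a b e n) (≈⇒≐ c d f n)) (sym (cf-+ b d n))))
    ; +-assoc = λ a b c → ≐⇒≈ ((a +q b) +q c) (a +q (b +q c)) (λ n → trans (cf-+ (a +q b) c n) (trans (cong (ℚ._+ cf c n) (cf-+ a b n))
        (trans (ℚP.+-assoc (cf a n) _ _) (sym (trans (cf-+ a (b +q c) n) (cong (cf a n ℚ.+_) (cf-+ b c n)))))))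
    ; +-comm = λ a b → ≐⇒≈ (a +q b) (b +q a) (λ n → trans (cf-+ a b n) (trans (ℚP.+-comm (cf a n) _) (sym (cf-+ b a n))))
    ; +-identityˡ = λ a → ≐⇒≈ a a (λ _ → refl)
    ; neg-cong = λ {a} {b} e → ≐⇒≈ (negq a) (negq b) (λ n → trans (cf-neg a n) (trans (cong ℚ.-_ (≈⇒≐ a b e n)) (sym (cf-neg b n))))
    ; neg-inverseˡ = λ a → ≐⇒≈ (negq a +q a) [] (λ n → trans (cf-+ (negq a) a n) (trans (cong (ℚ._+ cf a n) (cf-neg a n)) (ℚP.+-inverseˡ (cf a n))))
    ; *-cong = λ {a} {b} {c} {d} e f → ≐⇒≈ (a *q c) (b *q d) (*-cong′ {a} {b} {c} {d} (≈⇒≐ a b e) (≈⇒≐ c d f))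
    ; *-assoc = λ a b c → ≐⇒≈ ((a *q b) *q c) (a *q (b *q c)) (*-assoc′ a b c)
    ; *-comm = λ a b → ≐⇒≈ (a *q b) (b *q a) (*-comm′ a b)
    ; *-identityˡ = λ a → ≐⇒≈ ((1ℚ ∷ []) *q a) a (*-one a)
    ; distribʳ = λ a b c → ≐⇒≈ ((b +q c) *q a) ((b *q a) +q (c *q a)) (*-distribʳ′ a b c)
    }

  ℚ-domain : ∀ a b → ¬ a ≡ 0ℚ → a ℚ.* b ≡ 0ℚ → b ≡ 0ℚ
  ℚ-domain a b a≢0 e = trans (sym (ℚP.*-identityˡ b)) (trans (cong (ℚ._* b) (sym (ℚP.*-inverseˡ a)))
    (trans (ℚP.*-assoc (ℚ.1/ a) a b) (trans (cong (ℚ.1/ a ℚ.*_) e) (ℚP.*-zeroʳ (ℚ.1/ a)))))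
    where instance _ = ℚ.≢-nonZero a≢0

  private
    -- The lowest coefficient of the product is a b, so b = 0 when a ≠ 0; q can then be divided by
    -- the indeterminate.
    head-nonzero : ∀ a p → ¬ a ≡ 0ℚ → ∀ q → (a ∷ p) *q q ≐ [] → q ≐ []
    head-nonzero a p a≢0 [] e n = refl
    head-nonzero a p a≢0 (b ∷ q) e = λ { zero → b≡0 ; (suc n) → head-nonzero a p a≢0 q rest n }
      where
      b≡0 : b ≡ 0ℚ
      b≡0 = ℚ-domain a b a≢0 (trans (sym (cf-*-zero a p (b ∷ q))) (e 0))
      rest : (a ∷ p) *q q ≐ []
      rest n = begin
        cf ((a ∷ p) *q q) n                                       ≡⟨ sym (ℚP.+-identityˡ _) ⟩
        0ℚ ℚ.+ cf ((a ∷ p) *q q) n                                ≡⟨ cong (ℚ._+ cf ((a ∷ p) *q q) n) (sym (trans (cf-scale b p n) (trans (cong (ℚ._* cf p n) b≡0) (ℚP.*-zeroˡ (cf p n))))) ⟩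
        cf (map (b ℚ.*_) p) n ℚ.+ cf ((a ∷ p) *q q) n             ≡⟨ sym (cf-+ (map (b ℚ.*_) p) _ n) ⟩
        cf (map (b ℚ.*_) p +q ((a ∷ p) *q q)) n                   ≡⟨ sym (*-∷ (a ∷ p) b q (suc n)) ⟩
        cf ((a ∷ p) *q (b ∷ q)) (suc n)                           ≡⟨ e (suc n) ⟩
        0ℚ ∎
        where open ≡.≡-Reasoning

  -- Zero constant terms of p are stripped until a nonzero one appears, as it must for p ≠ 0.
  QPoly-domain : ∀ p → ¬ IsZeroQ p → ∀ q → p *q q ≐ [] → q ≐ []
  QPoly-domain [] p≢0 q e = ⊥-elim (p≢0 [])
  QPoly-domain (a ∷ p) p≢0 q e with a ℚ.≟ 0ℚ
  ... | no a≢0 = head-nonzero a p a≢0 q e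
  ... | yes a≡0 = QPoly-domain p (λ z → p≢0 (a≡0 ∷ z)) q (λ n → trans (sym (trans (cf-*-suc a p q n)
          (trans (cong (λ c → c ℚ.* cf q (suc n) ℚ.+ cf (p *q q) n) a≡0) (trans (cong (ℚ._+ cf (p *q q) n) (ℚP.*-zeroˡ (cf q (suc n)))) (ℚP.+-identityˡ _))))) (e (suc n)))

  NZPoly-nzd : ∀ d → NonZeroDivisor ℚ[α] (NZPoly.poly d)
  NZPoly-nzd d q e = ≐⇒≈ q [] (QPoly-domain (NZPoly.poly d) (NZPoly.nonzero d) q (≈⇒≐ (NZPoly.poly d *q q) [] e))

module Units (R : CRing) where
  open Kit R

  Invertible : Carrier → Set
  Invertible a = ∃ λ v → v * a ≈ 1#

  invertible-* : ∀ {a b} → Invertible a → Invertible b → Invertible (a * b)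
  invertible-* (v , e) (w , f) = v * w ,
    trans (solve 4 (λ v w a b → v :* w :* (a :* b) := v :* a :* (w :* b)) refl _ _ _ _) (trans (*-cong e f) (*-identityˡ _))

  invertible⇒nzd : ∀ {a} → Invertible a → NonZeroDivisor R a
  invertible⇒nzd {a} (v , e) b f = trans (sym (*-identityˡ b)) (trans (*-congʳ (sym e)) (trans (*-assoc _ _ _) (trans (*-congˡ f) (zeroʳ v))))

  slide : ∀ p → 1# * p * 1# ≈ 1# * (p * 1#)
  slide = solve 1 (λ p → con (+ 1) :* p :* con (+ 1) := con (+ 1) :* (p :* con (+ 1))) refl

module RationalFunctions where
  open QPolynomials
  private
    module G = Fractions ℚ[α] NZPoly NZPoly.poly NZPoly-nzd denProd (CommutativeRing.refl ℚ[α] {1ℚ ∷ []})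
      (λ d ds → CommutativeRing.refl ℚ[α] {NZPoly.poly d *q denProd ds})
    module Laws = RingLaws G.laws
    pr : F → QPoly × List NZPoly
    pr a = F.num a , F.den a

  abstract
    -- Sealed, to keep equality of fractions from unfolding into lists of rationals; `toF` and
    -- `fromF` are the identity behind the seal.
    𝔽 : CRing
    𝔽 = RingLaws.commutativeRing {C = F} {_≈_ = _≃_} {_+_ = _+F_} {_*_ = _*F_} {neg = -F_} {0# = 0F} {1# = 1F} record
      { isEquivalence = record { refl = λ {a} → IsEquivalence.refl Laws.isEquivalence {pr a} ; sym = λ {a} {b} → IsEquivalence.sym Laws.isEquivalence {pr a} {pr b}
                               ; trans = λ {a} {b} {c} → IsEquivalence.trans Laws.isEquivalence {pr a} {pr b} {pr c} }
      ; +-cong = λ {a} {b} {c} {d} → Laws.+-cong {pr a} {pr b} {pr c} {pr d}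
      ; +-assoc = λ a b c → Laws.+-assoc (pr a) (pr b) (pr c)
      ; +-comm = λ a b → Laws.+-comm (pr a) (pr b)
      ; +-identityˡ = λ a → Laws.+-identityˡ (pr a)
      ; neg-cong = λ {a} {b} → Laws.neg-cong {pr a} {pr b}
      ; neg-inverseˡ = λ a → Laws.neg-inverseˡ (pr a)
      ; *-cong = λ {a} {b} {c} {d} → Laws.*-cong {pr a} {pr b} {pr c} {pr d}
      ; *-assoc = λ a b c → Laws.*-assoc (pr a) (pr b) (pr c)
      ; *-comm = λ a b → Laws.*-comm (pr a) (pr b)
      ; *-identityˡ = λ a → Laws.*-identityˡ (pr a)
      ; distribʳ = λ a b c → Laws.distribʳ (pr a) (pr b) (pr c)
      }
      where open import Relation.Binary using (IsEquivalence)

  private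
    module K = CommutativeRing 𝔽

  abstract
    toF : F → K.Carrier
    toF a = a

    fromF : K.Carrier → F
    fromF a = a

    toF-fromF : ∀ a → toF (fromF a) K.≈ a
    toF-fromF a = K.refl {a}

    toF-cong : ∀ {a b} → a ≃ b → toF a K.≈ toF b
    toF-cong e = e

    toF-injective : ∀ {a b} → toF a K.≈ toF b → a ≃ b
    toF-injective e = e

    toF-+ : ∀ a b → toF (a +F b) K.≈ toF a K.+ toF b
    toF-+ a b = K.refl {a +F b}

    toF-* : ∀ a b → toF (a *F b) K.≈ toF a K.* toF b
    toF-* a b = K.refl {a *F b}

    toF-neg : ∀ a → toF (-F a) K.≈ K.- toF a
    toF-neg a = K.refl { -F a}

    toF-0 : toF 0F K.≈ K.0#
    toF-0 = K.refl {0F}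

    toF-1 : toF 1F K.≈ K.1#
    toF-1 = K.refl {1F}

  private
    num-ext : ∀ {p q} → p ≐ q → (p // []) ≃ (q // [])
    num-ext {p} {q} e = ≐⇒≈ (p *q (1ℚ ∷ [])) (q *q (1ℚ ∷ [])) (*-cong′ {p} {q} {1ℚ ∷ []} {1ℚ ∷ []} e (λ _ → ≡.refl))

    ℚ-suc : ∀ n → (+ suc n) ℚ./ 1 ≡ 1ℚ ℚ.+ (+ n) ℚ./ 1
    ℚ-suc n = ℚP.toℚᵘ-injective (begin
      ℚ.toℚᵘ ((+ suc n) ℚ./ 1)                   ≈⟨ ℚP.toℚᵘ-fromℚᵘ (ℚᵘ.mkℚᵘ (+ suc n) 0) ⟩
      ℚᵘ.mkℚᵘ (+ suc n) 0                        ≈⟨ ℚᵘ.*≡* (≡.cong (ℤ._* + 1) (lemma n)) ⟩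
      ℚᵘ.mkℚᵘ (+ 1) 0 ℚᵘ.+ ℚᵘ.mkℚᵘ (+ n) 0       ≈⟨ ℚᵘP.+-cong (ℚᵘP.≃-refl {ℚᵘ.mkℚᵘ (+ 1) 0}) (ℚᵘP.≃-sym (ℚP.toℚᵘ-fromℚᵘ (ℚᵘ.mkℚᵘ (+ n) 0))) ⟩
      ℚ.toℚᵘ 1ℚ ℚᵘ.+ ℚ.toℚᵘ ((+ n) ℚ./ 1)        ≈⟨ ℚᵘP.≃-sym (ℚP.toℚᵘ-homo-+ 1ℚ ((+ n) ℚ./ 1)) ⟩
      ℚ.toℚᵘ (1ℚ ℚ.+ (+ n) ℚ./ 1) ∎)
      where
      open ℚᵘP.≃-Reasoning
      lemma : ∀ n → + suc n ≡ + 1 ℤ.* + 1 ℤ.+ + n ℤ.* + 1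
      lemma n = ≡.cong (λ k → + 1 ℤ.+ k) (≡.sym (ℤP.*-identityʳ (+ n)))

    ℕ→F-suc : ∀ n → ℕ→F (suc n) ≃ 1F +F ℕ→F n
    ℕ→F-suc n = num-ext {(+ suc n) ℚ./ 1 ∷ []} {F.num (1F +F ℕ→F n)} λ
      { zero → ≡.trans (ℚ-suc n) (≡.sym (≡.cong (1ℚ ℚ.+_) (≡.trans (ℚP.+-identityʳ ((+ n) ℚ./ 1 ℚ.* 1ℚ)) (ℚP.*-identityʳ ((+ n) ℚ./ 1)))))
      ; (suc n) → ≡.refl }

  open Kit 𝔽 using (ι)
  open Units 𝔽 using (Invertible)

  toF-ℕ : ∀ n → toF (ℕ→F n) K.≈ ι n
  toF-ℕ zero = K.trans (toF-cong (num-ext {(+ 0) ℚ./ 1 ∷ []} {[]} λ { zero → ≡.refl ; (suc n) → ≡.refl })) toF-0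
  toF-ℕ (suc n) = K.trans (toF-cong (ℕ→F-suc n)) (K.trans (toF-+ 1F (ℕ→F n)) (K.+-cong toF-1 (toF-ℕ n)))

  poly-invertible : ∀ p → ¬ IsZeroQ p → Invertible (toF (p // []))
  poly-invertible p p≢0 = toF v , K.trans (K.sym (toF-* v (p // []))) (K.trans (toF-cong (Units.slide ℚ[α] p)) toF-1)
    where
    v : F
    v = (1ℚ ∷ []) // (record { poly = p ; nonzero = p≢0 } ∷ [])

  ℕ→F-invertible : ∀ n → Invertible (toF (ℕ→F (suc n)))
  ℕ→F-invertible n = poly-invertible _ λ { (e ∷ []) → nonzero e }
    where
    nonzero : ¬ (+ suc n) ℚ./ 1 ≡ 0ℚ
    nonzero e = zero-not-positive (≡.subst ℚ.Positive e (ℚP.normalize-pos (suc n) 1))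
      where
      zero-not-positive : ¬ ℚ.Positive 0ℚ
      zero-not-positive record { pos = () }

  α-invertible : Invertible (toF αF)
  α-invertible = poly-invertible _ λ { (_ ∷ e ∷ []) → absurd e }
    where
    absurd : ¬ 1ℚ ≡ 0ℚ
    absurd ()

open RationalFunctions public

private
  module Fᴷ = Kit 𝔽

-- Linear functionals on formal sums.

module Evaluation (T : CRing) (φ : Hom 𝔽 T) where
  open Kit T
  private
    module φ = HomProps φ

  scalar : F → Carrier
  scalar c = φ.⟦ toF c ⟧

  scalar-+ : ∀ a b → scalar (a +F b) ≈ scalar a + scalar b
  scalar-+ a b = trans (φ.⟦⟧-cong (toF-+ a b)) (φ.+-homo _ _)

  scalar-* : ∀ a b → scalar (a *F b) ≈ scalar a * scalar b
  scalar-* a b = trans (φ.⟦⟧-cong (toF-* a b)) (φ.*-homo _ _)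

  scalar-neg : ∀ a → scalar (-F a) ≈ - scalar a
  scalar-neg a = trans (φ.⟦⟧-cong (toF-neg a)) (φ.neg-homo _)

  scalar-1 : scalar 1F ≈ 1#
  scalar-1 = trans (φ.⟦⟧-cong toF-1) φ.1-homo

  scalar-ℕ : ∀ n → scalar (ℕ→F n) ≈ ι n
  scalar-ℕ n = trans (φ.⟦⟧-cong (toF-ℕ n)) (φ.ι-homo n)

  -- The linear extension of g to formal sums. An arbitrary g takes the place of a normal form: the
  -- ring laws of polynomials are proved by evaluating both sides on it.
  ev : ∀ {A : Set} → List (A × F) → (A → Carrier) → Carrier
  ev p g = Σ p (λ t → scalar (proj₂ t) * g (proj₁ t))

  ev-cong : ∀ {A : Set} (p : List (A × F)) {f g : A → Carrier} → (∀ a → f a ≈ g a) → ev p f ≈ ev p g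
  ev-cong p e = Σ-cong p (λ t → *-congˡ (e (proj₁ t)))

  ev-+ : ∀ {A : Set} (p : List (A × F)) (f g : A → Carrier) → ev p (λ a → f a + g a) ≈ ev p f + ev p g
  ev-+ p f g = trans (Σ-cong p (λ t → distribˡ _ _ _)) (Σ-+ p _ _)

  ev-*ˡ : ∀ {A : Set} (p : List (A × F)) c (g : A → Carrier) → ev p (λ a → c * g a) ≈ c * ev p g
  ev-*ˡ p c g = trans (Σ-cong p (λ t → solve 3 (λ x y z → x :* (y :* z) := y :* (x :* z)) refl _ _ _)) (Σ-*ˡ p c _)

  ev-scale : ∀ {A : Set} c (p : List (A × F)) (g : A → Carrier) →
             ev (map (λ { (e , d) → (e , c *F d) }) p) g ≈ scalar c * ev p g
  ev-scale c p g = trans (Σ-map _ p _) (trans (Σ-cong p (λ { (e , d) → trans (*-congʳ (scalar-* c d)) (*-assoc _ _ _) })) (Σ-*ˡ p _ _))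

  ev-mul : ∀ {A B C : Set} (_∙_ : A → B → C) (p : List (A × F)) (q : List (B × F)) (g : C → Carrier) →
    ev (concatMap (λ { (e , c) → map (λ { (e′ , d) → (e ∙ e′ , c *F d) }) q }) p) g ≈ ev p (λ a → ev q (λ b → g (a ∙ b)))
  ev-mul _∙_ p q g = trans (Σ-concatMap _ p _) (Σ-cong p (λ { (e , c) → trans (Σ-map _ q _) (trans
    (Σ-cong q (λ { (e′ , d) → trans (*-congʳ (scalar-* c d)) (*-assoc _ _ _) })) (Σ-*ˡ q _ _)) }))

  ev-swap : ∀ {A B : Set} (p : List (A × F)) (q : List (B × F)) (g : A → B → Carrier) →
            ev p (λ a → ev q (g a)) ≈ ev q (λ b → ev p (λ a → g a b))
  ev-swap p q g = begin
    Σ p (λ s → scalar (proj₂ s) * Σ q (λ t → scalar (proj₂ t) * g (proj₁ s) (proj₁ t)))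
      ≈⟨ Σ-cong p (λ s → sym (Σ-*ˡ q _ _)) ⟩
    Σ p (λ s → Σ q (λ t → scalar (proj₂ s) * (scalar (proj₂ t) * g (proj₁ s) (proj₁ t))))
      ≈⟨ Σ-swap p q _ ⟩
    Σ q (λ t → Σ p (λ s → scalar (proj₂ s) * (scalar (proj₂ t) * g (proj₁ s) (proj₁ t))))
      ≈⟨ Σ-cong q (λ t → trans (Σ-cong p (λ s → solve 3 (λ x y z → x :* (y :* z) := y :* (x :* z)) refl _ _ _)) (Σ-*ˡ p _ _)) ⟩
    Σ q (λ t → scalar (proj₂ t) * Σ p (λ s → scalar (proj₂ s) * g (proj₁ s) (proj₁ t))) ∎

  module _ {A X : Set} (_≟_ : DecidableEquality X) (key : A → X) where

    indicator : X → A → Carrier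
    indicator x a = if does (key a ≟ x) then 1# else 0#

    remove : X → List (A × F) → List (A × F)
    remove x = L.filter (λ t → ¬? (key (proj₁ t) ≟ x))

    remove-length : ∀ x p → length (remove x p) ≤ length p
    remove-length x p = LP.length-filter (λ t → ¬? (key (proj₁ t) ≟ x)) p

    ev-remove : ∀ a₀ p (g : A → Carrier) → (∀ a → key a ≡ key a₀ → g a ≈ g a₀) →
                ev p g ≈ ev p (indicator (key a₀)) * g a₀ + ev (remove (key a₀) p) g
    ev-remove a₀ [] g resp = solve 1 (λ x → con (+ 0) := con (+ 0) :* x :+ con (+ 0)) refl _
    ev-remove a₀ ((a , c) ∷ p) g resp with key a ≟ key a₀
    ... | yes e = trans (+-cong (*-congˡ (resp a e)) (ev-remove a₀ p g resp))
      (solve 4 (λ c x s r → c :* x :+ (s :* x :+ r) := (c :* con (+ 1) :+ s) :* x :+ r) refl _ _ _ _)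
    ... | no _ = trans (+-congˡ (ev-remove a₀ p g resp))
      (solve 5 (λ c x s r y → c :* y :+ (s :* x :+ r) := (c :* con (+ 0) :+ s) :* x :+ (c :* y :+ r)) refl _ _ _ _ _)

module Vanishing (T : CRing) (φ : Hom 𝔽 T) {A X : Set} (_≟_ : DecidableEquality X) (key : A → X) where
  open Kit T
  open Evaluation T φ
  private
    module φ = HomProps φ
    module E = Evaluation 𝔽 idᴴ

    indicator-homo : ∀ p x → φ.⟦ E.ev p (E.indicator _≟_ key x) ⟧ ≈ ev p (indicator _≟_ key x)
    indicator-homo p x = trans (φ.Σ-homo p _) (Σ-cong p (λ t → trans (φ.*-homo _ _) (*-congˡ (if-homo (does (key (proj₁ t) ≟ x))))))
      where
      if-homo : ∀ b → φ.⟦ if b then Fᴷ.1# else Fᴷ.0# ⟧ ≈ (if b then 1# else 0#)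
      if-homo true = φ.1-homo
      if-homo false = φ.0-homo

    remove-class : ∀ x y p → ¬ y ≡ x → E.ev (E.remove _≟_ key x p) (E.indicator _≟_ key y) Fᴷ.≈ E.ev p (E.indicator _≟_ key y)
    remove-class x y [] y≢x = Fᴷ.refl
    remove-class x y ((a , c) ∷ p) y≢x with key a ≟ x
    ... | no _ = Fᴷ.+-congˡ (remove-class x y p y≢x)
    ... | yes e = Fᴷ.trans (remove-class x y p y≢x) (Fᴷ.sym (Fᴷ.trans (Fᴷ.+-congʳ (Fᴷ.trans (Fᴷ.*-congˡ (Fᴷ.reflexive
          (≡.cong (λ b → if b then Fᴷ.1# else Fᴷ.0#) (dec-false (key a ≟ y) (λ e′ → y≢x (≡.trans (≡.sym e′) e)))))) (Fᴷ.zeroʳ _))) (Fᴷ.+-identityˡ _)))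

    removed-class : ∀ x p → E.ev (E.remove _≟_ key x p) (E.indicator _≟_ key x) Fᴷ.≈ Fᴷ.0#
    removed-class x [] = Fᴷ.refl
    removed-class x ((a , c) ∷ p) with key a ≟ x in eq
    ... | yes _ = removed-class x p
    ... | no _ = Fᴷ.trans (Fᴷ.+-cong (Fᴷ.trans (Fᴷ.*-congˡ (Fᴷ.reflexive (≡.cong (λ d → if does d then Fᴷ.1# else Fᴷ.0#) eq))) (Fᴷ.zeroʳ _)) (removed-class x p)) (Fᴷ.+-identityˡ _)

    bounded : ∀ n p → length p ≤ n → (∀ b → E.ev p (E.indicator _≟_ key (key b)) Fᴷ.≈ Fᴷ.0#) →
              ∀ g → (∀ a b → key a ≡ key b → g a ≈ g b) → ev p g ≈ 0#
    bounded n [] l z g resp = refl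
    bounded (suc n) p@((a , c) ∷ p′) (s≤s l) z g resp = begin
      ev p g                                                                          ≈⟨ ev-remove _≟_ key a p g (λ b → resp b a) ⟩
      ev p (indicator _≟_ key (key a)) * g a + ev (remove _≟_ key (key a) p) g        ≈⟨ +-cong (*-congʳ (trans (sym (indicator-homo p (key a))) (trans (φ.⟦⟧-cong (z a)) φ.0-homo))) rest ⟩
      0# * g a + 0#                                                                   ≈⟨ solve 1 (λ x → con (+ 0) :* x :+ con (+ 0) := con (+ 0)) refl _ ⟩
      0# ∎
      where
      shorter : length (remove _≟_ key (key a) p) ≤ n
      shorter = ℕP.≤-trans (ℕP.≤-reflexive (≡.cong length (LP.filter-reject (λ t → ¬? (key (proj₁ t) ≟ key a)) {x = (a , c)} {xs = p′} (λ ¬e → ¬e ≡.refl))))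
        (ℕP.≤-trans (remove-length _≟_ key (key a) p′) l)
      classes : ∀ b → E.ev (remove _≟_ key (key a) p) (E.indicator _≟_ key (key b)) Fᴷ.≈ Fᴷ.0#
      classes b with key b ≟ key a
      ... | yes e = ≡.subst (λ x → E.ev (remove _≟_ key (key a) p) (E.indicator _≟_ key x) Fᴷ.≈ Fᴷ.0#) (≡.sym e) (removed-class (key a) p)
      ... | no y≢x = Fᴷ.trans (remove-class (key a) (key b) p y≢x) (z b)
      rest : ev (remove _≟_ key (key a) p) g ≈ 0#
      rest = bounded n (remove _≟_ key (key a) p) shorter classes g resp

  -- The terms with one key contribute their coefficient sum, which is zero, times the common value
  -- of g, and without them the list is shorter. The key is the identity for monomials and `sortℕ`
  -- for products of power sums, whose index lists matter only up to order.
  class-zero⇒ev-zero : ∀ p → (∀ b → E.ev p (E.indicator _≟_ key (key b)) Fᴷ.≈ Fᴷ.0#) →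
                       ∀ g → (∀ a b → key a ≡ key b → g a ≈ g b) → ev p g ≈ 0#
  class-zero⇒ev-zero p = bounded (length p) p ℕP.≤-refl

-- Polynomial rings

module _ {n : ℕ} where
  private
    module E = Evaluation 𝔽 idᴴ
    _≟_ : DecidableEquality (Mono n)
    _≟_ = VP.≡-dec ℕ._≟_
    id′ : Mono n → Mono n
    id′ e = e

  coeff-ev : ∀ (p : Poly n) e → toF (coeff p e) Fᴷ.≈ E.ev p (E.indicator _≟_ id′ e)
  coeff-ev [] e = toF-0
  coeff-ev ((e′ , c) ∷ p) e with VP.≡-dec ℕ._≟_ e′ e
  ... | yes _ = Fᴷ.trans (toF-+ c _) (Fᴷ.+-cong (Fᴷ.sym (Fᴷ.*-identityʳ _)) (coeff-ev p e))
  ... | no _ = Fᴷ.trans (coeff-ev p e) (Fᴷ.sym (Fᴷ.trans (Fᴷ.+-congʳ (Fᴷ.zeroʳ _)) (Fᴷ.+-identityˡ _)))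

  ev⇒≈P : ∀ p q → (∀ (g : Mono n → Fᴷ.Carrier) → E.ev p g Fᴷ.≈ E.ev q g) → p ≈P q
  ev⇒≈P p q h e = toF-injective (Fᴷ.trans (coeff-ev p e) (Fᴷ.trans (h _) (Fᴷ.sym (coeff-ev q e))))

  -- Equality of all coefficients says that every class of the difference vanishes; this passes to
  -- functionals with values in any 𝔽-algebra.
  ≈P⇒ev : ∀ (T : CRing) (φ : Hom 𝔽 T) (let open Kit T) (p q : Poly n) → p ≈P q → ∀ (g : Mono n → Carrier) →
          Evaluation.ev T φ p g ≈ Evaluation.ev T φ q g
  ≈P⇒ev T φ p q h g = begin
    ev p g                                    ≈⟨ solve 2 (λ a b → a := (a :+ (:- con (+ 1)) :* b) :+ b) refl (ev p g) (ev q g) ⟩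
    ev p g + - 1# * ev q g + ev q g           ≈⟨ +-congʳ (trans (+-congˡ (sym (trans (ev-scale (-F 1F) q g) (*-congʳ (trans (scalar-neg 1F) (-‿cong scalar-1))))))
                                                  (trans (sym (Σ-++ p (negP q) _)) (Vanishing.class-zero⇒ev-zero T φ _≟_ id′ (p ++ negP q) classes g (λ a b e → reflexive (≡.cong g e))))) ⟩
    0# + ev q g                               ≈⟨ +-identityˡ _ ⟩
    ev q g ∎
    where
    open Kit T
    open Evaluation T φ
    classes : ∀ x → E.ev (p ++ negP q) (E.indicator _≟_ id′ x) Fᴷ.≈ Fᴷ.0#
    classes x = Fᴷ.trans (Fᴷ.Σ-++ p (negP q) _) (Fᴷ.trans (Fᴷ.+-cong
      (Fᴷ.trans (Fᴷ.sym (coeff-ev p x)) (Fᴷ.trans (toF-cong (h x)) (coeff-ev q x)))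
      (Fᴷ.trans (E.ev-scale (-F 1F) q _) (Fᴷ.*-congʳ (Fᴷ.trans (toF-neg 1F) (Fᴷ.-‿cong toF-1)))))
      (Fᴷ.solve 1 (λ a → a Fᴷ.:+ (Fᴷ.:- Fᴷ.con (+ 1)) Fᴷ.:* a Fᴷ.:= Fᴷ.con (+ 0)) Fᴷ.refl _))

module PolynomialRing (n : ℕ) where
  private
    module E = Evaluation 𝔽 idᴴ

    _⊕_ : Mono n → Mono n → Mono n
    _⊕_ = V.zipWith ℕ._+_

    ev≈ : ∀ {p q : Poly n} → p ≈P q → ∀ g → E.ev p g Fᴷ.≈ E.ev q g
    ev≈ {p} {q} = ≈P⇒ev 𝔽 idᴴ p q

    ev-* : ∀ (p q : Poly n) g → E.ev (p *P q) g Fᴷ.≈ E.ev p (λ a → E.ev q (λ b → g (a ⊕ b)))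
    ev-* p q g = E.ev-mul _⊕_ p q g

    ev-neg : ∀ (p : Poly n) g → E.ev (negP p) g Fᴷ.≈ Fᴷ.- E.ev p g
    ev-neg p g = Fᴷ.trans (E.ev-scale (-F 1F) p g) (Fᴷ.trans (Fᴷ.*-congʳ (Fᴷ.trans (toF-neg 1F) (Fᴷ.-‿cong toF-1)))
      (Fᴷ.solve 1 (λ a → (Fᴷ.:- Fᴷ.con (+ 1)) Fᴷ.:* a Fᴷ.:= Fᴷ.:- a) Fᴷ.refl _))

    ev-+ : ∀ (p q : Poly n) g → E.ev (p +P q) g Fᴷ.≈ E.ev p g Fᴷ.+ E.ev q g
    ev-+ p q g = Fᴷ.Σ-++ p q _

    ev-one : ∀ g → E.ev (constP {n} 1F) g Fᴷ.≈ g (V.replicate n 0)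
    ev-one g = Fᴷ.trans (Fᴷ.+-identityʳ _) (Fᴷ.trans (Fᴷ.*-congʳ toF-1) (Fᴷ.*-identityˡ _))

    laws : RingLaws (Poly n) _≈P_ _+P_ _*P_ negP 0P (constP 1F)
    laws = record
      { isEquivalence = record
        { refl = λ {p} → ev⇒≈P p p (λ _ → Fᴷ.refl)
        ; sym = λ {p} {q} e → ev⇒≈P q p (λ g → Fᴷ.sym (ev≈ {p} {q} e g))
        ; trans = λ {p} {q} {r} e f → ev⇒≈P p r (λ g → Fᴷ.trans (ev≈ {p} {q} e g) (ev≈ {q} {r} f g)) }
      ; +-cong = λ {a} {b} {c} {d} e f → ev⇒≈P (a +P c) (b +P d) (λ g → Fᴷ.trans (ev-+ a c g) (Fᴷ.trans (Fᴷ.+-cong (ev≈ {a} {b} e g) (ev≈ {c} {d} f g)) (Fᴷ.sym (ev-+ b d g))))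
      ; +-assoc = λ a b c → ev⇒≈P ((a +P b) +P c) (a +P (b +P c)) (λ g → Fᴷ.trans (ev-+ (a +P b) c g) (Fᴷ.trans (Fᴷ.+-congʳ (ev-+ a b g))
          (Fᴷ.trans (Fᴷ.+-assoc _ _ _) (Fᴷ.sym (Fᴷ.trans (ev-+ a (b +P c) g) (Fᴷ.+-congˡ (ev-+ b c g)))))))
      ; +-comm = λ a b → ev⇒≈P (a +P b) (b +P a) (λ g → Fᴷ.trans (ev-+ a b g) (Fᴷ.trans (Fᴷ.+-comm _ _) (Fᴷ.sym (ev-+ b a g))))
      ; +-identityˡ = λ a → ev⇒≈P a a (λ _ → Fᴷ.refl)
      ; neg-cong = λ {a} {b} e → ev⇒≈P (negP a) (negP b) (λ g → Fᴷ.trans (ev-neg a g) (Fᴷ.trans (Fᴷ.-‿cong (ev≈ {a} {b} e g)) (Fᴷ.sym (ev-neg b g))))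
      ; neg-inverseˡ = λ a → ev⇒≈P (negP a +P a) 0P (λ g → Fᴷ.trans (ev-+ (negP a) a g) (Fᴷ.trans (Fᴷ.+-congʳ (ev-neg a g)) (Fᴷ.-‿inverseˡ _)))
      ; *-cong = λ {a} {b} {c} {d} e f → ev⇒≈P (a *P c) (b *P d) (λ g → Fᴷ.trans (ev-* a c g) (Fᴷ.trans (ev≈ {a} {b} e _)
          (Fᴷ.trans (E.ev-cong b (λ x → ev≈ {c} {d} f _)) (Fᴷ.sym (ev-* b d g)))))
      ; *-assoc = λ a b c → ev⇒≈P ((a *P b) *P c) (a *P (b *P c)) (λ g → Fᴷ.trans (ev-* (a *P b) c g) (Fᴷ.trans (ev-* a b _) (Fᴷ.sym
          (Fᴷ.trans (ev-* a (b *P c) g) (E.ev-cong a (λ x → Fᴷ.trans (ev-* b c _)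
            (E.ev-cong b (λ y → E.ev-cong c (λ z → Fᴷ.reflexive (≡.cong g (≡.sym (VP.zipWith-assoc ℕP.+-assoc x y z))))))))))))
      ; *-comm = λ a b → ev⇒≈P (a *P b) (b *P a) (λ g → Fᴷ.trans (ev-* a b g) (Fᴷ.trans (E.ev-swap a b _) (Fᴷ.sym (Fᴷ.trans (ev-* b a g)
          (E.ev-cong b (λ x → E.ev-cong a (λ y → Fᴷ.reflexive (≡.cong g (VP.zipWith-comm ℕP.+-comm x y)))))))))
      ; *-identityˡ = λ a → ev⇒≈P (constP 1F *P a) a (λ g → Fᴷ.trans (ev-* (constP 1F) a g) (Fᴷ.trans (ev-one (λ x → E.ev a (λ y → g (x ⊕ y))))
          (E.ev-cong a (λ y → Fᴷ.reflexive (≡.cong g (VP.zipWith-identityˡ ℕP.+-identityˡ y))))))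
      ; distribʳ = λ a b c → ev⇒≈P ((b +P c) *P a) ((b *P a) +P (c *P a)) (λ g → Fᴷ.trans (ev-* (b +P c) a g) (Fᴷ.trans (ev-+ b c _)
          (Fᴷ.sym (Fᴷ.trans (ev-+ (b *P a) (c *P a) g) (Fᴷ.+-cong (ev-* b a g) (ev-* c a g))))))
      }

  abstract
    Polynomials : CRing
    Polynomials = RingLaws.commutativeRing laws

  private
    module K = CommutativeRing Polynomials

  abstract
    toP : Poly n → K.Carrier
    toP p = p

    toP-cong : ∀ {p q} → p ≈P q → toP p K.≈ toP q
    toP-cong e = e

    toP-injective : ∀ {p q} → toP p K.≈ toP q → p ≈P q
    toP-injective e = e

    toP-surjective : ∀ a → ∃ λ p → toP p K.≈ a
    toP-surjective a = a , K.refl {a}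

    toP-+ : ∀ p q → toP (p +P q) K.≈ toP p K.+ toP q
    toP-+ p q = K.refl {p +P q}

    toP-* : ∀ p q → toP (p *P q) K.≈ toP p K.* toP q
    toP-* p q = K.refl {p *P q}

    toP-neg : ∀ p → toP (negP p) K.≈ K.- toP p
    toP-neg p = K.refl {negP p}

    toP-0 : toP 0P K.≈ K.0#
    toP-0 = K.refl {0P}

    toP-1 : toP (constP 1F) K.≈ K.1#
    toP-1 = K.refl {constP 1F}

    const : Hom 𝔽 Polynomials
    const = record
      { ⟦_⟧ = λ a → constP (fromF a)
      ; ⟦⟧-cong = λ {a} {b} e → ev⇒≈P (constP (fromF a)) (constP (fromF b)) (λ g → Fᴷ.+-congʳ (Fᴷ.*-congʳ (cong′ e)))
      ; +-homo = λ a b → ev⇒≈P (constP (fromF (a Fᴷ.+ b))) (constP (fromF a) +P constP (fromF b)) (λ g → Fᴷ.trans (Fᴷ.+-congʳ (Fᴷ.*-congʳ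
          (Fᴷ.trans (toF-fromF _) (Fᴷ.+-cong (Fᴷ.sym (toF-fromF a)) (Fᴷ.sym (toF-fromF b))))))
          (Fᴷ.solve 3 (λ a b x → (a Fᴷ.:+ b) Fᴷ.:* x Fᴷ.:+ Fᴷ.con (+ 0) Fᴷ.:= a Fᴷ.:* x Fᴷ.:+ (b Fᴷ.:* x Fᴷ.:+ Fᴷ.con (+ 0))) Fᴷ.refl _ _ _))
      ; *-homo = λ a b → ev⇒≈P (constP (fromF (a Fᴷ.* b))) (constP (fromF a) *P constP (fromF b)) (λ g → Fᴷ.trans
          (Fᴷ.+-congʳ (Fᴷ.*-cong (Fᴷ.trans (toF-fromF _) (Fᴷ.*-cong (Fᴷ.sym (toF-fromF a)) (Fᴷ.sym (toF-fromF b))))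
             (Fᴷ.reflexive (≡.cong g (≡.sym (VP.zipWith-identityˡ ℕP.+-identityˡ (V.replicate n 0)))))))
          (Fᴷ.trans (Fᴷ.solve 3 (λ a b x → a Fᴷ.:* b Fᴷ.:* x Fᴷ.:+ Fᴷ.con (+ 0) Fᴷ.:= a Fᴷ.:* (b Fᴷ.:* x Fᴷ.:+ Fᴷ.con (+ 0)) Fᴷ.:+ Fᴷ.con (+ 0)) Fᴷ.refl _ _ _)
            (Fᴷ.sym (ev-* (constP (fromF a)) (constP (fromF b)) g))))
      ; 1-homo = ev⇒≈P (constP (fromF Fᴷ.1#)) (constP 1F) (λ g → Fᴷ.+-congʳ (Fᴷ.*-congʳ (Fᴷ.trans (toF-fromF _) (Fᴷ.sym toF-1)))) }
      where
      cong′ : ∀ {a b} → a Fᴷ.≈ b → toF (fromF a) Fᴷ.≈ toF (fromF b)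
      cong′ e = Fᴷ.trans (toF-fromF _) (Fᴷ.trans e (Fᴷ.sym (toF-fromF _)))

    toP-const : ∀ c → toP (constP c) K.≈ Hom.⟦_⟧ const (toF c)
    toP-const c = ev⇒≈P (constP c) (constP (fromF (toF c))) (λ g → Fᴷ.+-congʳ (Fᴷ.*-congʳ (Fᴷ.sym (toF-fromF (toF c)))))

    evalHom : ∀ (T : CRing) (φ : Hom 𝔽 T) (let open Kit T) (μ : Mono n → Carrier) → (∀ a b → μ (V.zipWith ℕ._+_ a b) ≈ μ a * μ b) →
              μ (V.replicate n 0) ≈ 1# → Hom Polynomials T
    evalHom T φ μ μ-⊕ μ-0 = record
      { ⟦_⟧ = λ p → ev p μ
      ; ⟦⟧-cong = λ {p} {q} e → ≈P⇒ev T φ p q e μ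
      ; +-homo = λ p q → Σ-++ p q _
      ; *-homo = λ p q → trans (ev-mul _⊕_ p q μ) (trans (ev-cong p (λ a → trans (ev-cong q (μ-⊕ a)) (ev-*ˡ q (μ a) μ)))
          (trans (ev-cong p (λ a → *-comm _ _)) (trans (ev-*ˡ p (ev q μ) μ) (*-comm _ _))))
      ; 1-homo = trans (+-identityʳ _) (trans (*-cong scalar-1 μ-0) (*-identityˡ _)) }
      where
      open Kit T
      open Evaluation T φ

    evalHom-toP : ∀ (T : CRing) (φ : Hom 𝔽 T) (let open Kit T) μ m⊕ m0 p →
                  Hom.⟦_⟧ (evalHom T φ μ m⊕ m0) (toP p) ≈ Evaluation.ev T φ p μ
    evalHom-toP T φ μ m⊕ m0 p = Kit.refl T

  open Evaluation Polynomials const public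

  mono : Mono n → K.Carrier
  mono e = toP ((e , 1F) ∷ [])

  mono-⊕ : ∀ a b → mono (V.zipWith ℕ._+_ a b) K.≈ mono a K.* mono b
  mono-⊕ a b = K.trans (toP-cong {p} {q} (ev⇒≈P p q (λ g → Fᴷ.trans (Fᴷ.+-congʳ (Fᴷ.*-congʳ toF-1)) (Fᴷ.trans
      (Fᴷ.solve 1 (λ x → Fᴷ.con (+ 1) Fᴷ.:* x Fᴷ.:+ Fᴷ.con (+ 0) Fᴷ.:= Fᴷ.con (+ 1) Fᴷ.:* (Fᴷ.con (+ 1) Fᴷ.:* x Fᴷ.:+ Fᴷ.con (+ 0)) Fᴷ.:+ Fᴷ.con (+ 0)) Fᴷ.refl _)
      (Fᴷ.trans (Fᴷ.+-congʳ (Fᴷ.*-cong (Fᴷ.sym toF-1) (Fᴷ.+-congʳ (Fᴷ.*-congʳ (Fᴷ.sym toF-1))))) (Fᴷ.sym (ev-* ((a , 1F) ∷ []) ((b , 1F) ∷ []) g))))))) (toP-* ((a , 1F) ∷ []) ((b , 1F) ∷ []))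
    where
    p q : Poly n
    p = (V.zipWith ℕ._+_ a b , 1F) ∷ []
    q = ((a , 1F) ∷ []) *P ((b , 1F) ∷ [])

  mono-0 : mono (V.replicate n 0) K.≈ K.1#
  mono-0 = toP-1

  toP-term : ∀ e c → toP ((e , c) ∷ []) K.≈ scalar c K.* mono e
  toP-term e c = K.trans (toP-cong {(e , c) ∷ []} {constP c *P ((e , 1F) ∷ [])} (ev⇒≈P ((e , c) ∷ []) (constP c *P ((e , 1F) ∷ [])) (λ g → Fᴷ.trans
      (Fᴷ.trans (Fᴷ.+-congʳ (Fᴷ.*-congˡ (Fᴷ.reflexive (≡.cong g (≡.sym (VP.zipWith-identityˡ ℕP.+-identityˡ e))))))
        (Fᴷ.trans (Fᴷ.solve 2 (λ c x → c Fᴷ.:* x Fᴷ.:+ Fᴷ.con (+ 0) Fᴷ.:= c Fᴷ.:* (Fᴷ.con (+ 1) Fᴷ.:* x Fᴷ.:+ Fᴷ.con (+ 0)) Fᴷ.:+ Fᴷ.con (+ 0)) Fᴷ.refl _ _)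
          (Fᴷ.+-congʳ (Fᴷ.*-congˡ (Fᴷ.+-congʳ (Fᴷ.*-congʳ (Fᴷ.sym toF-1)))))))
      (Fᴷ.sym (ev-* (constP c) ((e , 1F) ∷ []) g)))))
    (K.trans (toP-* (constP c) ((e , 1F) ∷ [])) (K.*-congʳ (toP-const c)))

  toP-ev : ∀ p → toP p K.≈ ev p mono
  toP-ev [] = toP-0
  toP-ev ((e , c) ∷ p) = K.trans (toP-+ ((e , c) ∷ []) p) (K.+-cong (toP-term e c) (toP-ev p))

module AugmentedHom {R T : CRing} (φ : Hom R T) where
  private
    module R where
      open Kit R public
      open Augmented R public
    module φ = HomProps φ
  open Kit T
  open Augmented T
  open φ using (⟦_⟧)

  bump-homo : ∀ r γ f → ⟦ R.bumpSum r γ f ⟧ ≈ bumpSum r γ (λ γ′ → ⟦ f γ′ ⟧)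
  bump-homo r [] f = φ.0-homo
  bump-homo r (g ∷ γ) f = trans (φ.+-homo _ _) (+-congˡ (bump-homo r γ _))

  augmented-homo : ∀ d γ → ⟦ R.augmented d γ ⟧ ≈ augmented (λ n → ⟦ d n ⟧) γ
  augmented-homo d γ = go (length γ) γ ≡.refl
    where
    go : ∀ n γ → length γ ≡ n → ⟦ R.augmented d γ ⟧ ≈ augmented (λ n → ⟦ d n ⟧) γ
    go n [] e = φ.1-homo
    go (suc n) (r ∷ γ) e = begin
      ⟦ R.augmented d (r ∷ γ) ⟧
        ≈⟨ φ.⟦⟧-cong (R.augmented-∷ d r γ) ⟩
      ⟦ d r R.* R.augmented d γ R.+ R.- R.bumpSum r γ (R.augmented d) ⟧
        ≈⟨ trans (φ.+-homo _ _) (+-cong (trans (φ.*-homo _ _) (*-congˡ (go n γ (ℕP.suc-injective e))))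
             (trans (φ.neg-homo _) (-‿cong (trans (bump-homo r γ _) (bump-cong r γ (λ γ′ l → go n γ′ (≡.trans l (ℕP.suc-injective e)))))))) ⟩
      ⟦ d r ⟧ * augmented (λ n → ⟦ d n ⟧) γ + - bumpSum r γ (augmented (λ n → ⟦ d n ⟧))
        ≈⟨ sym (augmented-∷ (λ n → ⟦ d n ⟧) r γ) ⟩
      augmented (λ n → ⟦ d n ⟧) (r ∷ γ) ∎

  powers-homo : ∀ B z G → ⟦ R.powers B z G ⟧ ≈ powers B ⟦ z ⟧ (λ n → ⟦ G n ⟧)
  powers-homo zero z G = φ.0-homo
  powers-homo (suc B) z G = trans (φ.*-homo _ _) (*-congˡ (trans (φ.+-homo _ _) (+-congˡ (powers-homo B z _))))

  expSum-homo : ∀ {A : Set} (x : A → R.Carrier) B K f → ⟦ R.expSum x B K f ⟧ ≈ expSum (λ j → ⟦ x j ⟧) B K (λ γ → ⟦ f γ ⟧)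
  expSum-homo x B [] f = refl
  expSum-homo x B (j ∷ K) f = trans (powers-homo B (x j) _) (powers-cong B ⟦ x j ⟧ (λ n → expSum-homo x B K _))

-- Differences of variables are only non-zero-divisors; they become units in the total ring of fractions.
module RegularVariables (R : CRing) (N : ℕ) (u : CommutativeRing.Carrier R) (x : Fin N → CommutativeRing.Carrier R)
  (d : ℕ → CommutativeRing.Carrier R) (B : ℕ) where
  open Kit R
  open Determinant R
  open RisingFactorial R
  open Rows R
  open Augmented R
  open TotalFractions R
  private
    module T where
      open Kit Frac public
      open Determinant Frac public
      open RisingFactorial Frac public
      open Rows Frac public
      open Augmented Frac public
    module φ = HomProps toFrac
    module A = AugmentedHom toFrac
    open φ using (⟦_⟧)

  expansionSum : Carrier
  expansionSum = S2 (allFin N) (λ K Z → rise u (length K) (length Z) * (sgn (length K) * expSum x B K (augmented d)))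

  det-regular : (∀ γ → B < sum γ → augmented d γ ≈ 0#) → (∀ l j → ¬ l ≡ j → NonZeroDivisor R (x l + - x j)) →
    det N (map (λ j → freeRow N u (x j) (powers B (x j) d)) (allFin N)) ≈ vandermonde (map x (allFin N)) * expansionSum
  det-regular van regular = toFrac-injective
    (T.trans (φ.det-homo N (map (λ j → freeRow N u (x j) (powers B (x j) d)) J)) (T.trans (T.det-cong N (rows J))
    (T.trans (T.Expansion.det-expansion ⟦ u ⟧ (λ j → ⟦ x j ⟧) rc d′ B van′ N J (≡.sym (LP.length-tabulate (λ i → i))) units)
    (T.trans (T.*-cong (T.trans (T.reflexive (≡.cong T.vandermonde (LP.map-∘ J))) (T.sym (φ.vandermonde-homo (map x J)))) (T.sym expansion-homo))
             (T.sym (φ.*-homo _ _))))))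
    where
    J : List (Fin N)
    J = allFin N
    d′ : ℕ → T.Carrier
    d′ n = ⟦ d n ⟧
    expansion-homo : ⟦ expansionSum ⟧ T.≈ T.S2 J (λ K Z → T.rise ⟦ u ⟧ (length K) (length Z) T.* (T.sgn (length K) T.* T.expSum (λ j → ⟦ x j ⟧) B K (T.augmented d′)))
    expansion-homo = T.trans (φ.S2-homo J _) (T.S2-cong J (λ K Z → T.trans (φ.*-homo _ _) (T.*-cong (φ.rise-homo u (length K) (length Z))
      (T.trans (φ.*-homo _ _) (T.*-cong (φ.sgn-homo (length K)) (T.trans (A.expSum-homo x B K _)
        (T.expSum-cong _ B K (λ γ _ → A.augmented-homo d γ))))))))
    van′ : ∀ γ → B < sum γ → T.augmented d′ γ T.≈ T.0#
    van′ γ p = T.trans (T.sym (A.augmented-homo d γ)) (T.trans (φ.⟦⟧-cong (van γ p)) φ.0-homo)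
    -- The diagonal value `T.0#` is a default; the reciprocals proper are those with l ≠ j.
    rc : Fin N → Fin N → T.Carrier
    rc l j with l Fin.≟ j
    ... | yes _ = T.0#
    ... | no l≢j = reciprocal (x l + - x j) (regular l j l≢j)
    rc-unit : ∀ l j → ¬ l ≡ j → rc l j T.* (⟦ x l ⟧ T.+ T.- ⟦ x j ⟧) T.≈ T.1#
    rc-unit l j l≢j with l Fin.≟ j
    ... | yes e = ⊥-elim (l≢j e)
    ... | no l≢j′ = T.trans (T.*-congˡ (T.trans (T.+-congˡ (T.sym (φ.neg-homo _))) (T.sym (φ.+-homo _ _)))) (reciprocal-* _ _)
    units : AllPairs (λ l j → rc l j T.* (⟦ x l ⟧ T.+ T.- ⟦ x j ⟧) T.≈ T.1#) J
    units = AllPairs.map (λ {l} {j} → rc-unit l j) (UniqueP.allFin⁺ N)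
    rows : ∀ L → φ.mapRows (map (λ j → freeRow N u (x j) (powers B (x j) d)) L) T.≋ map (λ j → T.freeRow N ⟦ u ⟧ ⟦ x j ⟧ (T.powers B ⟦ x j ⟧ d′)) L
    rows [] = T.[]
    rows (j ∷ L) = (λ s → T.trans (φ.*-homo _ _) (T.*-cong (φ.^-homo (x j) (N ∸ s))
      (T.trans (φ.+-homo _ _) (T.+-cong (T.trans (φ.+-homo _ _) (T.+-cong (T.trans (φ.+-homo _ _) (T.+-congˡ (φ.ι-homo (N ∸ 1))))
        (T.trans (φ.neg-homo _) (T.-‿cong (φ.ι-homo (N ∸ s)))))) (T.trans (φ.neg-homo _) (T.-‿cong (A.powers-homo B (x j) d))))))) T.∷ rows L

-- R[ε₁,…,εₗ] with εᵢ² = 0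

Tower : CRing → ℕ → CRing
Tower R zero = R
Tower R (suc n) = Dual (Tower R n)

towerEmbed : ∀ R n → Hom R (Tower R n)
towerEmbed R zero = idᴴ
towerEmbed R (suc n) = DualNumbers.embed (Tower R n) ∘ᴴ towerEmbed R n

module DualFacts (R : CRing) where
  open Kit R
  open DualNumbers R hiding (Dual)
  private
    module D = Kit (Dual R)
    module E = HomProps embed
    module Re = HomProps real

  embed-nzd : ∀ v → NonZeroDivisor R v → NonZeroDivisor (Dual R) E.⟦ v ⟧
  embed-nzd v n a e = dual-ext
    (trans (n _ (trans (*-congʳ (sym (re-emb v))) (trans (sym (Re.*-homo _ _)) (trans (Re.⟦⟧-cong e) Re.0-homo)))) (sym Re.0-homo))
    (trans (n _ (begin
      v * εpart a                                       ≈⟨ *-congʳ (sym (re-emb v)) ⟩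
      Re.⟦ E.⟦ v ⟧ ⟧ * εpart a                          ≈⟨ sym (trans (+-congˡ (trans (*-congʳ (εpart-emb v)) (zeroˡ _))) (+-identityʳ _)) ⟩
      Re.⟦ E.⟦ v ⟧ ⟧ * εpart a + εpart E.⟦ v ⟧ * Re.⟦ a ⟧  ≈⟨ sym (εpart-* _ _) ⟩
      εpart (E.⟦ v ⟧ D.* a)                             ≈⟨ trans (εpart-cong e) εpart-0 ⟩
      0# ∎)) (sym εpart-0))

tower-nzd : ∀ R n v → NonZeroDivisor R v → NonZeroDivisor (Tower R n) (Hom.⟦_⟧ (towerEmbed R n) v)
tower-nzd R zero v n = n
tower-nzd R (suc m) v n = DualFacts.embed-nzd (Tower R m) _ (tower-nzd R m v n)

module Towers (R : CRing) (α : CommutativeRing.Carrier R) where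
  open Kit R
  private
    module T (n : ℕ) = Kit (Tower R n)
    module D (n : ℕ) = DualNumbers (Tower R n)
    module Re (n : ℕ) = HomProps (DualNumbers.real (Tower R n))
    module E (n : ℕ) = HomProps (DualNumbers.embed (Tower R n))
    module H (n : ℕ) = HomProps (towerEmbed R n)

  C : List ℕ → Set
  C la = T.Carrier (length la)

  emb : ∀ la → Carrier → C la
  emb la = H.⟦_⟧ (length la)

  -- dₙ acts on p_la as α n ∂/∂pₙ; the index r of la stands for p_{r+1}.
  dvals : ∀ la → ℕ → C la
  dvals [] n = 0#
  dvals (r ∷ la) n = D.pair (length la) (dvals la n) (emb la (if does (suc r ℕ.≟ n) then α * ι (suc r) else 0#))

  module _ (p : ℕ → Carrier) where

    -- the coefficient of ε₁⋯εₗ in ∏ₐ (1 + εₐ p_{rₐ+1}) X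
    evTop : ∀ la → C la → Carrier
    evTop [] X = X
    evTop (r ∷ la) X = evTop la (T._+_ l (T._*_ l (emb la (p (suc r))) (Re.⟦_⟧ l X)) (D.εpart l X))
      where l = length la

    evTop-cong : ∀ la {X Y} → T._≈_ (length la) X Y → evTop la X ≈ evTop la Y
    evTop-cong [] e = e
    evTop-cong (r ∷ la) e = evTop-cong la (T.+-cong l (T.*-congˡ l (Re.⟦⟧-cong l e)) (D.εpart-cong l e))
      where l = length la

    evTop-+ : ∀ la X Y → evTop la (T._+_ (length la) X Y) ≈ evTop la X + evTop la Y
    evTop-+ [] X Y = refl
    evTop-+ (r ∷ la) X Y = trans (evTop-cong la (T.trans l (T.+-cong l (T.*-congˡ l (Re.+-homo l X Y)) (D.εpart-+ l X Y)) (shuffle _ _ _ _ _))) (evTop-+ la _ _)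
      where
      l = length la
      shuffle : ∀ c a b v w → T._≈_ l (T._+_ l (T._*_ l c (T._+_ l a b)) (T._+_ l v w)) (T._+_ l (T._+_ l (T._*_ l c a) v) (T._+_ l (T._*_ l c b) w))
      shuffle = solve′ 5 (λ c a b v w → c :*′ (a :+′ b) :+′ (v :+′ w) :=′ c :*′ a :+′ v :+′ (c :*′ b :+′ w)) (T.refl l)
        where open T l using () renaming (solve to solve′; _:=_ to _:=′_; _:+_ to _:+′_; _:*_ to _:*′_)

    evTop-scale : ∀ la c X → evTop la (T._*_ (length la) (emb la c) X) ≈ c * evTop la X
    evTop-scale [] c X = refl
    evTop-scale (r ∷ la) c X = trans (evTop-cong la (T.trans l
        (T.+-cong l (T.*-congˡ l (T.trans l (Re.*-homo l _ _) (T.*-congʳ l (D.re-emb l _))))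
          (T.trans l (D.εpart-* l _ _) (T.+-cong l (T.*-congʳ l (D.re-emb l _)) (T.*-congʳ l (D.εpart-emb l _))))) (shuffle _ _ _ _))) (evTop-scale la c _)
      where
      l = length la
      shuffle : ∀ c q a v → T._≈_ l (T._+_ l (T._*_ l q (T._*_ l c a)) (T._+_ l (T._*_ l c v) (T._*_ l (T.0# l) a))) (T._*_ l c (T._+_ l (T._*_ l q a) v))
      shuffle = solve′ 4 (λ c q a v → q :*′ (c :*′ a) :+′ (c :*′ v :+′ con′ (+ 0) :*′ a) :=′ c :*′ (q :*′ a :+′ v)) (T.refl l)
        where open T l using () renaming (solve to solve′; _:=_ to _:=′_; _:+_ to _:+′_; _:*_ to _:*′_; con to con′)

    evTop-0 : ∀ la → evTop la (T.0# (length la)) ≈ 0#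
    evTop-0 la = trans (evTop-cong la (T.sym (length la) (T.trans (length la) (T.*-congʳ (length la) (H.0-homo (length la))) (T.zeroˡ (length la) _)))) (trans (evTop-scale la 0# (T.0# (length la))) (zeroˡ _))

    evTop-Σ : ∀ {A : Set} la (L : List A) f → evTop la (T.Σ (length la) L f) ≈ Σ L (λ a → evTop la (f a))
    evTop-Σ la [] f = evTop-0 la
    evTop-Σ la (a ∷ L) f = trans (evTop-+ la _ _) (+-congˡ (evTop-Σ la L f))

  -- Filt la n X: X only involves products of ε's of total degree at least n.
  Filt : ∀ la → ℕ → C la → Set
  Filt [] zero X = ⊤
  Filt [] (suc n) X = X ≈ 0#
  Filt (r ∷ la) n X = Filt la n (Re.⟦_⟧ l X) × Filt la (n ∸ suc r) (D.εpart l X)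
    where l = length la

  filt-cong : ∀ la n {X Y} → T._≈_ (length la) X Y → Filt la n X → Filt la n Y
  filt-cong [] zero e f = tt
  filt-cong [] (suc n) e f = trans (sym e) f
  filt-cong (r ∷ la) n e (f , g) = filt-cong la n (Re.⟦⟧-cong (length la) e) f , filt-cong la _ (D.εpart-cong (length la) e) g

  filt-≤ : ∀ la {m n} X → m ≤ n → Filt la n X → Filt la m X
  filt-≤ [] {zero} X p f = tt
  filt-≤ [] {suc m} {suc n} X p f = f
  filt-≤ (r ∷ la) X p (f , g) = filt-≤ la _ p f , filt-≤ la _ (ℕP.∸-monoˡ-≤ (suc r) p) g

  filt-zero : ∀ la n → Filt la n (T.0# (length la))
  filt-zero [] zero = tt
  filt-zero [] (suc n) = refl
  filt-zero (r ∷ la) n = filt-cong la n (T.sym l (Re.0-homo l)) (filt-zero la n) , filt-cong la _ (T.sym l (D.εpart-0 l)) (filt-zero la _)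
    where l = length la

  filt-0 : ∀ la X → Filt la 0 X
  filt-0 [] X = tt
  filt-0 (r ∷ la) X = filt-0 la _ , filt-0 la _

  filt-+ : ∀ la n X Y → Filt la n X → Filt la n Y → Filt la n (T._+_ (length la) X Y)
  filt-+ [] zero X Y f g = tt
  filt-+ [] (suc n) X Y f g = trans (+-cong f g) (+-identityˡ _)
  filt-+ (r ∷ la) n X Y (f , f′) (g , g′) = filt-cong la n (T.sym l (Re.+-homo l X Y)) (filt-+ la n _ _ f g) ,
    filt-cong la _ (T.sym l (D.εpart-+ l X Y)) (filt-+ la _ _ _ f′ g′)
    where l = length la

  filt-neg : ∀ la n X → Filt la n X → Filt la n (T.-_ (length la) X)
  filt-neg [] zero X f = tt
  filt-neg [] (suc n) X f = trans (-‿cong f) -0#≈0#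
  filt-neg (r ∷ la) n X (f , f′) = filt-cong la n (T.sym l (Re.neg-homo l X)) (filt-neg la n _ f) ,
    filt-cong la _ (T.sym l (D.εpart-neg l X)) (filt-neg la _ _ f′)
    where l = length la

  -- In the product rule for the ε-part each summand lies deep enough, as (m + n) ∸ d ≤ m + (n ∸ d)
  -- also for truncated subtraction.
  filt-* : ∀ la m n X Y → Filt la m X → Filt la n Y → Filt la (m ℕ.+ n) (T._*_ (length la) X Y)
  filt-* [] zero zero X Y f g = tt
  filt-* [] zero (suc n) X Y f g = trans (*-congˡ g) (zeroʳ _)
  filt-* [] (suc m) n X Y f g = trans (*-congʳ f) (zeroˡ _)
  filt-* (r ∷ la) m n X Y (f , f′) (g , g′) = filt-cong la _ (T.sym l (Re.*-homo l X Y)) (filt-* la m n _ _ f g) ,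
    filt-cong la _ (T.sym l (D.εpart-* l X Y)) (filt-+ la _ _ _
      (filt-≤ la _ (∸-+ m n) (filt-* la m (n ∸ suc r) _ _ f g′))
      (filt-≤ la _ (ℕP.≤-trans (ℕP.≤-reflexive (≡.cong (_∸ suc r) (ℕP.+-comm m n))) (ℕP.≤-trans (∸-+ n m) (ℕP.≤-reflexive (ℕP.+-comm n (m ∸ suc r)))))
        (filt-* la (m ∸ suc r) n _ _ f′ g)))
    where
    l = length la
    ∸-+ : ∀ a b → (a ℕ.+ b) ∸ suc r ≤ a ℕ.+ (b ∸ suc r)
    ∸-+ a b = ℕP.m≤n+o⇒m∸n≤o (a ℕ.+ b) (suc r) (ℕP.≤-trans (ℕP.+-monoʳ-≤ a (ℕP.m≤n+m∸n b (suc r)))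
      (ℕP.≤-reflexive (≡.trans (≡.sym (ℕP.+-assoc a (suc r) _)) (≡.trans (≡.cong (ℕ._+ (b ∸ suc r)) (ℕP.+-comm a (suc r))) (ℕP.+-assoc (suc r) a _)))))

  filt-dvals : ∀ la n → Filt la n (dvals la n)
  filt-dvals [] zero = tt
  filt-dvals [] (suc n) = refl
  filt-dvals (r ∷ la) n = filt-cong la n (T.sym l (D.re-pair l _ _)) (filt-dvals la n) ,
    filt-cong la _ (T.sym l (D.εpart-pair l _ _)) second
    where
    l = length la
    second : Filt la (n ∸ suc r) (emb la (if does (suc r ℕ.≟ n) then α * ι (suc r) else 0#))
    second with suc r ℕ.≟ n
    ... | no r≢n = filt-cong la _ (T.sym l (T.trans l (H.⟦⟧-cong l (reflexive
            (≡.cong (λ b → if b then α * ι (suc r) else 0#) (dec-false (suc r ℕ.≟ n) r≢n)))) (H.0-homo l))) (filt-zero la _)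
    ... | yes ≡.refl = ≡.subst (λ k → Filt la k (emb la (if does (suc r ℕ.≟ suc r) then α * ι (suc r) else 0#))) (≡.sym (ℕP.n∸n≡0 (suc r))) (filt-0 la _)

  degree : List ℕ → ℕ
  degree la = sum (map suc la)

  -- The product of all ε's has degree `degree la`, the highest that occurs.
  filt-top : ∀ la n X → degree la < n → Filt la n X → T._≈_ (length la) X (T.0# (length la))
  filt-top [] (suc n) X p f = f
  filt-top (r ∷ la) n X p (f , g) = D.dual-ext l
    (T.trans l (filt-top la n _ (ℕP.≤-trans (s≤s (ℕP.m≤n+m (degree la) (suc r))) p) f) (T.sym l (Re.0-homo l)))
    (T.trans l (filt-top la _ _ (ℕP.m+n≤o⇒m≤o∸n (suc (degree la)) (≡.subst (_≤ n) (≡.cong suc (ℕP.+-comm (suc r) (degree la))) p)) g) (T.sym l (D.εpart-0 l)))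
    where l = length la

  -- Since `dvals la r` has filtration r, the value of c_γ m_γ at it has filtration |γ|. This is
  -- what permits the truncation of all sums over exponents.
  augmented-vanishes : ∀ la γ → degree la < sum γ → T._≈_ (length la) (Augmented.augmented (Tower R (length la)) (dvals la) γ) (T.0# (length la))
  augmented-vanishes la γ p = filt-top la (sum γ) _ p (filtered (length γ) γ ≡.refl)
    where
    open Augmented (Tower R (length la))
    l = length la
    bumped : ∀ r γ {f} n → (∀ γ′ → length γ′ ≡ length γ → sum γ′ ≡ r ℕ.+ sum γ → Filt la n (f γ′)) → Filt la n (bumpSum r γ f)
    bumped r [] n h = filt-zero la n
    bumped r (g ∷ γ) n h = filt-+ la n _ _ (h _ ≡.refl (ℕP.+-assoc r g (sum γ)))
      (bumped r γ n (λ γ′ e s → h (g ∷ γ′) (≡.cong suc e) (≡.trans (≡.cong (g ℕ.+_) s)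
        (≡.trans (≡.sym (ℕP.+-assoc g r _)) (≡.trans (≡.cong (ℕ._+ sum γ) (ℕP.+-comm g r)) (ℕP.+-assoc r g _))))))
    filtered : ∀ n γ → length γ ≡ n → Filt la (sum γ) (augmented (dvals la) γ)
    filtered n [] e = filt-0 la _
    filtered (suc n) (r ∷ γ) e = filt-cong la _ (T.sym l (augmented-∷ (dvals la) r γ)) (filt-+ la _ _ _
      (filt-* la r (sum γ) _ _ (filt-dvals la r) (filtered n γ (ℕP.suc-injective e)))
      (filt-neg la _ _ (bumped r γ _ (λ γ′ l s → ≡.subst (λ k → Filt la k (augmented (dvals la) γ′)) s (filtered n γ′ (≡.trans l (ℕP.suc-injective e)))))))

-- Multiplication by p_r as a dual number inside the determinant.

module Shift (R : CRing) where
  open Kit R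
  open Determinant R
  open DualNumbers R hiding (Dual)
  private
    module D where
      open Kit (Dual R) public
      open Determinant (Dual R) public
    module Re = HomProps real
    module E = HomProps embed

  single : ∀ {n} → Fin n → Fin n → Carrier → Carrier
  single zero zero c = c
  single zero (suc j) c = 0#
  single (suc i) zero c = 0#
  single (suc i) (suc j) c = single i j c

  Σ-tabulate : ∀ {A : Set} n (g : Fin n → A) (f : A → Carrier) → Σ (L.tabulate g) f ≈ Σ (allFin n) (λ i → f (g i))
  Σ-tabulate zero g f = refl
  Σ-tabulate (suc n) g f = +-congˡ (trans (Σ-tabulate n (λ i → g (suc i)) f) (sym (Σ-tabulate n suc (λ i → f (g i)))))

  Σ-allFin-suc : ∀ n (f : Fin (suc n) → Carrier) → Σ (allFin (suc n)) f ≈ f zero + Σ (allFin n) (λ i → f (suc i))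
  Σ-allFin-suc n f = +-congˡ (Σ-tabulate n suc f)

  re-rowProd : ∀ k {n} (σ : Vec ℕ n) (q w : Fin k → ℕ → Carrier) → Re.⟦ D.rowProd (L.tabulate (λ j s → pair (q j s) (w j s))) σ ⟧ ≈ rowProd (L.tabulate q) σ
  re-rowProd zero σ q w = Re.1-homo
  re-rowProd (suc k) [] q w = Re.0-homo
  re-rowProd (suc k) (s ∷ σ) q w = trans (Re.*-homo _ _) (*-cong (re-pair _ _) (re-rowProd k σ (λ j → q (suc j)) (λ j → w (suc j))))

  re-det : ∀ k n (q w : Fin k → ℕ → Carrier) → Re.⟦ D.det n (L.tabulate (λ j s → pair (q j s) (w j s))) ⟧ ≈ det n (L.tabulate q)
  re-det k n q w = trans (Re.Σ-homo (perms n) _) (Σ-cong (perms n) (λ σ → trans (Re.*-homo _ _) (*-cong (Re.sgn-homo (inv σ)) (re-rowProd k σ q w))))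

  -- Lowering row i by z i for one i at a time, weighted by y i, is a derivative.
  rowProd-shift : ∀ m {n} (σ : Vec ℕ n) (y : Fin m → Carrier) (q z : Fin m → ℕ → Carrier) →
    Σ (allFin m) (λ i → y i * rowProd (L.tabulate (λ j s → q j s + single i j (z j s))) σ) ≈
    Σ (allFin m) y * rowProd (L.tabulate q) σ + εpart (D.rowProd (L.tabulate (λ j s → pair (q j s) (y j * z j s))) σ)
  rowProd-shift zero σ y q z = sym (trans (+-cong (zeroˡ _) (trans (εpart-cong (D.sym E.1-homo)) (εpart-emb 1#))) (+-identityˡ _))
  rowProd-shift (suc m) [] y q z = trans (Σ-zero (allFin (suc m)) (λ i → zeroʳ _)) (sym (trans (+-cong (zeroʳ _) εpart-0) (+-identityˡ _)))
  rowProd-shift (suc m) (s ∷ σ) y q z = begin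
    Σ (allFin (suc m)) (λ i → y i * rowProd (L.tabulate (λ j s → q j s + single i j (z j s))) (s ∷ σ))
      ≈⟨ Σ-allFin-suc m (λ i → y i * rowProd (L.tabulate (λ j s → q j s + single i j (z j s))) (s ∷ σ)) ⟩
    y zero * ((q zero s + z zero s) * rowProd (L.tabulate (λ j s → q (suc j) s + 0#)) σ)
      + Σ (allFin m) (λ i → y (suc i) * ((q zero s + 0#) * rowProd (L.tabulate (λ j s → q (suc j) s + single i j (z (suc j) s))) σ))
      ≈⟨ +-cong (*-congˡ (*-congˡ (rowProd-cong (rows-cong m (λ j s → +-identityʳ _)) σ)))
           (trans (Σ-cong (allFin m) (λ i → solve 3 (λ y q r → y :* ((q :+ con (+ 0)) :* r) := q :* (y :* r)) refl _ _ _))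
             (trans (Σ-*ˡ (allFin m) (q zero s) _) (*-congˡ (rowProd-shift m σ (λ i → y (suc i)) (λ j → q (suc j)) (λ j → z (suc j)))))) ⟩
    y zero * ((q zero s + z zero s) * Q) + q zero s * (Σ (allFin m) (λ i → y (suc i)) * Q + εpart Q′)
      ≈⟨ solve 6 (λ y q z r t e → y :* ((q :+ z) :* r) :+ q :* (t :* r :+ e) := (y :+ t) :* (q :* r) :+ (q :* e :+ y :* z :* r)) refl
           (y zero) (q zero s) (z zero s) Q (Σ (allFin m) (λ i → y (suc i))) (εpart Q′) ⟩
    (y zero + Σ (allFin m) (λ i → y (suc i))) * (q zero s * Q) + (q zero s * εpart Q′ + y zero * z zero s * Q)
      ≈⟨ +-cong (*-congʳ (sym (Σ-allFin-suc m y))) (sym (trans (εpart-* _ _) (+-cong (*-congʳ (re-pair _ _)) (*-cong (εpart-pair _ _) (re-rowProd m σ (λ j → q (suc j)) _))))) ⟩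
    Σ (allFin (suc m)) y * (q zero s * Q) + εpart (pair (q zero s) (y zero * z zero s) D.* Q′) ∎
    where
    Q : Carrier
    Q = rowProd (L.tabulate (λ j → q (suc j))) σ
    Q′ : D.Carrier
    Q′ = D.rowProd (L.tabulate (λ j s → pair (q (suc j) s) (y (suc j) * z (suc j) s))) σ
    rows-cong : ∀ k {f g : Fin k → ℕ → Carrier} → (∀ j s → f j s ≈ g j s) → L.tabulate f ≋ L.tabulate g
    rows-cong zero e = []
    rows-cong (suc k) e = e zero ∷ rows-cong k (λ j → e (suc j))

  tabulate-≋ : ∀ k {f g : Fin k → ℕ → Carrier} → (∀ j s → f j s ≈ g j s) → L.tabulate f ≋ L.tabulate g
  tabulate-≋ zero e = []
  tabulate-≋ (suc k) e = e zero ∷ tabulate-≋ k (λ j → e (suc j))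

  Σ-εpart : ∀ {A : Set} (M : List A) f → εpart (D.Σ M f) ≈ Σ M (λ a → εpart (f a))
  Σ-εpart [] f = εpart-0
  Σ-εpart (a ∷ M) f = trans (εpart-+ _ _) (+-congˡ (Σ-εpart M f))

  det-shift : ∀ m n (y : Fin m → Carrier) (q z : Fin m → ℕ → Carrier) →
    Σ (allFin m) (λ i → y i * det n (L.tabulate (λ j s → q j s + single i j (z j s)))) ≈
    Σ (allFin m) y * det n (L.tabulate q) + εpart (D.det n (L.tabulate (λ j s → pair (q j s) (y j * z j s))))
  det-shift m n y q z = begin
    Σ (allFin m) (λ i → y i * Σ (perms n) (λ σ → sgn (inv σ) * rowProd (L.tabulate (λ j s → q j s + single i j (z j s))) σ))
      ≈⟨ trans (Σ-cong (allFin m) (λ i → sym (Σ-*ˡ (perms n) (y i) _))) (Σ-swap (allFin m) (perms n) _) ⟩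
    Σ (perms n) (λ σ → Σ (allFin m) (λ i → y i * (sgn (inv σ) * rowProd (L.tabulate (λ j s → q j s + single i j (z j s))) σ)))
      ≈⟨ Σ-cong (perms n) (λ σ → trans (Σ-cong (allFin m) (λ i → solve 3 (λ a b c → a :* (b :* c) := b :* (a :* c)) refl _ _ _))
           (trans (Σ-*ˡ (allFin m) _ _) (trans (*-congˡ (rowProd-shift m σ y q z))
           (solve 4 (λ s t r e → s :* (t :* r :+ e) := t :* (s :* r) :+ s :* e) refl _ _ _ _)))) ⟩
    Σ (perms n) (λ σ → Σ (allFin m) y * (sgn (inv σ) * rowProd (L.tabulate q) σ) + sgn (inv σ) * εpart (ε-row σ))
      ≈⟨ trans (Σ-+ (perms n) _ _) (+-cong (Σ-*ˡ (perms n) _ _) (sym (trans (Σ-εpart (perms n) _) (Σ-cong (perms n) (λ σ → sgn-out (inv σ) _))))) ⟩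
    Σ (allFin m) y * det n (L.tabulate q) + εpart (D.det n (L.tabulate (λ j s → pair (q j s) (y j * z j s)))) ∎
    where
    ε-row : ∀ {k} → Vec ℕ k → D.Carrier
    ε-row σ = D.rowProd (L.tabulate (λ j s → pair (q j s) (y j * z j s))) σ
    sgn-out : ∀ k a → εpart (D.sgn k D.* a) ≈ sgn k * εpart a
    sgn-out k a = trans (εpart-cong (D.*-congʳ (D.sym (E.sgn-homo k)))) (trans (εpart-* _ _)
      (trans (+-cong (*-congʳ (re-emb _)) (*-congʳ (εpart-emb _))) (solve 3 (λ s e a → s :* e :+ con (+ 0) :* a := s :* e) refl _ _ _)))

module Kernel (R : CRing) (α : CommutativeRing.Carrier R) (N : ℕ) (u : CommutativeRing.Carrier R) (x : Fin N → CommutativeRing.Carrier R) where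
  open Kit R
  open Shift R using (single)
  open Towers R α
  private
    module T (n : ℕ) where
      open Kit (Tower R n) public
      open Determinant (Tower R n) public
      open Augmented (Tower R n) public
    module D (n : ℕ) = DualNumbers (Tower R n)
    module Re (n : ℕ) = HomProps (DualNumbers.real (Tower R n))
    module E (n : ℕ) = HomProps (DualNumbers.embed (Tower R n))
    module H (n : ℕ) = HomProps (towerEmbed R n)

  psum : ℕ → Carrier
  psum r = Σ (allFin N) (λ i → x i ^ r)

  shiftedRow : ∀ n → (v : Fin N → T.Carrier n) → Fin N → ℕ → T.Carrier n
  shiftedRow n v i s = T._*_ n (T._^_ n (H.⟦_⟧ n (x i)) (N ∸ s)) (T._+_ n (T._+_ n (H.⟦_⟧ n u) (T.ι n (s ∸ 1))) (T.-_ n (v i)))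

  shiftedDet : ∀ n → (Fin N → T.Carrier n) → T.Carrier n
  shiftedDet n v = T.det n N (L.tabulate (shiftedRow n v))

  -- The determinant summed over the monomials of p_la: each factor p_{r+1} chooses a variable x_i,
  -- contributes x_i^(r+1) and raises the eigenvalue of α x_i ∂_i by α (r + 1). The argument v
  -- collects the eigenvalues so far.
  iterated : List ℕ → (Fin N → Carrier) → Carrier
  iterated [] v = shiftedDet 0 v
  iterated (r ∷ la) v = Σ (allFin N) (λ i → x i ^ suc r * iterated la (λ j → v j + single i j (α * ι (suc r))))

  module Truncated (B : ℕ) where

    hval : ∀ la → Fin N → C la
    hval la i = T.powers (length la) B (emb la (x i)) (dvals la)

    module _ (r : ℕ) (la : List ℕ) where
      private
        l = length la
        module S = Shift (Tower R l)
        c : Carrier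
        c = α * ι (suc r)

      -- Only the term with exponent r + 1 of the generating sum contains the new ε, and it lies
      -- within the truncation because r + 1 ≤ B.
      hval-∷ : suc r ≤ B → ∀ i → T._≈_ (suc l) (hval (r ∷ la) i) (D.pair l (hval la i) (T._*_ l (emb la c) (T._^_ l (emb la (x i)) (suc r))))
      hval-∷ r<B i = D.dual-ext l (T.trans l (re-powers B (dvals (r ∷ la)) (dvals la) (λ n → D.re-pair l _ _)) (T.sym l (D.re-pair l _ _)))
        (T.trans l (ε-powers B 0 (dvals (r ∷ la)) (λ n → D.εpart-pair l _ _))
          (T.trans l (select B r r<B) (T.sym l (D.εpart-pair l _ _))))
        where
        z : C la
        z = emb la (x i)
        re-powers : ∀ B G G′ → (∀ n → T._≈_ l (Re.⟦_⟧ l (G n)) (G′ n)) → T._≈_ l (Re.⟦_⟧ l (T.powers (suc l) B (E.⟦_⟧ l z) G)) (T.powers l B z G′)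
        re-powers zero G G′ e = Re.0-homo l
        re-powers (suc B) G G′ e = T.trans l (Re.*-homo l _ _) (T.*-cong l (D.re-emb l z)
          (T.trans l (Re.+-homo l _ _) (T.+-cong l (e 1) (re-powers B _ _ (λ n → e (suc n))))))
        coefficient : ℕ → C la
        coefficient n = emb la (if does (suc r ℕ.≟ n) then c else 0#)
        ε-powers : ∀ B k G → (∀ n → T._≈_ l (D.εpart l (G n)) (coefficient (k ℕ.+ n))) →
          T._≈_ l (D.εpart l (T.powers (suc l) B (E.⟦_⟧ l z) G)) (T.powers l B z (λ n → coefficient (k ℕ.+ n)))
        ε-powers zero k G e = D.εpart-0 l
        ε-powers (suc B) k G e = T.trans l (D.εpart-* l _ _) (T.trans l (T.+-cong l (T.*-congʳ l (D.re-emb l z)) (T.trans l (T.*-congʳ l (D.εpart-emb l z)) (T.zeroˡ l _)))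
          (T.trans l (T.+-identityʳ l _) (T.*-congˡ l (T.trans l (D.εpart-+ l _ _) (T.+-cong l (e 1)
            (T.trans l (ε-powers B (suc k) (λ n → G (suc n)) (λ n → T.trans l (e (suc n)) (T.reflexive l (≡.cong coefficient (ℕP.+-suc k n)))))
              (T.powers-cong l B z (λ n → T.reflexive l (≡.cong coefficient (≡.sym (ℕP.+-suc k n)))))))))))
        match : ℕ → ℕ → C la
        match q n = emb la (if does (suc q ℕ.≟ n) then c else 0#)
        select : ∀ B q → suc q ≤ B → T._≈_ l (T.powers l B z (match q)) (T._*_ l (emb la c) (T._^_ l z (suc q)))
        select (suc B) zero p = T.trans l (T.*-congˡ l (T.trans l (T.+-congˡ l (T.powers-zero⁺ l B z (λ n → H.0-homo l))) (T.+-identityʳ l _)))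
          (T.trans l (T.*-comm l _ _) (T.*-congˡ l (T.sym l (T.*-identityʳ l _))))
        select (suc B) (suc q) (s≤s p) = T.trans l (T.*-congˡ l (T.trans l (T.+-cong l (H.0-homo l) (select B q p)) (T.+-identityˡ l _)))
          (shuffle z (emb la c) (T._^_ l z (suc q)))
          where
          shuffle : ∀ a b d → T._≈_ l (T._*_ l a (T._*_ l b d)) (T._*_ l b (T._*_ l a d))
          shuffle = solve′ 3 (λ a b d → a :*′ (b :*′ d) :=′ b :*′ (a :*′ d)) (T.refl l)
            where open T l using () renaming (solve to solve′; _:=_ to _:=′_; _:*_ to _:*′_)

      -- Choosing x_i for p_{r+1} lowers row i by α (r + 1) x_i^(N-s). By `det-shift` the sum over
      -- i, weighted by x_i^(r+1), is the coefficient of ε in (1 + ε p_{r+1}) times the determinant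
      -- with h_j enlarged by ε α (r + 1) x_j^(r+1).
      tower-step : suc r ≤ B → ∀ (v : Fin N → Carrier) →
        T._≈_ l (T.Σ l (allFin N) (λ i → T._*_ l (emb la (x i ^ suc r)) (shiftedDet l (λ j → T._+_ l (emb la (v j + single i j c)) (hval la j)))))
          (T._+_ l (T._*_ l (emb la (psum (suc r))) (Re.⟦_⟧ l (shiftedDet (suc l) (λ j → T._+_ (suc l) (emb (r ∷ la) (v j)) (hval (r ∷ la) j)))))
                   (D.εpart l (shiftedDet (suc l) (λ j → T._+_ (suc l) (emb (r ∷ la) (v j)) (hval (r ∷ la) j)))))
      tower-step r<B v = T.trans l (T.Σ-cong l (allFin N) (λ i → T.*-congˡ l (T.det-cong l N (S.tabulate-≋ N (λ j s → lowered i j s)))))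
        (T.trans l (S.det-shift N N y q z) (T.+-cong l
          (T.*-cong l (T.sym l (H.Σ-homo l (allFin N) _)) (T.sym l (T.trans l (Re.⟦⟧-cong l rows) re-det)))
          (T.sym l (D.εpart-cong l rows))))
        where
        w : Fin N → C la
        w j = T._+_ l (emb la (v j)) (hval la j)
        y : Fin N → C la
        y i = emb la (x i ^ suc r)
        q z : Fin N → ℕ → C la
        q = shiftedRow l w
        z j s = T.-_ l (T._*_ l (emb la c) (T._^_ l (emb la (x j)) (N ∸ s)))
        emb-single : ∀ {n} (i j : Fin n) c → T._≈_ l (emb la (single i j c)) (S.single i j (emb la c))
        emb-single zero zero c = T.refl l
        emb-single zero (suc j) c = H.0-homo l
        emb-single (suc i) zero c = H.0-homo l
        emb-single (suc i) (suc j) c = emb-single i j c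
        single-lin : ∀ {n} (i j : Fin n) (p b : C la) → T._≈_ l (T.-_ l (T._*_ l p (S.single i j b))) (S.single i j (T.-_ l (T._*_ l b p)))
        single-lin zero zero p b = T.-‿cong l (T.*-comm l _ _)
        single-lin zero (suc j) p b = T.trans l (T.-‿cong l (T.zeroʳ l _)) (T.-0#≈0# l)
        single-lin (suc i) zero p b = T.trans l (T.-‿cong l (T.zeroʳ l _)) (T.-0#≈0# l)
        single-lin (suc i) (suc j) p b = single-lin i j p b
        lowered : ∀ i j s → T._≈_ l (shiftedRow l (λ j → T._+_ l (emb la (v j + single i j c)) (hval la j)) j s) (T._+_ l (q j s) (S.single i j (z j s)))
        lowered i j s = T.trans l (T.*-congˡ l (T.+-congˡ l (T.-‿cong l (T.+-congʳ l (T.trans l (H.+-homo l _ _) (T.+-congˡ l (emb-single i j c)))))))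
          (T.trans l (shuffle _ _ _ _ _) (T.+-congˡ l (single-lin i j (T._^_ l (emb la (x j)) (N ∸ s)) (emb la c))))
          where
          shuffle : ∀ p b v t h → T._≈_ l (T._*_ l p (T._+_ l b (T.-_ l (T._+_ l (T._+_ l v t) h)))) (T._+_ l (T._*_ l p (T._+_ l b (T.-_ l (T._+_ l v h)))) (T.-_ l (T._*_ l p t)))
          shuffle = solve′ 5 (λ p b v t h → p :*′ (b :-′ (v :+′ t :+′ h)) :=′ p :*′ (b :-′ (v :+′ h)) :-′ p :*′ t) (T.refl l)
            where open T l using () renaming (solve to solve′; _:=_ to _:=′_; _:*_ to _:*′_; _:+_ to _:+′_; _:-_ to _:-′_)
        -- The powers of x_j and u + s - 1 are constant in the new ε, so the ε-part of a row comes
        -- from h_j alone.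
        q≈ : ∀ j s → T._≈_ (suc l) (shiftedRow (suc l) (λ j → T._+_ (suc l) (emb (r ∷ la) (v j)) (hval (r ∷ la) j)) j s) (D.pair l (q j s) (T._*_ l (y j) (z j s)))
        q≈ j s = D.dual-ext l
          (T.trans l (Re.*-homo l _ _) (T.trans l (T.*-cong l power-re (T.trans l (Re.+-homo l _ _) (T.+-cong l base-re (T.trans l (Re.neg-homo l _) (T.-‿cong l tail-re)))))
            (T.sym l (D.re-pair l _ _))))
          (T.trans l (D.εpart-* l _ _) (T.trans l (T.+-cong l
              (T.*-cong l power-re (T.trans l (D.εpart-+ l _ _) (T.+-cong l base-ε (T.trans l (D.εpart-neg l _) (T.-‿cong l tail-ε)))))
              (T.*-congʳ l power-ε))
            (T.trans l (shuffle _ _ _ _) (T.trans l (T.*-congʳ l (T.sym l (H.^-homo l (x j) (suc r)))) (T.sym l (D.εpart-pair l _ _))))))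
          where
          power : T._≈_ (suc l) (T._^_ (suc l) (emb (r ∷ la) (x j)) (N ∸ s)) (E.⟦_⟧ l (T._^_ l (emb la (x j)) (N ∸ s)))
          power = T.sym (suc l) (E.^-homo l (emb la (x j)) (N ∸ s))
          power-re = T.trans l (Re.⟦⟧-cong l power) (D.re-emb l _)
          power-ε = T.trans l (D.εpart-cong l power) (D.εpart-emb l _)
          base : T._≈_ (suc l) (T._+_ (suc l) (emb (r ∷ la) u) (T.ι (suc l) (s ∸ 1))) (E.⟦_⟧ l (T._+_ l (emb la u) (T.ι l (s ∸ 1))))
          base = T.sym (suc l) (T.trans (suc l) (E.+-homo l _ _) (T.+-congˡ (suc l) (E.ι-homo l (s ∸ 1))))
          base-re = T.trans l (Re.⟦⟧-cong l base) (D.re-emb l _)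
          base-ε = T.trans l (D.εpart-cong l base) (D.εpart-emb l _)
          tail-re = T.trans l (Re.+-homo l _ _) (T.+-cong l (D.re-emb l _) (T.trans l (Re.⟦⟧-cong l (hval-∷ r<B j)) (D.re-pair l _ _)))
          tail-ε = T.trans l (D.εpart-+ l _ _) (T.+-cong l (D.εpart-emb l _) (T.trans l (D.εpart-cong l (hval-∷ r<B j)) (D.εpart-pair l _ _)))
          shuffle : ∀ p c y t → T._≈_ l (T._+_ l (T._*_ l p (T._+_ l (T.0# l) (T.-_ l (T._+_ l (T.0# l) (T._*_ l c y))))) (T._*_ l (T.0# l) t)) (T._*_ l y (T.-_ l (T._*_ l c p)))
          shuffle = solve′ 4 (λ p c y t → p :*′ (con′ (+ 0) :-′ (con′ (+ 0) :+′ c :*′ y)) :+′ con′ (+ 0) :*′ t :=′ y :*′ (:-′ (c :*′ p))) (T.refl l)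
            where open T l using () renaming (solve to solve′; _:=_ to _:=′_; _:*_ to _:*′_; _:+_ to _:+′_; _:-_ to _:-′_; :-_ to :-′_; con to con′)
        rows : T._≈_ (suc l) (shiftedDet (suc l) (λ j → T._+_ (suc l) (emb (r ∷ la) (v j)) (hval (r ∷ la) j)))
                 (T.det (suc l) N (L.tabulate (λ j s → D.pair l (q j s) (T._*_ l (y j) (z j s)))))
        rows = T.det-cong (suc l) N (Shift.tabulate-≋ (Tower R (suc l)) N q≈)
        re-det : T._≈_ l (Re.⟦_⟧ l (T.det (suc l) N (L.tabulate (λ j s → D.pair l (q j s) (T._*_ l (y j) (z j s)))))) (shiftedDet l w)
        re-det = S.re-det N N q (λ j s → T._*_ l (y j) (z j s))

    -- One factor of p_la becomes one ε: `evTop` peels off the outermost dual number exactly as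
    -- `iterated` sums over the variable chosen for the first factor.
    iterated-evTop : ∀ la → All (λ r → suc r ≤ B) la → ∀ v →
      iterated la v ≈ evTop psum la (shiftedDet (length la) (λ j → T._+_ (length la) (emb la (v j)) (hval la j)))
    iterated-evTop [] [] v = T.det-cong 0 N (Shift.tabulate-≋ R N (λ j s → *-congˡ (+-congˡ (-‿cong (sym (trans (+-congˡ (T.powers-zero 0 B (x j) (λ _ → refl))) (+-identityʳ _)))))))
    iterated-evTop (r ∷ la) (b ∷ bs) v = begin
      Σ (allFin N) (λ i → x i ^ suc r * iterated la (λ j → v j + single i j (α * ι (suc r))))
        ≈⟨ Σ-cong (allFin N) (λ i → trans (*-congˡ (iterated-evTop la bs _)) (sym (evTop-scale psum la _ _))) ⟩
      Σ (allFin N) (λ i → evTop psum la (T._*_ l (emb la (x i ^ suc r)) (shiftedDet l (λ j → T._+_ l (emb la (v j + single i j (α * ι (suc r)))) (hval la j)))))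
        ≈⟨ sym (evTop-Σ psum la (allFin N) _) ⟩
      evTop psum la (T.Σ l (allFin N) (λ i → T._*_ l (emb la (x i ^ suc r)) (shiftedDet l (λ j → T._+_ l (emb la (v j + single i j (α * ι (suc r)))) (hval la j)))))
        ≈⟨ evTop-cong psum la (tower-step r la b v) ⟩
      evTop psum (r ∷ la) (shiftedDet (suc l) (λ j → T._+_ (suc l) (emb (r ∷ la) (v j)) (hval (r ∷ la) j))) ∎
      where l = length la

-- The given polynomial expressions translated into ring terms.

module PolynomialLists (n : ℕ) where
  open PolynomialRing n
  open Kit Polynomials
  open Determinant Polynomials

  toP-concatMap : ∀ {A : Set} (f : A → Poly n) (L : List A) → toP (concatMap f L) ≈ Σ L (λ a → toP (f a))
  toP-concatMap f [] = toP-0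
  toP-concatMap f (a ∷ L) = trans (toP-+ (f a) (concatMap f L)) (+-congˡ (toP-concatMap f L))

  toP-sumP : ∀ {A : Set} (f : A → Poly n) (L : List A) → toP (sumP (map f L)) ≈ Σ L (λ a → toP (f a))
  toP-sumP f [] = toP-0
  toP-sumP f (a ∷ L) = trans (toP-+ (f a) (sumP (map f L))) (+-congˡ (toP-sumP f L))

  toP-prodP : ∀ {A : Set} (f : A → Poly n) (L : List A) → toP (prodP (map f L)) ≈ prodOver (λ a → toP (f a)) L
  toP-prodP f [] = toP-1
  toP-prodP f (a ∷ L) = trans (toP-* (f a) (prodP (map f L))) (*-congˡ (toP-prodP f L))

module MonomialHom (R : CRing) where
  open Kit R

  prodV : ∀ {m} → (Fin m → Carrier) → Vec ℕ m → Carrier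
  prodV x [] = 1#
  prodV x (e ∷ es) = x zero ^ e * prodV (λ i → x (suc i)) es

  record Multiplicative {m} (μ : Mono m → Carrier) : Set where
    field
      μ-⊕ : ∀ a b → μ (V.zipWith ℕ._+_ a b) ≈ μ a * μ b
      μ-0 : μ (V.replicate m 0) ≈ 1#
  open Multiplicative

  private
    tabulate-zero : ∀ m → V.tabulate {n = m} (λ _ → 0) ≡ V.replicate m 0
    tabulate-zero zero = ≡.refl
    tabulate-zero (suc m) = ≡.cong (0 ∷_) (tabulate-zero m)

    head-power : ∀ {m} (μ : Mono (suc m) → Carrier) → Multiplicative μ → ∀ e → μ (e ∷ V.replicate m 0) ≈ μ (1 ∷ V.replicate m 0) ^ e
    head-power μ M zero = μ-0 M
    head-power {m} μ M (suc e) = trans (reflexive (≡.cong (λ v → μ (suc e ∷ v)) (≡.sym (VP.zipWith-identityˡ ℕP.+-identityˡ (V.replicate m 0)))))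
      (trans (μ-⊕ M (1 ∷ V.replicate m 0) (e ∷ V.replicate m 0)) (*-congˡ (head-power μ M e)))

    tail-multiplicative : ∀ {m} {μ : Mono (suc m) → Carrier} → Multiplicative μ → Multiplicative (λ e → μ (0 ∷ e))
    tail-multiplicative M = record { μ-⊕ = λ a b → μ-⊕ M (0 ∷ a) (0 ∷ b) ; μ-0 = μ-0 M }

  unitExp-zero : ∀ {m} e → unitExp {suc m} zero e ≡ e ∷ V.replicate m 0
  unitExp-zero {m} e = ≡.cong (e ∷_) (tabulate-zero m)

  μ-prodV : ∀ {m} (μ : Mono m → Carrier) → Multiplicative μ → ∀ e → μ e ≈ prodV (λ i → μ (unitExp i 1)) e
  μ-prodV μ M [] = μ-0 M
  μ-prodV {suc m} μ M (e ∷ es) = begin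
    μ (e ∷ es)
      ≈⟨ trans (reflexive (≡.cong₂ (λ a v → μ (a ∷ v)) (≡.sym (ℕP.+-identityʳ e)) (≡.sym (VP.zipWith-identityˡ ℕP.+-identityˡ es)))) (μ-⊕ M (e ∷ V.replicate m 0) (0 ∷ es)) ⟩
    μ (e ∷ V.replicate m 0) * μ (0 ∷ es)
      ≈⟨ *-cong (trans (head-power μ M e) (reflexive (≡.cong (λ v → μ v ^ e) (≡.sym (unitExp-zero 1))))) (μ-prodV (λ v → μ (0 ∷ v)) (tail-multiplicative M) es) ⟩
    μ (unitExp zero 1) ^ e * prodV (λ i → μ (0 ∷ unitExp i 1)) es ∎

  μ-unit : ∀ {m} (μ : Mono m → Carrier) → Multiplicative μ → ∀ i r → μ (unitExp i r) ≈ μ (unitExp i 1) ^ r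
  μ-unit {suc m} μ M zero r = trans (reflexive (≡.cong μ (unitExp-zero r))) (trans (head-power μ M r) (reflexive (≡.cong (λ v → μ v ^ r) (≡.sym (unitExp-zero 1)))))
  μ-unit μ M (suc i) r = μ-unit (λ v → μ (0 ∷ v)) (tail-multiplicative M) i r

module PowerProducts (T : CRing) (φ : Hom 𝔽 T) (N : ℕ) where
  open Kit T
  open Evaluation T φ

  powProd : List ℕ → Poly N
  powProd la = prodP (map (λ r → powSum N (suc r)) la)

  ev-π : ∀ f (G : Mono N → Carrier) → ev (π N f) G ≈ ev f (λ ix → ev (powProd ix) G)
  ev-π f G = go f
    where
    go : ∀ f → ev (π N f) G ≈ ev f (λ ix → ev (powProd ix) G)
    go [] = refl
    go ((ix , c) ∷ f) = trans (Σ-++ (scaleP c (powProd ix)) (π N f) _) (+-cong (ev-scale c (powProd ix) G) (go f))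

  ev-powSum : ∀ r (G : Mono N → Carrier) → ev (powSum N r) G ≈ Σ (allFin N) (λ i → G (unitExp i r))
  ev-powSum r G = trans (Σ-map _ (allFin N) _) (Σ-cong (allFin N) (λ i → trans (*-congʳ scalar-1) (*-identityˡ _)))

  ev-powProd-∷ : ∀ r la (G : Mono N → Carrier) → ev (powProd (r ∷ la)) G ≈ Σ (allFin N) (λ i → ev (powProd la) (λ b → G (V.zipWith ℕ._+_ (unitExp i (suc r)) b)))
  ev-powProd-∷ r la G = trans (ev-mul (V.zipWith ℕ._+_) (powSum N (suc r)) (powProd la) G) (ev-powSum (suc r) _)

  ev-powProd-[] : ∀ (G : Mono N → Carrier) → ev (powProd []) G ≈ G (V.replicate N 0)
  ev-powProd-[] G = trans (+-identityʳ _) (trans (*-congʳ scalar-1) (*-identityˡ _))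

module SekiguchiDebiard (N : ℕ) where
  open PolynomialRing (suc N)
  open PolynomialLists (suc N)
  open Kit Polynomials
  open Determinant Polynomials
  open RisingFactorial Polynomials
  open MonomialHom Polynomials
  open Shift Polynomials using (single; Σ-tabulate; tabulate-≋)
  open PowerProducts Polynomials const N public

  α u : Carrier
  α = scalar αF
  u = mono uMono

  lift : Mono N → Carrier
  lift e = mono (0 ∷ e)

  x : Fin N → Carrier
  x i = lift (unitExp i 1)

  lift-multiplicative : Multiplicative lift
  lift-multiplicative = record { μ-⊕ = λ a b → mono-⊕ (0 ∷ a) (0 ∷ b) ; μ-0 = mono-0 }

  toP-liftU : ∀ p → toP (liftU p) ≈ ev p lift
  toP-liftU [] = toP-0
  toP-liftU ((e , c) ∷ p) = trans (toP-+ ((0 ∷ e , c) ∷ []) (liftU p)) (+-cong (toP-term (0 ∷ e) c) (toP-liftU p))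

  toP-linear : ∀ c → toP ((uMono , 1F) ∷ constP c) ≈ u + scalar c
  toP-linear c = trans (toP-+ ((uMono , 1F) ∷ []) (constP c)) (+-congˡ (toP-const c))

  toP-Δ : toP (Δ N) ≈ vandermonde (map x (allFin N))
  toP-Δ = go (allFin N)
    where
    go : ∀ J → toP (vand (map xVar J)) ≈ vandermonde (map x J)
    go [] = toP-1
    go (i ∷ J) = trans (toP-* _ (vand (map xVar J))) (*-cong (trans (toP-prodP (λ y → xVar i +P negP y) (map xVar J)) (differences J)) (go J))
      where
      differences : ∀ J → prodOver (λ y → toP (xVar i +P negP y)) (map xVar J) ≈ diffs (x i) (map x J)
      differences [] = refl
      differences (j ∷ J) = *-cong (trans (toP-+ (xVar i) (negP (xVar j))) (+-congˡ (toP-neg (xVar j)))) (differences J)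

  toP-risingTail : ∀ k → toP (risingTail N k) ≈ rise u k (N ∸ k)
  toP-risingTail k = trans (toP-prodP (λ j → (uMono , 1F) ∷ constP (ℕ→F j)) (map (k ℕ.+_) (upTo (N ∸ k))))
    (trans (reflexive (≡.cong (prodOver (λ j → toP ((uMono , 1F) ∷ constP (ℕ→F j)))) (LP.map-upTo (k ℕ.+_) (N ∸ k))))
      (go k (N ∸ k) (k ℕ.+_) (λ _ → ≡.refl)))
    where
    go : ∀ k r f → (∀ j → f j ≡ k ℕ.+ j) → prodOver (λ j → toP ((uMono , 1F) ∷ constP (ℕ→F j))) (applyUpTo f r) ≈ rise u k r
    go k zero f e = refl
    go k (suc r) f e = *-cong (trans (toP-linear (ℕ→F (f 0))) (+-congˡ (trans (scalar-ℕ (f 0)) (reflexive (≡.cong ι (≡.trans (e 0) (ℕP.+-identityʳ k)))))))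
      (go (suc k) r (λ j → f (suc j)) (λ j → ≡.trans (e (suc j)) (ℕP.+-suc k j)))

  scalar-sgn : ∀ k → scalar (negOnePow k) ≈ sgn k
  scalar-sgn zero = scalar-1
  scalar-sgn (suc k) = trans (scalar-neg _) (-‿cong (scalar-sgn k))

  private
    entry : Carrier → ℕ → ℕ → Carrier
    entry z e s = z ^ e * (z ^ (N ∸ s) * (u + ι (s ∸ 1) + - (α * ι e)))

    toP-linFactor : ∀ s e → toP (linFactor {N} s e) ≈ u + ι (s ∸ 1) + - (α * ι e)
    toP-linFactor s e = trans (toP-linear (ℕ→F (s ∸ 1) +F -F (αF *F ℕ→F e))) (trans (+-congˡ (trans (scalar-+ _ _) (+-cong (scalar-ℕ (s ∸ 1))
      (trans (scalar-neg _) (-‿cong (trans (scalar-* _ _) (*-congˡ (scalar-ℕ e)))))))) (sym (+-assoc _ _ _)))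

    term-rows : ∀ {m} (z : Fin m → Carrier) (e σ : Vec ℕ m) →
      prodV z (V.zipWith (λ ei si → ei ℕ.+ (N ∸ si)) e σ) * toP (prodP (V.toList (V.zipWith (linFactor {N}) σ e))) ≈
      rowProd (L.tabulate (λ i s → entry (z i) (V.lookup e i) s)) σ
    term-rows z [] [] = trans (*-identityˡ _) toP-1
    term-rows z (e ∷ es) (s ∷ σ) = begin
      z zero ^ (e ℕ.+ (N ∸ s)) * rest * toP (linFactor s e *P prodP (V.toList (V.zipWith linFactor σ es)))
        ≈⟨ *-cong (*-congʳ (^-+ _ e (N ∸ s))) (trans (toP-* (linFactor s e) _) (*-congʳ (toP-linFactor s e))) ⟩
      z zero ^ e * z zero ^ (N ∸ s) * rest * ((u + ι (s ∸ 1) + - (α * ι e)) * toP (prodP (V.toList (V.zipWith linFactor σ es))))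
        ≈⟨ solve 5 (λ a b p l r → a :* b :* p :* (l :* r) := a :* (b :* l) :* (p :* r)) refl _ _ _ _ _ ⟩
      entry (z zero) e s * (rest * toP (prodP (V.toList (V.zipWith linFactor σ es))))
        ≈⟨ *-congˡ (term-rows (λ i → z (suc i)) es σ) ⟩
      entry (z zero) e s * rowProd (L.tabulate (λ i s → entry (z (suc i)) (V.lookup es i) s)) σ ∎
      where
      rest = prodV (λ i → z (suc i)) (V.zipWith (λ ei si → ei ℕ.+ (N ∸ si)) es σ)

    toP-numS : ∀ g → toP (numS N g) ≈ ev g (λ e → det N (L.tabulate (λ i s → entry (x i) (V.lookup e i) s)))
    toP-numS g = trans (toP-concatMap _ g) (Σ-cong g (λ { (e , c) → trans (toP-concatMap _ (perms N)) (trans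
      (Σ-cong (perms N) (λ σ → begin
        toP (prodP ((((0 ∷ V.zipWith (λ ei si → ei ℕ.+ (N ∸ si)) e σ) , negOnePow (inv σ) *F c) ∷ []) ∷ V.toList (V.zipWith linFactor σ e)))
          ≈⟨ trans (toP-* _ (prodP (V.toList (V.zipWith linFactor σ e)))) (*-congʳ (trans (toP-term _ _) (*-cong
               (trans (scalar-* _ c) (*-congʳ (scalar-sgn (inv σ)))) (μ-prodV lift lift-multiplicative _)))) ⟩
        sgn (inv σ) * scalar c * prodV x (V.zipWith (λ ei si → ei ℕ.+ (N ∸ si)) e σ) * toP (prodP (V.toList (V.zipWith linFactor σ e)))
          ≈⟨ trans (solve 4 (λ s c p r → s :* c :* p :* r := c :* (s :* (p :* r))) refl _ _ _ _) (*-congˡ (*-congˡ (term-rows x e σ))) ⟩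
        scalar c * (sgn (inv σ) * rowProd (L.tabulate (λ i s → entry (x i) (V.lookup e i) s)) σ) ∎))
      (Σ-*ˡ (perms N) (scalar c) _)) }))

    prodOver-tabulate : ∀ k {n} (g : Fin k → Fin n) (a : Fin n → Carrier) → prodOver a (L.tabulate g) ≈ prodOver (λ i → a (g i)) (allFin k)
    prodOver-tabulate zero g a = refl
    prodOver-tabulate (suc k) g a = *-congˡ (trans (prodOver-tabulate k (λ i → g (suc i)) a) (sym (prodOver-tabulate k suc (λ i → a (g i)))))

    rowProd-scale : ∀ m {n} (σ : Vec ℕ n) (a : Fin m → Carrier) (q : Fin m → ℕ → Carrier) →
      rowProd (L.tabulate (λ i s → a i * q i s)) σ ≈ prodOver a (allFin m) * rowProd (L.tabulate q) σ
    rowProd-scale zero σ a q = sym (*-identityˡ _)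
    rowProd-scale (suc m) [] a q = sym (zeroʳ _)
    rowProd-scale (suc m) (s ∷ σ) a q = trans (*-congˡ (rowProd-scale m σ (λ i → a (suc i)) (λ i → q (suc i))))
      (trans (solve 4 (λ x y z w → x :* y :* (z :* w) := x :* z :* (y :* w)) refl _ _ _ _) (*-congʳ (*-congˡ (sym (prodOver-tabulate m suc a)))))

    prodV-prodOver : ∀ {m} (z : Fin m → Carrier) (e : Vec ℕ m) → prodOver (λ i → z i ^ V.lookup e i) (allFin m) ≈ prodV z e
    prodV-prodOver z [] = refl
    prodV-prodOver {suc m} z (e ∷ es) = *-congˡ (trans (prodOver-tabulate m suc (λ i → z i ^ V.lookup (e ∷ es) i)) (prodV-prodOver (λ i → z (suc i)) es))

  open Kernel Polynomials α N u x using (shiftedDet; shiftedRow; iterated; psum; module Truncated) public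

  private
    -- The powers x_i^(e_i) come out of the rows, and the action of α x_i ∂_i on x^e survives as the
    -- shift α e_i.
    det-entries : ∀ e → det N (L.tabulate (λ i s → entry (x i) (V.lookup e i) s)) ≈ lift e * shiftedDet 0 (λ i → α * ι (V.lookup e i))
    det-entries e = trans (Σ-cong (perms N) (λ σ → trans (*-congˡ (rowProd-scale N σ (λ i → x i ^ V.lookup e i) (shiftedRow 0 (λ i → α * ι (V.lookup e i)))))
      (trans (solve 3 (λ a b c → a :* (b :* c) := b :* (a :* c)) refl _ _ _)
        (*-congʳ (trans (prodV-prodOver x e) (sym (μ-prodV lift lift-multiplicative e)))))))
      (Σ-*ˡ (perms N) (lift e) _)

  private
    lookup-unit : ∀ {m} (i j : Fin m) r (b : Vec ℕ m) (c : Carrier) →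
      c * ι (V.lookup (V.zipWith ℕ._+_ (unitExp i r) b) j) ≈ single i j (c * ι r) + c * ι (V.lookup b j)
    lookup-unit zero zero r (e ∷ b) c = trans (*-congˡ (ι-+ r e)) (distribˡ _ _ _)
    lookup-unit {suc m} zero (suc j) r (e ∷ b) c = trans (reflexive (≡.cong (λ v → c * ι (V.lookup v (suc j))) (≡.trans (≡.cong (λ w → V.zipWith ℕ._+_ w (e ∷ b)) (unitExp-zero {m} r))
      (≡.cong (r ℕ.+ e ∷_) (VP.zipWith-identityˡ ℕP.+-identityˡ b))))) (sym (+-identityˡ _))
    lookup-unit (suc i) zero r (e ∷ b) c = sym (+-identityˡ _)
    lookup-unit (suc i) (suc j) r (e ∷ b) c = lookup-unit i j r b c

    shiftedDet-cong : ∀ {v w : Fin N → Carrier} → (∀ i → v i ≈ w i) → shiftedDet 0 v ≈ shiftedDet 0 w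
    shiftedDet-cong e = det-cong N (tabulate-≋ N (λ j s → *-congˡ (+-congˡ (-‿cong (e j)))))

    powProd-iterated : ∀ la (v : Fin N → Carrier) →
      ev (powProd la) (λ e → lift e * shiftedDet 0 (λ i → v i + α * ι (V.lookup e i))) ≈ iterated la v
    powProd-iterated [] v = trans (ev-powProd-[] (λ e → lift e * shiftedDet 0 (λ i → v i + α * ι (V.lookup e i)))) (trans (*-cong mono-0 (shiftedDet-cong (λ i → trans (+-congˡ (trans (*-congˡ (reflexive (≡.cong ι (VP.lookup-replicate i 0)))) (zeroʳ α))) (+-identityʳ _)))) (*-identityˡ _))
    powProd-iterated (r ∷ la) v = trans (ev-powProd-∷ r la _) (Σ-cong (allFin N) (λ i → trans
      (ev-cong (powProd la) (λ b → trans (*-cong (trans (Multiplicative.μ-⊕ lift-multiplicative _ _) (*-congʳ (μ-unit lift lift-multiplicative i (suc r))))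
          (shiftedDet-cong (λ j → trans (+-congˡ (lookup-unit i j (suc r) b α)) (sym (+-assoc _ _ _))))) (*-assoc _ _ _)))
      (trans (ev-*ˡ (powProd la) (x i ^ suc r) _) (*-congˡ (powProd-iterated la (λ j → v j + single i j (α * ι (suc r))))))))

  numS-iterated : ∀ f → toP (numS N (π N f)) ≈ ev f (λ la → iterated la (λ _ → 0#))
  numS-iterated f = trans (toP-numS (π N f)) (trans (ev-cong (π N f) (λ e → trans (det-entries e) (*-congˡ (shiftedDet-cong (λ i → sym (+-identityˡ _))))))
    (trans (ev-π f _) (ev-cong f (λ la → powProd-iterated la (λ _ → 0#)))))

-- Exponent vectors, their supports, and regularity of variable differences.

zeroCount : List ℕ → ℕ
zeroCount [] = 0
zeroCount (zero ∷ e) = suc (zeroCount e)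
zeroCount (suc _ ∷ e) = zeroCount e

support : ∀ {m} → Vec ℕ m → List ℕ
support e = nonzeros (V.toList e)

support-count : ∀ {m} (e : Vec ℕ m) → length (support e) ℕ.+ zeroCount (V.toList e) ≡ m
support-count [] = ≡.refl
support-count (zero ∷ e) = ≡.trans (ℕP.+-suc (length (support e)) _) (≡.cong suc (support-count e))
support-count (suc a ∷ e) = ≡.cong suc (support-count e)

module Enumeration (R : CRing) where
  open Kit R
  open Augmented R
  open MonomialHom R using (prodV)

  sumTo : ℕ → (ℕ → Carrier) → Carrier
  sumTo zero h = 0#
  sumTo (suc n) h = h 0 + sumTo n (λ k → h (suc k))

  Σ-applyUpTo : ∀ {A : Set} (f : ℕ → A) n (h : A → Carrier) → Σ (applyUpTo f n) h ≈ sumTo n (λ k → h (f k))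
  Σ-applyUpTo f zero h = refl
  Σ-applyUpTo f (suc n) h = +-congˡ (Σ-applyUpTo (λ k → f (suc k)) n h)

  sumTo-cong : ∀ n {f g} → (∀ k → k < n → f k ≈ g k) → sumTo n f ≈ sumTo n g
  sumTo-cong zero e = refl
  sumTo-cong (suc n) e = +-cong (e 0 (s≤s z≤n)) (sumTo-cong n (λ k p → e (suc k) (s≤s p)))

  sumTo-zero : ∀ n {f} → (∀ k → k < n → f k ≈ 0#) → sumTo n f ≈ 0#
  sumTo-zero zero e = refl
  sumTo-zero (suc n) e = trans (+-cong (e 0 (s≤s z≤n)) (sumTo-zero n (λ k p → e (suc k) (s≤s p)))) (+-identityˡ _)

  sumTo-single : ∀ n k f → k < n → (∀ j → j < n → ¬ j ≡ k → f j ≈ 0#) → sumTo n f ≈ f k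
  sumTo-single (suc n) zero f p e = trans (+-congˡ (sumTo-zero n (λ j q → e (suc j) (s≤s q) (λ ())))) (+-identityʳ _)
  sumTo-single (suc n) (suc k) f (s≤s p) e = trans (+-cong (e 0 (s≤s z≤n) (λ ()))
    (sumTo-single n k (λ j → f (suc j)) p (λ j q j≢k → e (suc j) (s≤s q) (λ { ≡.refl → j≢k ≡.refl })))) (+-identityˡ _)

  Σ-upTo : ∀ n h → Σ (upTo n) h ≈ sumTo n h
  Σ-upTo n h = Σ-applyUpTo (λ k → k) n h

  powers-sumTo : ∀ B z H → powers B z H ≈ sumTo B (λ n → z ^ suc n * H (suc n))
  powers-sumTo zero z H = refl
  powers-sumTo (suc B) z H = trans (*-congˡ (+-congˡ (powers-sumTo B z (λ n → H (suc n))))) (trans (distribˡ _ _ _)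
    (+-cong (*-congʳ (sym (*-identityʳ z))) (scale B (λ n → z ^ suc n * H (suc (suc n))) (λ n → z * z ^ suc n * H (suc (suc n))) (λ n → sym (*-assoc _ _ _)))))
    where
    scale : ∀ n f g → (∀ k → z * f k ≈ g k) → z * sumTo n f ≈ sumTo n g
    scale zero f g e = zeroʳ z
    scale (suc n) f g e = trans (distribˡ _ _ _) (+-cong (e 0) (scale n _ _ (λ k → e (suc k))))

  S2-powers : ∀ {A : Set} (J : List A) B z (G : ℕ → List A → List A → Carrier) → S2 J (λ K Z → powers B z (λ n → G n K Z)) ≈ powers B z (λ n → S2 J (G n))
  S2-powers [] B z G = refl
  S2-powers (j ∷ J) B z G = trans (+-cong (S2-powers J B z _) (S2-powers J B z _)) (sym (powers-+ B z _ _))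

  -- A set K of variables with positive exponents on it is the same as an exponent vector that
  -- vanishes exactly outside K.
  exponent-sum : ∀ {A : Set} m (g : Fin m → A) (x : A → Carrier) B (G : ℕ → ℕ → List ℕ → Carrier) →
    S2 (L.tabulate g) (λ K Z → expSum x B K (G (length K) (length Z))) ≈
    Σ (allVecs m B) (λ e → prodV (λ i → x (g i)) e * G (length (support e)) (zeroCount (V.toList e)) (support e))
  exponent-sum zero g x B G = solve 1 (λ a → a := con (+ 1) :* a :+ con (+ 0)) refl _
  exponent-sum (suc m) g x B G = begin
    S2 tail (λ K Z → powers B z (λ n → expSum x B K (λ γ → G (suc (length K)) (length Z) (n ∷ γ)))) + S2 tail (λ K Z → expSum x B K (G (length K) (suc (length Z))))
      ≈⟨ +-cong (trans (S2-powers tail B z _) (powers-cong B z (λ n → exponent-sum m (λ i → g (suc i)) x B (λ a b γ → G (suc a) b (n ∷ γ)))))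
           (exponent-sum m (λ i → g (suc i)) x B (λ a b → G a (suc b))) ⟩
    powers B z (λ n → Σ (allVecs m B) (λ e → prodV y e * G (suc (length (support e))) (zeroCount (V.toList e)) (n ∷ support e)))
      + Σ (allVecs m B) (λ e → prodV y e * G (length (support e)) (suc (zeroCount (V.toList e))) (support e))
      ≈⟨ +-comm _ _ ⟩
    Σ (allVecs m B) (λ e → prodV y e * G (length (support e)) (suc (zeroCount (V.toList e))) (support e))
      + powers B z (λ n → Σ (allVecs m B) (λ e → prodV y e * G (suc (length (support e))) (zeroCount (V.toList e)) (n ∷ support e)))
      ≈⟨ +-cong (trans (Σ-cong (allVecs m B) (λ e → *-congʳ (sym (*-identityˡ _)))) (sym (Σ-map (0 ∷_) (allVecs m B) _)))
           (trans (powers-sumTo B z _) (trans (sumTo-cong B (λ n _ → trans (sym (Σ-*ˡ (allVecs m B) _ _))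
             (trans (Σ-cong (allVecs m B) (λ e → sym (*-assoc _ _ _))) (sym (Σ-map (suc n ∷_) (allVecs m B) _))))) (sym (Σ-applyUpTo suc B _)))) ⟩
    Σ (map (0 ∷_) (allVecs m B)) term + Σ (applyUpTo suc B) (λ a → Σ (map (a ∷_) (allVecs m B)) term)
      ≈⟨ sym (Σ-concatMap (λ a → map (a ∷_) (allVecs m B)) (upTo (suc B)) term) ⟩
    Σ (allVecs (suc m) B) term ∎
    where
    tail = L.tabulate (λ i → g (suc i))
    z = x (g zero)
    y : Fin m → Carrier
    y i = x (g (suc i))
    term : Vec ℕ (suc m) → Carrier
    term e = prodV (λ i → x (g i)) e * G (length (support e)) (zeroCount (V.toList e)) (support e)

  -- Groups the vectors by the number k of nonzero entries; the number of zeros is then m - k, the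
  -- length needed for the rising factor.
  layers : ∀ m B (G : ℕ → ℕ → Carrier) (f : Vec ℕ m → Carrier) →
    Σ (allVecs m B) (λ e → G (length (support e)) (zeroCount (V.toList e)) * f e) ≈
    Σ (upTo (suc m)) (λ k → G k (m ∸ k) * Σ (allVecs m B) (λ e → if does (length (support e) ℕ.≟ k) then f e else 0#))
  layers m B G f = begin
    Σ (allVecs m B) (λ e → G (length (support e)) (zeroCount (V.toList e)) * f e)
      ≈⟨ Σ-cong (allVecs m B) (λ e → sym (layer e)) ⟩
    Σ (allVecs m B) (λ e → Σ (upTo (suc m)) (λ k → G k (m ∸ k) * (if does (length (support e) ℕ.≟ k) then f e else 0#)))
      ≈⟨ Σ-swap (allVecs m B) (upTo (suc m)) _ ⟩
    Σ (upTo (suc m)) (λ k → Σ (allVecs m B) (λ e → G k (m ∸ k) * (if does (length (support e) ℕ.≟ k) then f e else 0#)))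
      ≈⟨ Σ-cong (upTo (suc m)) (λ k → Σ-*ˡ (allVecs m B) _ _) ⟩
    Σ (upTo (suc m)) (λ k → G k (m ∸ k) * Σ (allVecs m B) (λ e → if does (length (support e) ℕ.≟ k) then f e else 0#)) ∎
    where
    layer : ∀ e → Σ (upTo (suc m)) (λ k → G k (m ∸ k) * (if does (length (support e) ℕ.≟ k) then f e else 0#)) ≈ G (length (support e)) (zeroCount (V.toList e)) * f e
    layer e = trans (Σ-upTo (suc m) _) (trans
      (sumTo-single (suc m) n (λ k → G k (m ∸ k) * (if does (n ℕ.≟ k) then f e else 0#)) (s≤s (ℕP.≤-trans (ℕP.m≤m+n n _) (ℕP.≤-reflexive (support-count e))))
        (λ j _ j≢n → trans (*-congˡ (reflexive (≡.cong (λ b → if b then f e else 0#) (dec-false (n ℕ.≟ j) (λ e → j≢n (≡.sym e)))))) (zeroʳ _)))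
      (*-cong (reflexive (≡.cong (G n) (≡.trans (≡.cong (_∸ n) (≡.sym (support-count e))) (ℕP.m+n∸m≡n n _))))
        (reflexive (≡.cong (λ b → if b then f e else 0#) (dec-true (n ℕ.≟ n) ≡.refl)))))
      where n = length (support e)

-- If x_l p = x_j p, moving one unit of exponent at a time from j to l equates every coefficient of p
-- with one that vanishes because its monomial is not divisible by x_j.
module VariableDifferences (n : ℕ) where
  open PolynomialRing n
  open Kit Polynomials
  private
    module E = Evaluation 𝔽 idᴴ
    _≟_ : DecidableEquality (Mono n)
    _≟_ = VP.≡-dec ℕ._≟_
    _⊕_ : Mono n → Mono n → Mono n
    _⊕_ = V.zipWith ℕ._+_
    δ : Mono n → Mono n → Fᴷ.Carrier
    δ = E.indicator _≟_ (λ e → e)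

    vec-ext : ∀ {m} {a b : Vec ℕ m} → (∀ i → V.lookup a i ≡ V.lookup b i) → a ≡ b
    vec-ext {a = a} {b} e = ≡.trans (≡.sym (VP.tabulate∘lookup a)) (≡.trans (VP.tabulate-cong e) (VP.tabulate∘lookup b))

    ⊕-lookup : ∀ (a b : Mono n) i → V.lookup (a ⊕ b) i ≡ V.lookup a i ℕ.+ V.lookup b i
    ⊕-lookup a b i = VP.lookup-zipWith ℕ._+_ i a b

    ⊕-cancel : ∀ (a b c : Mono n) → a ⊕ b ≡ a ⊕ c → b ≡ c
    ⊕-cancel a b c e = vec-ext (λ i → ℕP.+-cancelˡ-≡ (V.lookup a i) _ _ (≡.trans (≡.sym (⊕-lookup a b i)) (≡.trans (≡.cong (λ v → V.lookup v i) e) (⊕-lookup a c i))))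

    δ-⊕ : ∀ m e b → δ (m ⊕ e) (m ⊕ b) Fᴷ.≈ δ e b
    δ-⊕ m e b with b ≟ e
    ... | yes b≡e = Fᴷ.reflexive (≡.cong (λ d → if d then Fᴷ.1# else Fᴷ.0#) (dec-true ((m ⊕ b) ≟ (m ⊕ e)) (≡.cong (m ⊕_) b≡e)))
    ... | no b≢e = Fᴷ.reflexive (≡.cong (λ d → if d then Fᴷ.1# else Fᴷ.0#) (dec-false ((m ⊕ b) ≟ (m ⊕ e)) (λ q → b≢e (⊕-cancel m b e q))))

    unit : Fin n → Mono n
    unit i = unitExp i 1

    unit-self : ∀ i → V.lookup (unit i) i ≡ 1
    unit-self i = ≡.trans (VP.lookup∘tabulate _ i) (≡.cong (λ b → if b then 1 else 0) (dec-true (i Fin.≟ i) ≡.refl))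

    unit-other : ∀ i j → ¬ i ≡ j → V.lookup (unit i) j ≡ 0
    unit-other i j i≢j = ≡.trans (VP.lookup∘tabulate _ j) (≡.cong (λ b → if b then 1 else 0) (dec-false (i Fin.≟ j) i≢j))

    module _ (l j : Fin n) (l≢j : ¬ l ≡ j) (p : Poly n)
             (sym-l-j : ∀ (g : Mono n → Fᴷ.Carrier) → E.ev p (λ b → g (unit l ⊕ b)) Fᴷ.≈ E.ev p (λ b → g (unit j ⊕ b))) where

      coefficient-zero : ∀ k e → V.lookup e j ≡ k → E.ev p (δ e) Fᴷ.≈ Fᴷ.0#
      coefficient-zero k e ej = Fᴷ.trans (E.ev-cong p (λ b → Fᴷ.sym (δ-⊕ (unit l) e b))) (Fᴷ.trans (sym-l-j (δ (unit l ⊕ e))) (case k ej))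
        where
        case : ∀ k → V.lookup e j ≡ k → E.ev p (λ b → δ (unit l ⊕ e) (unit j ⊕ b)) Fᴷ.≈ Fᴷ.0#
        case zero ej = Fᴷ.trans (E.ev-cong p (λ b → Fᴷ.reflexive (≡.cong (λ d → if d then Fᴷ.1# else Fᴷ.0#) (dec-false ((unit j ⊕ b) ≟ (unit l ⊕ e)) (absurd b)))))
          (Fᴷ.trans (Fᴷ.Σ-cong p (λ _ → Fᴷ.zeroʳ _)) (Fᴷ.Σ-0 p))
          where
          absurd : ∀ b → ¬ (unit j ⊕ b) ≡ (unit l ⊕ e)
          absurd b q = ℕP.1+n≢0 (≡.trans (≡.sym (≡.cong (ℕ._+ V.lookup b j) (unit-self j))) (≡.trans (≡.sym (⊕-lookup (unit j) b j))
            (≡.trans (≡.cong (λ v → V.lookup v j) q) (≡.trans (⊕-lookup (unit l) e j) (≡.cong₂ ℕ._+_ (unit-other l j l≢j) ej)))))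
        case (suc k) ej = Fᴷ.trans (E.ev-cong p (λ b → Fᴷ.trans (Fᴷ.reflexive (≡.cong (λ v → δ v (unit j ⊕ b)) (≡.sym e′-spec))) (δ-⊕ (unit j) e′ b)))
          (coefficient-zero k e′ e′j)
          where
          e′ : Mono n
          e′ = V.zipWith _∸_ (unit l ⊕ e) (unit j)
          e′-lookup : ∀ i → V.lookup e′ i ≡ (V.lookup (unit l) i ℕ.+ V.lookup e i) ∸ V.lookup (unit j) i
          e′-lookup i = ≡.trans (VP.lookup-zipWith _∸_ i (unit l ⊕ e) (unit j)) (≡.cong (_∸ V.lookup (unit j) i) (⊕-lookup (unit l) e i))
          e′j : V.lookup e′ j ≡ k
          e′j = ≡.trans (e′-lookup j) (≡.cong₂ _∸_ (≡.cong₂ ℕ._+_ (unit-other l j l≢j) ej) (unit-self j))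
          e′-spec : unit j ⊕ e′ ≡ unit l ⊕ e
          e′-spec = vec-ext (λ i → ≡.trans (⊕-lookup (unit j) e′ i) (≡.trans (≡.cong (V.lookup (unit j) i ℕ.+_) (e′-lookup i))
            (≡.trans (ℕP.m+[n∸m]≡n (below i)) (≡.sym (⊕-lookup (unit l) e i)))))
            where
            below : ∀ i → V.lookup (unit j) i ≤ V.lookup (unit l) i ℕ.+ V.lookup e i
            below i with j Fin.≟ i
            ... | yes ≡.refl = ℕP.≤-trans (ℕP.≤-reflexive (unit-self j)) (ℕP.≤-trans (ℕP.≤-trans (s≤s z≤n) (ℕP.≤-reflexive (≡.sym ej))) (ℕP.m≤n+m _ _))
            ... | no j≢i = ℕP.≤-trans (ℕP.≤-reflexive (unit-other j i j≢i)) z≤n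

  variable-difference-regular : ∀ l j → ¬ l ≡ j → NonZeroDivisor Polynomials (mono (unitExp l 1) + - mono (unitExp j 1))
  variable-difference-regular l j l≢j a e with toP-surjective a
  ... | p , p≈a = trans (sym p≈a) (trans (toP-cong {p} {0P} (λ m → toF-injective (Fᴷ.trans (coeff-ev p m)
        (Fᴷ.trans (coefficient-zero l j l≢j p symmetric (V.lookup m j) m ≡.refl) (Fᴷ.sym toF-0))))) toP-0)
    where
    u∷ : Fin n → Poly n
    u∷ i = (unit i , 1F) ∷ []
    products : (u∷ l *P p) ≈P (u∷ j *P p)
    products = toP-injective (begin
      toP (u∷ l *P p)                      ≈⟨ trans (toP-* (u∷ l) p) (*-congˡ p≈a) ⟩
      mono (unit l) * a                    ≈⟨ solve 3 (λ x y a → x :* a := (x :- y) :* a :+ y :* a) refl (mono (unit l)) (mono (unit j)) a ⟩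
      (mono (unit l) + - mono (unit j)) * a + mono (unit j) * a   ≈⟨ trans (+-congʳ e) (+-identityˡ _) ⟩
      mono (unit j) * a                    ≈⟨ sym (trans (toP-* (u∷ j) p) (*-congˡ p≈a)) ⟩
      toP (u∷ j *P p) ∎)
    times-unit : ∀ i g → E.ev (u∷ i *P p) g Fᴷ.≈ E.ev p (λ b → g (unit i ⊕ b))
    times-unit i g = Fᴷ.trans (E.ev-mul _⊕_ (u∷ i) p g) (Fᴷ.trans (Fᴷ.+-identityʳ _) (Fᴷ.trans (Fᴷ.*-congʳ E.scalar-1) (Fᴷ.*-identityˡ _)))
    symmetric : ∀ (g : Mono n → Fᴷ.Carrier) → E.ev p (λ b → g (unit l ⊕ b)) Fᴷ.≈ E.ev p (λ b → g (unit j ⊕ b))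
    symmetric g = Fᴷ.trans (Fᴷ.sym (times-unit l g)) (Fᴷ.trans (≈P⇒ev 𝔽 idᴴ (u∷ l *P p) (u∷ j *P p) products g) (times-unit j g))

-- Partitions and multiplicities

sort-↭ : ∀ xs → sortℕ xs ↭ xs
sort-↭ = SortingAlgorithm.sort-↭ mergeSort

sort-≡⇒↭ : ∀ {xs ys} → sortℕ xs ≡ sortℕ ys → xs ↭ ys
sort-≡⇒↭ {xs} {ys} e = ↭-trans (↭-sym (sort-↭ xs)) (≡.subst (_↭ ys) (≡.sym e) (sort-↭ ys))

↭⇒sort-≡ : ∀ {xs ys} → xs ↭ ys → sortℕ xs ≡ sortℕ ys
↭⇒sort-≡ {xs} {ys} p = ≋⇒≡ (SortedP.↗↭↗⇒≋ ℕP.≤-totalOrder (SortingAlgorithm.sort-↗ mergeSort xs) (SortingAlgorithm.sort-↗ mergeSort ys)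
  (↭⇒↭ₛ (↭-trans (sort-↭ xs) (↭-trans p (↭-sym (sort-↭ ys))))))

-- Built from the comparison of sorted lists that occurs in `msym`, so that its `does` agrees
-- definitionally with the test made there.
↭? : ∀ (ix jx : List ℕ) → Dec (ix ↭ jx)
↭? ix jx = map′ sort-≡⇒↭ ↭⇒sort-≡ (LP.≡-dec ℕ._≟_ (sortℕ ix) (sortℕ jx))

count-here : ∀ x la → count x (x ∷ la) ≡ suc (count x la)
count-here x la = ≡.cong (λ b → if b then suc (count x la) else count x la) (dec-true (x ℕ.≟ x) ≡.refl)

count-there : ∀ {x r} la → ¬ x ≡ r → count r (x ∷ la) ≡ count r la
count-there {x} {r} la x≢r = ≡.cong (λ b → if b then suc (count r la) else count r la) (dec-false (x ℕ.≟ r) x≢r)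

count-↭ : ∀ r {la mu} → la ↭ mu → count r la ≡ count r mu
count-↭ r Perm.refl = ≡.refl
count-↭ r (prep x p) = ≡.cong (λ n → if does (x ℕ.≟ r) then suc n else n) (count-↭ r p)
count-↭ r (swap {xs} {ys} x y p) = ≡.trans
  (≡.cong (λ n → if does (x ℕ.≟ r) then suc (if does (y ℕ.≟ r) then suc n else n) else (if does (y ℕ.≟ r) then suc n else n)) (count-↭ r p))
  (exchange (does (x ℕ.≟ r)) (does (y ℕ.≟ r)) (count r ys))
  where
  exchange : ∀ a b (n : ℕ) → _≡_ {A = ℕ} (if a then suc (if b then suc n else n) else (if b then suc n else n)) (if b then suc (if a then suc n else n) else (if a then suc n else n))
  exchange true true n = ≡.refl
  exchange true false n = ≡.refl
  exchange false true n = ≡.refl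
  exchange false false n = ≡.refl
count-↭ r (Perm.trans p q) = ≡.trans (count-↭ r p) (count-↭ r q)

count-above : ∀ la {r} → maxℕ la < r → count r la ≡ 0
count-above [] p = ≡.refl
count-above (x ∷ la) {r} p = ≡.trans (count-there la (λ e → ℕP.<-irrefl e (ℕP.≤-<-trans (ℕP.m≤m⊔n x (maxℕ la)) p)))
  (count-above la (ℕP.≤-<-trans (ℕP.m≤n⊔m x (maxℕ la)) p))

count-map-suc : ∀ r la → count (suc r) (map suc la) ≡ count r la
count-map-suc r [] = ≡.refl
count-map-suc r (x ∷ la) = ≡.cong (λ n → if does (x ℕ.≟ r) then suc n else n) (count-map-suc r la)

module MultiplicityProducts (R : CRing) where
  open Kit R

  prodTo : ℕ → (ℕ → Carrier) → Carrier
  prodTo zero h = 1#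
  prodTo (suc n) h = h 0 * prodTo n (λ k → h (suc k))

  prodTo-cong : ∀ n {f g} → (∀ k → k < n → f k ≈ g k) → prodTo n f ≈ prodTo n g
  prodTo-cong zero e = refl
  prodTo-cong (suc n) e = *-cong (e 0 (s≤s z≤n)) (prodTo-cong n (λ k p → e (suc k) (s≤s p)))

  prodTo-extend : ∀ n m h → n ≤ m → (∀ k → n ≤ k → h k ≈ 1#) → prodTo m h ≈ prodTo n h
  prodTo-extend zero zero h p e = refl
  prodTo-extend zero (suc m) h p e = trans (*-cong (e 0 z≤n) (prodTo-extend zero m (λ k → h (suc k)) z≤n (λ k _ → e (suc k) z≤n))) (*-identityˡ _)
  prodTo-extend (suc n) (suc m) h (s≤s p) e = *-congˡ (prodTo-extend n m (λ k → h (suc k)) p (λ k q → e (suc k) (s≤s q)))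

  prodTo-update : ∀ n x c h h′ → x < n → h x ≈ c * h′ x → (∀ k → ¬ k ≡ x → h k ≈ h′ k) → prodTo n h ≈ c * prodTo n h′
  prodTo-update (suc n) zero c h h′ p e f = trans (*-cong e (prodTo-cong n (λ k _ → f (suc k) (λ ())))) (*-assoc _ _ _)
  prodTo-update (suc n) (suc x) c h h′ (s≤s p) e f = trans
    (*-cong (f 0 (λ ())) (prodTo-update n x c (λ k → h (suc k)) (λ k → h′ (suc k)) p e (λ k k≢x → f (suc k) (λ e → k≢x (ℕP.suc-injective e)))))
    (solve 3 (λ a c b → a :* (c :* b) := c :* (a :* b)) refl _ _ _)

  ι-product : ∀ {A : Set} (f : A → ℕ) L → ι (product (map f L)) ≈ prodOver (λ a → ι (f a)) L
  ι-product f [] = +-identityʳ _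
  ι-product f (a ∷ L) = trans (ι-* (f a) _) (*-congˡ (ι-product f L))

  prodOver-applyUpTo : ∀ {A : Set} (h : A → Carrier) (f : ℕ → A) n → prodOver h (applyUpTo f n) ≈ prodTo n (λ k → h (f k))
  prodOver-applyUpTo h f zero = refl
  prodOver-applyUpTo h f (suc n) = *-congˡ (prodOver-applyUpTo h (λ k → f (suc k)) n)

  -- ∏_r φ r (multiplicity of r in la)
  module _ (φ ψ : ℕ → ℕ → ℕ) (φ-0 : ∀ r → φ r 0 ≡ 1) (φ-suc : ∀ r n → φ r (suc n) ≡ ψ r n ℕ.* φ r n) where

    countProduct : List ℕ → Carrier
    countProduct la = ι (product (map (λ r → φ r (count r la)) (upTo (suc (maxℕ la)))))

    private
      upToBound : ∀ B la → maxℕ la < B → countProduct la ≈ prodTo B (λ r → ι (φ r (count r la)))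
      upToBound B la p = trans (ι-product (λ r → φ r (count r la)) (upTo (suc (maxℕ la))))
        (trans (prodOver-applyUpTo (λ r → ι (φ r (count r la))) (λ k → k) (suc (maxℕ la)))
        (sym (prodTo-extend (suc (maxℕ la)) B _ p (λ k q → trans (reflexive (≡.cong (λ n → ι n) (≡.trans (≡.cong (φ k) (count-above la q)) (φ-0 k)))) (+-identityʳ _)))))

    -- A common upper bound is chosen for the two products; then only the factor at x differs, by
    -- the quotient ψ of consecutive values of φ.
    countProduct-∷ : ∀ x la → countProduct (x ∷ la) ≈ ι (ψ x (count x la)) * countProduct la
    countProduct-∷ x la = trans (upToBound B (x ∷ la) ℕP.≤-refl) (trans
      (prodTo-update B x _ _ (λ r → ι (φ r (count r la))) (s≤s (ℕP.m≤m⊔n x (maxℕ la)))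
        (trans (reflexive (≡.cong ι (≡.trans (≡.cong (φ x) (count-here x la)) (φ-suc x _)))) (ι-* (ψ x (count x la)) _))
        (λ k k≢x → reflexive (≡.cong (λ n → ι (φ k n)) (count-there la (λ e → k≢x (≡.sym e))))))
      (*-congˡ (sym (upToBound B la (s≤s (ℕP.m≤n⊔m x (maxℕ la)))))))
      where B = suc (maxℕ (x ∷ la))

    countProduct-↭ : ∀ {la mu} → la ↭ mu → countProduct la ≈ countProduct mu
    countProduct-↭ {la} {mu} p = trans (upToBound B la (s≤s (ℕP.m≤m+n _ _))) (trans
      (prodTo-cong B (λ k _ → reflexive (≡.cong (λ n → ι (φ k n)) (count-↭ k p))))
      (sym (upToBound B mu (s≤s (ℕP.m≤n+m _ _)))))
      where B = suc (maxℕ la ℕ.+ maxℕ mu)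

module Picks (R : CRing) where
  open Kit R

  P-cong-↭ : ∀ {A : Set} (L : List A) {f g : A → List A → Carrier} → (∀ b M → L ↭ b ∷ M → f b M ≈ g b M) → P L f ≈ P L g
  P-cong-↭ [] e = refl
  P-cong-↭ (a ∷ L) e = +-cong (e a L ↭-refl) (P-cong-↭ L (λ b M p → e b (a ∷ M) (↭-trans (prep a p) (swap a b ↭-refl))))

  P-count : ∀ r (L : List ℕ) v → P L (λ b _ → if does (b ℕ.≟ r) then v else 0#) ≈ ι (count r L) * v
  P-count r [] v = sym (zeroˡ _)
  P-count r (a ∷ L) v = trans (+-congˡ (P-count r L v)) (step (does (a ℕ.≟ r)))
    where
    step : ∀ b → (if b then v else 0#) + ι (count r L) * v ≈ ι (if b then suc (count r L) else count r L) * v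
    step true = solve 2 (λ n v → v :+ n :* v := (con (+ 1) :+ n) :* v) refl _ _
    step false = +-identityˡ _

  P-zero : ∀ {A : Set} (L : List A) → P L (λ _ _ → 0#) ≈ 0#
  P-zero [] = refl
  P-zero (a ∷ L) = trans (+-identityˡ _) (P-zero L)

  -- A function supported on pairs of permuted lists, expanded along the first entry of the left one.
  match-∷ : ∀ (m : List ℕ → List ℕ → Carrier) (v : List ℕ → Carrier) (c : ℕ → Carrier) →
    (∀ {s κ} → s ↭ κ → m s κ ≈ v s) → (∀ {s κ} → ¬ (s ↭ κ) → m s κ ≈ 0#) → (∀ r s → v (r ∷ s) ≈ c r * ι (suc (count r s)) * v s) →
    ∀ r s κ → m (r ∷ s) κ ≈ P κ (λ b κ′ → (if does (b ℕ.≟ r) then c r else 0#) * m s κ′)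
  match-∷ m v c m-↭ m-¬↭ v-∷ r s κ = case (↭? (r ∷ s) κ)
    where
    test-true : ∀ x → (if does (r ℕ.≟ r) then x else 0#) ≈ x
    test-true x = reflexive (≡.cong (λ t → if t then x else 0#) (dec-true (r ℕ.≟ r) ≡.refl))
    test-false : ∀ {b} → ¬ b ≡ r → ∀ x → (if does (b ℕ.≟ r) then x else 0#) ≈ 0#
    test-false {b} b≢r x = reflexive (≡.cong (λ t → if t then x else 0#) (dec-false (b ℕ.≟ r) b≢r))
    matched : (r ∷ s) ↭ κ → ∀ b κ′ → κ ↭ b ∷ κ′ → (if does (b ℕ.≟ r) then c r * v s else 0#) ≈ (if does (b ℕ.≟ r) then c r else 0#) * m s κ′
    matched p b κ′ q with b ℕ.≟ r
    ... | no b≢r = trans (test-false b≢r _) (sym (trans (*-congʳ (test-false b≢r _)) (zeroˡ _)))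
    ... | yes ≡.refl = trans (test-true _) (sym (*-cong (test-true _) (m-↭ (PermP.drop-∷ (↭-trans p q)))))
    unmatched : ¬ ((r ∷ s) ↭ κ) → ∀ b κ′ → κ ↭ b ∷ κ′ → (if does (b ℕ.≟ r) then c r else 0#) * m s κ′ ≈ 0#
    unmatched ¬p b κ′ q with b ℕ.≟ r
    ... | no b≢r = trans (*-congʳ (test-false b≢r _)) (zeroˡ _)
    ... | yes ≡.refl = trans (*-congˡ (m-¬↭ (λ t → ¬p (↭-trans (prep b t) (↭-sym q))))) (zeroʳ _)
    case : Dec ((r ∷ s) ↭ κ) → m (r ∷ s) κ ≈ P κ (λ b κ′ → (if does (b ℕ.≟ r) then c r else 0#) * m s κ′)
    case (yes p) = begin
      m (r ∷ s) κ                              ≈⟨ trans (m-↭ p) (v-∷ r s) ⟩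
      c r * ι (suc (count r s)) * v s          ≈⟨ solve 3 (λ c n v → c :* n :* v := n :* (c :* v)) refl _ _ _ ⟩
      -- The number of entries of κ that can be matched with the head r is the multiplicity of r in
      -- r ∷ s.
      ι (suc (count r s)) * (c r * v s)        ≈⟨ *-congʳ (reflexive (≡.cong ι (≡.trans (≡.sym (count-here r s)) (count-↭ r p)))) ⟩
      ι (count r κ) * (c r * v s)              ≈⟨ sym (P-count r κ (c r * v s)) ⟩
      P κ (λ b κ′ → if does (b ℕ.≟ r) then c r * v s else 0#)   ≈⟨ P-cong-↭ κ (matched p) ⟩
      P κ (λ b κ′ → (if does (b ℕ.≟ r) then c r else 0#) * m s κ′) ∎
    case (no ¬p) = trans (m-¬↭ ¬p) (sym (trans (P-cong-↭ κ (unmatched ¬p)) (P-zero κ)))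

module DualProduct (R : CRing) where
  open Kit R
  open DualNumbers R hiding (Dual)
  private
    module D where
      open Kit (Dual R) public
    module Re = HomProps real

  εpart-product : ∀ {A : Set} (d : A → D.Carrier) κ →
    εpart (D.prodOver d κ) ≈ P κ (λ b κ′ → εpart (d b) * prodOver (λ a → Re.⟦ d a ⟧) κ′)
  εpart-product d [] = trans (εpart-cong (D.sym (HomProps.1-homo embed))) (εpart-emb 1#)
  εpart-product d (b ∷ κ) = begin
    εpart (d b D.* D.prodOver d κ)
      ≈⟨ trans (εpart-* _ _) (+-cong (*-congˡ (εpart-product d κ)) (*-congˡ (Re.prodOver-homo d κ))) ⟩
    Re.⟦ d b ⟧ * P κ (λ b κ′ → εpart (d b) * prodOver (λ a → Re.⟦ d a ⟧) κ′) + εpart (d b) * prodOver (λ a → Re.⟦ d a ⟧) κ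
      ≈⟨ trans (+-comm _ _) (+-congˡ (trans (sym (P-*ˡ κ _ _)) (P-cong κ (λ c κ′ → solve 3 (λ x y z → x :* (y :* z) := y :* (x :* z)) refl _ _ _)))) ⟩
    P (b ∷ κ) (λ b κ′ → εpart (d b) * prodOver (λ a → Re.⟦ d a ⟧) κ′) ∎

-- The bilinear form on products of power sums.

module Pairing where
  private
    module E = Evaluation 𝔽 idᴴ
    module Pk = Picks 𝔽

  open Towers 𝔽 (toF αF)

  zΦ zΨ : ℕ → ℕ → ℕ
  zΦ r n = r ℕ.^ n ℕ.* (n !)
  zΨ r n = r ℕ.* suc n

  private
    z-0 : ∀ r → zΦ r 0 ≡ 1
    z-0 r = ≡.refl
    z-suc : ∀ r n → zΦ r (suc n) ≡ zΨ r n ℕ.* zΦ r n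
    z-suc r n = ℕP.[m*n]*[o*p]≡[m*o]*[n*p] r (r ℕ.^ n) (suc n) (n !)
    open MultiplicityProducts 𝔽

    zᴷ : List ℕ → Fᴷ.Carrier
    zᴷ = countProduct zΦ zΨ z-0 z-suc

  basisNorm : List ℕ → Fᴷ.Carrier
  basisNorm ix = toF αF Fᴷ.^ length ix Fᴷ.* zᴷ (map suc ix)

  basisPairing : List ℕ → List ℕ → Fᴷ.Carrier
  basisPairing ix jx = toF (pairBasis ix jx)

  private
    toF-pow : ∀ a n → toF (powF a n) Fᴷ.≈ toF a Fᴷ.^ n
    toF-pow a zero = toF-1
    toF-pow a (suc n) = Fᴷ.trans (toF-* a (powF a n)) (Fᴷ.*-congˡ (toF-pow a n))

  basisPairing-↭ : ∀ {ix jx} → ix ↭ jx → basisPairing ix jx Fᴷ.≈ basisNorm ix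
  basisPairing-↭ {ix} {jx} p with LP.≡-dec ℕ._≟_ (sortℕ ix) (sortℕ jx)
  ... | yes _ = Fᴷ.trans (toF-* (powF αF (length ix)) (ℕ→F (zPart (map suc ix)))) (Fᴷ.*-cong (toF-pow αF (length ix)) (toF-ℕ (zPart (map suc ix))))
  ... | no ≢ = ⊥-elim (≢ (↭⇒sort-≡ p))

  basisPairing-¬↭ : ∀ {ix jx} → ¬ (ix ↭ jx) → basisPairing ix jx Fᴷ.≈ Fᴷ.0#
  basisPairing-¬↭ {ix} {jx} ¬p with LP.≡-dec ℕ._≟_ (sortℕ ix) (sortℕ jx)
  ... | yes e = ⊥-elim (¬p (sort-≡⇒↭ e))
  ... | no _ = toF-0

  basisNorm-↭ : ∀ {ix jx} → ix ↭ jx → basisNorm ix Fᴷ.≈ basisNorm jx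
  basisNorm-↭ p = Fᴷ.*-cong (Fᴷ.reflexive (≡.cong (toF αF Fᴷ.^_) (PermP.↭-length p))) (countProduct-↭ zΦ zΨ z-0 z-suc (PermP.map⁺ suc p))

  basisNorm-∷ : ∀ r la → basisNorm (r ∷ la) Fᴷ.≈ toF αF Fᴷ.* Fᴷ.ι (suc r) Fᴷ.* Fᴷ.ι (suc (count r la)) Fᴷ.* basisNorm la
  basisNorm-∷ r la = Fᴷ.trans (Fᴷ.*-congˡ (Fᴷ.trans (countProduct-∷ zΦ zΨ z-0 z-suc (suc r) (map suc la))
      (Fᴷ.*-congʳ (Fᴷ.trans (Fᴷ.ι-* (suc r) (suc (count (suc r) (map suc la)))) (Fᴷ.*-congˡ (Fᴷ.reflexive (≡.cong (λ n → Fᴷ.ι (suc n)) (count-map-suc r la))))))))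
    (Fᴷ.solve 5 (λ a p r c z → a Fᴷ.:* p Fᴷ.:* (r Fᴷ.:* c Fᴷ.:* z) Fᴷ.:= a Fᴷ.:* r Fᴷ.:* c Fᴷ.:* (p Fᴷ.:* z)) Fᴷ.refl _ _ _ _ _)

  -- By the recursion only α and positive integers occur as factors. This is the nondegeneracy of
  -- the form.
  basisNorm-invertible : ∀ la → Units.Invertible 𝔽 (basisNorm la)
  basisNorm-invertible [] = Fᴷ.1# , Fᴷ.trans (Fᴷ.*-identityˡ _) (Fᴷ.trans (Fᴷ.*-identityˡ _) (Fᴷ.+-identityʳ _))
  basisNorm-invertible (r ∷ la) = transport (Fᴷ.sym (basisNorm-∷ r la)) (invertible-* (invertible-* (invertible-* α-invertible (ι-invertible r)) (ι-invertible (count r la))) (basisNorm-invertible la))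
    where
    open Units 𝔽
    transport : ∀ {a b} → a Fᴷ.≈ b → Invertible a → Invertible b
    transport e (v , f) = v , Fᴷ.trans (Fᴷ.*-congˡ (Fᴷ.sym e)) f
    ι-invertible : ∀ n → Invertible (Fᴷ.ι (suc n))
    ι-invertible n = transport (toF-ℕ (suc n)) (ℕ→F-invertible n)

  -- The adjoint of multiplication by p_n is α n ∂/∂p_n, here with n = r + 1; the sum over b is the
  -- derivative of p_κ.
  basisPairing-∷ : ∀ r la κ → basisPairing (r ∷ la) κ Fᴷ.≈ Fᴷ.P κ (λ b κ′ → (if does (b ℕ.≟ r) then toF αF Fᴷ.* Fᴷ.ι (suc r) else Fᴷ.0#) Fᴷ.* basisPairing la κ′)
  basisPairing-∷ = Pk.match-∷ basisPairing basisNorm (λ r → toF αF Fᴷ.* Fᴷ.ι (suc r)) basisPairing-↭ basisPairing-¬↭ basisNorm-∷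

-- Functoriality of dual numbers and towers.

module DualMap {R S : CRing} (φ : Hom R S) where
  private
    module R where
      open Kit R public
      open DualNumbers R public hiding (Dual)
    module φ = HomProps φ
    module DR = Kit (Dual R)
    module ReR = HomProps (DualNumbers.real R)
    module ReS = HomProps (DualNumbers.real S)
  open Kit S
  open DualNumbers S hiding (Dual)
  open φ using (⟦_⟧)

  dualMap : Hom (Dual R) (Dual S)
  dualMap = record
    { ⟦_⟧ = λ a → pair ⟦ ReR.⟦ a ⟧ ⟧ ⟦ R.εpart a ⟧
    ; ⟦⟧-cong = λ e → dual-ext (trans (re-pair _ _) (trans (φ.⟦⟧-cong (ReR.⟦⟧-cong e)) (sym (re-pair _ _))))
                               (trans (εpart-pair _ _) (trans (φ.⟦⟧-cong (R.εpart-cong e)) (sym (εpart-pair _ _))))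
    ; +-homo = λ a b → dual-ext
        (trans (re-pair _ _) (trans (φ.⟦⟧-cong (ReR.+-homo a b)) (trans (φ.+-homo _ _) (sym (trans (ReS.+-homo _ _) (+-cong (re-pair _ _) (re-pair _ _)))))))
        (trans (εpart-pair _ _) (trans (φ.⟦⟧-cong (R.εpart-+ a b)) (trans (φ.+-homo _ _) (sym (trans (εpart-+ _ _) (+-cong (εpart-pair _ _) (εpart-pair _ _)))))))
    ; *-homo = λ a b → dual-ext
        (trans (re-pair _ _) (trans (φ.⟦⟧-cong (ReR.*-homo a b)) (trans (φ.*-homo _ _) (sym (trans (ReS.*-homo _ _) (*-cong (re-pair _ _) (re-pair _ _)))))))
        (trans (εpart-pair _ _) (trans (φ.⟦⟧-cong (R.εpart-* a b)) (trans (trans (φ.+-homo _ _) (+-cong (φ.*-homo _ _) (φ.*-homo _ _)))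
          (sym (trans (εpart-* _ _) (+-cong (*-cong (re-pair _ _) (εpart-pair _ _)) (*-cong (εpart-pair _ _) (re-pair _ _))))))))
    ; 1-homo = dual-ext (trans (re-pair _ _) (trans (φ.⟦⟧-cong ReR.1-homo) (trans φ.1-homo (sym ReS.1-homo))))
        (trans (εpart-pair _ _) (trans (φ.⟦⟧-cong (R.trans (R.εpart-cong (DR.sym (HomProps.1-homo R.embed))) (R.εpart-emb R.1#)))
          (trans φ.0-homo (sym (trans (εpart-cong (CommutativeRing.sym (Dual S) (HomProps.1-homo embed))) (εpart-emb 1#)))))) }

  dualMap-re : ∀ a → ReS.⟦ Hom.⟦_⟧ dualMap a ⟧ ≈ ⟦ ReR.⟦ a ⟧ ⟧
  dualMap-re a = re-pair _ _

  dualMap-ε : ∀ a → εpart (Hom.⟦_⟧ dualMap a) ≈ ⟦ R.εpart a ⟧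
  dualMap-ε a = εpart-pair _ _

  dualMap-pair : ∀ a b → CommutativeRing._≈_ (Dual S) (Hom.⟦_⟧ dualMap (R.pair a b)) (pair ⟦ a ⟧ ⟦ b ⟧)
  dualMap-pair a b = dual-ext (trans (dualMap-re _) (trans (φ.⟦⟧-cong (R.re-pair a b)) (sym (re-pair _ _))))
    (trans (dualMap-ε _) (trans (φ.⟦⟧-cong (R.εpart-pair a b)) (sym (εpart-pair _ _))))

  dualMap-embed : ∀ a → CommutativeRing._≈_ (Dual S) (Hom.⟦_⟧ dualMap (Hom.⟦_⟧ R.embed a)) (Hom.⟦_⟧ embed ⟦ a ⟧)
  dualMap-embed a = dual-ext (trans (dualMap-re _) (trans (φ.⟦⟧-cong (R.re-emb a)) (sym (re-emb _))))
    (trans (dualMap-ε _) (trans (φ.⟦⟧-cong (R.εpart-emb a)) (trans φ.0-homo (sym (εpart-emb _)))))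

towerMap : ∀ {R S} → Hom R S → ∀ n → Hom (Tower R n) (Tower S n)
towerMap φ zero = φ
towerMap φ (suc n) = DualMap.dualMap (towerMap φ n)

towerMap-embed : ∀ {R S} (φ : Hom R S) n a → CommutativeRing._≈_ (Tower S n) (Hom.⟦_⟧ (towerMap φ n) (Hom.⟦_⟧ (towerEmbed R n) a)) (Hom.⟦_⟧ (towerEmbed S n) (Hom.⟦_⟧ φ a))
towerMap-embed {S = S} φ zero a = CommutativeRing.refl S
towerMap-embed {R} {S} φ (suc n) a = CommutativeRing.trans (Tower S (suc n)) (DualMap.dualMap-embed (towerMap φ n) _)
  (Hom.⟦⟧-cong (DualNumbers.embed (Tower S n)) (towerMap-embed φ n a))

module TowerMap {R S : CRing} (φ : Hom R S) (α : CommutativeRing.Carrier R) where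
  private
    module TR = Towers R α
    module TS = Towers S (Hom.⟦_⟧ φ α)
    module S (n : ℕ) = Kit (Tower S n)
    module φ = HomProps φ

  map-dvals : ∀ la n → S._≈_ (length la) (Hom.⟦_⟧ (towerMap φ (length la)) (TR.dvals la n)) (TS.dvals la n)
  map-dvals [] n = φ.0-homo
  map-dvals (r ∷ la) n = S.trans (suc l) (DualMap.dualMap-pair (towerMap φ l) _ _)
    (DualNumbers.dual-ext (Tower S l)
      (S.trans l (DualNumbers.re-pair (Tower S l) _ _) (S.trans l (map-dvals la n) (S.sym l (DualNumbers.re-pair (Tower S l) _ _))))
      (S.trans l (DualNumbers.εpart-pair (Tower S l) _ _) (S.trans l (S.trans l (towerMap-embed φ l _) (Hom.⟦⟧-cong (towerEmbed S l) (if-homo (does (suc r ℕ.≟ n)))))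
        (S.sym l (DualNumbers.εpart-pair (Tower S l) _ _)))))
    where
    l = length la
    module S₀ = Kit S
    module R₀ = Kit R
    if-homo : ∀ b → φ.⟦ if b then α R₀.* R₀.ι (suc r) else R₀.0# ⟧ S₀.≈ (if b then φ.⟦ α ⟧ S₀.* S₀.ι (suc r) else S₀.0#)
    if-homo true = S₀.trans (φ.*-homo _ _) (S₀.*-congˡ (φ.ι-homo (suc r)))
    if-homo false = φ.0-homo

prodOver-↭ : ∀ (R : CRing) (let open Kit R) {A : Set} (f : A → Carrier) {xs ys} → xs ↭ ys → prodOver f xs ≈ prodOver f ys
prodOver-↭ R f Perm.refl = CommutativeRing.refl R
prodOver-↭ R f (prep x p) = CommutativeRing.*-congˡ R (prodOver-↭ R f p)
prodOver-↭ R f (swap x y p) = trans (*-congˡ (*-congˡ (prodOver-↭ R f p))) (solve 3 (λ a b c → a :* (b :* c) := b :* (a :* c)) refl _ _ _)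
  where open Kit R
prodOver-↭ R f (Perm.trans p q) = CommutativeRing.trans R (prodOver-↭ R f p) (prodOver-↭ R f q)

prodOver-++ : ∀ (R : CRing) (let open Kit R) {A : Set} (f : A → Carrier) xs ys → prodOver f (xs ++ ys) ≈ prodOver f xs * prodOver f ys
prodOver-++ R f [] ys = CommutativeRing.sym R (CommutativeRing.*-identityˡ R _)
prodOver-++ R f (x ∷ xs) ys = trans (*-congˡ (prodOver-++ R f xs ys)) (sym (*-assoc _ _ _))
  where open Kit R

-- The adjoint of multiplication, computed in the tower.

module Adjoints where
  open Pairing
  open Towers 𝔽 (toF αF)

  private
    module E = Evaluation 𝔽 idᴴ
    module T (n : ℕ) = Kit (Tower 𝔽 n)
    module D (n : ℕ) = DualNumbers (Tower 𝔽 n)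
    module Re (n : ℕ) = HomProps (DualNumbers.real (Tower 𝔽 n))
    module H (n : ℕ) = HomProps (towerEmbed 𝔽 n)
    zeros : ℕ → Fᴷ.Carrier
    zeros _ = Fᴷ.0#

  dprod : ∀ la → List ℕ → C la
  dprod la κ = T.prodOver (length la) (λ b → dvals la (suc b)) κ

  -- the functional calculus p_r ↦ dvals la r
  θ : ∀ la → Λel → C la
  θ la h = Evaluation.ev (Tower 𝔽 (length la)) (towerEmbed 𝔽 (length la)) h (dprod la)

  -- the element of Λ obtained by applying X to p_la
  Γ : ∀ la → C la → Λel
  Γ [] X = ([] , fromF X) ∷ []
  Γ (r ∷ la) X = map (λ t → (r ∷ proj₁ t) , proj₂ t) (Γ la (Re.⟦_⟧ (length la) X)) ++ Γ la (D.εpart (length la) X)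

  private
    -- The product rule, where the new ε enters d_n only for n = r + 1.
    εpart-dprod : ∀ r la κ → T._≈_ (length la) (D.εpart (length la) (dprod (r ∷ la) κ))
      (T.P (length la) κ (λ b κ′ → T._*_ (length la) (emb la (if does (b ℕ.≟ r) then toF αF Fᴷ.* Fᴷ.ι (suc r) else Fᴷ.0#)) (dprod la κ′)))
    εpart-dprod r la κ = T.trans l (DualProduct.εpart-product (Tower 𝔽 l) (λ b → dvals (r ∷ la) (suc b)) κ)
      (T.P-cong l κ (λ b κ′ → T.*-cong l (T.trans l (D.εpart-pair l _ _) (Hom.⟦⟧-cong (towerEmbed 𝔽 l) (Fᴷ.reflexive (≡.cong (λ t → if t then toF αF Fᴷ.* Fᴷ.ι (suc r) else Fᴷ.0#) (does-sym r b)))))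
        (prodOver-cong′ κ′)))
      where
      l = length la
      does-sym : ∀ a b → does (suc a ℕ.≟ suc b) ≡ does (b ℕ.≟ a)
      does-sym a b with b ℕ.≟ a
      ... | yes e = ≡.trans (dec-true (suc a ℕ.≟ suc b) (≡.cong suc (≡.sym e))) (≡.sym (dec-true (b ℕ.≟ a) e))
      ... | no ne = ≡.trans (dec-false (suc a ℕ.≟ suc b) (λ e → ne (≡.sym (ℕP.suc-injective e)))) (≡.sym (dec-false (b ℕ.≟ a) ne))
      prodOver-cong′ : ∀ κ → T._≈_ l (T.prodOver l (λ a → Re.⟦_⟧ l (dvals (r ∷ la) (suc a))) κ) (dprod la κ)
      prodOver-cong′ [] = T.refl l
      prodOver-cong′ (a ∷ κ) = T.*-cong l (D.re-pair l _ _) (prodOver-cong′ κ)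

    re-dprod : ∀ r la κ → T._≈_ (length la) (Re.⟦_⟧ (length la) (dprod (r ∷ la) κ)) (dprod la κ)
    re-dprod r la [] = Re.1-homo (length la)
    re-dprod r la (b ∷ κ) = T.trans l (Re.*-homo l _ _) (T.*-cong l (D.re-pair l _ _) (re-dprod r la κ))
      where l = length la

    evTop-P : ∀ q la κ (f : ℕ → List ℕ → C la) → evTop q la (T.P (length la) κ f) Fᴷ.≈ Fᴷ.P κ (λ b κ′ → evTop q la (f b κ′))
    evTop-P q la [] f = evTop-0 q la
    evTop-P q la (b ∷ κ) f = Fᴷ.trans (evTop-+ q la _ _) (Fᴷ.+-congˡ (evTop-P q la κ _))

    ev-P : ∀ {A : Set} (p : List (A × F)) κ (f : A → ℕ → List ℕ → Fᴷ.Carrier) → E.ev p (λ a → Fᴷ.P κ (f a)) Fᴷ.≈ Fᴷ.P κ (λ b κ′ → E.ev p (λ a → f a b κ′))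
    ev-P p [] f = Fᴷ.trans (Fᴷ.Σ-cong p (λ _ → Fᴷ.zeroʳ _)) (Fᴷ.Σ-0 p)
    ev-P p (b ∷ κ) f = Fᴷ.trans (E.ev-+ p _ _) (Fᴷ.+-congˡ (ev-P p κ _))

    coeffᴾ : ℕ → ℕ → Fᴷ.Carrier
    coeffᴾ r b = if does (b ℕ.≟ r) then toF αF Fᴷ.* Fᴷ.ι (suc r) else Fᴷ.0#

    basisPairing-[] : ∀ κ → basisPairing [] κ Fᴷ.≈ dprod [] κ
    basisPairing-[] [] = Fᴷ.trans (basisPairing-↭ {[]} {[]} ↭-refl) (Fᴷ.trans (Fᴷ.*-identityˡ _) (Fᴷ.+-identityʳ _))
    basisPairing-[] (b ∷ κ) = Fᴷ.trans (basisPairing-¬↭ {[]} {b ∷ κ} nonempty) (Fᴷ.sym (Fᴷ.zeroˡ _))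
      where
      nonempty : ¬ ([] ↭ b ∷ κ)
      nonempty p with PermP.↭-length p
      ... | ()

    -- At p = 0 the functional `evTop` extracts the coefficient of the product of all ε's. Pairing
    -- with p_κ is thus multiplication by p_κ(d) followed by this extraction; the step is that
    -- removing a part of κ is the ε-part of p_κ(d).
    Γ-pairing : ∀ la X κ → E.ev (Γ la X) (λ a → basisPairing a κ) Fᴷ.≈ evTop zeros la (T._*_ (length la) X (dprod la κ))
    Γ-pairing [] X κ = Fᴷ.trans (Fᴷ.+-identityʳ _) (Fᴷ.*-cong (toF-fromF X) (basisPairing-[] κ))
    Γ-pairing (r ∷ la) X κ = begin
      E.ev (map (λ t → (r ∷ proj₁ t) , proj₂ t) (Γ la X₀) ++ Γ la X₁) (λ a → basisPairing a κ)
        ≈⟨ trans (Σ-++ (map (λ t → (r ∷ proj₁ t) , proj₂ t) (Γ la X₀)) (Γ la X₁) _) (+-congʳ (Σ-map _ (Γ la X₀) _)) ⟩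
      E.ev (Γ la X₀) (λ a → basisPairing (r ∷ a) κ) + E.ev (Γ la X₁) (λ a → basisPairing a κ)
        ≈⟨ +-cong (trans (E.ev-cong (Γ la X₀) (λ a → basisPairing-∷ r a κ)) (trans (ev-P (Γ la X₀) κ _)
             (P-cong κ (λ b κ′ → trans (E.ev-*ˡ (Γ la X₀) _ _) (*-congˡ (Γ-pairing la X₀ κ′)))))) (Γ-pairing la X₁ κ) ⟩
      P κ (λ b κ′ → coeffᴾ r b * evTop zeros la (T._*_ l X₀ (dprod la κ′))) + evTop zeros la (T._*_ l X₁ (dprod la κ))
        ≈⟨ +-congʳ (sym (trans (evTop-cong zeros la (T.trans l (T.*-congˡ l (εpart-dprod r la κ)) (T.trans l (T.sym l (T.P-*ˡ l κ _ _))
             (T.P-cong l κ (λ b κ′ → swap-left _ _ _))))) (trans (evTop-P zeros la κ _) (P-cong κ (λ b κ′ → evTop-scale zeros la _ _))))) ⟩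
      evTop zeros la (T._*_ l X₀ (D.εpart l (dprod (r ∷ la) κ))) + evTop zeros la (T._*_ l X₁ (dprod la κ))
        ≈⟨ sym (trans (evTop-cong zeros la (T.trans l (T.+-cong l (T.trans l (T.*-congʳ l (H.0-homo l)) (T.zeroˡ l _))
              (T.trans l (D.εpart-* l _ _) (T.+-congˡ l (T.*-congˡ l (re-dprod r la κ))))) (T.+-identityˡ l _)))
            (evTop-+ zeros la _ _)) ⟩
      evTop zeros (r ∷ la) (T._*_ (suc l) X (dprod (r ∷ la) κ)) ∎
      where
      open Fᴷ
      l = length la
      X₀ = Re.⟦_⟧ l X
      X₁ = D.εpart l X
      swap-left : ∀ a b c → T._≈_ l (T._*_ l a (T._*_ l b c)) (T._*_ l b (T._*_ l a c))
      swap-left a b c = T.trans l (T.sym l (T.*-assoc l a b c)) (T.trans l (T.*-congʳ l (T.*-comm l a b)) (T.*-assoc l b a c))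

    basisPairing-evTop : ∀ la κ → basisPairing la κ Fᴷ.≈ evTop zeros la (dprod la κ)
    basisPairing-evTop [] κ = basisPairing-[] κ
    basisPairing-evTop (r ∷ la) κ = trans (basisPairing-∷ r la κ) (trans (P-cong κ (λ b κ′ → *-congˡ (basisPairing-evTop la κ′)))
      (sym (trans (evTop-cong zeros la (T.trans l (T.+-cong l (T.trans l (T.*-congʳ l (H.0-homo l)) (T.zeroˡ l _)) (εpart-dprod r la κ)) (T.+-identityˡ l _)))
        (trans (evTop-P zeros la κ _) (P-cong κ (λ b κ′ → evTop-scale zeros la _ _))))))
      where
      open Fᴷ
      l = length la

    bracket : ∀ f g → toF ⟨ f , g ⟩ Fᴷ.≈ E.ev f (λ a → E.ev g (basisPairing a))
    bracket f g = trans (toF-sum (concatMap _ f)) (trans (Σ-concatMap _ f _) (Σ-cong f (λ { (a , c) → trans (Σ-map _ g _)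
      (trans (Σ-cong g (λ { (b , d) → trans (toF-* (c *F d) (pairBasis a b)) (trans (*-congʳ (toF-* c d)) (*-assoc _ _ _)) })) (Σ-*ˡ g _ _)) })))
      where
      open Fᴷ
      toF-sum : ∀ L → toF (sumF L) ≈ Σ L toF
      toF-sum [] = toF-0
      toF-sum (a ∷ L) = trans (toF-+ a (sumF L)) (+-congˡ (toF-sum L))

    evTop-ev : ∀ q la h (g : List ℕ → C la) → evTop q la (Evaluation.ev (Tower 𝔽 (length la)) (towerEmbed 𝔽 (length la)) h g) Fᴷ.≈ E.ev h (λ a → evTop q la (g a))
    evTop-ev q la h g = Fᴷ.trans (evTop-Σ q la h _) (Fᴷ.Σ-cong h (λ t → evTop-scale q la _ _))

  module AdjointFormula (M G f : Λel) (adjoint : ∀ h → ⟨ G , h ⟩ ≃ ⟨ f , M *Λ h ⟩) where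
    private
      -- The explicit candidate for the adjoint of M at f: the value M(d), applied to each product
      -- of power sums in f.
      Γf : Λel
      Γf = concatMap (λ t → scaleΛ (proj₂ t) (Γ (proj₁ t) (θ (proj₁ t) M))) f

      ev-Γf : ∀ (R : CRing) (φ : Hom 𝔽 R) (let open Kit R) (let open Evaluation R φ) g → ev Γf g ≈ ev f (λ ix → ev (Γ ix (θ ix M)) g)
      ev-Γf R φ g = Kit.trans R (Kit.Σ-concatMap R _ f _) (Kit.Σ-cong R f (λ t → Evaluation.ev-scale R φ (proj₂ t) (Γ (proj₁ t) (θ (proj₁ t) M)) g))

      -- By hypothesis ⟨G, p_κ⟩ = ⟨f, M p_κ⟩, which is the top coefficient of M(d) p_κ(d) term by
      -- term in f; the same holds for `Γf` by `Γ-pairing`.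
      same-pairing : ∀ κ → E.ev G (λ a → basisPairing a κ) Fᴷ.≈ E.ev Γf (λ a → basisPairing a κ)
      same-pairing κ = begin
        E.ev G (λ a → basisPairing a κ)
          ≈⟨ E.ev-cong G (λ a → sym (single (basisPairing a))) ⟩
        E.ev G (λ a → E.ev h (basisPairing a))
          ≈⟨ trans (sym (bracket G h)) (trans (toF-cong (adjoint h)) (bracket f (M *Λ h))) ⟩
        E.ev f (λ ix → E.ev (M *Λ h) (basisPairing ix))
          ≈⟨ E.ev-cong f (λ ix → trans (E.ev-mul _++_ M h (basisPairing ix)) (E.ev-cong M (λ b → trans (single (λ c → basisPairing ix (b ++ c))) (trans (basisPairing-evTop ix (b ++ κ))
               (evTop-cong zeros ix (prodOver-++ (Tower 𝔽 (length ix)) _ b κ)))))) ⟩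
        E.ev f (λ ix → E.ev M (λ b → evTop zeros ix (T._*_ (length ix) (dprod ix b) (dprod ix κ))))
          ≈⟨ E.ev-cong f (λ ix → trans (sym (evTop-ev zeros ix M _)) (evTop-cong zeros ix (factor ix))) ⟩
        E.ev f (λ ix → evTop zeros ix (T._*_ (length ix) (θ ix M) (dprod ix κ)))
          ≈⟨ E.ev-cong f (λ ix → sym (Γ-pairing ix (θ ix M) κ)) ⟩
        E.ev f (λ ix → E.ev (Γ ix (θ ix M)) (λ a → basisPairing a κ))
          ≈⟨ sym (ev-Γf 𝔽 idᴴ _) ⟩
        E.ev Γf (λ a → basisPairing a κ) ∎
        where
        open Fᴷ
        h : Λel
        h = (κ , 1F) ∷ []
        single : ∀ g → E.ev h g ≈ g κ
        single g = trans (+-identityʳ _) (trans (*-congʳ toF-1) (*-identityˡ _))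
        factor : ∀ ix → T._≈_ (length ix) (Evaluation.ev (Tower 𝔽 (length ix)) (towerEmbed 𝔽 (length ix)) M (λ b → T._*_ (length ix) (dprod ix b) (dprod ix κ)))
                   (T._*_ (length ix) (θ ix M) (dprod ix κ))
        factor ix = T.trans l (Evaluation.ev-cong (Tower 𝔽 l) (towerEmbed 𝔽 l) M (λ b → T.*-comm l _ _))
          (T.trans l (Evaluation.ev-*ˡ (Tower 𝔽 l) (towerEmbed 𝔽 l) M (dprod ix κ) _) (T.*-comm l _ _))
          where l = length ix

      _≟_ : DecidableEquality (List ℕ)
      _≟_ = LP.≡-dec ℕ._≟_

      difference : Λel
      difference = G ++ scaleΛ (-F 1F) Γf

      ev-difference : ∀ (R : CRing) (φ : Hom 𝔽 R) (let open Kit R) (let open Evaluation R φ) g → ev difference g ≈ ev G g + - ev Γf g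
      ev-difference R φ g = trans (Σ-++ G (scaleΛ (-F 1F) Γf) _) (+-congˡ (trans (ev-scale (-F 1F) Γf g) (trans (*-congʳ (trans (scalar-neg 1F) (-‿cong scalar-1)))
        (solve 1 (λ a → (:- con (+ 1)) :* a := :- a) refl _))))
        where
        open Kit R
        open Evaluation R φ

      -- Pairing with p_κ gives the coefficient sum of the class of κ times the norm of p_κ, and the
      -- norm can be cancelled.
      classes : ∀ κ → E.ev difference (E.indicator _≟_ sortℕ (sortℕ κ)) Fᴷ.≈ Fᴷ.0#
      classes κ = Units.invertible⇒nzd 𝔽 (basisNorm-invertible κ) _ (begin
        basisNorm κ * E.ev difference (E.indicator _≟_ sortℕ (sortℕ κ))
          ≈⟨ sym (E.ev-*ˡ difference (basisNorm κ) _) ⟩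
        E.ev difference (λ a → basisNorm κ * E.indicator _≟_ sortℕ (sortℕ κ) a)
          ≈⟨ E.ev-cong difference basisPairing-indicator ⟩
        E.ev difference (λ a → basisPairing a κ)
          ≈⟨ trans (ev-difference 𝔽 idᴴ _) (trans (+-congʳ (same-pairing κ)) (-‿inverseʳ _)) ⟩
        0# ∎)
        where
        open Fᴷ
        basisPairing-indicator : ∀ a → basisNorm κ * E.indicator _≟_ sortℕ (sortℕ κ) a ≈ basisPairing a κ
        basisPairing-indicator a = case (sortℕ a ≟ sortℕ κ)
          where
          case : Dec (sortℕ a ≡ sortℕ κ) → basisNorm κ * E.indicator _≟_ sortℕ (sortℕ κ) a ≈ basisPairing a κ
          case (yes e) = trans (*-congˡ (reflexive (≡.cong (λ b → if b then 1# else 0#) (dec-true (sortℕ a ≟ sortℕ κ) e)))) (trans (*-identityʳ _)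
            (trans (basisNorm-↭ {κ} {a} (↭-sym (sort-≡⇒↭ {a} {κ} e))) (sym (basisPairing-↭ {a} {κ} (sort-≡⇒↭ {a} {κ} e)))))
          case (no ne) = trans (*-congˡ (reflexive (≡.cong (λ b → if b then 1# else 0#) (dec-false (sortℕ a ≟ sortℕ κ) ne)))) (trans (zeroʳ _)
            (sym (basisPairing-¬↭ {a} {κ} (λ p → ne (↭⇒sort-≡ p)))))

    module _ (R : CRing) (φ : Hom 𝔽 R) (q : ℕ → CommutativeRing.Carrier R) where
      open Kit R
      open Evaluation R φ
      private
        module TR = Towers R (Hom.⟦_⟧ φ (toF αF))
        module TK (n : ℕ) = Kit (Tower R n)
        qprod : List ℕ → Carrier
        qprod = prodOver (λ b → q (suc b))

      -- `Γ` mirrors the recursion of `evTop`: terms from the real part keep the factor p_{r+1},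
      -- terms from the ε-part have lost it.
      Γ-value : ∀ la X → ev (Γ la X) qprod ≈ TR.evTop q la (Hom.⟦_⟧ (towerMap φ (length la)) X)
      Γ-value [] X = trans (+-identityʳ _) (trans (*-identityʳ _) (Hom.⟦⟧-cong φ (toF-fromF X)))
      Γ-value (r ∷ la) X = begin
        ev (map (λ t → (r ∷ proj₁ t) , proj₂ t) (Γ la X₀) ++ Γ la X₁) qprod
          ≈⟨ trans (Σ-++ (map (λ t → (r ∷ proj₁ t) , proj₂ t) (Γ la X₀)) (Γ la X₁) _) (+-congʳ (Σ-map _ (Γ la X₀) _)) ⟩
        ev (Γ la X₀) (λ a → q (suc r) * qprod a) + ev (Γ la X₁) qprod
          ≈⟨ +-cong (trans (ev-*ˡ (Γ la X₀) _ _) (*-congˡ (Γ-value la X₀))) (Γ-value la X₁) ⟩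
        q (suc r) * TR.evTop q la (Hom.⟦_⟧ (towerMap φ l) X₀) + TR.evTop q la (Hom.⟦_⟧ (towerMap φ l) X₁)
          ≈⟨ sym (trans (TR.evTop-cong q la (TK.+-cong l (TK.*-congˡ l (DualMap.dualMap-re (towerMap φ l) X)) (DualMap.dualMap-ε (towerMap φ l) X)))
               (trans (TR.evTop-+ q la _ _) (+-congʳ (TR.evTop-scale q la _ _)))) ⟩
        TR.evTop q (r ∷ la) (Hom.⟦_⟧ (towerMap φ (suc l)) X) ∎
        where
        l = length la
        X₀ = Re.⟦_⟧ l X
        X₁ = D.εpart l X

      -- G and `Γf` agree class by class, hence under every substitution p_r ↦ q r, in particular
      -- for power sums in N variables.
      adjoint-value : ev G qprod ≈ ev f (λ ix → TR.evTop q ix (Hom.⟦_⟧ (towerMap φ (length ix)) (θ ix M)))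
      adjoint-value = begin
        ev G qprod
          ≈⟨ solve 2 (λ a b → a := (a :- b) :+ b) refl _ (ev Γf qprod) ⟩
        ev G qprod + - ev Γf qprod + ev Γf qprod
          ≈⟨ +-congʳ (trans (sym (ev-difference R φ qprod)) (Vanishing.class-zero⇒ev-zero R φ _≟_ sortℕ difference classes qprod
               (λ a b e → prodOver-↭ R (λ b → q (suc b)) {a} {b} (sort-≡⇒↭ {a} {b} e)))) ⟩
        0# + ev Γf qprod
          ≈⟨ trans (+-identityˡ _) (ev-Γf R φ qprod) ⟩
        ev f (λ ix → ev (Γ ix (θ ix M)) qprod)
          ≈⟨ ev-cong f (λ ix → Γ-value ix (θ ix M)) ⟩
        ev f (λ ix → TR.evTop q ix (Hom.⟦_⟧ (towerMap φ (length ix)) (θ ix M))) ∎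

-- Sums over partitions and over exponent vectors.

max-↭ : ∀ {xs ys} → xs ↭ ys → maxℕ xs ≡ maxℕ ys
max-↭ Perm.refl = ≡.refl
max-↭ (prep x p) = ≡.cong (x ⊔_) (max-↭ p)
max-↭ (swap {xs} {ys} x y p) = ≡.trans (≡.sym (ℕP.⊔-assoc x y (maxℕ xs))) (≡.trans (≡.cong₂ _⊔_ (ℕP.⊔-comm x y) (max-↭ p)) (ℕP.⊔-assoc y x (maxℕ ys)))
max-↭ (Perm.trans p q) = ≡.trans (max-↭ p) (max-↭ q)

-- Brings a largest part to the front, as `decParts` lists parts in weakly decreasing order.
max-pick : ∀ a s → ∃ λ s′ → (a ∷ s) ↭ maxℕ (a ∷ s) ∷ s′
max-pick a [] = [] , ≡.subst (λ m → (a ∷ []) ↭ m ∷ []) (≡.sym (ℕP.⊔-identityʳ a)) ↭-refl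
max-pick a s@(b ∷ t) with max-pick b t | ℕP.≤-total (maxℕ s) a
... | _ , _ | inj₁ m≤a = s , ≡.subst (λ m → (a ∷ s) ↭ m ∷ s) (≡.sym (ℕP.m≥n⇒m⊔n≡m m≤a)) ↭-refl
... | s′ , p | inj₂ a≤m = a ∷ s′ , ≡.subst (λ m → (a ∷ s) ↭ m ∷ a ∷ s′) (≡.sym (ℕP.m≤n⇒m⊔n≡n a≤m)) (↭-trans (prep a p) (swap a (maxℕ s) ↭-refl))

max-support : ∀ {m} (e : Vec ℕ m) → maxℕ (support e) ≡ maxℕ (V.toList e)
max-support [] = ≡.refl
max-support (zero ∷ e) = max-support e
max-support (suc a ∷ e) = ≡.cong (suc a ⊔_) (max-support e)

support-positive : ∀ {m} (e : Vec ℕ m) → All (1 ≤_) (support e)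
support-positive [] = []
support-positive (zero ∷ e) = support-positive e
support-positive (suc a ∷ e) = s≤s z≤n ∷ support-positive e

allVecs-bounded : ∀ n B → All (λ e → maxℕ (V.toList e) ≤ B) (allVecs n B)
allVecs-bounded zero B = z≤n ∷ []
allVecs-bounded (suc n) B = AllP.concat⁺ (AllP.map⁺ (AllP.applyUpTo⁺₁ (λ k → k) (suc B)
  (λ { (s≤s k≤B) → AllP.map⁺ (All.map (λ p → ℕP.⊔-lub k≤B p) (allVecs-bounded n B)) })))

decParts-shape : ∀ k D → All (λ la → length la ≡ k × maxℕ la ≤ D × All (1 ≤_) la) (decParts k D)
decParts-shape zero D = (≡.refl , z≤n , []) ∷ []
decParts-shape (suc k) D = AllP.concat⁺ (AllP.map⁺ (AllP.map⁺ (AllP.applyUpTo⁺₁ (λ p → p) D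
  (λ {p} p<D → AllP.map⁺ (All.map (λ { (l , m , q) → ≡.cong suc l , ℕP.⊔-lub p<D (ℕP.≤-trans m p<D) , s≤s z≤n ∷ q }) (decParts-shape k (suc p)))))))

module PartitionSums (R : CRing) where
  open Kit R
  open Enumeration R
  open Determinant R using (Σ-congᴬ)

  ind : List ℕ → List ℕ → Carrier
  ind s la = if does (↭? s la) then 1# else 0#

  ind-true : ∀ {s la} → s ↭ la → ind s la ≈ 1#
  ind-true {s} {la} p = reflexive (≡.cong (λ t → if t then 1# else 0#) (dec-true (↭? s la) p))

  ind-false : ∀ {s la} → ¬ (s ↭ la) → ind s la ≈ 0#
  ind-false {s} {la} p = reflexive (≡.cong (λ t → if t then 1# else 0#) (dec-false (↭? s la) p))

  ind-drop : ∀ {s a s′} la → s ↭ a ∷ s′ → ind s (a ∷ la) ≈ ind s′ la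
  ind-drop {s} {a} {s′} la p = case (↭? s′ la)
    where
    case : Dec (s′ ↭ la) → ind s (a ∷ la) ≈ ind s′ la
    case (yes q) = trans (ind-true (↭-trans p (prep a q))) (sym (ind-true q))
    case (no ¬q) = trans (ind-false (λ r → ¬q (PermP.drop-∷ (↭-trans (↭-sym p) r)))) (sym (ind-false ¬q))

  Σ-filter : ∀ {A : Set} {P : A → Set} (P? : Decidable P) (xs : List A) f → Σ (L.filter P? xs) f ≈ Σ xs (λ a → if does (P? a) then f a else 0#)
  Σ-filter P? [] f = refl
  Σ-filter P? (x ∷ xs) f with does (P? x)
  ... | true = +-congˡ (Σ-filter P? xs f)
  ... | false = trans (Σ-filter P? xs f) (sym (+-identityˡ _))

  -- The first part of a decreasing rearrangement must be the maximum of s, so just one choice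
  -- contributes at every level.
  decParts-once : ∀ k D s → maxℕ s ≤ D → All (1 ≤_) s → length s ≡ k → Σ (decParts k D) (ind s) ≈ 1#
  decParts-once zero D [] m pos e = trans (+-identityʳ _) (ind-true {[]} {[]} ↭-refl)
  decParts-once (suc k) D s@(a ∷ t) m pos e with max-pick a t
  ... | s′ , p = begin
    Σ (decParts (suc k) D) (ind s)
      ≈⟨ trans (Σ-concatMap _ (map suc (upTo D)) _) (trans (Σ-map suc (upTo D) _) (trans (Σ-upTo D _) (sumTo-cong D (λ q _ → Σ-map (suc q ∷_) (decParts k (suc q)) _)))) ⟩
    sumTo D (λ q → Σ (decParts k (suc q)) (λ la → ind s (suc q ∷ la)))
      ≈⟨ sumTo-single D q₀ _ q₀<D other ⟩
    Σ (decParts k (suc q₀)) (λ la → ind s (suc q₀ ∷ la))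
      ≈⟨ Σ-cong (decParts k (suc q₀)) (λ la → ind-drop la (≡.subst (λ n → s ↭ n ∷ s′) (≡.sym suc-q₀) p)) ⟩
    Σ (decParts k (suc q₀)) (ind s′)
      ≈⟨ decParts-once k (suc q₀) s′ (≡.subst (maxℕ s′ ≤_) (≡.sym suc-q₀) max-s′) (All.tail pos′) (ℕP.suc-injective (≡.trans (≡.sym (PermP.↭-length p)) e)) ⟩
    1# ∎
    where
    M = maxℕ s
    pos′ : All (1 ≤_) (M ∷ s′)
    pos′ = PermP.All-resp-↭ p pos
    q₀ : ℕ
    q₀ = ℕ.pred M
    suc-q₀ : suc q₀ ≡ M
    suc-q₀ = ℕP.suc-pred M {{ℕ.>-nonZero (All.head pos′)}}
    q₀<D : q₀ < D
    q₀<D = ≡.subst (_≤ D) (≡.sym suc-q₀) m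
    max-s′ : maxℕ s′ ≤ M
    max-s′ = ≡.subst (maxℕ s′ ≤_) (≡.sym (max-↭ p)) (ℕP.m≤n⊔m M (maxℕ s′))
    other : ∀ j → j < D → ¬ j ≡ q₀ → Σ (decParts k (suc j)) (λ la → ind s (suc j ∷ la)) ≈ 0#
    other j _ j≢q₀ = trans (Σ-congᴬ {g = λ _ → 0#} (All.map (λ {la} shape → ind-false {s} {suc j ∷ la} (λ r → j≢q₀ (ℕP.suc-injective (≡.trans
      (≡.sym (ℕP.m≥n⇒m⊔n≡m (proj₁ (proj₂ shape)))) (≡.trans (≡.sym (max-↭ r)) (≡.sym suc-q₀)))))) (decParts-shape k (suc j)))) (Σ-0 (decParts k (suc j)))

  decParts-never : ∀ k D s → ¬ length s ≡ k → Σ (decParts k D) (ind s) ≈ 0#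
  decParts-never k D s ne = trans (Σ-congᴬ {g = λ _ → 0#} (All.map (λ {la} shape → ind-false {s} {la} (λ r → ne (≡.trans (PermP.↭-length r) (proj₁ shape)))) (decParts-shape k D)))
    (Σ-0 (decParts k D))

  sumTo-extend : ∀ n m h → n ≤ m → (∀ k → n ≤ k → h k ≈ 0#) → sumTo m h ≈ sumTo n h
  sumTo-extend zero m h p e = sumTo-zero m (λ k _ → e k z≤n)
  sumTo-extend (suc n) (suc m) h (s≤s p) e = +-congˡ (sumTo-extend n m (λ k → h (suc k)) p (λ k q → e (suc k) (s≤s q)))

  allVecs-sum : ∀ n B (h : Vec ℕ (suc n) → Carrier) → Σ (allVecs (suc n) B) h ≈ sumTo (suc B) (λ a → Σ (allVecs n B) (λ e → h (a ∷ e)))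
  allVecs-sum n B h = trans (Σ-concatMap (λ a → map (a ∷_) (allVecs n B)) (upTo (suc B)) h) (trans (Σ-upTo (suc B) _)
    (sumTo-cong (suc B) (λ a _ → Σ-map (a ∷_) (allVecs n B) h)))

  allVecs-extend : ∀ n B D (h : Vec ℕ n → Carrier) → B ≤ D → (∀ e → B < maxℕ (V.toList e) → h e ≈ 0#) → Σ (allVecs n D) h ≈ Σ (allVecs n B) h
  allVecs-extend zero B D h p z = refl
  allVecs-extend (suc n) B D h p z = trans (allVecs-sum n D h) (trans
    (sumTo-extend (suc B) (suc D) _ (s≤s p) (λ k q → Σ-zero (allVecs n D) (λ e → z (k ∷ e) (ℕP.≤-trans q (ℕP.m≤m⊔n k _)))))
    (trans (sumTo-cong (suc B) (λ a _ → allVecs-extend n B D (λ e → h (a ∷ e)) p (λ e q → z (a ∷ e) (ℕP.≤-trans q (ℕP.m≤n⊔m a _)))))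
      (sym (allVecs-sum n B h))))

  -- The same filtered list as in `msym`, so that `msym n la` is definitionally a map over it.
  monomialExponents : ∀ n → List ℕ → List (Vec ℕ n)
  monomialExponents n la = L.filter (λ e → LP.≡-dec ℕ._≟_ (sortℕ (nonzeros (V.toList e))) (sortℕ la)) (allVecs n (maxℕ la))

  monomial-sum : ∀ n la D (h : Vec ℕ n → Carrier) → maxℕ la ≤ D → Σ (monomialExponents n la) h ≈ Σ (allVecs n D) (λ e → ind (support e) la * h e)
  monomial-sum n la D h p = trans (Σ-filter _ (allVecs n (maxℕ la)) h) (trans (Σ-cong (allVecs n (maxℕ la)) (λ e → if-* (does (↭? (support e) la)) (h e)))
    (sym (allVecs-extend n (maxℕ la) D _ p (λ e q → trans (*-congʳ (ind-false {support e} {la} (λ r → ℕP.<-irrefl (≡.trans (≡.sym (max-↭ r)) (max-support e)) q))) (zeroˡ _)))))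
    where
    if-* : ∀ b x → (if b then x else 0#) ≈ (if b then 1# else 0#) * x
    if-* true x = sym (*-identityˡ x)
    if-* false x = sym (zeroˡ x)

  -- The nonzero entries of an exponent vector bounded by D, k in number, form exactly one partition
  -- of `decParts k D` up to order, and f does not see the order.
  regroup : ∀ n k D (g : Vec ℕ n → Carrier) (f : List ℕ → Carrier) → (∀ {s t} → s ↭ t → f s ≈ f t) →
    Σ (decParts k D) (λ la → Σ (monomialExponents n la) g * f la) ≈
    Σ (allVecs n D) (λ e → if does (length (support e) ℕ.≟ k) then g e * f (support e) else 0#)
  regroup n k D g f inv = begin
    Σ (decParts k D) (λ la → Σ (monomialExponents n la) g * f la)
      ≈⟨ Σ-congᴬ (All.map (λ {la} shape → trans (*-congʳ (monomial-sum n la D g (proj₁ (proj₂ shape)))) (sym (Σ-*ʳ (allVecs n D) _ _))) (decParts-shape k D)) ⟩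
    Σ (decParts k D) (λ la → Σ (allVecs n D) (λ e → ind (support e) la * g e * f la))
      ≈⟨ Σ-swap (decParts k D) (allVecs n D) _ ⟩
    Σ (allVecs n D) (λ e → Σ (decParts k D) (λ la → ind (support e) la * g e * f la))
      ≈⟨ Σ-cong (allVecs n D) (λ e → trans (Σ-cong (decParts k D) (λ la → replace e la)) (Σ-*ʳ (decParts k D) _ _)) ⟩
    Σ (allVecs n D) (λ e → Σ (decParts k D) (ind (support e)) * (g e * f (support e)))
      ≈⟨ Σ-congᴬ (All.map (λ {e} b → select e b) (allVecs-bounded n D)) ⟩
    Σ (allVecs n D) (λ e → if does (length (support e) ℕ.≟ k) then g e * f (support e) else 0#) ∎
    where
    replace : ∀ e la → ind (support e) la * g e * f la ≈ ind (support e) la * (g e * f (support e))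
    replace e la = case (↭? (support e) la)
      where
      case : Dec (support e ↭ la) → ind (support e) la * g e * f la ≈ ind (support e) la * (g e * f (support e))
      case (yes p) = trans (*-congˡ (sym (inv p))) (*-assoc _ _ _)
      case (no ¬p) = trans (*-congʳ (*-congʳ (ind-false {support e} {la} ¬p))) (trans (solve 3 (λ a b c → con (+ 0) :* a :* b := con (+ 0) :* c) refl _ _ _) (*-congʳ (sym (ind-false {support e} {la} ¬p))))
    select : ∀ e → maxℕ (V.toList e) ≤ D → Σ (decParts k D) (ind (support e)) * (g e * f (support e)) ≈ (if does (length (support e) ℕ.≟ k) then g e * f (support e) else 0#)
    select e b with length (support e) ℕ.≟ k
    ... | yes l = trans (*-congʳ (decParts-once k D (support e) (≡.subst (_≤ D) (≡.sym (max-support e)) b) (support-positive e) l))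
            (trans (*-identityˡ _) (reflexive (≡.cong (λ t → if t then g e * f (support e) else 0#) (≡.sym (dec-true (length (support e) ℕ.≟ k) l)))))
    ... | no ne = trans (*-congʳ (decParts-never k D (support e) ne)) (trans (zeroˡ _)
            (reflexive (≡.cong (λ t → if t then g e * f (support e) else 0#) (≡.sym (dec-false (length (support e) ℕ.≟ k) ne)))))

-- falling factorials N(N−1)⋯(N−l+1), by the recursion that counts injections
falling : ℕ → ℕ → ℕ
falling zero zero = 1
falling zero (suc l) = 0
falling (suc N) l = falling N l ℕ.+ l ℕ.* falling N (ℕ.pred l)

falling-zero : ∀ N l → N < l → falling N l ≡ 0
falling-zero zero (suc l) p = ≡.refl
falling-zero (suc N) (suc l) (s≤s p) = ≡.trans (≡.cong₂ (λ a b → a ℕ.+ suc l ℕ.* b) (falling-zero N (suc l) (ℕP.m≤n⇒m≤1+n p)) (falling-zero N l p)) (ℕP.*-zeroʳ (suc l))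

-- For l < N the recursion gives (N - l) N! + (l + 1) N! = (N + 1)!. The case l = N is separate
-- because there the first summand of the recursion vanishes.
falling-! : ∀ N l → l ≤ N → ((N ∸ l) !) ℕ.* falling N l ≡ N !
falling-! zero zero p = ≡.refl
falling-! (suc N) zero p = ≡.trans (≡.cong ((suc N !) ℕ.*_) (≡.trans (ℕP.+-identityʳ _) (falling-one N))) (ℕP.*-identityʳ _)
  where
  falling-one : ∀ N → falling N 0 ≡ 1
  falling-one zero = ≡.refl
  falling-one (suc N) = ≡.trans (ℕP.+-identityʳ _) (falling-one N)
falling-! (suc N) (suc l) (s≤s p) with ℕP.m≤n⇒m<n∨m≡n p
... | inj₂ ≡.refl = ≡.trans (≡.cong₂ (λ a b → (a !) ℕ.* (b ℕ.+ suc N ℕ.* falling N N)) (ℕP.n∸n≡0 N) (falling-zero N (suc N) ℕP.≤-refl))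
  (≡.trans (ℕP.*-identityˡ _) (≡.cong (suc N ℕ.*_) (≡.trans (≡.sym (≡.trans (≡.cong (λ a → (a !) ℕ.* falling N N) (ℕP.n∸n≡0 N)) (ℕP.*-identityˡ _))) (falling-! N N ℕP.≤-refl))))
... | inj₁ l<N = begin
    ((N ∸ l) !) ℕ.* (falling N (suc l) ℕ.+ suc l ℕ.* falling N l)
      ≡⟨ ℕP.*-distribˡ-+ ((N ∸ l) !) (falling N (suc l)) (suc l ℕ.* falling N l) ⟩
    ((N ∸ l) !) ℕ.* falling N (suc l) ℕ.+ ((N ∸ l) !) ℕ.* (suc l ℕ.* falling N l)
      ≡⟨ ≡.cong₂ ℕ._+_ (≡.trans (≡.cong (λ a → (a !) ℕ.* falling N (suc l)) split) (≡.trans (ℕP.*-assoc (suc (N ∸ suc l)) ((N ∸ suc l) !) (falling N (suc l))) (≡.cong (suc (N ∸ suc l) ℕ.*_) (falling-! N (suc l) l<N))))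
           (≡.trans (solve 3 (λ a b c → a :* (b :* c) := b :* (a :* c)) ≡.refl ((N ∸ l) !) (suc l) (falling N l)) (≡.cong (suc l ℕ.*_) (falling-! N l p))) ⟩
    suc (N ∸ suc l) ℕ.* (N !) ℕ.+ suc l ℕ.* (N !)
      ≡⟨ ≡.sym (ℕP.*-distribʳ-+ (N !) (suc (N ∸ suc l)) (suc l)) ⟩
    (suc (N ∸ suc l) ℕ.+ suc l) ℕ.* (N !)
      ≡⟨ ≡.cong (λ a → suc a ℕ.* (N !)) (ℕP.m∸n+n≡m l<N) ⟩
    (suc N) ! ∎
    where
    open ≡.≡-Reasoning
    open +-*-Solver
    split : N ∸ l ≡ suc (N ∸ suc l)
    split = ℕP.+-∸-assoc 1 l<N

-- The multiplicity c_λ as a count of matchings.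

module Counting (R : CRing) where
  open Kit R
  open PartitionSums R
  open Enumeration R
  open Picks R
  open MultiplicityProducts R
  open Nodes R using (P-length)

  private
    cΦ cΨ : ℕ → ℕ → ℕ
    cΦ r n = n !
    cΨ r n = suc n
    c-0 : ∀ r → cΦ r 0 ≡ 1
    c-0 r = ≡.refl
    c-suc : ∀ r n → cΦ r (suc n) ≡ cΨ r n ℕ.* cΦ r n
    c-suc r n = ≡.refl

  cK : List ℕ → Carrier
  cK = countProduct cΦ cΨ c-0 c-suc

  -- the number of bijections between two lists preserving the entries
  matchings : List ℕ → List ℕ → Carrier
  matchings s la = ind s la * cK s

  matchings-↭ : ∀ {s la} → s ↭ la → matchings s la ≈ cK s
  matchings-↭ {s} {la} p = trans (*-congʳ (ind-true {s} {la} p)) (*-identityˡ _)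

  matchings-¬↭ : ∀ {s la} → ¬ (s ↭ la) → matchings s la ≈ 0#
  matchings-¬↭ {s} {la} p = trans (*-congʳ (ind-false {s} {la} p)) (zeroˡ _)

  matchings-cPart : ∀ s la → matchings s la ≈ ι (cPart la) * ind s la
  matchings-cPart s la = case (↭? s la)
    where
    case : Dec (s ↭ la) → matchings s la ≈ ι (cPart la) * ind s la
    case (yes p) = trans (*-comm _ _) (*-congʳ (countProduct-↭ cΦ cΨ c-0 c-suc p))
    case (no ¬p) = trans (matchings-¬↭ {s} {la} ¬p) (sym (trans (*-congˡ (ind-false {s} {la} ¬p)) (zeroʳ _)))

  matchings-∷ : ∀ x s la → matchings (x ∷ s) la ≈ P la (λ b la′ → (if does (b ℕ.≟ x) then 1# else 0#) * matchings s la′)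
  matchings-∷ = match-∷ matchings cK (λ _ → 1#) (λ {s} {la} → matchings-↭ {s} {la}) (λ {s} {la} → matchings-¬↭ {s} {la})
    (λ x s → trans (countProduct-∷ cΦ cΨ c-0 c-suc x s) (*-congʳ (sym (*-identityˡ _))))

  Σ-P : ∀ {A B : Set} (M : List B) (L : List A) (f : B → A → List A → Carrier) → Σ M (λ b → P L (f b)) ≈ P L (λ a L′ → Σ M (λ b → f b a L′))
  Σ-P M [] f = Σ-0 M
  Σ-P M (a ∷ L) f = trans (Σ-+ M _ _) (+-congˡ (Σ-P M L _))

  matchings-total : ∀ N B la → maxℕ la ≤ B → All (1 ≤_) la → Σ (allVecs N B) (λ e → matchings (support e) la) ≈ ι (falling N (length la))
  matchings-total zero B [] m pos = +-congʳ (trans (matchings-↭ {[]} {[]} ↭-refl) (+-identityʳ _))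
  matchings-total zero B (a ∷ la) m pos = trans (+-congʳ (matchings-¬↭ {[]} {a ∷ la} (λ p → nonempty (PermP.↭-length p)))) (+-identityˡ _)
    where
    nonempty : ¬ (0 ≡ suc (length la))
    nonempty ()
  matchings-total (suc N) B la m pos = begin
    Σ (allVecs (suc N) B) (λ e → matchings (support e) la)
      ≈⟨ allVecs-sum N B _ ⟩
    Σ (allVecs N B) (λ e → matchings (support e) la) + sumTo B (λ a → Σ (allVecs N B) (λ e → matchings (suc a ∷ support e) la))
      ≈⟨ +-cong (matchings-total N B la m pos) (trans (sumTo-cong B (λ a _ → trans (Σ-cong (allVecs N B) (λ e → matchings-∷ (suc a) (support e) la)) (Σ-P (allVecs N B) la _)))
           (trans (sym (Σ-upTo B _)) (Σ-P (upTo B) la _))) ⟩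
    ι (falling N (length la)) + P la (λ b la′ → Σ (upTo B) (λ a → Σ (allVecs N B) (λ e → (if does (b ℕ.≟ suc a) then 1# else 0#) * matchings (support e) la′)))
      ≈⟨ +-congˡ (P-cong-↭ la one-pick) ⟩
    ι (falling N (length la)) + P la (λ b la′ → ι (falling N (ℕ.pred (suc (length la′)))) * 1#)
      ≈⟨ +-congˡ (trans (P-length (λ n → ι (falling N (ℕ.pred n))) la (λ _ _ → 1#)) (trans (*-comm _ _) (*-congʳ (trans (P-const la 1#) (*-identityʳ _))))) ⟩
    ι (falling N (length la)) + ι (length la) * ι (falling N (ℕ.pred (length la)))
      ≈⟨ sym (trans (ι-+ (falling N (length la)) _) (+-congˡ (ι-* (length la) _))) ⟩
    ι (falling (suc N) (length la)) ∎
    where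
    one-pick : ∀ b la′ → la ↭ b ∷ la′ →
      Σ (upTo B) (λ a → Σ (allVecs N B) (λ e → (if does (b ℕ.≟ suc a) then 1# else 0#) * matchings (support e) la′)) ≈ ι (falling N (length la′)) * 1#
    one-pick b la′ p = trans (Σ-cong (upTo B) (λ a → Σ-*ˡ (allVecs N B) _ _)) (trans (Σ-upTo B _) (trans
      (sumTo-single B (ℕ.pred b) _ b≤B (λ j _ j≢ → trans (*-congʳ (test-false (λ e → j≢ (≡.cong ℕ.pred (≡.sym e))))) (zeroˡ _)))
      (trans (*-comm _ _) (*-cong (matchings-total N B la′ max′ (All.tail pos′)) (test-true (≡.sym suc-b))))))
      where
      pos′ : All (1 ≤_) (b ∷ la′)
      pos′ = PermP.All-resp-↭ p pos
      suc-b : suc (ℕ.pred b) ≡ b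
      suc-b = ℕP.suc-pred b {{ℕ.>-nonZero (All.head pos′)}}
      max-b : maxℕ (b ∷ la′) ≤ B
      max-b = ≡.subst (_≤ B) (max-↭ p) m
      b≤B : suc (ℕ.pred b) ≤ B
      b≤B = ≡.subst (_≤ B) (≡.sym suc-b) (ℕP.≤-trans (ℕP.m≤m⊔n b (maxℕ la′)) max-b)
      max′ : maxℕ la′ ≤ B
      max′ = ℕP.≤-trans (ℕP.m≤n⊔m b (maxℕ la′)) max-b
      test-true : ∀ {x} → b ≡ x → (if does (b ℕ.≟ x) then 1# else 0#) ≈ 1#
      test-true {x} e = reflexive (≡.cong (λ t → if t then 1# else 0#) (dec-true (b ℕ.≟ x) e))
      test-false : ∀ {x} → ¬ b ≡ x → (if does (b ℕ.≟ x) then 1# else 0#) ≈ 0#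
      test-false {x} ne = reflexive (≡.cong (λ t → if t then 1# else 0#) (dec-false (b ℕ.≟ x) ne))

unit-⊕-head : ∀ {m} r x (e : Vec ℕ m) → V.zipWith ℕ._+_ (unitExp zero r) (x ∷ e) ≡ (r ℕ.+ x) ∷ e
unit-⊕-head {m} r x e = ≡.trans (≡.cong (λ w → V.zipWith ℕ._+_ w (x ∷ e)) (MonomialHom.unitExp-zero 𝔽 {m} r)) (≡.cong (r ℕ.+ x ∷_) (VP.zipWith-identityˡ ℕP.+-identityˡ e))

support-grows : ∀ {m} (i : Fin m) r (e : Vec ℕ m) → length (support (V.zipWith ℕ._+_ (unitExp i r) e)) ≤ suc (length (support e))
support-grows zero r (x ∷ e) = ℕP.≤-trans (ℕP.≤-reflexive (≡.cong (λ w → length (support w)) (unit-⊕-head r x e))) (bound r x)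
  where
  bound : ∀ r x → length (support ((r ℕ.+ x) ∷ e)) ≤ suc (length (support (x ∷ e)))
  bound zero x = ℕP.n≤1+n _
  bound (suc r) zero = ℕP.≤-refl
  bound (suc r) (suc x) = ℕP.n≤1+n _
support-grows (suc i) r (zero ∷ e) = support-grows i r e
support-grows (suc i) r (suc x ∷ e) = s≤s (support-grows i r e)

-- The value of m_λ at p_r ↦ d_r.

module AugmentedValue (T : CRing) (φ : Hom 𝔽 T) (d : ℕ → CommutativeRing.Carrier T) where
  open Kit T
  open Evaluation T φ
  open Augmented T
  open Shift T using (Σ-allFin-suc)

  -- Adding r + 1 at a zero coordinate creates a new part, and the zero coordinates all give the
  -- same value; at a nonzero coordinate it merges with a part. W records the dependence on the
  -- number of parts.
  coordinate-sum : ∀ {m} r (e : Vec ℕ m) (W : ℕ → Carrier) (f : List ℕ → Carrier) → (∀ {s t} → s ↭ t → f s ≈ f t) →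
    Σ (allFin m) (λ i → W (length (support (V.zipWith ℕ._+_ (unitExp i (suc r)) e))) * f (support (V.zipWith ℕ._+_ (unitExp i (suc r)) e))) ≈
    ι (zeroCount (V.toList e)) * (W (suc (length (support e))) * f (suc r ∷ support e)) + W (length (support e)) * bumpSum (suc r) (support e) f
  coordinate-sum r [] W f inv = solve 2 (λ a b → con (+ 0) := con (+ 0) :* a :+ b :* con (+ 0)) refl _ _
  coordinate-sum {suc m} r (zero ∷ e) W f inv = trans (Σ-allFin-suc m _) (trans (+-cong
      (reflexive (≡.cong (λ w → W (length (support w)) * f (support w)) (≡.trans (unit-⊕-head (suc r) 0 e) (≡.cong (_∷ e) (ℕP.+-identityʳ (suc r))))))
      (coordinate-sum r e W f inv))
    (solve 3 (λ t n b → t :+ (n :* t :+ b) := (con (+ 1) :+ n) :* t :+ b) refl _ _ _))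
  coordinate-sum {suc m} r (suc x ∷ e) W f inv = trans (Σ-allFin-suc m _) (trans (+-cong
      (reflexive (≡.cong (λ w → W (length (support w)) * f (support w)) (unit-⊕-head (suc r) (suc x) e)))
      (trans (coordinate-sum r e (λ n → W (suc n)) (λ s → f (suc x ∷ s)) (λ p → inv (prep (suc x) p)))
        (+-congʳ (*-congˡ (*-congˡ (inv (swap (suc x) (suc r) ↭-refl)))))))
    (solve 4 (λ w h t b → w :* h :+ (t :+ w :* b) := t :+ w :* (h :+ b)) refl _ _ _ _))

  module _ (N : ℕ) where
    open PowerProducts T φ N

    dprodᵀ : List ℕ → Carrier
    dprodᵀ = prodOver (λ b → d (suc b))

    -- a functional on Λ_N recovering d: it turns multiplication by p_r into multiplication by d r
    extract : Mono N → Carrier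
    extract e = ι ((N ∸ length (support e)) !) * augmented d (support e)

    -- With ℓ parts there are N - ℓ free positions, and (N - ℓ) (N - ℓ - 1)! = (N - ℓ)! equalises
    -- the weights of new and merged parts. The recursion of `augmented` then cancels the merged
    -- terms. The bound ℓ < N provides a free position.
    extract-step : ∀ r e → length (support e) < N → Σ (allFin N) (λ i → extract (V.zipWith ℕ._+_ (unitExp i (suc r)) e)) ≈ d (suc r) * extract e
    extract-step r e p = begin
      Σ (allFin N) (λ i → extract (V.zipWith ℕ._+_ (unitExp i (suc r)) e))
        ≈⟨ coordinate-sum r e (λ n → ι ((N ∸ n) !)) (augmented d) (augmented-↭ d) ⟩
      ι (zeroCount (V.toList e)) * (ι ((N ∸ suc k) !) * augmented d (suc r ∷ support e)) + ι ((N ∸ k) !) * bumpSum (suc r) (support e) (augmented d)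
        ≈⟨ +-congʳ (trans (sym (*-assoc _ _ _)) (*-congʳ (trans (sym (ι-* (zeroCount (V.toList e)) _)) (reflexive (≡.cong ι factorial))))) ⟩
      ι ((N ∸ k) !) * augmented d (suc r ∷ support e) + ι ((N ∸ k) !) * bumpSum (suc r) (support e) (augmented d)
        ≈⟨ +-congʳ (*-congˡ (augmented-∷ d (suc r) (support e))) ⟩
      ι ((N ∸ k) !) * (d (suc r) * augmented d (support e) + - bumpSum (suc r) (support e) (augmented d)) + ι ((N ∸ k) !) * bumpSum (suc r) (support e) (augmented d)
        ≈⟨ solve 4 (λ w x a b → w :* (x :* a :- b) :+ w :* b := x :* (w :* a)) refl _ _ _ _ ⟩
      d (suc r) * extract e ∎
      where
      k = length (support e)
      factorial : zeroCount (V.toList e) ℕ.* ((N ∸ suc k) !) ≡ (N ∸ k) !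
      factorial = ≡.trans (≡.cong (ℕ._* ((N ∸ suc k) !)) (≡.trans (≡.sym (ℕP.m+n∸m≡n k _)) (≡.trans (≡.cong (_∸ k) (support-count e)) (ℕP.+-∸-assoc 1 p))))
        (≡.cong _! (≡.sym (ℕP.+-∸-assoc 1 p)))

    -- Each power sum raises the number of parts by at most one, so the bound on ℓ + |κ| leaves a
    -- free position at every step.
    extract-powProd : ∀ κ e → length (support e) ℕ.+ length κ ≤ N → ev (powProd κ) (λ b → extract (V.zipWith ℕ._+_ b e)) ≈ dprodᵀ κ * extract e
    extract-powProd [] e p = trans (ev-powProd-[] (λ b → extract (V.zipWith ℕ._+_ b e))) (trans (reflexive (≡.cong extract (VP.zipWith-identityˡ ℕP.+-identityˡ e))) (sym (*-identityˡ _)))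
    extract-powProd (r ∷ κ) e p = begin
      ev (powProd (r ∷ κ)) (λ b → extract (V.zipWith ℕ._+_ b e))
        ≈⟨ ev-powProd-∷ r κ _ ⟩
      Σ (allFin N) (λ i → ev (powProd κ) (λ b → extract (V.zipWith ℕ._+_ (V.zipWith ℕ._+_ (unitExp i (suc r)) b) e)))
        ≈⟨ Σ-cong (allFin N) (λ i → trans (ev-cong (powProd κ) (λ b → reflexive (≡.cong extract (reassociate (unitExp i (suc r)) b))))
             (extract-powProd κ (V.zipWith ℕ._+_ (unitExp i (suc r)) e) (ℕP.≤-trans (ℕP.+-monoˡ-≤ (length κ) (support-grows i (suc r) e)) (ℕP.≤-trans (ℕP.≤-reflexive (≡.sym (ℕP.+-suc _ _))) p)))) ⟩
      Σ (allFin N) (λ i → dprodᵀ κ * extract (V.zipWith ℕ._+_ (unitExp i (suc r)) e))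
        ≈⟨ trans (Σ-*ˡ (allFin N) _ _) (*-congˡ (extract-step r e (ℕP.≤-trans (ℕP.m≤m+n (suc (length (support e))) (length κ)) (ℕP.≤-trans (ℕP.≤-reflexive (≡.sym (ℕP.+-suc _ _))) p)))) ⟩
      dprodᵀ κ * (d (suc r) * extract e)
        ≈⟨ solve 3 (λ a b c → a :* (b :* c) := b :* a :* c) refl _ _ _ ⟩
      dprodᵀ (r ∷ κ) * extract e ∎
      where
      reassociate : ∀ a b → V.zipWith ℕ._+_ (V.zipWith ℕ._+_ a b) e ≡ V.zipWith ℕ._+_ b (V.zipWith ℕ._+_ a e)
      reassociate a b = ≡.trans (≡.cong (λ w → V.zipWith ℕ._+_ w e) (VP.zipWith-comm ℕP.+-comm a b)) (VP.zipWith-assoc ℕP.+-assoc b a e)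

    extract-value : ∀ κ → length κ ≤ N → ev (powProd κ) extract ≈ ι (N !) * dprodᵀ κ
    extract-value κ p = begin
      ev (powProd κ) extract
        ≈⟨ ev-cong (powProd κ) (λ b → reflexive (≡.cong extract (≡.sym (VP.zipWith-identityʳ ℕP.+-identityʳ b)))) ⟩
      ev (powProd κ) (λ b → extract (V.zipWith ℕ._+_ b (V.replicate N 0)))
        ≈⟨ extract-powProd κ (V.replicate N 0) (≡.subst (λ s → length s ℕ.+ length κ ≤ N) (≡.sym (support-zero N)) p) ⟩
      dprodᵀ κ * extract (V.replicate N 0)
        ≈⟨ *-congˡ (reflexive (≡.cong (λ s → ι ((N ∸ length s) !) * augmented d s) (support-zero N))) ⟩
      dprodᵀ κ * (ι (N !) * 1#)
        ≈⟨ solve 2 (λ a b → a :* (b :* con (+ 1)) := b :* a) refl _ _ ⟩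
      ι (N !) * dprodᵀ κ ∎
      where
      support-zero : ∀ m → support (V.replicate m 0) ≡ []
      support-zero zero = ≡.refl
      support-zero (suc m) = support-zero m

  module _ (M : Λel) (la : List ℕ) (pos : All (1 ≤_) la) (monomial : ∀ N → π N M ≈P msym N la) where
    open PartitionSums T
    open Counting T
    open Determinant T using (Σ-congᴬ)
    private
      -- Large enough for each product of power sums in M and for all parts of la.
      N : ℕ
      N = sum (map (λ t → length (proj₁ t)) M) ℕ.+ length la
      open PowerProducts T φ N

      short : ∀ (L : Λel) n → sum (map (λ t → length (proj₁ t)) L) ≤ n → All (λ t → length (proj₁ t) ≤ n) L
      short [] n p = []
      short (t ∷ L) n p = ℕP.≤-trans (ℕP.m≤m+n _ _) p ∷ short L n (ℕP.≤-trans (ℕP.m≤n+m _ _) p)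

      ι!-invertible : ∀ n → Units.Invertible T (ι (n !))
      ι!-invertible zero = 1# , trans (*-identityˡ _) (+-identityʳ _)
      ι!-invertible (suc n) = transport (sym (ι-* (suc n) (n !))) (invertible-* (image n) (ι!-invertible n))
        where
        open Units T
        transport : ∀ {a b} → a ≈ b → Invertible a → Invertible b
        transport e (v , f) = v , trans (*-congˡ (sym e)) f
        module φ = HomProps φ
        image : ∀ n → Invertible (ι (suc n))
        image n = φ.⟦ proj₁ (ℕ→F-invertible n) ⟧ , trans (*-congˡ (sym (scalar-ℕ (suc n)))) (trans (sym (φ.*-homo _ _)) (trans (φ.⟦⟧-cong (proj₂ (ℕ→F-invertible n))) φ.1-homo))

    -- `extract` takes the value N! M(d) on π N M. On `msym N la` it gives (N - ℓ)! (c_λ m_λ)(d) for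
    -- each monomial, and c_λ times the number of monomials is N!/(N - ℓ)!. Characteristic zero
    -- allows N! to be cancelled.
    augmented-value : ι (cPart la) * ev M (prodOver (λ b → d (suc b))) ≈ augmented d la
    augmented-value = cancel (begin
      ι (N !) * (ι (cPart la) * ev M (dprodᵀ N))
        ≈⟨ trans (solve 3 (λ a b c → a :* (b :* c) := b :* (a :* c)) refl _ _ _) (*-congˡ (trans (sym (ev-*ˡ M _ _)) (Σ-congᴬ (All.map (λ {t} p → *-congˡ (sym (extract-value N (proj₁ t) p)))
             (short M N (ℕP.m≤m+n _ _)))))) ⟩
      ι (cPart la) * ev M (λ κ → ev (powProd κ) (extract N))
        ≈⟨ *-congˡ (trans (sym (ev-π M (extract N))) (trans (≈P⇒ev T φ (π N M) (msym N la) (monomial N) (extract N))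
             (trans (Σ-map _ (monomialExponents N la) _) (trans (Σ-cong (monomialExponents N la) (λ e → trans (*-congʳ scalar-1) (*-identityˡ _)))
               (monomial-sum N la (maxℕ la) (extract N) ℕP.≤-refl))))) ⟩
      ι (cPart la) * Σ (allVecs N (maxℕ la)) (λ e → ind (support e) la * extract N e)
        ≈⟨ trans (sym (Σ-*ˡ (allVecs N (maxℕ la)) _ _)) (Σ-cong (allVecs N (maxℕ la)) matched) ⟩
      Σ (allVecs N (maxℕ la)) (λ e → matchings (support e) la * (ι ((N ∸ length la) !) * augmented d la))
        ≈⟨ trans (Σ-*ʳ (allVecs N (maxℕ la)) _ _) (*-congʳ (matchings-total N (maxℕ la) la ℕP.≤-refl pos)) ⟩
      ι (falling N (length la)) * (ι ((N ∸ length la) !) * augmented d la)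
        ≈⟨ trans (solve 3 (λ a b c → a :* (b :* c) := b :* a :* c) refl _ _ _) (*-congʳ (trans (sym (ι-* ((N ∸ length la) !) _)) (reflexive (≡.cong ι (falling-! N (length la) (ℕP.m≤n+m _ _)))))) ⟩
      ι (N !) * augmented d la ∎)
      where
      cancel : ∀ {a b} → ι (N !) * a ≈ ι (N !) * b → a ≈ b
      cancel {a} {b} e = trans (solve 2 (λ a b → a := (a :- b) :+ b) refl a b) (trans (+-congʳ (Units.invertible⇒nzd T (ι!-invertible N) (a + - b)
        (trans (solve 3 (λ v a b → v :* (a :- b) := v :* a :- v :* b) refl _ a b) (trans (+-congʳ e) (-‿inverseʳ _))))) (+-identityˡ _))
      matched : ∀ e → ι (cPart la) * (ind (support e) la * extract N e) ≈ matchings (support e) la * (ι ((N ∸ length la) !) * augmented d la)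
      matched e = case (↭? (support e) la)
        where
        case : Dec (support e ↭ la) → ι (cPart la) * (ind (support e) la * extract N e) ≈ matchings (support e) la * (ι ((N ∸ length la) !) * augmented d la)
        case (yes p) = trans (sym (*-assoc _ _ _)) (*-cong (sym (matchings-cPart (support e) la)) (*-cong (reflexive (≡.cong (λ n → ι ((N ∸ n) !)) (PermP.↭-length p))) (augmented-↭ d p)))
        case (no ¬p) = trans (*-congˡ (trans (*-congʳ (ind-false {support e} {la} ¬p)) (zeroˡ _))) (trans (zeroʳ _) (sym (trans (*-congʳ (matchings-¬↭ {support e} {la} ¬p)) (zeroˡ _))))

open Adjoints using (θ; module AdjointFormula)

-- The two forms of a row agree only at 1 ≤ s ≤ N, because of the truncated subtractions.
module RowForms (R : CRing) where
  open Kit R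
  open Determinant R
  open Rows R

  private
    rowProd-congᴮ : ∀ N m {n} (σ : Vec ℕ n) → VAll.All (λ s → 1 ≤ s × s ≤ N) σ → (f g : Fin m → ℕ → Carrier) →
      (∀ j s → 1 ≤ s → s ≤ N → f j s ≈ g j s) → rowProd (L.tabulate f) σ ≈ rowProd (L.tabulate g) σ
    rowProd-congᴮ N zero σ b f g e = refl
    rowProd-congᴮ N (suc m) [] b f g e = refl
    rowProd-congᴮ N (suc m) (s ∷ σ) (b VAll.∷ bs) f g e = *-cong (e zero s (proj₁ b) (proj₂ b)) (rowProd-congᴮ N m σ bs (λ j → f (suc j)) (λ j → g (suc j)) (λ j → e (suc j)))

  det-rows : ∀ N u (x v h : Fin N → Carrier) → (∀ j → v j ≈ h j) →
    det N (L.tabulate (λ j s → x j ^ (N ∸ s) * (u + ι (s ∸ 1) + - v j))) ≈ det N (map (λ j → freeRow N u (x j) (h j)) (allFin N))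
  det-rows N u x v h e = trans
    (Σ-congᴬ (All.map (λ {σ} b → *-congˡ (rowProd-congᴮ N N σ b _ _ (λ j s p q → *-congˡ (+-cong (base s p q) (-‿cong (e j)))))) (permutation-entries N)))
    (reflexive (≡.cong (det N) (≡.sym (LP.map-tabulate (λ j → j) (λ j → freeRow N u (x j) (h j))))))
    where
    base : ∀ s → 1 ≤ s → s ≤ N → u + ι (s ∸ 1) ≈ u + ι (N ∸ 1) + - ι (N ∸ s)
    base (suc s) _ q = trans (solve 3 (λ u a b → u :+ a := u :+ (a :+ b) :- b) refl u (ι s) (ι (N ∸ suc s)))
      (+-congʳ (+-congˡ (trans (sym (ι-+ s (N ∸ suc s))) (reflexive (≡.cong ι (split N q))))))
      where
      split : ∀ N → suc s ≤ N → s ℕ.+ (N ∸ suc s) ≡ N ∸ 1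
      split (suc N) (s≤s q) = ℕP.m+[n∸m]≡n q

-- The terms with |K| = k, and their identification with the adjoint sum.

module Layers (N : ℕ) (D : ℕ) where
  open SekiguchiDebiard N
  open PolynomialRing (suc N)
  open Kit Polynomials
  open Determinant Polynomials
  open RisingFactorial Polynomials
  open Towers Polynomials α
  private
    module T (n : ℕ) where
      open Kit (Tower Polynomials n) public
      open Determinant (Tower Polynomials n) public
      open Augmented (Tower Polynomials n) public
      open RisingFactorial (Tower Polynomials n) public
      open Enumeration (Tower Polynomials n) public
      open MonomialHom (Tower Polynomials n) public
    module H (n : ℕ) = HomProps (towerEmbed Polynomials n)

  V : Carrier
  V = vandermonde (map x (allFin N))

  -- The double sum over K and γ in the determinant identity, restricted to |K| = k and written over
  -- exponent vectors.
  layerSum : ∀ la → ℕ → C la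
  layerSum la k = T.Σ l (allVecs N D) (λ e → if does (length (support e) ℕ.≟ k) then T._*_ l (emb la (lift e)) (T.augmented l (dvals la) (support e)) else T.0# l)
    where l = length la

  layer : List ℕ → ℕ → Carrier
  layer la k = sgn k * evTop psum la (layerSum la k)

  private
    emb-lift : ∀ la e → T._≈_ (length la) (emb la (lift e)) (T.prodV (length la) (λ i → emb la (x i)) e)
    emb-lift la e = T.trans l (Hom.⟦⟧-cong (towerEmbed Polynomials l) (MonomialHom.μ-prodV Polynomials lift lift-multiplicative e)) (go x e)
      where
      l = length la
      go : ∀ {m} (z : Fin m → Carrier) (e : Vec ℕ m) → T._≈_ l (emb la (MonomialHom.prodV Polynomials z e)) (T.prodV l (λ i → emb la (z i)) e)
      go z [] = H.1-homo l
      go z (a ∷ e) = T.trans l (H.*-homo l _ _) (T.*-cong l (H.^-homo l (z zero) a) (go (λ i → z (suc i)) e))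

    regular : ∀ la l j → ¬ l ≡ j → NonZeroDivisor (Tower Polynomials (length la)) (T._+_ (length la) (emb la (x l)) (T.-_ (length la) (emb la (x j))))
    regular la l j l≢j a e = tower-nzd Polynomials n _ (VariableDifferences.variable-difference-regular (suc N) (suc l) (suc j) (λ { ≡.refl → l≢j ≡.refl })) a
      (T.trans n (T.*-congʳ n (T.trans n (H.+-homo n _ _) (T.+-congˡ n (H.neg-homo n _)))) e)
      where n = length la

    expansion-layers : ∀ la → T._≈_ (length la) (RegularVariables.expansionSum (Tower Polynomials (length la)) N (emb la u) (λ i → emb la (x i)) (dvals la) D)
      (T.Σ (length la) (upTo (suc N)) (λ k → T._*_ (length la) (emb la (rise u k (N ∸ k) * sgn k)) (layerSum la k)))
    expansion-layers la = T.trans l (T.S2-cong l (allFin N) (λ K Z → T.trans l (T.sym l (T.*-assoc l _ _ _)) (T.sym l (T.expSum-*ˡ l x′ D K _ _))))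
      (T.trans l (T.exponent-sum l N (λ i → i) x′ D (λ a b γ → T._*_ l (weight a b) (T.augmented l (dvals la) γ)))
      (T.trans l (T.Σ-cong l (allVecs N D) (λ e → T.trans l (swap-left _ _ _) (T.*-congˡ l (T.*-congʳ l (T.sym l (emb-lift la e))))))
      (T.trans l (T.layers l N D weight _)
        (T.Σ-cong l (upTo (suc N)) (λ k → T.*-congʳ l (T.sym l (T.trans l (H.*-homo l _ _) (T.*-cong l (H.rise-homo l u k (N ∸ k)) (H.sgn-homo l k)))))))))
      where
      l = length la
      x′ : Fin N → C la
      x′ i = emb la (x i)
      weight : ℕ → ℕ → C la
      weight a b = T._*_ l (T.rise l (emb la u) a b) (T.sgn l a)
      swap-left : ∀ a b c → T._≈_ l (T._*_ l a (T._*_ l b c)) (T._*_ l b (T._*_ l a c))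
      swap-left a b c = T.trans l (T.sym l (T.*-assoc l a b c)) (T.trans l (T.*-congʳ l (T.*-comm l a b)) (T.*-assoc l b a c))

  degree-part : ∀ la → degree la ≤ D → All (λ r → suc r ≤ D) la
  degree-part [] p = []
  degree-part (r ∷ la) p = ℕP.≤-trans (ℕP.m≤m+n (suc r) (degree la)) p ∷ degree-part la (ℕP.≤-trans (ℕP.m≤n+m (degree la) (suc r)) p)

  -- The determinant identity is applied over the tower and then read off by `evTop`. The bound
  -- `degree la` ≤ D makes the sums h_i complete and kills all exponent vectors of degree beyond D.
  iterated-layers : ∀ la → degree la ≤ D → iterated la (λ _ → 0#) ≈ V * Σ (upTo (suc N)) (λ k → rise u k (N ∸ k) * layer la k)
  iterated-layers la p = begin
    iterated la (λ _ → 0#)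
      ≈⟨ Truncated.iterated-evTop D la (degree-part la p) (λ _ → 0#) ⟩
    evTop psum la (Kernel.shiftedDet Polynomials α N u x l (λ j → T._+_ l (emb la 0#) (Truncated.hval D la j)))
      ≈⟨ evTop-cong psum la (T.trans l (RowForms.det-rows (Tower Polynomials l) N (emb la u) (λ i → emb la (x i)) _ (Truncated.hval D la)
             (λ j → T.trans l (T.+-congʳ l (H.0-homo l)) (T.+-identityˡ l _)))
           (T.trans l (RegularVariables.det-regular (Tower Polynomials l) N (emb la u) (λ i → emb la (x i)) (dvals la) D
               (λ γ q → augmented-vanishes la γ (ℕP.≤-<-trans p q)) (regular la))
             (T.*-cong l (T.trans l (T.reflexive l (≡.cong (T.vandermonde l) (LP.map-∘ (allFin N)))) (T.sym l (H.vandermonde-homo l (map x (allFin N))))) (expansion-layers la)))) ⟩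
    evTop psum la (T._*_ l (emb la V) (T.Σ l (upTo (suc N)) (λ k → T._*_ l (emb la (rise u k (N ∸ k) * sgn k)) (layerSum la k))))
      ≈⟨ trans (evTop-scale psum la V _) (*-congˡ (trans (evTop-Σ psum la (upTo (suc N)) _) (Σ-cong (upTo (suc N)) (λ k → trans (evTop-scale psum la _ _) (*-assoc _ _ _))))) ⟩
    V * Σ (upTo (suc N)) (λ k → rise u k (N ∸ k) * layer la k) ∎
    where l = length la

  numS-layers : ∀ f → All (λ t → degree (proj₁ t) ≤ D) f → toP (numS N (π N f)) ≈ V * Σ (upTo (suc N)) (λ k → rise u k (N ∸ k) * ev f (λ la → layer la k))
  numS-layers f small = begin
    toP (numS N (π N f))
      ≈⟨ trans (numS-iterated f) (Σ-congᴬ (All.map (λ {t} p → *-congˡ (iterated-layers (proj₁ t) p)) small)) ⟩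
    ev f (λ la → V * Σ (upTo (suc N)) (λ k → rise u k (N ∸ k) * layer la k))
      ≈⟨ ev-*ˡ f V _ ⟩
    V * ev f (λ la → Σ (upTo (suc N)) (λ k → rise u k (N ∸ k) * layer la k))
      ≈⟨ *-congˡ (trans (Σ-cong f (λ t → sym (Σ-*ˡ (upTo (suc N)) _ _))) (trans (Σ-swap f (upTo (suc N)) _) (Σ-cong (upTo (suc N)) (λ k → ev-*ˡ f _ _)))) ⟩
    V * Σ (upTo (suc N)) (λ k → rise u k (N ∸ k) * ev f (λ la → layer la k)) ∎

  image : Λel → Carrier
  image g = ev g (prodOver (λ r → psum (suc r)))

  toP-image : ∀ g → toP (liftU (π N g)) ≈ image g
  toP-image g = trans (toP-liftU (π N g)) (trans (ev-π g lift) (ev-cong g powers))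
    where
    powers : ∀ ix → ev (powProd ix) lift ≈ prodOver (λ r → psum (suc r)) ix
    powers [] = trans (ev-powProd-[] lift) mono-0
    powers (r ∷ ix) = trans (ev-powProd-∷ r ix lift) (trans (Σ-cong (allFin N) (λ i → trans (ev-cong (powProd ix) (λ b → MonomialHom.Multiplicative.μ-⊕ lift-multiplicative _ b))
      (trans (ev-*ˡ (powProd ix) _ _) (*-cong (MonomialHom.μ-unit Polynomials lift lift-multiplicative i (suc r)) (powers ix))))) (Σ-*ʳ (allFin N) _ _))

  image-* : ∀ g h → image (g *Λ h) ≈ image g * image h
  image-* g h = trans (ev-mul _++_ g h _) (trans (ev-cong g (λ a → trans (ev-cong h (λ b → prodOver-++ Polynomials _ a b)) (trans (ev-*ˡ h _ _) (*-comm _ _))))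
    (trans (ev-*ˡ g _ _) (*-comm _ _)))

  module _ (M : List ℕ → Λel) (monomial : ∀ la N → π N (M la) ≈P msym N la) where

    image-monomial : ∀ la → image (M la) ≈ Σ (PartitionSums.monomialExponents Polynomials N la) lift
    image-monomial la = trans (sym (toP-image (M la))) (trans (toP-liftU (π N (M la))) (trans (≈P⇒ev Polynomials const (π N (M la)) (msym N la) (monomial la N) lift)
      (trans (Σ-map _ (PartitionSums.monomialExponents Polynomials N la) _) (Σ-cong (PartitionSums.monomialExponents Polynomials N la) (λ e → trans (*-congʳ scalar-1) (*-identityˡ _))))))

    image-rhs : ∀ k G → image (rhsTrunc k D M G) ≈ Σ (decParts k D) (λ la → sgn k * ι (cPart la) * (image (M la) * image (G la)))
    image-rhs k G = go (decParts k D)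
      where
      go : ∀ las → image (sumΛ (map (λ la → scaleΛ (negOnePow k *F ℕ→F (cPart la)) (M la *Λ G la)) las)) ≈ Σ las (λ la → sgn k * ι (cPart la) * (image (M la) * image (G la)))
      go [] = refl
      go (la ∷ las) = trans (Σ-++ (scaleΛ (negOnePow k *F ℕ→F (cPart la)) (M la *Λ G la)) _ _) (+-cong
        (trans (ev-scale (negOnePow k *F ℕ→F (cPart la)) (M la *Λ G la) _) (*-cong (trans (scalar-* _ _) (*-cong (scalar-sgn k) (scalar-ℕ (cPart la)))) (image-* (M la) (G la)))) (go las))

    -- A monomial in N variables has at most N nonzero exponents, so m_λ becomes 0 when ℓ(λ) > N.
    image-rhs-zero : ∀ k G → N < k → image (rhsTrunc k D M G) ≈ 0#
    image-rhs-zero k G N<k = trans (image-rhs k G) (trans (Σ-congᴬ {g = λ _ → 0#} (All.map (λ {la} shape → trans (*-congˡ (trans (*-congʳ (vanish la shape)) (zeroˡ _))) (zeroʳ _)) (decParts-shape k D))) (Σ-0 (decParts k D)))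
      where
      open PartitionSums Polynomials
      vanish : ∀ la → length la ≡ k × maxℕ la ≤ D × All (1 ≤_) la → image (M la) ≈ 0#
      vanish la (l , m , _) = trans (image-monomial la) (trans (monomial-sum N la D lift m) (Σ-zero (allVecs N D) (λ e → trans (*-congʳ (ind-false {support e} {la}
        (λ r → ℕP.<⇒≱ N<k (ℕP.≤-trans (ℕP.≤-reflexive (≡.trans (≡.sym l) (≡.sym (PermP.↭-length r)))) (ℕP.≤-trans (ℕP.m≤m+n _ _) (ℕP.≤-reflexive (support-count e))))))) (zeroˡ _))))

    module _ (f : Λel) (G : List ℕ → Λel) (adjoint : ∀ la h → ⟨ G la , h ⟩ ≃ ⟨ f , M la *Λ h ⟩) where

      private
        mapped : ∀ ix la → C ix
        mapped ix la = Hom.⟦_⟧ (towerMap const (length ix)) (θ ix (M la))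

        -- The adjoint was computed in the tower over 𝔽; its image in the tower over polynomials is
        -- again evaluation at d, and there c_λ m_λ is `augmented`.
        normalised : ∀ ix la → All (1 ≤_) la → T._≈_ (length ix) (T._*_ (length ix) (emb ix (ι (cPart la))) (mapped ix la)) (T.augmented (length ix) (dvals ix) la)
        normalised ix la pos = T.trans l (T.*-cong l (H.ι-homo l (cPart la)) (T.trans l (HomProps.Σ-homo (towerMap const l) (M la) _)
            (T.Σ-cong l (M la) (λ t → T.trans l (HomProps.*-homo (towerMap const l) _ _) (T.*-cong l (towerMap-embed const l _)
              (T.trans l (HomProps.prodOver-homo (towerMap const l) _ (proj₁ t)) (prodOver-cong′ (proj₁ t))))))))
          (AugmentedValue.augmented-value (Tower Polynomials l) (towerEmbed Polynomials l ∘ᴴ const) (dvals ix) (M la) la pos (monomial la))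
          where
          l = length ix
          prodOver-cong′ : ∀ κ → T._≈_ l (T.prodOver l (λ b → Hom.⟦_⟧ (towerMap const l) (Towers.dvals 𝔽 (toF αF) ix (suc b))) κ) (T.prodOver l (λ b → dvals ix (suc b)) κ)
          prodOver-cong′ [] = T.refl l
          prodOver-cong′ (b ∷ κ) = T.*-cong l (TowerMap.map-dvals const (toF αF) ix (suc b)) (prodOver-cong′ κ)

      -- The adjoint contributes m_λ(d), and multiplication contributes m_λ(x). Spreading m_λ(x)
      -- over its monomials turns the sum of m_λ(x) (c_λ m_λ)(d) over partitions of length k into
      -- the sum over exponent vectors with k nonzero entries.
      image-rhs-layers : ∀ k → image (rhsTrunc k D M G) ≈ ev f (λ ix → layer ix k)
      image-rhs-layers k = begin
        image (rhsTrunc k D M G)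
          ≈⟨ image-rhs k G ⟩
        Σ (decParts k D) (λ la → sgn k * ι (cPart la) * (image (M la) * image (G la)))
          ≈⟨ Σ-congᴬ (All.map (λ {la} shape → summand la (proj₂ (proj₂ shape))) (decParts-shape k D)) ⟩
        Σ (decParts k D) (λ la → ev f (λ ix → sgn k * evTop psum ix (T._*_ (length ix) (emb ix (W la)) (T.augmented (length ix) (dvals ix) la))))
          ≈⟨ trans (Σ-swap (decParts k D) f _) (Σ-cong f (λ t → trans (Σ-*ˡ (decParts k D) _ _) (*-congˡ (Σ-*ˡ (decParts k D) _ _)))) ⟩
        ev f (λ ix → sgn k * Σ (decParts k D) (λ la → evTop psum ix (T._*_ (length ix) (emb ix (W la)) (T.augmented (length ix) (dvals ix) la))))
          ≈⟨ ev-cong f (λ ix → *-congˡ (trans (sym (evTop-Σ psum ix (decParts k D) _)) (evTop-cong psum ix (regrouped ix)))) ⟩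
        ev f (λ ix → layer ix k) ∎
        where
        W : List ℕ → Carrier
        W la = Σ (PartitionSums.monomialExponents Polynomials N la) lift
        summand : ∀ la → All (1 ≤_) la → sgn k * ι (cPart la) * (image (M la) * image (G la)) ≈
          ev f (λ ix → sgn k * evTop psum ix (T._*_ (length ix) (emb ix (W la)) (T.augmented (length ix) (dvals ix) la)))
        summand la pos = begin
          sgn k * ι (cPart la) * (image (M la) * image (G la))
            ≈⟨ *-congˡ (*-cong (image-monomial la) (AdjointFormula.adjoint-value (M la) (G la) f (adjoint la) Polynomials const psum)) ⟩
          sgn k * ι (cPart la) * (W la * ev f (λ ix → evTop psum ix (mapped ix la)))
            ≈⟨ solve 4 (λ s c w e → s :* c :* (w :* e) := s :* w :* c :* e) refl _ _ _ _ ⟩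
          sgn k * W la * ι (cPart la) * ev f (λ ix → evTop psum ix (mapped ix la))
            ≈⟨ sym (ev-*ˡ f _ _) ⟩
          ev f (λ ix → sgn k * W la * ι (cPart la) * evTop psum ix (mapped ix la))
            ≈⟨ ev-cong f (λ ix → trans (trans (*-congʳ (*-assoc _ _ _)) (*-assoc _ _ _)) (*-congˡ (trans (*-assoc _ _ _)
                 (trans (*-congˡ (sym (evTop-scale psum ix _ _))) (trans (sym (evTop-scale psum ix _ _)) (evTop-cong psum ix (T.*-congˡ (length ix) (normalised ix la pos)))))))) ⟩
          ev f (λ ix → sgn k * evTop psum ix (T._*_ (length ix) (emb ix (W la)) (T.augmented (length ix) (dvals ix) la))) ∎
        regrouped : ∀ ix → T._≈_ (length ix) (T.Σ (length ix) (decParts k D) (λ la → T._*_ (length ix) (emb ix (W la)) (T.augmented (length ix) (dvals ix) la))) (layerSum ix k)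
        regrouped ix = T.trans l (T.Σ-cong l (decParts k D) (λ la → T.*-congʳ l (H.Σ-homo l (PartitionSums.monomialExponents Polynomials N la) lift)))
          (PartitionSums.regroup (Tower Polynomials l) N k D (λ e → emb ix (lift e)) (T.augmented l (dvals ix)) (T.augmented-↭ l (dvals ix)))
          where l = length ix

-- Uniqueness of the expansion coefficients.

module RisingExpansions (R : CRing) (regular : ∀ n → NonZeroDivisor R (Kit.ι R (suc n))) where
  open Kit R
  open RisingFactorial R
  open Enumeration R

  -- The factors run from u + k to u + k + r - 1, so u + m is among them.
  rise-zero : ∀ m k r → k ≤ m → m < k ℕ.+ r → rise (- ι m) k r ≈ 0#
  rise-zero m k zero k≤m p = ⊥-elim (ℕP.<⇒≱ p (ℕP.≤-trans (ℕP.≤-reflexive (ℕP.+-identityʳ k)) k≤m))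
  rise-zero m k (suc r) k≤m p with ℕP.m≤n⇒m<n∨m≡n k≤m
  ... | inj₂ ≡.refl = trans (*-congʳ (-‿inverseˡ _)) (zeroˡ _)
  ... | inj₁ k<m = trans (*-congˡ (rise-zero m (suc k) r k<m (≡.subst (m <_) (ℕP.+-suc k r) p))) (zeroʳ _)

  -- For k > m all factors are positive integers at u = -m; d is k - m - 1.
  rise-regular : ∀ m k d r → k ≡ m ℕ.+ suc d → NonZeroDivisor R (rise (- ι m) k r)
  rise-regular m k d zero p a e = trans (sym (*-identityˡ a)) e
  rise-regular m k d (suc r) p a e = rise-regular m (suc k) (suc d) r (≡.trans (≡.cong suc p) (≡.sym (ℕP.+-suc m (suc d)))) a
    (regular d _ (trans (*-congʳ (sym factor)) (trans (sym (*-assoc _ _ _)) e)))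
    where
    factor : - ι m + ι k ≈ ι (suc d)
    factor = trans (+-congˡ (trans (reflexive (≡.cong ι p)) (ι-+ m (suc d)))) (solve 2 (λ a b → :- a :+ (a :+ b) := b) refl _ _)

  -- At u = −(k − 1) every term with a smaller index vanishes, and those with a larger index are zero by descending induction.
  coefficients-zero : ∀ N (δ : ℕ → Carrier) → (∀ m → Σ (upTo (suc N)) (λ k → δ k * rise (- ι m) k (N ∸ k)) ≈ 0#) →
    ∀ k → 1 ≤ k → k ≤ N → δ k ≈ 0#
  coefficients-zero N δ e k = below (suc (N ∸ k)) k ℕP.≤-refl
    where
    below : ∀ n k → N ∸ k < n → 1 ≤ k → k ≤ N → δ k ≈ 0#
    below (suc n) (suc m) (s≤s p) _ q = rise-regular m (suc m) 0 (N ∸ suc m) (≡.sym (ℕP.+-comm m 1)) (δ (suc m))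
      (trans (*-comm _ _) (trans (sym (trans (Σ-upTo (suc N) _) (sumTo-single (suc N) (suc m) (λ k → δ k * rise (- ι m) k (N ∸ k)) (s≤s q) others))) (e m)))
      where
      others : ∀ j → j < suc N → ¬ j ≡ suc m → δ j * rise (- ι m) j (N ∸ j) ≈ 0#
      others j (s≤s j≤N) j≢ with ℕP.<-cmp j (suc m)
      ... | tri< (s≤s j≤m) _ _ = trans (*-congˡ (rise-zero m j (N ∸ j) j≤m (ℕP.≤-trans q (ℕP.≤-reflexive (≡.sym (ℕP.m+[n∸m]≡n j≤N)))))) (zeroʳ _)
      ... | tri≈ _ j≡ _ = ⊥-elim (j≢ j≡)
      ... | tri> _ _ j> = trans (*-congʳ (below n j (ℕP.<-≤-trans (ℕP.∸-monoʳ-< j> j≤N) p) (ℕP.≤-trans (s≤s z≤n) j>) j≤N)) (zeroˡ _)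

module Specialisation (N : ℕ) where
  open PolynomialRing N
  open Kit Polynomials
  open RisingFactorial Polynomials
  private
    module U where
      open PolynomialRing (suc N) public
      open Kit (PolynomialRing.Polynomials (suc N)) public
      open RisingFactorial (PolynomialRing.Polynomials (suc N)) public
      open SekiguchiDebiard N using (u) public

    -- The substitution u = -m on monomials, u being the variable with index 0.
    μ : ℕ → Mono (suc N) → Carrier
    μ m (e ∷ es) = (- ι m) ^ e * mono es

    μ-⊕ : ∀ m a b → μ m (V.zipWith ℕ._+_ a b) ≈ μ m a * μ m b
    μ-⊕ m (a ∷ as) (b ∷ bs) = trans (*-cong (^-+ _ a b) (mono-⊕ as bs)) (solve 4 (λ x y z w → x :* y :* (z :* w) := x :* z :* (y :* w)) refl _ _ _ _)

    μ-0 : ∀ m → μ m (V.replicate (suc N) 0) ≈ 1#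
    μ-0 m = trans (*-identityˡ _) mono-0

    at : ℕ → Hom U.Polynomials Polynomials
    at m = U.evalHom Polynomials const (μ m) (μ-⊕ m) (μ-0 m)
    module at (m : ℕ) = HomProps (at m)

    at-toP : ∀ m p → at.⟦_⟧ m (U.toP p) ≈ ev p (μ m)
    at-toP m = U.evalHom-toP Polynomials const (μ m) (μ-⊕ m) (μ-0 m)

    at-u : ∀ m → at.⟦_⟧ m U.u ≈ - ι m
    at-u m = trans (at-toP m ((uMono , 1F) ∷ [])) (trans (+-identityʳ _) (trans (*-cong scalar-1 (trans (*-congˡ mono-0) (*-identityʳ _))) (trans (*-identityˡ _) (*-identityʳ _))))

  at-liftU : ∀ m p → at.⟦_⟧ m (U.toP (liftU p)) ≈ toP p
  at-liftU m p = trans (at-toP m (liftU p)) (trans (Σ-map _ p _) (trans (Σ-cong p (λ t → *-congˡ (*-identityˡ _))) (sym (toP-ev p))))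

  ι-regular : ∀ n → NonZeroDivisor Polynomials (ι (suc n))
  ι-regular n a e = Units.invertible⇒nzd Polynomials {scalar (ℕ→F (suc n))}
    (const.⟦ proj₁ (ℕ→F-invertible n) ⟧ , trans (sym (const.*-homo _ _)) (trans (const.⟦⟧-cong (proj₂ (ℕ→F-invertible n))) const.1-homo))
    a (trans (*-congʳ (scalar-ℕ (suc n))) e)
    where module const = HomProps const

  -- The coefficients are free of u, so u ↦ -m leaves them unchanged and only the rising factors
  -- specialise, to integers. The resulting equations determine the differences of the coefficients.
  expansion-unique : ∀ (a b : ℕ → Poly N) →
    U.Σ (upTo (suc N)) (λ k → U.toP (liftU (a k)) U.* U.rise U.u k (N ∸ k)) U.≈ U.Σ (upTo (suc N)) (λ k → U.toP (liftU (b k)) U.* U.rise U.u k (N ∸ k)) →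
    ∀ k → 1 ≤ k → k ≤ N → a k ≈P b k
  expansion-unique a b e k p q = toP-injective (trans (solve 2 (λ x y → x := (x :- y) :+ y) refl _ _)
    (trans (+-congʳ (RisingExpansions.coefficients-zero Polynomials ι-regular N (λ k → toP (a k) + - toP (b k)) difference k p q)) (+-identityˡ _)))
    where
    specialised : ∀ m c → at.⟦_⟧ m (U.Σ (upTo (suc N)) (λ k → U.toP (liftU (c k)) U.* U.rise U.u k (N ∸ k))) ≈ Σ (upTo (suc N)) (λ k → toP (c k) * rise (- ι m) k (N ∸ k))
    specialised m c = trans (at.Σ-homo m (upTo (suc N)) _) (Σ-cong (upTo (suc N)) (λ k → trans (at.*-homo m _ _)
      (*-cong (at-liftU m (c k)) (trans (at.rise-homo m U.u k (N ∸ k)) (rise-cong k (N ∸ k) (at-u m))))))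
      where
      rise-cong : ∀ {v w} k r → v ≈ w → rise v k r ≈ rise w k r
      rise-cong k zero e = refl
      rise-cong k (suc r) e = *-cong (+-congʳ e) (rise-cong (suc k) r e)
    difference : ∀ m → Σ (upTo (suc N)) (λ k → (toP (a k) + - toP (b k)) * rise (- ι m) k (N ∸ k)) ≈ 0#
    difference m = begin
      Σ (upTo (suc N)) (λ k → (toP (a k) + - toP (b k)) * rise (- ι m) k (N ∸ k))
        ≈⟨ trans (Σ-cong (upTo (suc N)) (λ k → solve 3 (λ x y r → (x :- y) :* r := x :* r :+ (:- con (+ 1)) :* (y :* r)) refl _ _ _)) (Σ-+ (upTo (suc N)) _ _) ⟩
      Σ (upTo (suc N)) (λ k → toP (a k) * rise (- ι m) k (N ∸ k)) + Σ (upTo (suc N)) (λ k → - 1# * (toP (b k) * rise (- ι m) k (N ∸ k)))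
        ≈⟨ +-cong (trans (sym (specialised m a)) (trans (at.⟦⟧-cong m e) (specialised m b))) (Σ-*ˡ (upTo (suc N)) (- 1#) _) ⟩
      Σ (upTo (suc N)) (λ k → toP (b k) * rise (- ι m) k (N ∸ k)) + - 1# * Σ (upTo (suc N)) (λ k → toP (b k) * rise (- ι m) k (N ∸ k))
        ≈⟨ solve 1 (λ x → x :+ (:- con (+ 1)) :* x := con (+ 0)) refl _ ⟩
      0# ∎

  liftU-zero : ∀ p → U.toP (liftU p) U.≈ U.0# → p ≈P 0P
  liftU-zero p e = toP-injective (trans (sym (at-liftU 0 p)) (trans (at.⟦⟧-cong 0 e) (trans (at.0-homo 0) (sym toP-0))))

module RegularVandermonde (R : CRing) where
  open Kit R
  open Determinant R

  nzd-* : ∀ {v w} → NonZeroDivisor R v → NonZeroDivisor R w → NonZeroDivisor R (v * w)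
  nzd-* n m a e = m a (n _ (trans (sym (*-assoc _ _ _)) e))

  nzd-1 : NonZeroDivisor R 1#
  nzd-1 a e = trans (sym (*-identityˡ a)) e

  vandermonde-nzd : ∀ {xs} → AllPairs (λ x y → NonZeroDivisor R (x + - y)) xs → NonZeroDivisor R (vandermonde xs)
  vandermonde-nzd [] = nzd-1
  vandermonde-nzd {x ∷ xs} (n ∷ ns) = nzd-* (diffs-nzd n) (vandermonde-nzd ns)
    where
    diffs-nzd : ∀ {ys} → All (λ y → NonZeroDivisor R (x + - y)) ys → NonZeroDivisor R (diffs x ys)
    diffs-nzd [] = nzd-1
    diffs-nzd {y ∷ ys} (n ∷ ns) = nzd-* {x + - y} {diffs x ys} n (diffs-nzd ns)

-- Comparison of the two expansions of S_N(u) f.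

module Comparison (M : List ℕ → Λel) (monomial : ∀ la N → π N (M la) ≈P msym N la) (f : Λel) (G : List ℕ → Λel)
  (adjoint : ∀ la h → ⟨ G la , h ⟩ ≃ ⟨ f , M la *Λ h ⟩) (N D : ℕ) where
  open SekiguchiDebiard N
  open PolynomialRing (suc N)
  open PolynomialLists (suc N)
  open Kit Polynomials
  open Determinant Polynomials
  open RisingFactorial Polynomials
  open Layers N D
  open Towers Polynomials α using (degree)
  open RegularVandermonde Polynomials
  open NonZeroDivisors Polynomials

  private
    V-regular : NonZeroDivisor Polynomials V
    V-regular = vandermonde-nzd (AllPairsP.map⁺ (AllPairs.map
      (λ {i} {j} i≢j → VariableDifferences.variable-difference-regular (suc N) (suc i) (suc j) (λ { ≡.refl → i≢j ≡.refl })) (UniqueP.allFin⁺ N)))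

    expansionOf : (ℕ → Poly N) → Carrier
    expansionOf a = Σ (upTo (suc N)) (λ k → toP (liftU (a k)) * rise u k (N ∸ k))

    toP-expansion : ∀ a → toP (Δ N *P sumP (map (λ k → liftU (a k) *P risingTail N k) (upTo (suc N)))) ≈ V * expansionOf a
    toP-expansion a = trans (toP-* (Δ N) _) (*-cong toP-Δ (trans (toP-sumP (λ k → liftU (a k) *P risingTail N k) (upTo (suc N)))
      (Σ-cong (upTo (suc N)) (λ k → trans (toP-* (liftU (a k)) (risingTail N k)) (*-congˡ (toP-risingTail k))))))

  -- Both families satisfy the same equation after multiplication by Δ. As a product of differences
  -- of distinct variables, Δ is a non-zero-divisor and cancels.
  expansion-coefficient : All (λ t → degree (proj₁ t) ≤ D) f → ∀ a → IsSDExpansion N (π N f) a → ∀ k → 1 ≤ k → k ≤ N → a k ≈P π N (rhsTrunc k D M G)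
  expansion-coefficient small a e = Specialisation.expansion-unique N a (λ k → π N (rhsTrunc k D M G)) (nzd-cancel V-regular (begin
    V * expansionOf a
      ≈⟨ trans (sym (toP-expansion a)) (toP-cong e) ⟩
    toP (numS N (π N f))
      ≈⟨ numS-layers f small ⟩
    V * Σ (upTo (suc N)) (λ k → rise u k (N ∸ k) * ev f (λ la → layer la k))
      ≈⟨ *-congˡ (Σ-cong (upTo (suc N)) (λ k → trans (*-comm _ _) (*-congʳ (sym (trans (toP-image (rhsTrunc k D M G)) (image-rhs-layers M monomial f G adjoint k)))))) ⟩
    V * expansionOf (λ k → π N (rhsTrunc k D M G)) ∎))

  too-few-variables : ∀ k → N < k → π N (rhsTrunc k D M G) ≈P 0P
  too-few-variables k N<k = Specialisation.liftU-zero N _ (trans (toP-image (rhsTrunc k D M G)) (image-rhs-zero M monomial k G N<k))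

mainTheorem2 :
  (M : List ℕ → Λel) → (∀ la N → π N (M la) ≈P msym N la) →
  (f : Λel) → (G : List ℕ → Λel) → (∀ la h → ⟨ G la , h ⟩ ≃ ⟨ f , M la *Λ h ⟩) →
  (k : ℕ) → 1 ≤ k →
  ∃[ D₀ ] (∀ D → D₀ ≤ D → ∀ N → 1 ≤ N →
    ((k ≤ N → (a : ℕ → Poly N) → IsSDExpansion N (π N f) a → a k ≈P π N (rhsTrunc k D M G))
     × (N < k → π N (rhsTrunc k D M G) ≈P 0P)))
-- The sum of the degrees of all terms of f bounds each of them. For D at least this large, the
-- determinant expansion of every term may be truncated at D without loss.
mainTheorem2 M monomial f G adjoint k 1≤k = sum (map weight f) , λ D D₀≤D N _ →
  (λ k≤N a e → Comparison.expansion-coefficient M monomial f G adjoint N D (bounded D f D₀≤D) a e k 1≤k k≤N) ,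
  Comparison.too-few-variables M monomial f G adjoint N D k
  where
  weight : List ℕ × F → ℕ
  weight t = sum (map suc (proj₁ t))
  bounded : ∀ D f → sum (map weight f) ≤ D → All (λ t → weight t ≤ D) f
  bounded D [] p = []
  bounded D (t ∷ f) p = ℕP.≤-trans (ℕP.m≤m+n _ _) p ∷ bounded D f (ℕP.≤-trans (ℕP.m≤n+m _ (weight t)) p)
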